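{- As $x\to\infty$, $|\mathscr{V}^1_2(x)|\sim \dfrac{\pi(x)}{2}$, where $\mathscr{V}^1_2(x)=\{m\in\mathscr{V}^1_2: m\le x\}$.
   Context: $\phi$ is Euler's totient function, $\mathrm{A}(m)=|\phi^{ -1}(m)|$, and $\pi(x)$ is the number of primes $\le x$. $\mathscr{V}^1_2=\{2r: r \text{ odd positive integer},\ \mathrm{A}(2r)=2\}$. -}

module Defs where

open import Data.Nat using (ℕ; zero; suc; _+_; _*_; _≤_; ∣_-_∣)
open import Data.Nat.Coprimality using (coprime?)
open import Data.Nat.Primality using (prime?)
open import Data.List using (List; length; filter; upTo; map)
open import Data.List.Membership.Propositional using (_∈_)
open import Data.List.Relation.Unary.Unique.Propositional using (Unique)
open import Data.Product using (Σ; _×_; ∃)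
open import Function.Bundles using (_⇔_)
open import Relation.Binary.PropositionalEquality using (_≡_)

-- Euler's totient: φ n = #{ k : 1 ≤ k ≤ n , gcd(k,n) = 1 }  (so φ 1 = 1, φ 0 = 0).
φ : ℕ → ℕ
φ n = length (filter (λ k → coprime? k n) (map suc (upTo n)))

HasSize : (ℕ → Set) → ℕ → Set
HasSize P c = Σ (List ℕ) λ xs → Unique xs × (∀ n → (n ∈ xs) ⇔ P n) × (length xs ≡ c)

Preimage : ℕ → ℕ → Set
Preimage m n = (1 ≤ n) × (φ n ≡ m)

A≡ : ℕ → ℕ → Set
A≡ m c = HasSize (Preimage m) c

V12 : ℕ → Set
V12 m = (∃ λ j → m ≡ 2 * (2 * j + 1)) × A≡ m 2

V12≤ : ℕ → ℕ → Set
V12≤ x m = (m ≤ x) × V12 m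

π : ℕ → ℕ
π x = length (filter prime? (upTo (suc x)))

-- If r is odd and φ(n) = 2 r > 2, then n = p^a or n = 2 p^a with p ≡ 3 mod 4. So, up to the negligible prime
-- powers with a ≥ 2, the numbers counted are p - 1 with p ≡ 3 mod 4, and the claim is that half of the primes
-- are ≡ 3 mod 4, that is R(x) = Σ_{n ≤ x} χ(n) Λ(n) = o(x) for the character χ modulo 4.
--
-- This is proved by Selberg's method. Möbius inversion gives R(x) log x + Σ χ(n) Λ(n) R(x/n) = O(x), without a
-- main term; iterating it, and replacing the weights Λ log + Λ * Λ by 2 log with Selberg's formula for Λ, gives
-- |R(x)| (log x)² ≤ 2 Σ_{n ≤ x} log n |R(x/n)| + O(x log x). Since Σ χ(n) Λ(n)/n is bounded (L(1,χ) ≠ 0), R is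
-- small somewhere in every window [y, K y], hence, by the Brun–Titchmarsh bound that Selberg's formula implies,
-- on an interval of proportional length. Therefore a bound |R(x)| ≤ M x for large x improves by a fixed amount.
--
-- Real numbers are avoided: for each X the logarithm is replaced by a completely additive L : ℕ → ℚ with
-- 1/(n+1) ≤ L(n+1) - L(n) ≤ 1/n for n < X, and no constant depends on X.

{-# OPTIONS --safe #-}

module Submission where

open import Defs
open import Data.Bool using (if_then_else_)
open import Data.List using (List; []; _∷_; _++_; length; filter; map; upTo; applyUpTo)
open import Data.List.Membership.Propositional using (_∈_)
open import Data.List.Membership.Propositional.Properties using
    (∈-filter⁺; ∈-filter⁻; ∈-map⁺; ∈-map⁻; ∈-upTo⁺; ∈-upTo⁻)
open import Data.List.Membership.Propositional.Properties.WithK using (unique∧set⇒bag)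
open import Data.List.Properties using (map-upTo)
open import Data.List.Relation.Binary.BagAndSetEquality using (∼bag⇒↭)
open import Data.List.Relation.Binary.Permutation.Propositional as Perm using (_↭_)
open import Data.List.Relation.Binary.Permutation.Propositional.Properties using (↭-length)
open import Data.List.Relation.Unary.All using (All; []; _∷_)
open import Data.List.Relation.Unary.All.Properties using (++⁺)
open import Data.List.Relation.Unary.AllPairs using ([]; _∷_)
open import Data.List.Relation.Unary.Any using (here; there)
open import Data.List.Relation.Unary.Unique.Propositional.Properties using (filter⁺; map⁺; upTo⁺)
open import Data.Nat using (ℕ; zero; suc; _+_; _*_; _≤_; _<_; z≤n; s≤s; _∸_; _≤?_; _^_; >-nonZero; _/_; _%_;
    pred; ∣_-_∣)
open import Data.Nat.Coprimality as Coprimality using (Coprime; coprime?)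
open import Data.Nat.DivMod using (m/n*n≤m; /-monoˡ-≤; m*n/n≡m; m/n/o≡m/[n*o]; n/1≡n; m≡m%n+[m/n]*n; m%n<n;
    m<n⇒m/n≡0; m/n<m)
open import Data.Nat.Divisibility using (_∣_; divides; _∣?_; ∣⇒≤; ∣1⇒≡1; 1∣_; m∣m*n; n∣m*n; m*n∣⇒m∣; *-monoʳ-∣;
    *-cancelˡ-∣; ∣m⇒∣m*n; ∣n⇒∣m*n; quotient; m∣n⇒n≡quotient*m; _∤_; ∣-trans; ∣m+n∣m⇒∣n; ∣m∣n⇒∣m+n)
open import Data.Nat.Induction using (<-rec)
open import Data.Nat.ListAction using (product)
open import Data.Nat.ListAction.Properties using (product-++)
open import Data.Nat.Primality using (Prime; prime?; ¬prime[0]; ¬prime[1]; prime⇒irreducible; prime⇒nonZero;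
    euclidsLemma; prime[2])
open import Data.Nat.Properties as ℕₚ using (_≟_)
open import Data.Product using (_×_; _,_; proj₁; proj₂; ∃)
open import Data.Sum using (_⊎_; inj₁; inj₂)
open import Function.Bundles using (mk⇔; Equivalence)
open import Relation.Nullary using (¬_; Dec; yes; no; contradiction; does)
open import Relation.Nullary.Decidable using (dec-true; dec-false)
open import Relation.Binary.PropositionalEquality
open import Data.Nat.Primality.Factorisation
open PrimeFactorisation using (isFactorisation; factorsPrime)

-- As `2 Σ log n / n` is at most `(log x)² + log x`, inserting `|R(t)| ≤ M t` into the iterated
-- inequality returns `M` up to lower-order terms, so any saving of order `x (log x)²` in the
-- weighted sum is a gain. Windows of ratio `K` up to about `x^(1/4)` supply it: their number is
-- proportional to `log x`, and each saves `x log x` times a constant depending on `N` only, where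
-- `1/N` measures the smallness of `R` in a window. While `M ≥ 4/N`, one pass thus lowers `M` by an
-- amount independent of `M`. With `M = j/g` for a fixed integer `g`, a descent of `j` through the
-- natural numbers replaces the usual limit superior.
--
-- The price of rational logarithms is that each `X` has its own `L`, `Λ` and `R`. The threshold of
-- a bound for `R` must therefore serve all of them at once, and Euler's constant, `L(1,χ)` and
-- infinite sums are replaced by truncations at `X`. Inequalities are mostly kept multiplied out;
-- nonlinear steps reach linear arithmetic as products of nonnegative quantities.

-- The rationals as an ordered field

module Field where

  open import Data.Nat as ℕ using (ℕ; zero; suc)
  open import Data.Integer as ℤ using (ℤ; +_)
  import Data.Integer.Properties as ℤₚ
  open import Data.Rational as ℚ using (ℚ; mkℚ)
  import Data.Rational.Properties as ℚₚ
  import Data.Rational.Unnormalised as ℚᵘ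
  import Data.Rational.Unnormalised.Properties as ℚᵘₚ
  open import Data.Sum using (_⊎_; inj₁; inj₂)
  open import Relation.Nullary using (Dec)
  open import Relation.Binary.PropositionalEquality
  open import Data.Nat.Coprimality using (1-coprimeTo) renaming (sym to coprime-sym)

  infixl 6 _⊕_ _⊖_
  infixl 7 _⊗_
  infix 8 ⊝_
  infix 4 _≼_

  -- The operations are sealed so that the type checker never unfolds rational arithmetic.
  opaque
    Q : Set
    Q = ℚ

    _⊕_ _⊗_ : Q → Q → Q
    _⊕_ = ℚ._+_
    _⊗_ = ℚ._*_

    ⊝_ : Q → Q
    ⊝_ = ℚ.-_

    _≼_ : Q → Q → Set
    _≼_ = ℚ._≤_

    ∥_∥ : Q → Q
    ∥_∥ = ℚ.∣_∣

    ζ : ℤ → Q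
    ζ i = mkℚ i 0 (coprime-sym (1-coprimeTo _))

    inv : ℕ → Q
    -- Default value; the estimates use `inv` at positive arguments only.
    inv zero    = ζ (+ 0)
    inv (suc n) = ℚ.1/_ (ζ (+ suc n)) {{_}}

  _⊖_ : Q → Q → Q
  a ⊖ b = a ⊕ ⊝ b

  ι : ℕ → Q
  ι n = ζ (+ n)

  opaque
    unfolding Q

    ⊕-assoc : ∀ a b c → (a ⊕ b) ⊕ c ≡ a ⊕ (b ⊕ c)
    ⊕-assoc = ℚₚ.+-assoc
    ⊕-comm : ∀ a b → a ⊕ b ≡ b ⊕ a
    ⊕-comm = ℚₚ.+-comm
    ⊗-assoc : ∀ a b c → (a ⊗ b) ⊗ c ≡ a ⊗ (b ⊗ c)
    ⊗-assoc = ℚₚ.*-assoc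
    ⊗-comm : ∀ a b → a ⊗ b ≡ b ⊗ a
    ⊗-comm = ℚₚ.*-comm
    ⊗-distribˡ : ∀ a b c → a ⊗ (b ⊕ c) ≡ a ⊗ b ⊕ a ⊗ c
    ⊗-distribˡ = ℚₚ.*-distribˡ-+

    ⊕-identityˡ : ∀ a → ι 0 ⊕ a ≡ a
    ⊕-identityˡ = ℚₚ.+-identityˡ
    ⊗-identityˡ : ∀ a → ι 1 ⊗ a ≡ a
    ⊗-identityˡ = ℚₚ.*-identityˡ
    ⊕-inverseʳ : ∀ a → a ⊕ ⊝ a ≡ ι 0
    ⊕-inverseʳ = ℚₚ.+-inverseʳ

    ζ-+ : ∀ i j → ζ (i ℤ.+ j) ≡ ζ i ⊕ ζ j
    ζ-+ i j = ℚₚ.toℚᵘ-injective (ℚᵘₚ.≃-trans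
      (ℚᵘ.*≡* (cong (ℤ._* + 1) (sym (cong₂ ℤ._+_ (ℤₚ.*-identityʳ i) (ℤₚ.*-identityʳ j)))))
      (ℚᵘₚ.≃-sym (ℚₚ.toℚᵘ-homo-+ (ζ i) (ζ j))))

    ζ-* : ∀ i j → ζ (i ℤ.* j) ≡ ζ i ⊗ ζ j
    ζ-* i j = ℚₚ.toℚᵘ-injective (ℚᵘₚ.≃-trans (ℚᵘ.*≡* refl)
      (ℚᵘₚ.≃-sym (ℚₚ.toℚᵘ-homo-* (ζ i) (ζ j))))

    ≼-refl : ∀ {a} → a ≼ a
    ≼-refl = ℚₚ.≤-refl
    ≼-trans : ∀ {a b c} → a ≼ b → b ≼ c → a ≼ c
    ≼-trans = ℚₚ.≤-trans
    ≼-antisym : ∀ {a b} → a ≼ b → b ≼ a → a ≡ b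
    ≼-antisym = ℚₚ.≤-antisym
    ≼-total : ∀ a b → a ≼ b ⊎ b ≼ a
    ≼-total = ℚₚ.≤-total
    _≼?_ : ∀ a b → Dec (a ≼ b)
    _≼?_ = ℚ._≤?_

    ⊕-mono : ∀ {a b c d} → a ≼ b → c ≼ d → a ⊕ c ≼ b ⊕ d
    ⊕-mono = ℚₚ.+-mono-≤

    ⊗-nonneg : ∀ {a b} → ι 0 ≼ a → ι 0 ≼ b → ι 0 ≼ a ⊗ b
    ⊗-nonneg {a} {b} p q = subst (ℚ._≤ a ℚ.* b) (ℚₚ.*-zeroʳ a)
      (ℚₚ.*-monoˡ-≤-nonNeg a {{ℚ.nonNegative p}} q)

    ι-mono : ∀ {m n} → m ℕ.≤ n → ι m ≼ ι n
    ι-mono {m} {n} p = ℚ.*≤* (ℤₚ.*-monoʳ-≤-nonNeg (+ 1) (ℤ.+≤+ p))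

    ι-cancel : ∀ {m n} → ι m ≼ ι n → m ℕ.≤ n
    ι-cancel {m} {n} (ℚ.*≤* p) with subst₂ ℤ._≤_ (ℤₚ.*-identityʳ (+ m)) (ℤₚ.*-identityʳ (+ n)) p
    ... | ℤ.+≤+ q = q

    inv-ι : ∀ n → inv (suc n) ⊗ ι (suc n) ≡ ι 1
    inv-ι n = ℚₚ.*-inverseˡ (ζ (+ suc n)) {{_}}

    ≼-∥∥ : ∀ a → a ≼ ∥ a ∥
    ≼-∥∥ a with ℚₚ.≤-total (ζ (+ 0)) a
    ... | inj₁ p = ℚₚ.≤-reflexive (sym (ℚₚ.0≤p⇒∣p∣≡p p))
    ... | inj₂ p = ℚₚ.≤-trans p (ℚₚ.0≤∣p∣ a)

    ∥∥-neg : ∀ a → ∥ ⊝ a ∥ ≡ ∥ a ∥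
    ∥∥-neg = ℚₚ.∣-p∣≡∣p∣

    ∥∥-≼ : ∀ {a b} → a ≼ b → ⊝ a ≼ b → ∥ a ∥ ≼ b
    ∥∥-≼ {a} p q with ℚₚ.∣p∣≡p∨∣p∣≡-p a
    ... | inj₁ e = ℚₚ.≤-trans (ℚₚ.≤-reflexive e) p
    ... | inj₂ e = ℚₚ.≤-trans (ℚₚ.≤-reflexive e) q

    ∥∥-⊗ : ∀ a b → ∥ a ⊗ b ∥ ≡ ∥ a ∥ ⊗ ∥ b ∥
    ∥∥-⊗ = ℚₚ.∣p*q∣≡∣p∣*∣q∣

  ⊝-∥∥ : ∀ a → ⊝ a ≼ ∥ a ∥
  ⊝-∥∥ a = subst (⊝ a ≼_) (∥∥-neg a) (≼-∥∥ (⊝ a))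

  ≼-reflexive : ∀ {a b} → a ≡ b → a ≼ b
  ≼-reflexive refl = ≼-refl

  ι-+ : ∀ m n → ι (m ℕ.+ n) ≡ ι m ⊕ ι n
  ι-+ m n = ζ-+ (+ m) (+ n)

  ι-* : ∀ m n → ι (m ℕ.* n) ≡ ι m ⊗ ι n
  ι-* m n = trans (cong ζ (ℤₚ.pos-* m n)) (ζ-* (+ m) (+ n))

  0≼ι : ∀ n → ι 0 ≼ ι n
  0≼ι n = ι-mono ℕ.z≤n

  infixl 3 _≼≡_
  infixr 3 _≡≼_

  _≼≡_ : ∀ {a b c} → a ≼ b → b ≡ c → a ≼ c
  p ≼≡ refl = p

  _≡≼_ : ∀ {a b c} → a ≡ b → b ≼ c → a ≼ c
  refl ≡≼ p = p

open Field

-- A decision procedure for linear arithmetic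

module Lin where

  open Field
  open import Data.Nat as ℕ using (ℕ; zero; suc; _≡ᵇ_; _<ᵇ_)
  import Data.Nat.Properties as ℕₚ
  open import Data.Integer as ℤ using (ℤ; +_; -[1+_])
  open import Data.Bool using (Bool; true; false; if_then_else_; T; _∧_; not)
  open import Data.List using (List; []; _∷_; map; _++_; length; concatMap)
  open import Data.List.Relation.Unary.All using (All; []; _∷_)
  open import Data.Maybe using (Maybe; just; nothing)
  open import Data.Product using (_×_; _,_; proj₁)
  open import Data.Sum using (inj₁; inj₂)
  open import Data.Unit using (tt)
  open import Relation.Binary.PropositionalEquality

  infixl 6 _:+_ _:-_
  infixl 7 _:*_
  infix 5 _:≤_ _:≡_
  infixr 4 _⇒_
  infix 4 ⊢_

  data Expr : Set where
    var       : ℕ → Expr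
    con       : ℕ → Expr
    _:+_ _:-_ _:*_ : Expr → Expr → Expr
    :-_       : Expr → Expr

  data Formula : Set where
    _:≤_ _:≡_ : Expr → Expr → Formula

  data Sequent : Set where
    ⊢_  : Formula → Sequent
    _⇒_ : Formula → Sequent → Sequent

  Env : Set
  Env = List Q

  look : Env → ℕ → Q
  look []       _       = ι 0
  look (a ∷ _)  zero    = a
  look (_ ∷ as) (suc i) = look as i

  ⟦_⟧ : Expr → Env → Q
  ⟦ var i ⟧ ρ  = look ρ i
  ⟦ con n ⟧ ρ  = ι n
  ⟦ e :+ f ⟧ ρ = ⟦ e ⟧ ρ ⊕ ⟦ f ⟧ ρ
  ⟦ e :- f ⟧ ρ = ⟦ e ⟧ ρ ⊖ ⟦ f ⟧ ρ
  ⟦ e :* f ⟧ ρ = ⟦ e ⟧ ρ ⊗ ⟦ f ⟧ ρ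
  ⟦ :- e ⟧ ρ   = ⊝ ⟦ e ⟧ ρ

  ⟦_⟧F : Formula → Env → Set
  ⟦ e :≤ f ⟧F ρ = ⟦ e ⟧ ρ ≼ ⟦ f ⟧ ρ
  ⟦ e :≡ f ⟧F ρ = ⟦ e ⟧ ρ ≡ ⟦ f ⟧ ρ

  ⟦_⟧S : Sequent → Env → Set
  ⟦ ⊢ g ⟧S ρ   = ⟦ g ⟧F ρ
  ⟦ h ⇒ s ⟧S ρ = ⟦ h ⟧F ρ → ⟦ s ⟧S ρ

  -- Polynomials as sorted lists of monomials; a monomial is the sorted list of its variables.

  Mono : Set
  Mono = List ℕ

  Poly : Set
  Poly = List (Mono × ℤ)

  eqM : Mono → Mono → Bool
  eqM []       []       = true
  eqM (x ∷ xs) (y ∷ ys) = (x ≡ᵇ y) ∧ eqM xs ys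
  eqM _        _        = false

  ltM : Mono → Mono → Bool
  ltM _        []       = false
  ltM []       (_ ∷ _)  = true
  ltM (x ∷ xs) (y ∷ ys) = if x <ᵇ y then true else if x ≡ᵇ y then ltM xs ys else false

  insertM : ℕ → Mono → Mono
  insertM x []       = x ∷ []
  insertM x (y ∷ ys) = if y <ᵇ x then y ∷ insertM x ys else x ∷ y ∷ ys

  mulM : Mono → Mono → Mono
  mulM []       m = m
  mulM (x ∷ xs) m = insertM x (mulM xs m)

  consP : Mono → ℤ → Poly → Poly
  consP m (+ 0) p = p
  consP m c     p = (m , c) ∷ p

  addT : Mono → ℤ → Poly → Poly
  addT m c [] = consP m c []
  addT m c ((m′ , c′) ∷ p) =
    if eqM m m′ then consP m (c ℤ.+ c′) p
    else if ltM m m′ then consP m c ((m′ , c′) ∷ p)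
    else (m′ , c′) ∷ addT m c p

  addP : Poly → Poly → Poly
  addP []            q = q
  addP ((m , c) ∷ p) q = addT m c (addP p q)

  mulT : Mono → ℤ → Poly → Poly
  mulT m c []              = []
  mulT m c ((m′ , c′) ∷ p) = addT (mulM m m′) (c ℤ.* c′) (mulT m c p)

  mulP : Poly → Poly → Poly
  mulP []            q = []
  mulP ((m , c) ∷ p) q = addP (mulT m c q) (mulP p q)

  scale : ℤ → Poly → Poly
  scale c = mulT [] c

  norm : Expr → Poly
  norm (var i)  = (i ∷ [] , + 1) ∷ []
  norm (con n)  = consP [] (+ n) []
  norm (e :+ f) = addP (norm e) (norm f)
  norm (e :- f) = addP (norm e) (scale -[1+ 0 ] (norm f))
  norm (e :* f) = mulP (norm e) (norm f)
  norm (:- e)   = scale -[1+ 0 ] (norm e)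

  ⊕-identityʳ : ∀ a → a ⊕ ι 0 ≡ a
  ⊕-identityʳ a = trans (⊕-comm a (ι 0)) (⊕-identityˡ a)

  ⊗-identityʳ : ∀ a → a ⊗ ι 1 ≡ a
  ⊗-identityʳ a = trans (⊗-comm a (ι 1)) (⊗-identityˡ a)

  ⊗-distribʳ : ∀ a b c → (b ⊕ c) ⊗ a ≡ b ⊗ a ⊕ c ⊗ a
  ⊗-distribʳ a b c = trans (⊗-comm (b ⊕ c) a)
    (trans (⊗-distribˡ a b c) (cong₂ _⊕_ (⊗-comm a b) (⊗-comm a c)))

  ⊕-cancelʳ : ∀ a b c → b ⊕ a ≡ c ⊕ a → b ≡ c
  ⊕-cancelʳ a b c e = trans (sym (undo b)) (trans (cong (_⊕ ⊝ a) e) (undo c))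
    where
    undo : ∀ x → (x ⊕ a) ⊕ ⊝ a ≡ x
    undo x = trans (⊕-assoc x a (⊝ a)) (trans (cong (x ⊕_) (⊕-inverseʳ a)) (⊕-identityʳ x))

  ⊗-zeroˡ : ∀ a → ι 0 ⊗ a ≡ ι 0
  ⊗-zeroˡ a = ⊕-cancelʳ (ι 0 ⊗ a) (ι 0 ⊗ a) (ι 0)
    (trans (sym (⊗-distribʳ a (ι 0) (ι 0))) (trans (cong (_⊗ a) (⊕-identityˡ (ι 0))) (sym (⊕-identityˡ _))))

  ⊗-zeroʳ : ∀ a → a ⊗ ι 0 ≡ ι 0
  ⊗-zeroʳ a = trans (⊗-comm a (ι 0)) (⊗-zeroˡ a)

  -1⊗ : ∀ a → ζ -[1+ 0 ] ⊗ a ≡ ⊝ a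
  -1⊗ a = ⊕-cancelʳ a (ζ -[1+ 0 ] ⊗ a) (⊝ a) (begin
    ζ -[1+ 0 ] ⊗ a ⊕ a            ≡⟨ cong (ζ -[1+ 0 ] ⊗ a ⊕_) (sym (⊗-identityˡ a)) ⟩
    ζ -[1+ 0 ] ⊗ a ⊕ ι 1 ⊗ a      ≡⟨ sym (⊗-distribʳ a (ζ -[1+ 0 ]) (ι 1)) ⟩
    (ζ -[1+ 0 ] ⊕ ι 1) ⊗ a        ≡⟨ cong (_⊗ a) (sym (ζ-+ -[1+ 0 ] (+ 1))) ⟩
    ι 0 ⊗ a                       ≡⟨ ⊗-zeroˡ a ⟩
    ι 0                           ≡⟨ sym (⊕-inverseʳ a) ⟩
    a ⊕ ⊝ a                       ≡⟨ ⊕-comm a (⊝ a) ⟩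
    ⊝ a ⊕ a                       ∎)
    where open ≡-Reasoning

  ⊕-left-comm : ∀ a b c → a ⊕ (b ⊕ c) ≡ b ⊕ (a ⊕ c)
  ⊕-left-comm a b c = trans (sym (⊕-assoc a b c)) (trans (cong (_⊕ c) (⊕-comm a b)) (⊕-assoc b a c))

  ⊗-left-comm : ∀ a b c → a ⊗ (b ⊗ c) ≡ b ⊗ (a ⊗ c)
  ⊗-left-comm a b c = trans (sym (⊗-assoc a b c)) (trans (cong (_⊗ c) (⊗-comm a b)) (⊗-assoc b a c))

  module _ (ρ : Env) where

    evalM : Mono → Q
    evalM []       = ι 1
    evalM (x ∷ xs) = look ρ x ⊗ evalM xs

    evalP : Poly → Q
    evalP []            = ι 0
    evalP ((m , c) ∷ p) = ζ c ⊗ evalM m ⊕ evalP p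

    eqM-sound : ∀ m m′ → eqM m m′ ≡ true → m ≡ m′
    eqM-sound []       []       _ = refl
    eqM-sound (x ∷ xs) (y ∷ ys) e with x ≡ᵇ y in d
    ... | true = cong₂ _∷_ (ℕₚ.≡ᵇ⇒≡ x y (subst T (sym d) tt)) (eqM-sound xs ys e)

    insertM-sound : ∀ x m → evalM (insertM x m) ≡ look ρ x ⊗ evalM m
    insertM-sound x []       = refl
    insertM-sound x (y ∷ ys) with y <ᵇ x
    ... | true  = trans (cong (look ρ y ⊗_) (insertM-sound x ys)) (⊗-left-comm _ _ _)
    ... | false = refl

    mulM-sound : ∀ m m′ → evalM (mulM m m′) ≡ evalM m ⊗ evalM m′
    mulM-sound []       m′ = sym (⊗-identityˡ _)
    mulM-sound (x ∷ xs) m′ = trans (insertM-sound x (mulM xs m′))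
      (trans (cong (look ρ x ⊗_) (mulM-sound xs m′)) (sym (⊗-assoc _ _ _)))

    consP-sound : ∀ m c p → evalP (consP m c p) ≡ ζ c ⊗ evalM m ⊕ evalP p
    consP-sound m (+ 0)        p = sym (trans (cong (_⊕ evalP p) (⊗-zeroˡ _)) (⊕-identityˡ _))
    consP-sound m (+ suc n)    p = refl
    consP-sound m -[1+ n ]     p = refl

    addT-sound : ∀ m c p → evalP (addT m c p) ≡ ζ c ⊗ evalM m ⊕ evalP p
    addT-sound m c [] = consP-sound m c []
    addT-sound m c ((m′ , c′) ∷ p) with eqM m m′ in e
    ... | true with refl ← eqM-sound m m′ e = trans (consP-sound m (c ℤ.+ c′) p)
            (trans (cong (λ z → z ⊗ evalM m ⊕ evalP p) (ζ-+ c c′))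
            (trans (cong (_⊕ evalP p) (⊗-distribʳ _ _ _)) (⊕-assoc _ _ _)))
    ... | false with ltM m m′
    ...   | true  = consP-sound m c ((m′ , c′) ∷ p)
    ...   | false = trans (cong (ζ c′ ⊗ evalM m′ ⊕_) (addT-sound m c p)) (⊕-left-comm _ _ _)

    addP-sound : ∀ p q → evalP (addP p q) ≡ evalP p ⊕ evalP q
    addP-sound []            q = sym (⊕-identityˡ _)
    addP-sound ((m , c) ∷ p) q = trans (addT-sound m c (addP p q))
      (trans (cong (ζ c ⊗ evalM m ⊕_) (addP-sound p q)) (sym (⊕-assoc _ _ _)))

    mulT-sound : ∀ m c p → evalP (mulT m c p) ≡ (ζ c ⊗ evalM m) ⊗ evalP p
    mulT-sound m c []              = sym (⊗-zeroʳ _)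
    mulT-sound m c ((m′ , c′) ∷ p) = trans (addT-sound (mulM m m′) (c ℤ.* c′) (mulT m c p))
      (trans (cong₂ _⊕_
        (trans (cong₂ _⊗_ (ζ-* c c′) (mulM-sound m m′))
          (trans (⊗-assoc _ _ _) (trans (cong (ζ c ⊗_) (⊗-left-comm _ _ _)) (sym (⊗-assoc _ _ _)))))
        (mulT-sound m c p)) (sym (⊗-distribˡ _ _ _)))

    mulP-sound : ∀ p q → evalP (mulP p q) ≡ evalP p ⊗ evalP q
    mulP-sound []            q = sym (⊗-zeroˡ _)
    mulP-sound ((m , c) ∷ p) q = trans (addP-sound (mulT m c q) (mulP p q))
      (trans (cong₂ _⊕_ (mulT-sound m c q) (mulP-sound p q)) (sym (⊗-distribʳ _ _ _)))

    scale-sound : ∀ c p → evalP (scale c p) ≡ ζ c ⊗ evalP p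
    scale-sound c p = trans (mulT-sound [] c p) (cong (_⊗ evalP p) (⊗-identityʳ _))

    neg-sound : ∀ p → evalP (scale -[1+ 0 ] p) ≡ ⊝ evalP p
    neg-sound p = trans (scale-sound -[1+ 0 ] p) (-1⊗ _)

    norm-sound : ∀ e → evalP (norm e) ≡ ⟦ e ⟧ ρ
    norm-sound (var i)  = trans (⊕-identityʳ _) (trans (⊗-identityˡ _) (⊗-identityʳ _))
    norm-sound (con n)  = trans (consP-sound [] (+ n) []) (trans (⊕-identityʳ _) (⊗-identityʳ _))
    norm-sound (e :+ f) = trans (addP-sound (norm e) (norm f)) (cong₂ _⊕_ (norm-sound e) (norm-sound f))
    norm-sound (e :- f) = trans (addP-sound (norm e) (scale -[1+ 0 ] (norm f)))
      (cong₂ _⊕_ (norm-sound e) (trans (neg-sound (norm f)) (cong ⊝_ (norm-sound f))))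
    norm-sound (e :* f) = trans (mulP-sound (norm e) (norm f)) (cong₂ _⊗_ (norm-sound e) (norm-sound f))
    norm-sound (:- e)   = trans (neg-sound (norm e)) (cong ⊝_ (norm-sound e))

  -- Certificates: the hypotheses l ≤ r (or l ≡ r), written as r - l, with integer multipliers.

  gap : Formula → Poly
  gap (l :≤ r) = norm (r :- l)
  gap (l :≡ r) = norm (r :- l)

  isEq : Formula → Bool
  isEq (_ :≤ _) = false
  isEq (_ :≡ _) = true

  isNonNeg : ℤ → Bool
  isNonNeg (+ _)    = true
  isNonNeg -[1+ _ ] = false

  admissible : List Formula → List ℤ → Bool
  admissible []               _        = true
  admissible (h ∷ hs)         []       = true
  admissible ((l :≤ r) ∷ hs) (c ∷ cs) = isNonNeg c ∧ admissible hs cs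
  admissible ((l :≡ r) ∷ hs) (c ∷ cs) = admissible hs cs

  combine : List Formula → List ℤ → Poly
  combine []       _        = []
  combine (h ∷ hs) []       = []
  combine (h ∷ hs) (c ∷ cs) = addP (scale c (gap h)) (combine hs cs)

  nonPosP : Poly → Bool
  nonPosP []                     = true
  nonPosP (([] , -[1+ _ ]) ∷ []) = true
  nonPosP _                      = false

  -- Acceptance means that `k + 1` times the goal exceeds an admissible combination of the
  -- hypotheses by a nonnegative constant. The factor `k + 1` is what allows integer multipliers.
  checkCert : List Formula → Poly → ℕ → List ℤ → Bool
  checkCert hs g k cs = admissible hs cs ∧ nonPosP (addP (scale -[1+ k ] g) (combine hs cs))

  0≼-gap : ∀ {a b} → a ≼ b → ι 0 ≼ b ⊖ a
  0≼-gap {a} {b} p = subst (_≼ b ⊖ a) (⊕-inverseʳ a) (⊕-mono p (≼-refl {⊝ a}))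

  ≼-from-gap : ∀ {a b} → ι 0 ≼ b ⊖ a → a ≼ b
  ≼-from-gap {a} {b} p = subst₂ _≼_ (⊕-identityˡ a)
    (trans (⊕-assoc b (⊝ a) a) (trans (cong (b ⊕_) (trans (⊕-comm _ _) (⊕-inverseʳ a))) (⊕-identityʳ b)))
    (⊕-mono p (≼-refl {a}))

  ⊕-nonneg : ∀ {a b} → ι 0 ≼ a → ι 0 ≼ b → ι 0 ≼ a ⊕ b
  ⊕-nonneg {a} {b} p q = subst (_≼ a ⊕ b) (⊕-identityˡ (ι 0)) (⊕-mono p q)

  ∧-elim : ∀ {a b} → T (a ∧ b) → T a × T b
  ∧-elim {true} t = tt , t

  module _ (ρ : Env) where

    gap-≤ : ∀ l r → ⟦ l :≤ r ⟧F ρ → ι 0 ≼ evalP ρ (gap (l :≤ r))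
    gap-≤ l r p = subst (ι 0 ≼_) (sym (norm-sound ρ (r :- l))) (0≼-gap p)

    combine-nonneg : ∀ hs cs → All (λ h → ⟦ h ⟧F ρ) hs → T (admissible hs cs) → ι 0 ≼ evalP ρ (combine hs cs)
    combine-nonneg []       _        _        _ = ≼-refl
    combine-nonneg (h ∷ hs) []       _        _ = ≼-refl
    combine-nonneg ((l :≤ r) ∷ hs) (+ c ∷ cs) (p ∷ ps) t =
      subst (ι 0 ≼_) (sym (addP-sound ρ (scale (+ c) (gap (l :≤ r))) (combine hs cs)))
        (⊕-nonneg
          (subst (ι 0 ≼_) (sym (scale-sound ρ (+ c) (gap (l :≤ r)))) (⊗-nonneg (0≼ι c) (gap-≤ l r p)))
          (combine-nonneg hs cs ps t))
    combine-nonneg ((l :≡ r) ∷ hs) (c ∷ cs) (p ∷ ps) t =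
      subst (ι 0 ≼_) (sym (trans (addP-sound ρ (scale c (gap (l :≡ r))) (combine hs cs))
        (trans (cong (_⊕ _) (trans (scale-sound ρ c (gap (l :≡ r)))
          (trans (cong (ζ c ⊗_) (trans (norm-sound ρ (r :- l))
              (trans (cong (λ z → ⟦ r ⟧ ρ ⊖ z) p) (⊕-inverseʳ _)))) (⊗-zeroʳ _))))
          (⊕-identityˡ _))))
        (combine-nonneg hs cs ps t)

    nonPosP-sound : ∀ p → T (nonPosP p) → evalP ρ p ≼ ι 0
    nonPosP-sound []                      _ = ≼-refl
    nonPosP-sound (([] , -[1+ n ]) ∷ []) _ = ≼-from-gap (subst (ι 0 ≼_)
      (sym (trans (⊕-identityˡ _) (trans (sym (-1⊗ _))
        (trans (cong (ζ -[1+ 0 ] ⊗_) (trans (⊕-identityʳ _) (⊗-identityʳ _)))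
          (trans (sym (ζ-* -[1+ 0 ] -[1+ n ])) (cong ι (ℕₚ.+-identityʳ (suc n)))))))) (0≼ι (suc n)))

    suc⊗-cancel : ∀ k a → ι 0 ≼ ι (suc k) ⊗ a → ι 0 ≼ a
    suc⊗-cancel k a p with ≼-total (ι 0) a
    ... | inj₁ q = q
    ... | inj₂ q = ≼-trans p (subst₂ _≼_ (sym (trans (cong (_⊗ a) (ι-+ 1 k))
        (trans (⊗-distribʳ a (ι 1) (ι k)) (cong (_⊕ ι k ⊗ a) (⊗-identityˡ a)))))
                                       (⊕-identityʳ a) (⊕-mono ≼-refl k⊗a≼0))
      where
      k⊗a≼0 : ι k ⊗ a ≼ ι 0
      k⊗a≼0 = ≼-from-gap (subst (ι 0 ≼_) (trans (cong (ι k ⊗_) (⊕-identityˡ _))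
          (trans (cong (ι k ⊗_) (sym (-1⊗ a)))
                (trans (⊗-left-comm _ _ _) (trans (-1⊗ _) (sym (⊕-identityˡ _))))))
                (⊗-nonneg (0≼ι k) (0≼-gap q)))

    checkCert-sound : ∀ hs g k cs → All (λ h → ⟦ h ⟧F ρ) hs → T (checkCert hs g k cs) → ι 0 ≼ evalP ρ g
    checkCert-sound hs g k cs ps t with ∧-elim t
    ... | t₁ , t₂ = suc⊗-cancel k _ (≼-from-gap (subst (ι 0 ≼_) (cong (ι (suc k) ⊗ evalP ρ g ⊕_) (sym zero-neg))
        (subst (ι 0 ≼_) (sym (⊕-identityʳ _)) 0≼kg)))
      where
      total = nonPosP-sound (addP (scale -[1+ k ] g) (combine hs cs)) t₂
      zero-neg : ⊝ ι 0 ≡ ι 0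
      zero-neg = trans (sym (⊕-identityˡ _)) (⊕-inverseʳ (ι 0))
      total-eq : evalP ρ (addP (scale -[1+ k ] g) (combine hs cs)) ≡ evalP ρ (combine hs cs) ⊖ ι (suc k) ⊗ evalP
          ρ g
      total-eq = trans (addP-sound ρ (scale -[1+ k ] g) (combine hs cs)) (trans (⊕-comm _ _)
        (cong (evalP ρ (combine hs cs) ⊕_) (trans (scale-sound ρ -[1+ k ] g)
          (trans (cong (_⊗ evalP ρ g) (trans (cong ζ (cong -[1+_] (sym (ℕₚ.+-identityʳ k))))
              (ζ-* -[1+ 0 ] (+ suc k))))
            (trans (⊗-assoc _ _ _) (-1⊗ _))))))
      0≼kg : ι 0 ≼ ι (suc k) ⊗ evalP ρ g
      0≼kg = ≼-trans (combine-nonneg hs cs ps t₁) (≼-from-gap (subst (ι 0 ≼_)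
        (trans (⊕-identityˡ _) (trans (cong ⊝_ total-eq) neg-gap)) (0≼-gap total)))
        where
        A = evalP ρ (combine hs cs)
        B = ι (suc k) ⊗ evalP ρ g
        neg-gap : ⊝ (A ⊖ B) ≡ B ⊖ A
        neg-gap = ⊕-cancelʳ (A ⊖ B) _ _ (trans (⊕-comm _ _) (trans (⊕-inverseʳ _)
            (sym (trans (⊕-assoc B (⊝ A) _)
          (trans (cong (B ⊕_) (trans (sym (⊕-assoc (⊝ A) A (⊝ B)))
              (trans (cong (_⊕ ⊝ B) (trans (⊕-comm _ _) (⊕-inverseʳ A))) (⊕-identityˡ _)))) (⊕-inverseʳ B))))))

  -- Search for the multipliers by Gaussian and Fourier–Motzkin elimination.
  -- A row carries the multipliers it was obtained with; multiplier 0 belongs to the negated goal.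

  Row : Set
  Row = Poly × List ℤ

  addC : List ℤ → List ℤ → List ℤ
  addC []       ds       = ds
  addC cs       []       = cs
  addC (c ∷ cs) (d ∷ ds) = c ℤ.+ d ∷ addC cs ds

  linComb : ℤ → Row → ℤ → Row → Row
  linComb a (p , cs) b (q , ds) = addP (scale a p) (scale b q) , addC (map (a ℤ.*_) cs) (map (b ℤ.*_) ds)

  coeff : Mono → Poly → ℤ
  coeff m []             = + 0
  coeff m ((m′ , c) ∷ p) = if eqM m m′ then c else coeff m p

  posCoeff negCoeff : Mono → Row → Bool
  posCoeff m (p , _) with coeff m p
  ... | + suc _ = true
  ... | _       = false
  negCoeff m (p , _) with coeff m p
  ... | -[1+ _ ] = true
  ... | _        = false

  filterᵇ′ : {A : Set} → (A → Bool) → List A → List A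
  filterᵇ′ f []       = []
  filterᵇ′ f (x ∷ xs) = if f x then x ∷ filterᵇ′ f xs else filterᵇ′ f xs

  headMono : Poly → Maybe Mono
  headMono []                 = nothing
  headMono (([] , _) ∷ p)     = headMono p
  headMono ((m@(_ ∷ _) , _) ∷ _) = just m

  reduceBy : Mono → Row → Row → Row
  reduceBy m e r with coeff m (proj₁ r)
  ... | + 0 = r
  ... | a with coeff m (proj₁ e)
  ...   | + n        = linComb (+ n) r (ℤ.- a) e
  ...   | -[1+ n ]   = linComb (+ suc n) r a e

  gauss : ℕ → List Row → List Row → List Row
  gauss zero    es       rs = rs
  gauss (suc n) []       rs = rs
  gauss (suc n) (e ∷ es) rs with headMono (proj₁ e)
  ... | nothing = gauss n es rs
  ... | just m  = gauss n (map (reduceBy m e) es) (map (reduceBy m e) rs)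

  cross : Mono → List Row → List Row → List Row
  cross m ps qs = concatMap (λ p → map (λ q → linComb (ℤ.- coeff m (proj₁ q)) p (coeff m (proj₁ p)) q) qs) ps

  monos : List Row → List Mono
  monos = concatMap (λ r → filterᵇ′ (λ { [] → false ; (_ ∷ _) → true }) (map proj₁ (proj₁ r)))

  cost : List Row → Mono → ℕ
  cost rs m = length (filterᵇ′ (posCoeff m) rs) ℕ.* length (filterᵇ′ (negCoeff m) rs)

  cheapest : List Row → List Mono → Maybe (Mono × ℕ) → Maybe Mono
  cheapest rs []       nothing        = nothing
  cheapest rs []       (just (m , _)) = just m
  cheapest rs (m ∷ ms) nothing        = cheapest rs ms (just (m , cost rs m))
  cheapest rs (m ∷ ms) (just (b , c)) with cost rs m
  ... | d = cheapest rs ms (if d <ᵇ c then just (m , d) else just (b , c))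

  fourierMotzkin : ℕ → List Row → List Row
  fourierMotzkin zero    rs = rs
  fourierMotzkin (suc n) rs with cheapest rs (monos rs) nothing
  ... | nothing = rs
  ... | just m  = fourierMotzkin n
    (cross m (filterᵇ′ (posCoeff m) rs) (filterᵇ′ (negCoeff m) rs) ++
     filterᵇ′ (λ r → not (posCoeff m r) ∧ not (negCoeff m r)) rs)

  goalUsed : Row → Bool
  goalUsed (_ , + suc _ ∷ _) = true
  goalUsed _                 = false

  closed : Row → Bool
  closed r = goalUsed r ∧ nonPosP (proj₁ r)

  -- A row that uses the goal may be left with a positive constant, for instance when the goal is
  -- `1 ≤ 0`. A row free of the goal with a negative constant exposes contradictory hypotheses, and
  -- a multiple of it cancels that constant.
  pick : List Row → Maybe (ℕ × List ℤ)
  pick rs with filterᵇ′ closed (rs ++ concatMap (λ r → map (λ s → linComb (coeff [] (proj₁ r)) s (ℤ.- coeff [] (proj₁ s)) r)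
                                          (filterᵇ′ (λ s → not (goalUsed s) ∧ negCoeff [] s) rs))
                                (filterᵇ′ (λ r → goalUsed r ∧ posCoeff [] r) rs))
  ... | (_ , + suc k ∷ cs) ∷ _ = just (k , cs)
  ... | _                      = nothing

  unit : ℕ → List ℤ
  unit zero    = + 1 ∷ []
  unit (suc n) = + 0 ∷ unit n

  rowsFrom : (Formula → Bool) → ℕ → List Formula → List Row
  rowsFrom f n []       = []
  rowsFrom f n (h ∷ hs) = if f h then (gap h , unit n) ∷ rowsFrom f (suc n) hs else rowsFrom f (suc n) hs

  search : List Formula → Poly → Maybe (ℕ × List ℤ)
  -- Fuel: at most 40 equations are used and at most 40 monomials eliminated.
  search hs g = pick (fourierMotzkin 40 (gauss 40 (rowsFrom isEq 1 hs)
    ((scale -[1+ 0 ] g , unit 0) ∷ rowsFrom (λ h → not (isEq h)) 1 hs)))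

  -- Soundness rests on the checker alone: a wrong answer of `search` only makes `proves` false.
  proves : List Formula → Poly → Bool
  proves hs g with search hs g
  ... | nothing       = false
  ... | just (k , cs) = checkCert hs g k cs

  proves-sound : ∀ ρ hs g → All (λ h → ⟦ h ⟧F ρ) hs → T (proves hs g) → ι 0 ≼ evalP ρ g
  proves-sound ρ hs g ps t with search hs g
  ... | just (k , cs) = checkCert-sound ρ hs g k cs ps t

  decide : List Formula → Sequent → Bool
  decide hs (⊢ (l :≤ r)) = proves hs (gap (l :≤ r))
  decide hs (⊢ (l :≡ r)) = proves hs (gap (l :≤ r)) ∧ proves hs (gap (r :≤ l))
  decide hs (h ⇒ s)      = decide (h ∷ hs) s

  decide-sound : ∀ ρ hs s → All (λ h → ⟦ h ⟧F ρ) hs → T (decide hs s) → ⟦ s ⟧S ρ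
  decide-sound ρ hs (⊢ (l :≤ r)) ps t = ≼-from-gap (subst (ι 0 ≼_) (norm-sound ρ (r :- l))
      (proves-sound ρ hs _ ps t))
  decide-sound ρ hs (⊢ (l :≡ r)) ps t with ∧-elim t
  ... | t₁ , t₂ = ≼-antisym (decide-sound ρ hs (⊢ (l :≤ r)) ps t₁) (decide-sound ρ hs (⊢ (r :≤ l)) ps t₂)
  decide-sound ρ hs (h ⇒ s)      ps t = λ p → decide-sound ρ (h ∷ hs) s (p ∷ ps) t

  Schema : ℕ → Set
  Schema zero    = Sequent
  Schema (suc n) = Expr → Schema n

  instantiate : ∀ n → ℕ → Schema n → Sequent
  instantiate zero    i s = s
  instantiate (suc n) i f = instantiate n (suc i) (f (var i))

  Closure : ℕ → List Q → Sequent → Set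
  Closure zero    ρ s = ⟦ s ⟧S ρ
  Closure (suc n) ρ s = ∀ a → Closure n (ρ ++ a ∷ []) s

  -- Linear arithmetic, with the monomials as unknowns: nonlinear facts have to be supplied as hypotheses.

  lin : ∀ n (f : Schema n) {_ : T (decide [] (instantiate n 0 f))} → Closure n [] (instantiate n 0 f)
  lin n f {t} = go n [] 
    where
    go : ∀ m ρ → Closure m ρ (instantiate n 0 f)
    go zero    ρ = decide-sound ρ [] (instantiate n 0 f) [] t
    go (suc m) ρ = λ a → go m (ρ ++ a ∷ [])

open Lin using (lin; con; :-_; _:+_; _:-_; _:*_; _:≤_; _:≡_; _⇒_; ⊢_; ⊕-identityʳ; ⊗-identityʳ; ⊗-distribʳ;
    ⊗-zeroˡ; ⊗-zeroʳ; -1⊗; ⊕-left-comm; ⊗-left-comm; 0≼-gap)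

-- Absolute values, indicators and finite sums

⊗-monoˡ : ∀ {a b c} → ι 0 ≼ c → a ≼ b → c ⊗ a ≼ c ⊗ b
⊗-monoˡ {a} {b} {c} p q = lin 3 (λ a b c → con 0 :≤ c :* (b :- a) ⇒ ⊢ c :* a :≤ c :* b) a b c
    (⊗-nonneg p (0≼-gap q))

⊗-monoʳ : ∀ {a b c} → ι 0 ≼ c → a ≼ b → a ⊗ c ≼ b ⊗ c
⊗-monoʳ {a} {b} {c} p q = subst₂ _≼_ (⊗-comm c a) (⊗-comm c b) (⊗-monoˡ p q)

⊗-mono : ∀ {a b c d} → ι 0 ≼ a → ι 0 ≼ d → a ≼ b → c ≼ d → a ⊗ c ≼ b ⊗ d
⊗-mono p q r s = ≼-trans (⊗-monoˡ p s) (⊗-monoʳ q r)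

0≼∥∥ : ∀ a → ι 0 ≼ ∥ a ∥
0≼∥∥ a = lin 2 (λ a b → a :≤ b ⇒ :- a :≤ b ⇒ ⊢ con 0 :≤ b) a ∥ a ∥ (≼-∥∥ a) (⊝-∥∥ a)

∥∥-triangle : ∀ a b → ∥ a ⊕ b ∥ ≼ ∥ a ∥ ⊕ ∥ b ∥
∥∥-triangle a b = ∥∥-≼
  (⊕-mono (≼-∥∥ a) (≼-∥∥ b))
  (lin 4 (λ a b c d → :- a :≤ c ⇒ :- b :≤ d ⇒ ⊢ :- (a :+ b) :≤ c :+ d) a b _ _ (⊝-∥∥ a) (⊝-∥∥ b))

∥∥-nonneg : ∀ {a} → ι 0 ≼ a → ∥ a ∥ ≡ a
∥∥-nonneg {a} p = ≼-antisym (∥∥-≼ ≼-refl (lin 1 (λ a → con 0 :≤ a ⇒ ⊢ :- a :≤ a) a p)) (≼-∥∥ a)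

∥∥-contract : ∀ {c} a → ∥ c ∥ ≼ ι 1 → ∥ c ⊗ a ∥ ≼ ∥ a ∥
∥∥-contract {c} a p = subst₂ _≼_ (sym (∥∥-⊗ c a)) (⊗-identityˡ _) (⊗-monoʳ (0≼∥∥ a) p)

0≼1 : ι 0 ≼ ι 1
0≼1 = 0≼ι 1

1⋠0 : ¬ (ι 1 ≼ ι 0)
1⋠0 p with ι-cancel {1} {0} p
... | ()

𝟙 : {P : Set} → Dec P → Q
𝟙 d = if does d then ι 1 else ι 0

𝟙-yes : {P : Set} (d : Dec P) → P → 𝟙 d ≡ ι 1
𝟙-yes d p rewrite dec-true d p = refl

𝟙-no : {P : Set} (d : Dec P) → ¬ P → 𝟙 d ≡ ι 0
𝟙-no d p rewrite dec-false d p = refl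

𝟙-⇔ : {P R : Set} (d : Dec P) (e : Dec R) → (P → R) → (R → P) → 𝟙 d ≡ 𝟙 e
𝟙-⇔ (yes p) e f g = sym (𝟙-yes e (f p))
𝟙-⇔ (no ¬p) e f g = sym (𝟙-no e (λ r → ¬p (g r)))

𝟙-nonneg : {P : Set} (d : Dec P) → ι 0 ≼ 𝟙 d
𝟙-nonneg (yes _) = 0≼1
𝟙-nonneg (no _)  = ≼-refl

𝟙-≼1 : {P : Set} (d : Dec P) → 𝟙 d ≼ ι 1
𝟙-≼1 (yes _) = ≼-refl
𝟙-≼1 (no _)  = 0≼1

-- Indices start at 1, so that arbitrary values at 0, such as those of `inv` and `additive`, never
-- enter.
∑ : ℕ → (ℕ → Q) → Q
∑ zero    f = ι 0
∑ (suc n) f = ∑ n f ⊕ f (suc n)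

∑-cong : ∀ n {f g} → (∀ i → 1 ≤ i → i ≤ n → f i ≡ g i) → ∑ n f ≡ ∑ n g
∑-cong zero    h = refl
∑-cong (suc n) h = cong₂ _⊕_ (∑-cong n (λ i p q → h i p (ℕₚ.m≤n⇒m≤1+n q))) (h (suc n) (s≤s z≤n) ℕₚ.≤-refl)

∑-cong′ : ∀ n {f g} → (∀ i → f i ≡ g i) → ∑ n f ≡ ∑ n g
∑-cong′ n h = ∑-cong n (λ i _ _ → h i)

∑-mono : ∀ n {f g} → (∀ i → 1 ≤ i → i ≤ n → f i ≼ g i) → ∑ n f ≼ ∑ n g
∑-mono zero    h = ≼-refl
∑-mono (suc n) h = ⊕-mono (∑-mono n (λ i p q → h i p (ℕₚ.m≤n⇒m≤1+n q))) (h (suc n) (s≤s z≤n) ℕₚ.≤-refl)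

∑-const : ∀ n c → ∑ n (λ _ → c) ≡ ι n ⊗ c
∑-const zero    c = sym (⊗-zeroˡ c)
∑-const (suc n) c = trans (cong (_⊕ c) (∑-const n c))
  (trans (lin 2 (λ m c → ⊢ m :* c :+ c :≡ (con 1 :+ m) :* c) (ι n) c) (cong (_⊗ c) (sym (ι-+ 1 n))))

∑-zero : ∀ n {f} → (∀ i → 1 ≤ i → i ≤ n → f i ≡ ι 0) → ∑ n f ≡ ι 0
∑-zero n h = trans (∑-cong n h) (trans (∑-const n (ι 0)) (⊗-zeroʳ _))

∑-nonneg : ∀ n {f} → (∀ i → 1 ≤ i → i ≤ n → ι 0 ≼ f i) → ι 0 ≼ ∑ n f
∑-nonneg n {f} h = subst (_≼ ∑ n f) (∑-zero n (λ _ _ _ → refl)) (∑-mono n h)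

∑-⊕ : ∀ n f g → ∑ n (λ i → f i ⊕ g i) ≡ ∑ n f ⊕ ∑ n g
∑-⊕ zero    f g = sym (⊕-identityˡ _)
∑-⊕ (suc n) f g = trans (cong (_⊕ (f (suc n) ⊕ g (suc n))) (∑-⊕ n f g))
  (lin 4 (λ a b c d → ⊢ (a :+ b) :+ (c :+ d) :≡ (a :+ c) :+ (b :+ d)) (∑ n f) (∑ n g) _ _)

∑-⊗ˡ : ∀ n c f → ∑ n (λ i → c ⊗ f i) ≡ c ⊗ ∑ n f
∑-⊗ˡ zero    c f = sym (⊗-zeroʳ c)
∑-⊗ˡ (suc n) c f = trans (cong (_⊕ c ⊗ f (suc n)) (∑-⊗ˡ n c f)) (sym (⊗-distribˡ c _ _))

∑-⊗ʳ : ∀ n c f → ∑ n (λ i → f i ⊗ c) ≡ ∑ n f ⊗ c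
∑-⊗ʳ n c f = trans (∑-cong′ n (λ i → ⊗-comm (f i) c)) (trans (∑-⊗ˡ n c f) (⊗-comm c _))

∑-⊝ : ∀ n f → ∑ n (λ i → ⊝ f i) ≡ ⊝ ∑ n f
∑-⊝ n f = trans (∑-cong′ n (λ i → sym (-1⊗ (f i)))) (trans (∑-⊗ˡ n _ f) (-1⊗ _))

∑-⊖ : ∀ n f g → ∑ n (λ i → f i ⊖ g i) ≡ ∑ n f ⊖ ∑ n g
∑-⊖ n f g = trans (∑-⊕ n f (λ i → ⊝ g i)) (cong (∑ n f ⊕_) (∑-⊝ n g))

∑-swap : ∀ m n (f : ℕ → ℕ → Q) → ∑ m (λ i → ∑ n (f i)) ≡ ∑ n (λ j → ∑ m (λ i → f i j))
∑-swap zero    n f = sym (∑-zero n (λ _ _ _ → refl))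
∑-swap (suc m) n f = trans (cong (_⊕ ∑ n (f (suc m))) (∑-swap m n f)) (sym (∑-⊕ n _ _))

∥∑∥ : ∀ n f → ∥ ∑ n f ∥ ≼ ∑ n (λ i → ∥ f i ∥)
∥∑∥ zero    f = ≼-reflexive (∥∥-nonneg ≼-refl)
∥∑∥ (suc n) f = ≼-trans (∥∥-triangle _ _) (⊕-mono (∥∑∥ n f) ≼-refl)

∑-trunc : ∀ {m n} f → m ≤ n → (∀ i → m < i → i ≤ n → f i ≡ ι 0) → ∑ n f ≡ ∑ m f
∑-trunc {m} {n} f p h with m ≟ n
... | yes refl = refl
∑-trunc {m} {zero}  f z≤n h | no _ = refl
∑-trunc {m} {suc n} f p   h | no m≢n with ℕₚ.m≤n⇒m<n∨m≡n p
... | inj₂ e          = contradiction e m≢n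
... | inj₁ m<sn@(s≤s q) = trans (cong₂ _⊕_ (∑-trunc f q (λ i a b → h i a (ℕₚ.m≤n⇒m≤1+n b)))
    (h (suc n) m<sn ℕₚ.≤-refl)) (⊕-identityʳ _)

∑-monoʳ : ∀ {m n} f → m ≤ n → (∀ i → m < i → i ≤ n → ι 0 ≼ f i) → ∑ m f ≼ ∑ n f
∑-monoʳ {m} {n} f p h with m ≟ n
... | yes refl = ≼-refl
∑-monoʳ {m} {zero}  f z≤n h | no _ = ≼-refl
∑-monoʳ {m} {suc n} f p   h | no m≢n with ℕₚ.m≤n⇒m<n∨m≡n p
... | inj₂ e          = contradiction e m≢n
... | inj₁ m<sn@(s≤s q) = ≼-trans (∑-monoʳ f q (λ i a b → h i a (ℕₚ.m≤n⇒m≤1+n b)))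
  (lin 2 (λ a b → con 0 :≤ b ⇒ ⊢ a :≤ a :+ b) _ _ (h (suc n) m<sn ℕₚ.≤-refl))

∑-single : ∀ n k (f : ℕ → Q) → 1 ≤ k → k ≤ n → (∀ i → 1 ≤ i → i ≤ n → i ≢ k → f i ≡ ι 0) → ∑ n f ≡ f k
∑-single zero (suc k) f p () h
∑-single (suc n) k f p q h with k ≟ suc n
... | yes refl = trans (cong (_⊕ f (suc n)) (∑-zero n (λ i a b → h i a (ℕₚ.m≤n⇒m≤1+n b) (ℕₚ.<⇒≢ (s≤s b)))))
    (⊕-identityˡ _)
... | no k≢ = trans (cong₂ _⊕_
  (∑-single n k f p (ℕₚ.≤-pred (ℕₚ.≤∧≢⇒< q k≢)) (λ i a b → h i a (ℕₚ.m≤n⇒m≤1+n b)))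
  (h (suc n) (s≤s z≤n) ℕₚ.≤-refl (λ e → k≢ (sym e)))) (⊕-identityʳ _)

∑-δ : ∀ n k (f : ℕ → Q) → 1 ≤ k → k ≤ n → ∑ n (λ i → 𝟙 (i ≟ k) ⊗ f i) ≡ f k
∑-δ n k f p q = trans (∑-single n k _ p q (λ i _ _ ne → trans (cong (_⊗ f i) (𝟙-no (i ≟ k) ne)) (⊗-zeroˡ _)))
  (trans (cong (_⊗ f k) (𝟙-yes (k ≟ k) refl)) (⊗-identityˡ _))

∑-split : ∀ m n (f : ℕ → Q) → ∑ (m + n) f ≡ ∑ m f ⊕ ∑ n (λ i → f (m + i))
∑-split m zero    f rewrite ℕₚ.+-identityʳ m = sym (⊕-identityʳ _)
∑-split m (suc n) f rewrite ℕₚ.+-suc m n = trans (cong (_⊕ f (suc (m + n))) (∑-split m n f)) (⊕-assoc _ _ _)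

∑-telescope : ∀ n (g : ℕ → Q) → ∑ n (λ i → g i ⊖ g (suc i)) ≡ g 1 ⊖ g (suc n)
∑-telescope zero    g = sym (⊕-inverseʳ (g 1))
∑-telescope (suc n) g = trans (cong (_⊕ (g (suc n) ⊖ g (suc (suc n)))) (∑-telescope n g))
  (lin 3 (λ a b c → ⊢ (a :- b) :+ (b :- c) :≡ a :- c) (g 1) (g (suc n)) (g (suc (suc n))))

abel : ∀ n (c g : ℕ → Q) → ∑ n (λ i → c i ⊗ g i) ≡ ∑ n (λ k → ∑ k c ⊗ (g k ⊖ g (suc k))) ⊕ ∑ n c ⊗ g (suc n)
abel zero    c g = lin 1 (λ a → ⊢ con 0 :≡ con 0 :+ con 0 :* a) (g 1)
abel (suc n) c g = trans (cong (_⊕ c (suc n) ⊗ g (suc n)) (abel n c g))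
  (lin 5 (λ A S c g h → ⊢ (A :+ S :* g) :+ c :* g :≡ (A :+ (S :+ c) :* (g :- h)) :+ (S :+ c) :* h)
    (∑ n (λ k → ∑ k c ⊗ (g k ⊖ g (suc k)))) (∑ n c) (c (suc n)) (g (suc n)) (g (suc (suc n))))

-- Primes, additive functions and Möbius inversion

prime≥2 : ∀ {p} → Prime p → 2 ≤ p
prime≥2 {zero}        pr = contradiction pr ¬prime[0]
prime≥2 {suc zero}    pr = contradiction pr ¬prime[1]
prime≥2 {suc (suc p)} pr = s≤s (s≤s z≤n)

prime≥1 : ∀ {p} → Prime p → 1 ≤ p
prime≥1 pr = ℕₚ.≤-trans (s≤s z≤n) (prime≥2 pr)

prime∤1 : ∀ {p} → Prime p → ¬ p ∣ 1
prime∤1 pr d = ¬prime[1] (subst Prime (∣1⇒≡1 d) pr)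

prime∣prime : ∀ {p q} → Prime p → Prime q → p ∣ q → p ≡ q
prime∣prime pp pq d with prime⇒irreducible pq d
... | inj₁ refl = contradiction pp ¬prime[1]
... | inj₂ e    = e

primeDivisor : ∀ n → 2 ≤ n → ∃ λ q → Prime q × q ∣ n
primeDivisor n@(suc (suc _)) (s≤s (s≤s _)) with factorise n
... | record { factors = [] ; isFactorisation = () }
... | record { factors = q ∷ qs ; isFactorisation = e ; factorsPrime = pq ∷ _ } =
  q , pq , subst (q ∣_) (sym e) (m∣m*n (product qs))

∣⇒≤′ : ∀ {m n} → 1 ≤ n → m ∣ n → m ≤ n
∣⇒≤′ p d = ∣⇒≤ {{>-nonZero p}} d

^≥1 : ∀ {p} k → 1 ≤ p → 1 ≤ p ^ k
^≥1 zero    h = ℕₚ.≤-refl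
^≥1 (suc k) h = ℕₚ.*-mono-≤ h (^≥1 k h)

n<p^n : ∀ {p} → 2 ≤ p → ∀ n → n < p ^ n
n<p^n     h zero    = s≤s z≤n
n<p^n {p} h (suc n) = ℕₚ.≤-trans (ℕₚ.+-mono-≤ (^≥1 n (ℕₚ.≤-trans (s≤s z≤n) h)) (n<p^n h n))
  (ℕₚ.≤-trans (ℕₚ.≤-reflexive (cong (p ^ n +_) (sym (ℕₚ.+-identityʳ (p ^ n))))) (ℕₚ.*-monoˡ-≤ (p ^ n) h))

prime-power-∣ : ∀ {p q} k m → Prime p → Prime q → p ≢ q → p ^ k ∣ q * m → p ^ k ∣ m
prime-power-∣ zero    m pp pq ne d = 1∣ m
prime-power-∣ {p} {q} (suc k) m pp pq ne d with euclidsLemma q m pp (m*n∣⇒m∣ p (p ^ k) d)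
... | inj₁ p∣q = contradiction (prime∣prime pp pq p∣q) ne
... | inj₂ (divides m′ refl) = subst (p * p ^ k ∣_) (ℕₚ.*-comm p m′) (*-monoʳ-∣ p (prime-power-∣ k m′ pp pq ne
  (*-cancelˡ-∣ p {{prime⇒nonZero pp}} (subst (p * p ^ k ∣_) eq d))))
  where
  eq : q * (m′ * p) ≡ p * (q * m′)
  eq = trans (sym (ℕₚ.*-assoc q m′ p)) (ℕₚ.*-comm (q * m′) p)

module Additive (ℓ : ℕ → Q) where

  total : List ℕ → Q
  total []       = ι 0
  total (p ∷ ps) = ℓ p ⊕ total ps

  total-++ : ∀ ps qs → total (ps ++ qs) ≡ total ps ⊕ total qs
  total-++ []       qs = sym (⊕-identityˡ _)
  total-++ (p ∷ ps) qs = trans (cong (ℓ p ⊕_) (total-++ ps qs)) (sym (⊕-assoc _ _ _))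

  total-↭ : ∀ {ps qs} → ps ↭ qs → total ps ≡ total qs
  total-↭ Perm.refl         = refl
  total-↭ (Perm.prep x r)   = cong (ℓ x ⊕_) (total-↭ r)
  total-↭ (Perm.swap x y r) = trans (⊕-left-comm _ _ _) (cong (λ z → ℓ y ⊕ (ℓ x ⊕ z)) (total-↭ r))
  total-↭ (Perm.trans r s)  = trans (total-↭ r) (total-↭ s)

  additive : ℕ → Q
  additive zero    = ι 0
  additive (suc n) = total (factors (factorise (suc n)))

  -- Two prime factorisations are permutations of each other. The freedom of choice lets
  -- `additive-*` concatenate factorisations.
  additive-factors : ∀ {n} → 1 ≤ n → (f : PrimeFactorisation n) → additive n ≡ total (factors f)
  additive-factors {suc n} _ f = total-↭ (factorisationUnique (factorise (suc n)) f)

  additive-* : ∀ m n → 1 ≤ m → 1 ≤ n → additive (m * n) ≡ additive m ⊕ additive n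
  additive-* m n p q = trans (additive-factors (ℕₚ.*-mono-≤ p q) fac)
    (trans (total-++ (factors fm) (factors fn)) (sym (cong₂ _⊕_ (additive-factors p fm)
        (additive-factors q fn))))
    where
    fm = factorise m {{>-nonZero p}}
    fn = factorise n {{>-nonZero q}}
    fac : PrimeFactorisation (m * n)
    fac = record
      { factors         = factors fm ++ factors fn
      ; isFactorisation = trans (cong₂ _*_ (isFactorisation fm) (isFactorisation fn))
                                   (sym (product-++ (factors fm) (factors fn)))
      ; factorsPrime    = ++⁺ (factorsPrime fm) (factorsPrime fn) }

-- Test functions vanish beyond `X`, so sums of `G (m * n)` over `m, n ≤ X` in effect run over all
-- pairs and can be regrouped by the product.
Supp : ℕ → (ℕ → Q) → Set
Supp X G = ∀ n → X < n → G n ≡ ι 0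

Supp-dilate : ∀ {X} {G : ℕ → Q} d → 1 ≤ d → Supp X G → Supp X (λ n → G (n * d))
Supp-dilate {X} d p s n q = s (n * d) (ℕₚ.≤-trans q (subst (_≤ n * d) (ℕₚ.*-identityʳ n) (ℕₚ.*-monoʳ-≤ n p)))

module _ (X : ℕ) where

  -- The Dirichlet convolution of `h` with the point mass at `q`, expressed by its action on the
  -- test function `G`.
  push : ∀ {G : ℕ → Q} (h : ℕ → Q) q → 1 ≤ q → Supp X G →
         ∑ X (λ n → h n ⊗ G (n * q)) ≡ ∑ X (λ m → ∑ X (λ n → 𝟙 (m ≟ n * q) ⊗ h n) ⊗ G m)
  push {G} h q q≥1 s = begin
    ∑ X (λ n → h n ⊗ G (n * q))                                    ≡⟨ ∑-cong X
        (λ n p _ → cong (h n ⊗_) (sym (pick n p))) ⟩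
    ∑ X (λ n → h n ⊗ ∑ X (λ m → 𝟙 (m ≟ n * q) ⊗ G m))              ≡⟨ ∑-cong′ X (λ n → sym (∑-⊗ˡ X (h n) _)) ⟩
    ∑ X (λ n → ∑ X (λ m → h n ⊗ (𝟙 (m ≟ n * q) ⊗ G m)))            ≡⟨ ∑-swap X X _ ⟩
    ∑ X (λ m → ∑ X (λ n → h n ⊗ (𝟙 (m ≟ n * q) ⊗ G m)))            ≡⟨ ∑-cong′ X (λ m → trans (∑-cong′ X (λ n →
                                                                         lin 3 (λ a b c → ⊢ a :* (b :* c) :≡ b
                                                                             :* a :* c) (h n) (𝟙 (m ≟ n * q))
                                                                             (G m)))
                                                                         (∑-⊗ʳ X (G m) _)) ⟩
    ∑ X (λ m → ∑ X (λ n → 𝟙 (m ≟ n * q) ⊗ h n) ⊗ G m)              ∎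
    where
    open ≡-Reasoning
    pick : ∀ n → 1 ≤ n → ∑ X (λ m → 𝟙 (m ≟ n * q) ⊗ G m) ≡ G (n * q)
    pick n p with n * q ≤? X
    ... | yes le = ∑-δ X (n * q) G (ℕₚ.*-mono-≤ p q≥1) le
    ... | no ¬le = trans (∑-zero X (λ m _ m≤X → trans (cong (_⊗ G m) (𝟙-no (m ≟ n * q) (λ { refl → ¬le m≤X })))
        (⊗-zeroˡ _)))
                         (sym (s (n * q) (ℕₚ.≰⇒> ¬le)))

  fibre : ∀ (h : ℕ → Q) q k → 1 ≤ q → 1 ≤ k → k ≤ X → ∑ X (λ n → 𝟙 (k * q ≟ n * q) ⊗ h n) ≡ h k
  fibre h q k q≥1 p le = trans (∑-cong′ X (λ n → cong (_⊗ h n) (𝟙-⇔ (k * q ≟ n * q) (n ≟ k)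
      (λ e → sym (ℕₚ.*-cancelʳ-≡ k n q {{>-nonZero q≥1}} e)) (λ { refl → refl }))))
    (∑-δ X k h p le)

  fibre-empty : ∀ (h : ℕ → Q) q m → ¬ q ∣ m → ∑ X (λ n → 𝟙 (m ≟ n * q) ⊗ h n) ≡ ι 0
  fibre-empty h q m nd = ∑-zero X (λ n _ _ → trans (cong (_⊗ h n) (𝟙-no (m ≟ n * q) (λ e → nd (divides n e))))
      (⊗-zeroˡ _))

  factor≤ : ∀ {k q m} → 1 ≤ m → m ≤ X → m ≡ k * q → 1 ≤ k × 1 ≤ q × k ≤ X
  factor≤ {zero}          () le refl
  factor≤ {suc k} {zero}  p le e = contradiction p (ℕₚ.<⇒≱ (subst (_< 1) (sym (trans e (ℕₚ.*-zeroʳ k)))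
      (s≤s z≤n)))
  factor≤ {suc k} {suc q} p le refl = s≤s z≤n , s≤s z≤n , ℕₚ.≤-trans (ℕₚ.m≤m*n (suc k) (suc q)) le

  sum-multiples : ∀ {G : ℕ → Q} q → 1 ≤ q → Supp X G → ∑ X (λ n → G (n * q)) ≡ ∑ X (λ m → 𝟙 (q ∣? m) ⊗ G m)
  sum-multiples {G} q q≥1 s = trans (∑-cong′ X (λ n → sym (⊗-identityˡ _)))
    (trans (push (λ _ → ι 1) q q≥1 s) (∑-cong X (λ m p le → cong (_⊗ G m) (count m p le))))
    where
    count : ∀ m → 1 ≤ m → m ≤ X → ∑ X (λ n → 𝟙 (m ≟ n * q) ⊗ ι 1) ≡ 𝟙 (q ∣? m)
    count m p le with q ∣? m
    ... | no nd = fibre-empty (λ _ → ι 1) q m nd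
    ... | yes (divides k refl) with factor≤ p le refl
    ...   | a , _ , b = fibre (λ _ → ι 1) q k q≥1 a b

  -- Möbius inversion, one prime at a time: μ P is the Möbius function restricted to the P-smooth numbers.

  μ : ℕ → ℕ → Q
  μ zero    m = 𝟙 (m ≟ 1)
  μ (suc P) m = μ P m ⊖ 𝟙 (prime? (suc P)) ⊗ ∑ X (λ n → 𝟙 (m ≟ n * suc P) ⊗ μ P n)

  μ-large : ∀ P m q → 1 ≤ m → m ≤ X → Prime q → P < q → q ∣ m → μ P m ≡ ι 0
  μ-large zero    m q p le pq _ d = 𝟙-no (m ≟ 1) (λ { refl → prime∤1 pq d })
  μ-large (suc P) m q p le pq lt d with prime? (suc P)
  ... | no _   = trans (cong₂ _⊖_ (μ-large P m q p le pq (ℕₚ.<-trans (ℕₚ.n<1+n P) lt) d) (⊗-zeroˡ _))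
                          (⊕-inverseʳ _)
  ... | yes pP = trans (cong₂ _⊖_ (μ-large P m q p le pq (ℕₚ.<-trans (ℕₚ.n<1+n P) lt) d)
                            (trans (cong (ι 1 ⊗_) rest) (⊗-zeroʳ _))) (⊕-inverseʳ _)
    where
    rest : ∑ X (λ n → 𝟙 (m ≟ n * suc P) ⊗ μ P n) ≡ ι 0
    rest with suc P ∣? m
    ... | no nd = fibre-empty (μ P) (suc P) m nd
    ... | yes (divides k refl) with factor≤ p le refl
    ...   | a , b , c = trans (fibre (μ P) (suc P) k b a c) (μ-large P k q a c pq (ℕₚ.<-trans (ℕₚ.n<1+n P) lt)
        q∣k)
      where
      q∣k : q ∣ k
      q∣k with euclidsLemma k (suc P) pq d
      ... | inj₁ r = r
      ... | inj₂ r = contradiction (sym (prime∣prime pq pP r)) (ℕₚ.<⇒≢ lt)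

  -- The recursion subtracts two values of which at most one is nonzero: if the prime `suc P`
  -- divides `m`, then `μ-large` kills `μ P m`.
  μ-bound : ∀ P m → 1 ≤ m → m ≤ X → ∥ μ P m ∥ ≼ ι 1
  μ-bound zero    m p le = ≼-trans (≼-reflexive (∥∥-nonneg (𝟙-nonneg (m ≟ 1)))) (𝟙-≼1 (m ≟ 1))
  μ-bound (suc P) m p le with prime? (suc P)
  ... | no _   = subst (λ z → ∥ z ∥ ≼ ι 1) (lin 2 (λ a b → ⊢ a :≡ a :- con 0 :* b) (μ P m) _) (μ-bound P m p le)
  ... | yes pP with suc P ∣? m
  ...   | no nd = subst (λ z → ∥ z ∥ ≼ ι 1) (trans (lin 1 (λ a → ⊢ a :≡ a :- con 1 :* con 0) (μ P m))
                    (cong (λ z → μ P m ⊖ ι 1 ⊗ z) (sym (fibre-empty (μ P) (suc P) m nd)))) (μ-bound P m p le)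
  ...   | yes (divides k refl) with factor≤ p le refl
  ...     | a , b , c = subst (_≼ ι 1) (trans (sym (∥∥-neg (μ P k))) (cong ∥_∥ eq)) (μ-bound P k a c)
    where
    eq : ⊝ μ P k ≡ μ P (k * suc P) ⊖ ι 1 ⊗ ∑ X (λ n → 𝟙 (k * suc P ≟ n * suc P) ⊗ μ P n)
    eq = trans (lin 1 (λ a → ⊢ :- a :≡ con 0 :- con 1 :* a) (μ P k))
      (cong₂ (λ y z → y ⊖ ι 1 ⊗ z) (sym (μ-large P (k * suc P) (suc P) p le pP (ℕₚ.n<1+n P) (n∣m*n k)))
          (sym (fibre (μ P) (suc P) k b a c)))

  -- The indicator of the numbers without prime factor up to `P`, as a product that grows in step
  -- with the recursion of `μ`.
  rough : ℕ → ℕ → Q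
  rough zero    n = ι 1
  rough (suc P) n = rough P n ⊗ (ι 1 ⊖ 𝟙 (prime? (suc P)) ⊗ 𝟙 (suc P ∣? n))

  rough-1 : ∀ P → rough P 1 ≡ ι 1
  rough-1 zero = refl
  rough-1 (suc P) with prime? (suc P)
  ... | no _   = trans (cong (_⊗ _) (rough-1 P)) (lin 1 (λ a → ⊢ con 1 :* (con 1 :- con 0 :* a) :≡ con 1) _)
  ... | yes pP = trans (cong₂ (λ y z → y ⊗ (ι 1 ⊖ ι 1 ⊗ z)) (rough-1 P) (𝟙-no (suc P ∣? 1) (prime∤1 pP)))
                          (lin 0 (⊢ con 1 :* (con 1 :- con 1 :* con 0) :≡ con 1))

  rough-factor : ∀ P n q → Prime q → q ≤ P → q ∣ n → rough P n ≡ ι 0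
  rough-factor zero    n q pq le d = contradiction (ℕₚ.≤-trans (prime≥1 pq) le) λ ()
  rough-factor (suc P) n q pq le d with q ≟ suc P
  ... | no ne = trans (cong (_⊗ _) (rough-factor P n q pq (ℕₚ.≤-pred (ℕₚ.≤∧≢⇒< le ne)) d)) (⊗-zeroˡ _)
  ... | yes refl = trans (cong₂ (λ y z → rough P n ⊗ (ι 1 ⊖ y ⊗ z)) (𝟙-yes (prime? (suc P)) pq)
      (𝟙-yes (suc P ∣? n) d))
                            (lin 1 (λ a → ⊢ a :* (con 1 :- con 1 :* con 1) :≡ con 0) (rough P n))

  rough-* : ∀ P n q → Prime q → P < q → rough P (n * q) ≡ rough P n
  rough-* zero    n q pq lt = refl
  rough-* (suc P) n q pq lt with prime? (suc P)
  ... | no _   = cong₂ _⊗_ (rough-* P n q pq (ℕₚ.<-trans (ℕₚ.n<1+n P) lt))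
      (cong (ι 1 ⊖_) (trans (⊗-zeroˡ _) (sym (⊗-zeroˡ _))))
  ... | yes pP = cong₂ (λ y z → y ⊗ (ι 1 ⊖ ι 1 ⊗ z)) (rough-* P n q pq (ℕₚ.<-trans (ℕₚ.n<1+n P) lt))
    (𝟙-⇔ (suc P ∣? n * q) (suc P ∣? n) to (λ d → ∣m⇒∣m*n q d))
    where
    to : suc P ∣ n * q → suc P ∣ n
    to d with euclidsLemma n q pP d
    ... | inj₁ r = r
    ... | inj₂ r = contradiction (prime∣prime pP pq r) (ℕₚ.<⇒≢ lt)

  -- Legendre's sieve. A new prime `p` subtracts the induction hypothesis for `k ↦ Γ (k * p)`; as
  -- `rough P` does not see the factor `p`, this is the part of the old sum over the multiples of
  -- `p`.
  μ-rough : ∀ P {Γ : ℕ → Q} → Supp X Γ →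
            ∑ X (λ n → μ P n ⊗ ∑ X (λ m → Γ (m * n))) ≡ ∑ X (λ k → rough P k ⊗ Γ k)
  μ-rough zero {Γ} s with 1 ≤? X
  ... | yes 1≤X = trans (∑-δ X 1 _ ℕₚ.≤-refl 1≤X) (∑-cong′ X (λ k → trans (cong Γ (ℕₚ.*-identityʳ k))
      (sym (⊗-identityˡ _))))
  ... | no 1≰X = trans (∑-zero X (λ i p le → contradiction (ℕₚ.≤-trans p le) 1≰X))
                         (sym (∑-zero X (λ i p le → contradiction (ℕₚ.≤-trans p le) 1≰X)))
  μ-rough (suc P) {Γ} s with prime? (suc P)
  ... | no _ = trans (∑-cong′ X (λ n → lin 3 (λ a b c → ⊢ (a :- con 0 :* b) :* c :≡ a :* c) (μ P n) _ _))
    (trans (μ-rough P s) (∑-cong′ X (λ n → lin 3 (λ a b c → ⊢ a :* c :≡ a :* (con 1 :- con 0 :* b) :* c)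
        (rough P n) _ _)))
  ... | yes pP = begin
    ∑ X (λ n → (μ P n ⊖ ι 1 ⊗ B n) ⊗ A n)                      ≡⟨ ∑-cong′ X
        (λ n → lin 3 (λ a b c → ⊢ (a :- con 1 :* b) :* c :≡ a :* c :- b :* c) (μ P n) (B n) (A n)) ⟩
    ∑ X (λ n → μ P n ⊗ A n ⊖ B n ⊗ A n)                        ≡⟨ ∑-⊖ X _ _ ⟩
    ∑ X (λ n → μ P n ⊗ A n) ⊖ ∑ X (λ n → B n ⊗ A n)            ≡⟨ cong₂ _⊖_ (μ-rough P s) second ⟩
    ∑ X (λ k → rough P k ⊗ Γ k) ⊖ ∑ X (λ k → 𝟙 (p ∣? k) ⊗ (rough P k ⊗ Γ k)) ≡⟨ sym (∑-⊖ X _ _) ⟩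
    ∑ X (λ k → rough P k ⊗ Γ k ⊖ 𝟙 (p ∣? k) ⊗ (rough P k ⊗ Γ k))  ≡⟨ ∑-cong′ X
        (λ k → lin 3 (λ a b c → ⊢ a :* c :- b :* (a :* c) :≡ a :* (con 1 :- con 1 :* b) :* c) (rough P k)
        (𝟙 (p ∣? k)) (Γ k)) ⟩
    ∑ X (λ k → rough P k ⊗ (ι 1 ⊖ ι 1 ⊗ 𝟙 (p ∣? k)) ⊗ Γ k)       ∎
    where
    open ≡-Reasoning
    p = suc P
    A B : ℕ → Q
    A n = ∑ X (λ m → Γ (m * n))
    B n = ∑ X (λ k → 𝟙 (n ≟ k * p) ⊗ μ P k)
    A-supp : Supp X A
    A-supp n lt = ∑-zero X (λ m m≥1 _ → s (m * n) (ℕₚ.≤-trans lt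
        (subst (_≤ m * n) (ℕₚ.*-identityˡ n) (ℕₚ.*-monoˡ-≤ n m≥1))))
    second : ∑ X (λ n → B n ⊗ A n) ≡ ∑ X (λ k → 𝟙 (p ∣? k) ⊗ (rough P k ⊗ Γ k))
    second = begin
      ∑ X (λ n → B n ⊗ A n)                                   ≡⟨ sym (push (μ P) p (s≤s z≤n) A-supp) ⟩
      ∑ X (λ n → μ P n ⊗ A (n * p))                           ≡⟨ ∑-cong′ X
          (λ n → cong (μ P n ⊗_) (∑-cong′ X (λ m → cong Γ (sym (ℕₚ.*-assoc m n p))))) ⟩
      ∑ X (λ n → μ P n ⊗ ∑ X (λ m → Γ (m * n * p)))           ≡⟨ μ-rough P (Supp-dilate p (s≤s z≤n) s) ⟩
      ∑ X (λ k → rough P k ⊗ Γ (k * p))                       ≡⟨ ∑-cong′ X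
          (λ k → cong (_⊗ Γ (k * p)) (sym (rough-* P k p pP (ℕₚ.n<1+n P)))) ⟩
      ∑ X (λ k → rough P (k * p) ⊗ Γ (k * p))                 ≡⟨ sum-multiples {λ m → rough P m ⊗ Γ m} p
          (s≤s z≤n) (λ n lt → trans (cong (rough P n ⊗_) (s n lt)) (⊗-zeroʳ _)) ⟩
      ∑ X (λ k → 𝟙 (p ∣? k) ⊗ (rough P k ⊗ Γ k))              ∎

  -- Every number in `[2, X]` has a prime factor at most `X`, so the sieve leaves only 1.
  μ-inversion : ∀ {Γ : ℕ → Q} → 1 ≤ X → Supp X Γ → ∑ X (λ n → μ X n ⊗ ∑ X (λ m → Γ (m * n))) ≡ Γ 1
  μ-inversion {Γ} 1≤X s = trans (μ-rough X s) (trans (∑-single X 1 _ ℕₚ.≤-refl 1≤X other)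
    (trans (cong (_⊗ Γ 1) (rough-1 X)) (⊗-identityˡ _)))
    where
    other : ∀ k → 1 ≤ k → k ≤ X → k ≢ 1 → rough X k ⊗ Γ k ≡ ι 0
    other k p le ne with primeDivisor k (ℕₚ.≤∧≢⇒< p (λ e → ne (sym e)))
    ... | q , pq , d = trans (cong (_⊗ Γ k) (rough-factor X k q pq (ℕₚ.≤-trans (∣⇒≤′ p d) le) d)) (⊗-zeroˡ _)

-- The von Mangoldt function

-- On [1, X] the function L has every property of the logarithm that is needed, but its values are rational.

record IsLog (X : ℕ) (L : ℕ → Q) : Set where
  field
    L-*     : ∀ m n → 1 ≤ m → 1 ≤ n → L (m * n) ≡ L m ⊕ L n
    L-upper : ∀ n → 1 ≤ n → n < X → (L (suc n) ⊖ L n) ⊗ ι n ≼ ι 1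
    L-lower : ∀ n → 1 ≤ n → n < X → ι 1 ≼ (L (suc n) ⊖ L n) ⊗ ι (suc n)

record CompletelyMultiplicative (f : ℕ → Q) : Set where
  field
    f-1     : f 1 ≡ ι 1
    f-*     : ∀ m n → f (m * n) ≡ f m ⊗ f n
    f-bound : ∀ n → ∥ f n ∥ ≼ ι 1

product≥1 : ∀ {ps} → All Prime ps → 1 ≤ product ps
product≥1 []         = ℕₚ.≤-refl
product≥1 (pp ∷ pps) = ℕₚ.*-mono-≤ (prime≥1 pp) (product≥1 pps)

module VonMangoldt {X : ℕ} {L : ℕ → Q} (isLog : IsLog X L) where
  open IsLog isLog

  L-1 : L 1 ≡ ι 0
  L-1 = lin 1 (λ a → a :≡ a :+ a ⇒ ⊢ a :≡ con 0) (L 1) (L-* 1 1 ℕₚ.≤-refl ℕₚ.≤-refl)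

  weight : ℕ → Q
  weight p = 𝟙 (prime? p) ⊗ L p

  -- Written as a sum over prime powers instead of by cases on `n`, so that `Λ-sum` becomes an
  -- exchange of summations. The range of `j` loses nothing for `n ≤ X`, as `j < p ^ j`.
  Λ : ℕ → Q
  Λ n = ∑ X (λ p → weight p ⊗ ∑ X (λ j → 𝟙 (n ≟ p ^ j)))

  -- The exponent of the prime `p` in `k`, for `1 ≤ k ≤ X`, counted as the number of powers of `p`
  -- that divide `k`.
  valuation : ℕ → ℕ → Q
  valuation p k = ∑ X (λ j → 𝟙 (p ^ j ∣? k))

  weight-cong : ∀ p {a b : Q} → (Prime p → a ≡ b) → weight p ⊗ a ≡ weight p ⊗ b
  weight-cong p h with prime? p
  ... | yes pp = cong (ι 1 ⊗ L p ⊗_) (h pp)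
  ... | no _   = lin 3 (λ l a b → ⊢ con 0 :* l :* a :≡ con 0 :* l :* b) (L p) _ _

  valuation-same : ∀ q m → Prime q → 1 ≤ m → q * m ≤ X → valuation q (q * m) ≡ ι 1 ⊕ valuation q m
  valuation-same q m pq m≥1 le = go X refl
    where
    open ≡-Reasoning
    -- `X` is generalised so that it can be matched as a successor. Shifting `j` by one leaves the
    -- top index `X` unmatched, where `q ^ X` exceeds `m`.
    go : ∀ Z → Z ≡ X → ∑ Z (λ j → 𝟙 (q ^ j ∣? q * m)) ≡ ι 1 ⊕ ∑ Z (λ j → 𝟙 (q ^ j ∣? m))
    go zero    refl = contradiction (ℕₚ.≤-trans (ℕₚ.*-mono-≤ (prime≥1 pq) m≥1) le) λ ()
    go (suc Y) refl = begin
      ∑ (suc Y) (λ j → 𝟙 (q ^ j ∣? q * m))                              ≡⟨ ∑-split 1 Y _ ⟩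
      (ι 0 ⊕ 𝟙 (q ^ 1 ∣? q * m)) ⊕ ∑ Y (λ j → 𝟙 (q ^ suc j ∣? q * m))   ≡⟨ cong₂ _⊕_ first
          (∑-cong′ Y (λ j → 𝟙-⇔ (q ^ suc j ∣? q * m) (q ^ j ∣? m) (*-cancelˡ-∣ q {{prime⇒nonZero pq}})
          (*-monoʳ-∣ q))) ⟩
      ι 1 ⊕ ∑ Y (λ j → 𝟙 (q ^ j ∣? m))                                  ≡⟨ cong (ι 1 ⊕_)
          (sym (trans (cong (∑ Y _ ⊕_) last) (⊕-identityʳ _))) ⟩
      ι 1 ⊕ ∑ (suc Y) (λ j → 𝟙 (q ^ j ∣? m))                            ∎
      where
      first : ι 0 ⊕ 𝟙 (q ^ 1 ∣? q * m) ≡ ι 1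
      first = trans (⊕-identityˡ _) (𝟙-yes (q ^ 1 ∣? q * m) (subst (_∣ q * m) (sym (ℕₚ.*-identityʳ q))
          (m∣m*n m)))
      last : 𝟙 (q ^ suc Y ∣? m) ≡ ι 0
      last = 𝟙-no (q ^ suc Y ∣? m) (λ d → ℕₚ.<⇒≱ (n<p^n (prime≥2 pq) (suc Y))
        (ℕₚ.≤-trans (∣⇒≤′ m≥1 d) (ℕₚ.≤-trans (ℕₚ.m≤n*m m q {{prime⇒nonZero pq}}) le)))

  valuation-other : ∀ p q m → Prime p → Prime q → p ≢ q → valuation p (q * m) ≡ valuation p m
  valuation-other p q m pp pq ne = ∑-cong′ X (λ j → 𝟙-⇔ (p ^ j ∣? q * m) (p ^ j ∣? m)
    (prime-power-∣ j m pp pq ne) (∣n⇒∣m*n q))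

  valuation-1 : ∀ p → Prime p → valuation p 1 ≡ ι 0
  valuation-1 p pp = ∑-zero X (λ { (suc j) _ _ → 𝟙-no (p ^ suc j ∣? 1) (λ d → prime∤1 pp (m*n∣⇒m∣ p (p ^ j) d))
      })

  W : ℕ → Q
  W k = ∑ X (λ p → weight p ⊗ valuation p k)

  W-* : ∀ q m → Prime q → 1 ≤ m → q * m ≤ X → W (q * m) ≡ L q ⊕ W m
  W-* q m pq m≥1 le = begin
    W (q * m)                                                   ≡⟨ ∑-cong′ X
        (λ p → trans (weight-cong p (step p)) (⊗-distribˡ _ _ _)) ⟩
    ∑ X (λ p → weight p ⊗ 𝟙 (p ≟ q) ⊕ weight p ⊗ valuation p m) ≡⟨ ∑-⊕ X _ _ ⟩
    ∑ X (λ p → weight p ⊗ 𝟙 (p ≟ q)) ⊕ W m                      ≡⟨ cong (_⊕ W m)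
        (trans (∑-cong′ X (λ p → ⊗-comm _ _)) (∑-δ X q weight (prime≥1 pq) q≤X)) ⟩
    weight q ⊕ W m                                              ≡⟨ cong (_⊕ W m)
        (trans (cong (_⊗ L q) (𝟙-yes (prime? q) pq)) (⊗-identityˡ _)) ⟩
    L q ⊕ W m                                                   ∎
    where
    open ≡-Reasoning
    q≤X : q ≤ X
    q≤X = ℕₚ.≤-trans (ℕₚ.m≤m*n q m {{>-nonZero m≥1}}) le
    step : ∀ p → Prime p → valuation p (q * m) ≡ 𝟙 (p ≟ q) ⊕ valuation p m
    step p pp with p ≟ q
    ... | yes refl = trans (valuation-same p m pp m≥1 le) (cong (_⊕ valuation p m) (sym (𝟙-yes (p ≟ p) refl)))
    ... | no ne    = trans (valuation-other p q m pp pq ne)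
      (trans (sym (⊕-identityˡ _)) (cong (_⊕ valuation p m) (sym (𝟙-no (p ≟ q) ne))))

  W≡L : ∀ k → 1 ≤ k → k ≤ X → W k ≡ L k
  W≡L k k≥1 le with factorise k {{>-nonZero k≥1}}
  ... | record { factors = ps ; isFactorisation = refl ; factorsPrime = pps } = go ps pps le
    where
    go : ∀ ps → All Prime ps → product ps ≤ X → W (product ps) ≡ L (product ps)
    go []       []         le = trans (∑-zero X (λ p _ _ → trans (weight-cong p (valuation-1 p)) (⊗-zeroʳ _)))
        (sym L-1)
    go (q ∷ ps) (pq ∷ pps) le = trans (W-* q (product ps) pq (product≥1 pps) le)
      (trans (cong (L q ⊕_) (go ps pps (ℕₚ.≤-trans (ℕₚ.m≤n*m (product ps) q {{prime⇒nonZero pq}}) le)))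
        (sym (L-* q (product ps) (prime≥1 pq) (product≥1 pps))))

  Λ-sum : ∀ (G : ℕ → Q) → Supp X G → ∑ X (λ n → Λ n ⊗ G n) ≡ ∑ X (λ p → weight p ⊗ ∑ X (λ j → G (p ^ j)))
  Λ-sum G s = begin
    ∑ X (λ n → Λ n ⊗ G n)                                                          ≡⟨ ∑-cong′ X
        (λ n → sym (∑-⊗ʳ X (G n) _)) ⟩
    ∑ X (λ n → ∑ X (λ p → weight p ⊗ ∑ X (λ j → 𝟙 (n ≟ p ^ j)) ⊗ G n))             ≡⟨ ∑-swap X X _ ⟩
    ∑ X (λ p → ∑ X (λ n → weight p ⊗ ∑ X (λ j → 𝟙 (n ≟ p ^ j)) ⊗ G n))             ≡⟨ ∑-cong X
        (λ p p≥1 _ → trans (∑-cong′ X (λ n → trans (⊗-assoc _ _ _) (cong (weight p ⊗_) (sym (∑-⊗ʳ X (G n) _)))))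
        (∑-⊗ˡ X _ _)) ⟩
    ∑ X (λ p → weight p ⊗ ∑ X (λ n → ∑ X (λ j → 𝟙 (n ≟ p ^ j) ⊗ G n)))             ≡⟨ ∑-cong X
        (λ p p≥1 _ → cong (weight p ⊗_) (trans (∑-swap X X _) (∑-cong′ X (λ j → at (p ^ j) (^≥1 j p≥1))))) ⟩
    ∑ X (λ p → weight p ⊗ ∑ X (λ j → G (p ^ j)))                                   ∎
    where
    open ≡-Reasoning
    at : ∀ k → 1 ≤ k → ∑ X (λ n → 𝟙 (n ≟ k) ⊗ G n) ≡ G k
    at k k≥1 with k ≤? X
    ... | yes le = ∑-δ X k G k≥1 le
    ... | no ¬le = trans (∑-zero X (λ n _ n≤X → trans (cong (_⊗ G n) (𝟙-no (n ≟ k) (λ { refl → ¬le n≤X })))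
        (⊗-zeroˡ _)))
                         (sym (s k (ℕₚ.≰⇒> ¬le)))

  Λ-divisors : ∀ k → 1 ≤ k → k ≤ X → ∑ X (λ n → Λ n ⊗ 𝟙 (n ∣? k)) ≡ L k
  Λ-divisors k k≥1 le = trans (Λ-sum (λ n → 𝟙 (n ∣? k)) (λ n lt → 𝟙-no (n ∣? k)
      (λ d → ℕₚ.<⇒≱ lt (ℕₚ.≤-trans (∣⇒≤′ k≥1 d) le))))
    (W≡L k k≥1 le)

  -- The identity `Λ * 1 = log`, tested against `Γ`.
  Λ-conv : ∀ {Γ : ℕ → Q} → Supp X Γ → ∑ X (λ n → Λ n ⊗ ∑ X (λ m → Γ (m * n))) ≡ ∑ X (λ k → L k ⊗ Γ k)
  Λ-conv {Γ} s = begin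
    ∑ X (λ n → Λ n ⊗ ∑ X (λ m → Γ (m * n)))                ≡⟨ ∑-cong X
        (λ n n≥1 _ → trans (cong (Λ n ⊗_) (sum-multiples X n n≥1 s)) (sym (∑-⊗ˡ X _ _))) ⟩
    ∑ X (λ n → ∑ X (λ k → Λ n ⊗ (𝟙 (n ∣? k) ⊗ Γ k)))       ≡⟨ ∑-swap X X _ ⟩
    ∑ X (λ k → ∑ X (λ n → Λ n ⊗ (𝟙 (n ∣? k) ⊗ Γ k)))       ≡⟨ ∑-cong X
        (λ k k≥1 le → trans (∑-cong′ X (λ n → sym (⊗-assoc _ _ _)))
        (trans (∑-⊗ʳ X (Γ k) _) (cong (_⊗ Γ k) (Λ-divisors k k≥1 le)))) ⟩
    ∑ X (λ k → L k ⊗ Γ k)                                  ∎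
    where open ≡-Reasoning

  L-suc-≼ : ∀ n → 1 ≤ n → n < X → L n ≼ L (suc n)
  L-suc-≼ n p q with ≼-total (L n) (L (suc n))
  ... | inj₁ r = r
  ... | inj₂ r = contradiction (≼-trans (L-lower n p q) (lin 3
      (λ a b c → con 0 :≤ (a :- b) :* c ⇒ ⊢ (b :- a) :* c :≤ con 0) (L n) (L (suc n)) (ι (suc n))
      (⊗-nonneg (0≼-gap r) (0≼ι (suc n))))) 1⋠0

  L-mono : ∀ m n → 1 ≤ m → m ≤ n → n ≤ X → L m ≼ L n
  L-mono m zero    p le _ = contradiction (ℕₚ.≤-trans p le) λ ()
  L-mono m (suc n) p le q with ℕₚ.m≤n⇒m<n∨m≡n le
  ... | inj₂ refl        = ≼-refl
  ... | inj₁ (s≤s m≤n)   = ≼-trans (L-mono m n p m≤n (ℕₚ.≤-trans (ℕₚ.n≤1+n n) q))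
      (L-suc-≼ n (ℕₚ.≤-trans p m≤n) q)

  L-nonneg : ∀ n → 1 ≤ n → n ≤ X → ι 0 ≼ L n
  L-nonneg n p q = subst (_≼ L n) L-1 (L-mono 1 n ℕₚ.≤-refl p q)

  weight-nonneg : ∀ p → 1 ≤ p → p ≤ X → ι 0 ≼ weight p
  weight-nonneg p a b = ⊗-nonneg (𝟙-nonneg (prime? p)) (L-nonneg p a b)

  Λ-nonneg : ∀ n → ι 0 ≼ Λ n
  Λ-nonneg n = ∑-nonneg X (λ p a b → ⊗-nonneg (weight-nonneg p a b)
      (∑-nonneg X (λ j _ _ → 𝟙-nonneg (n ≟ p ^ j))))

  -- `Λ n` is one of the nonnegative terms of `Λ-divisors`.
  Λ≼L : ∀ n → 1 ≤ n → n ≤ X → Λ n ≼ L n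
  Λ≼L n p q = ≼-trans (≼-reflexive (sym (∑-δ X n Λ p q))) (≼-trans
    (∑-mono X (λ k _ _ → ≼-trans (≼-reflexive (⊗-comm _ _)) (⊗-monoˡ (Λ-nonneg k) (bound k))))
        (≼-reflexive (Λ-divisors n p q)))
    where
    bound : ∀ k → 𝟙 (k ≟ n) ≼ 𝟙 (k ∣? n)
    bound k with k ≟ n
    ... | yes refl = ≼-trans (𝟙-≼1 (k ≟ k)) (≼-reflexive (sym (𝟙-yes (k ∣? k)
        (divides 1 (sym (ℕₚ.+-identityʳ k))))))
    ... | no ne    = ≼-trans (≼-reflexive (𝟙-no (k ≟ n) ne)) (𝟙-nonneg (k ∣? n))

-- Reciprocals and integer division

inv-ι′ : ∀ n → 1 ≤ n → inv n ⊗ ι n ≡ ι 1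
inv-ι′ (suc n) _ = inv-ι n

1≼ι : ∀ {n} → 1 ≤ n → ι 1 ≼ ι n
1≼ι = ι-mono

ι-suc : ∀ n → ι (suc n) ≡ ι n ⊕ ι 1
ι-suc n = trans (ι-+ 1 n) (⊕-comm _ _)

⊗-cancel-≼ : ∀ n {a b} → 1 ≤ n → ι n ⊗ a ≼ ι n ⊗ b → a ≼ b
⊗-cancel-≼ n {a} {b} p h with ≼-total a b
... | inj₁ q = q
... | inj₂ q = lin 4 (λ a b i n → i :* n :≡ con 1 ⇒ con 0 :≤ (a :- b) :* (n :- con 1) ⇒ n :* a :≤ n :* b ⇒ ⊢ a
    :≤ b)
                 a b (inv n) (ι n) (inv-ι′ n p) (⊗-nonneg (0≼-gap q) (0≼-gap (1≼ι p))) h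

inv-nonneg : ∀ n → 1 ≤ n → ι 0 ≼ inv n
inv-nonneg n p = ⊗-cancel-≼ n p (subst₂ _≼_ (sym (⊗-zeroʳ _)) (trans (sym (inv-ι′ n p)) (⊗-comm _ _)) 0≼1)

inv-≼1 : ∀ n → 1 ≤ n → inv n ≼ ι 1
inv-≼1 n p = ⊗-cancel-≼ n p (subst₂ _≼_ (trans (sym (inv-ι′ n p)) (⊗-comm _ _)) (sym (⊗-identityʳ _)) (1≼ι p))

≼-inv : ∀ n {a b} → 1 ≤ n → a ⊗ ι n ≼ b → a ≼ b ⊗ inv n
≼-inv n {a} {b} p h = lin 4 (λ a b i n → i :* n :≡ con 1 ⇒ a :* (i :* n) :≡ a ⇒ con 0 :≤ i :* (b :- a :* n) ⇒ ⊢
    a :≤ b :* i)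
  a b (inv n) (ι n) (inv-ι′ n p) (trans (cong (a ⊗_) (inv-ι′ n p)) (⊗-identityʳ a))
      (⊗-nonneg (inv-nonneg n p) (0≼-gap h))

inv-≼ : ∀ n {a b} → 1 ≤ n → b ≼ a ⊗ ι n → b ⊗ inv n ≼ a
inv-≼ n {a} {b} p h = lin 4 (λ a b i n → a :* (i :* n) :≡ a ⇒ con 0 :≤ i :* (a :* n :- b) ⇒ ⊢ b :* i :≤ a)
  a b (inv n) (ι n) (trans (cong (a ⊗_) (inv-ι′ n p)) (⊗-identityʳ a)) (⊗-nonneg (inv-nonneg n p) (0≼-gap h))

infixl 7 _÷_
_÷_ : ℕ → ℕ → ℕ
-- Default value, with which `÷-from` and `÷-÷` hold for every divisor.
x ÷ zero  = 0
x ÷ suc n = x / suc n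

÷-to : ∀ {x m} n → m * n ≤ x → 1 ≤ n → m ≤ x ÷ n
÷-to {x} {m} (suc n) h _ = subst (_≤ x / suc n) (m*n/n≡m m (suc n)) (/-monoˡ-≤ (suc n) h)

÷-from : ∀ {x m} n → m ≤ x ÷ n → m * n ≤ x
÷-from {x} {m} zero    h = subst (_≤ x) (sym (ℕₚ.*-zeroʳ m)) z≤n
÷-from {x} {m} (suc n) h = ℕₚ.≤-trans (ℕₚ.*-monoˡ-≤ (suc n) h) (m/n*n≤m x (suc n))

÷-÷ : ∀ x m n → x ÷ m ÷ n ≡ x ÷ (m * n)
÷-÷ x zero    zero    = refl
÷-÷ x zero    (suc n) = refl
÷-÷ x (suc m) zero    rewrite ℕₚ.*-zeroʳ m = refl
÷-÷ x (suc m) (suc n) = m/n/o≡m/[n*o] x (suc m) (suc n)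

÷-1 : ∀ x → x ÷ 1 ≡ x
÷-1 x = n/1≡n x

÷-≤ : ∀ x n → 1 ≤ n → x ÷ n ≤ x
÷-≤ x (suc n) p = ℕₚ.≤-trans (ℕₚ.m≤m*n (x ÷ suc n) (suc n)) (÷-from (suc n) ℕₚ.≤-refl)

÷-large : ∀ {x} n → x < n → x ÷ n ≡ 0
÷-large (suc n) lt = m<n⇒m/n≡0 lt

÷-≥1 : ∀ {x} n → 1 ≤ n → n ≤ x → 1 ≤ x ÷ n
÷-≥1 {x} n p h = ÷-to n (subst (_≤ x) (sym (ℕₚ.*-identityˡ n)) h) p

÷-anti : ∀ x {m n} → 1 ≤ m → m ≤ n → x ÷ n ≤ x ÷ m
÷-anti x {m} {n} p h = ÷-to m (ℕₚ.≤-trans (ℕₚ.*-monoʳ-≤ (x ÷ n) h) (÷-from n ℕₚ.≤-refl)) p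

÷-< : ∀ x n → 1 ≤ n → x < (x ÷ n + 1) * n
÷-< x n@(suc n′) p = subst₂ _<_ (sym (m≡m%n+[m/n]*n x n)) eq (ℕₚ.+-monoˡ-< (x / n * n) (m%n<n x n))
  where
  eq : n + x / n * n ≡ (x / n + 1) * n
  eq = cong (_* n) (ℕₚ.+-comm 1 (x / n))

∑-floor : ∀ X {x} n (f : ℕ → Q) → 1 ≤ n → x ≤ X → ∑ X (λ m → 𝟙 (m * n ≤? x) ⊗ f m) ≡ ∑ (x ÷ n) f
∑-floor X {x} n f p le = trans
  (∑-trunc _ (ℕₚ.≤-trans (÷-≤ x n p) le) (λ i lt _ → trans (cong (_⊗ f i)
      (𝟙-no (i * n ≤? x) (λ h → ℕₚ.<⇒≱ lt (÷-to n h p)))) (⊗-zeroˡ _)))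
  (∑-cong (x ÷ n) (λ i _ h → trans (cong (_⊗ f i) (𝟙-yes (i * n ≤? x) (÷-from n h))) (⊗-identityˡ _)))

∑-cut : ∀ X {x} (f : ℕ → Q) → x ≤ X → ∑ X (λ m → 𝟙 (m ≤? x) ⊗ f m) ≡ ∑ x f
∑-cut X {x} f le = trans (∑-cong′ X (λ m → cong (_⊗ f m) (𝟙-⇔ (m ≤? x) (m * 1 ≤? x)
    (subst (_≤ x) (sym (ℕₚ.*-identityʳ m))) (subst (_≤ x) (ℕₚ.*-identityʳ m)))))
  (trans (∑-floor X 1 f ℕₚ.≤-refl le) (cong (λ k → ∑ k f) (÷-1 x)))

ι-÷-≼ : ∀ x n → 1 ≤ n → ι (x ÷ n) ≼ ι x ⊗ inv n
ι-÷-≼ x n p = ≼-inv n p (subst (_≼ ι x) (ι-* (x ÷ n) n) (ι-mono (÷-from n ℕₚ.≤-refl)))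

≼-ι-÷ : ∀ x n → 1 ≤ n → ι x ⊗ inv n ≼ ι (x ÷ n) ⊕ ι 1
≼-ι-÷ x n p = inv-≼ n p (subst (ι x ≼_) (trans (ι-* (x ÷ n + 1) n) (cong (_⊗ ι n) (ι-+ (x ÷ n) 1)))
    (ι-mono (ℕₚ.<⇒≤ (÷-< x n p))))

inv-antitone : ∀ a b → 1 ≤ a → a ≤ b → inv b ≼ inv a
inv-antitone a b p q = ⊗-cancel-≼ b (ℕₚ.≤-trans p q) (lin 4 (λ a b i j → i :* a :≡ con 1 ⇒ j :* b :≡ con 1 ⇒ con
    0 :≤ i :* (b :- a) ⇒ ⊢ b :* j :≤ b :* i) (ι a) (ι b) (inv a) (inv b) (inv-ι′ a p)
    (inv-ι′ b (ℕₚ.≤-trans p q)) (⊗-nonneg (inv-nonneg a p) (0≼-gap (ι-mono q))))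

-- Chebyshev and Mertens estimates

half-bounds : ∀ x → 2 * (x ÷ 2) ≤ x × x ≤ 2 * (x ÷ 2) + 1
half-bounds x = subst (_≤ x) (ℕₚ.*-comm (x ÷ 2) 2) (÷-from 2 ℕₚ.≤-refl) ,
  subst (_≤ 2 * (x ÷ 2) + 1) (sym (trans (m≡m%n+[m/n]*n x 2) (trans (ℕₚ.+-comm (x % 2) _)
      (cong (_+ x % 2) (ℕₚ.*-comm (x ÷ 2) 2)))))
    (ℕₚ.+-monoʳ-≤ (2 * (x ÷ 2)) (ℕₚ.≤-pred (m%n<n x 2)))

module Estimates {X : ℕ} {L : ℕ → Q} (isLog : IsLog X L) where
  open IsLog isLog public
  open VonMangoldt isLog public

  L-diff-upper : ∀ m k → 1 ≤ m → m + k ≤ X → (L (m + k) ⊖ L m) ⊗ ι m ≼ ι k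
  L-diff-upper m zero    p le rewrite ℕₚ.+-identityʳ m = ≼-reflexive
      (lin 2 (λ a b → ⊢ (a :- a) :* b :≡ con 0) (L m) (ι m))
  L-diff-upper m (suc k) p le rewrite ℕₚ.+-suc m k = _≼≡_ (lin 6
      (λ a b c m n k → (b :- a) :* m :≤ k ⇒ (c :- b) :* n :≤ con 1 ⇒ con 0 :≤ (c :- b) :* (n :- m) ⇒ ⊢ (c :- a)
      :* m :≤ k :+ con 1)
      (L m) (L (m + k)) (L (suc (m + k))) (ι m) (ι (m + k)) (ι k)
      (L-diff-upper m k p (ℕₚ.<⇒≤ le)) (L-upper (m + k) 1≤m+k le)
      (⊗-nonneg (0≼-gap (L-suc-≼ (m + k) 1≤m+k le)) (0≼-gap (ι-mono (ℕₚ.m≤m+n m k))))) (sym (ι-suc k))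
    where
    1≤m+k = ℕₚ.≤-trans p (ℕₚ.m≤m+n m k)

  L-diff-≼ : ∀ m n → 1 ≤ m → m ≤ n → n ≤ X → (L n ⊖ L m) ⊗ ι m ≼ ι n ⊖ ι m
  L-diff-≼ m n p h le with ℕₚ.m≤n⇒∃[o]m+o≡n h
  ... | k , refl = ≼-trans (L-diff-upper m k p le) (≼-reflexive
    (trans (lin 2 (λ a b → ⊢ a :≡ (b :+ a) :- b) (ι k) (ι m)) (cong (_⊖ ι m) (sym (ι-+ m k)))))

  L-≼ : ∀ n → 1 ≤ n → n ≤ X → L n ≼ ι n ⊖ ι 1
  L-≼ n p le = lin 3 (λ l o n → (l :- o) :* con 1 :≤ n :- con 1 ⇒ o :≡ con 0 ⇒ ⊢ l :≤ n :- con 1) (L n) (L 1)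
      (ι n) (L-diff-≼ 1 n ℕₚ.≤-refl p le) L-1

  T : ℕ → Q
  T x = ∑ x L

  -- Stirling's formula with error `log x`. The induction for this side consumes `L-lower`, the one
  -- for `T-lower` consumes `L-upper`.
  T-upper : ∀ x → 1 ≤ x → x ≤ X → T x ≼ ι x ⊗ L x ⊖ ι x ⊕ ι 1 ⊕ L x
  T-upper (suc zero)    p le = lin 1 (λ l → l :≡ con 0 ⇒ ⊢ con 0 :+ l :≤ con 1 :* l :- con 1 :+ con 1 :+ l)
      (L 1) L-1
  T-upper (suc (suc n)) p le = subst (λ z → T (suc n) ⊕ L (suc (suc n)) ≼ z ⊗ L (suc (suc n)) ⊖ z ⊕ ι 1 ⊕ L
      (suc (suc n))) (sym (ι-suc (suc n)))
    (lin 4 (λ t l l′ n → t :≤ n :* l :- n :+ con 1 :+ l ⇒ con 1 :≤ (l′ :- l) :* (n :+ con 1) ⇒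
        ⊢ t :+ l′ :≤ (n :+ con 1) :* l′ :- (n :+ con 1) :+ con 1 :+ l′)
      (T (suc n)) (L (suc n)) (L (suc (suc n))) (ι (suc n)) (T-upper (suc n) (s≤s z≤n) (ℕₚ.<⇒≤ le))
      (subst (λ z → ι 1 ≼ (L (suc (suc n)) ⊖ L (suc n)) ⊗ z) (ι-suc (suc n)) (L-lower (suc n) (s≤s z≤n) le)))

  T-lower : ∀ x → 1 ≤ x → x ≤ X → ι x ⊗ L x ⊖ ι x ⊕ ι 1 ≼ T x
  T-lower (suc zero)    p le = lin 1 (λ l → l :≡ con 0 ⇒ ⊢ con 1 :* l :- con 1 :+ con 1 :≤ con 0 :+ l) (L 1) L-1
  T-lower (suc (suc n)) p le = subst (λ z → z ⊗ L (suc (suc n)) ⊖ z ⊕ ι 1 ≼ T (suc n) ⊕ L (suc (suc n)))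
      (sym (ι-suc (suc n)))
    (lin 4 (λ t l l′ n → n :* l :- n :+ con 1 :≤ t ⇒ (l′ :- l) :* n :≤ con 1 ⇒
        ⊢ (n :+ con 1) :* l′ :- (n :+ con 1) :+ con 1 :≤ t :+ l′)
      (T (suc n)) (L (suc n)) (L (suc (suc n))) (ι (suc n)) (T-lower (suc n) (s≤s z≤n) (ℕₚ.<⇒≤ le))
      (L-upper (suc n) (s≤s z≤n) le))

  ψ : ℕ → Q
  ψ x = ∑ x Λ

  ψ-nonneg : ∀ x → ι 0 ≼ ψ x
  ψ-nonneg x = ∑-nonneg x (λ n _ _ → Λ-nonneg n)

  ψ-mono : ∀ {x y} → x ≤ y → ψ x ≼ ψ y
  ψ-mono h = ∑-monoʳ Λ h (λ i _ _ → Λ-nonneg i)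

  θ-supp : ∀ {x} → x ≤ X → Supp X (λ n → 𝟙 (n ≤? x))
  θ-supp {x} le n lt = 𝟙-no (n ≤? x) (λ h → ℕₚ.<⇒≱ lt (ℕₚ.≤-trans h le))

  count : ∀ {x} n → 1 ≤ n → x ≤ X → ∑ X (λ m → 𝟙 (m * n ≤? x)) ≡ ι (x ÷ n)
  count {x} n p le = trans (∑-cong′ X (λ m → sym (⊗-identityʳ _))) (trans (∑-floor X n (λ _ → ι 1) p le)
    (trans (∑-const (x ÷ n) (ι 1)) (⊗-identityʳ _)))

  T-Λ : ∀ x → x ≤ X → ∑ X (λ n → Λ n ⊗ ι (x ÷ n)) ≡ T x
  T-Λ x le = trans (∑-cong X (λ n p _ → cong (Λ n ⊗_) (sym (count n p le))))
    (trans (Λ-conv (θ-supp le)) (trans (∑-cong′ X (λ k → ⊗-comm _ _)) (∑-cut X L le)))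

  ψ-cut : ∀ {x} → x ≤ X → ∑ X (λ n → Λ n ⊗ 𝟙 (n ≤? x)) ≡ ψ x
  ψ-cut le = trans (∑-cong′ X (λ n → ⊗-comm _ _)) (∑-cut X Λ le)

  -- Chebyshev's `⌊x/n⌋ - 2⌊x/2n⌋`. It is the parity of `⌊x/n⌋`, hence 0 or 1, and it equals 1 for
  -- `x/2 < n ≤ x`.
  remainder : ℕ → ℕ → Q
  remainder x n = ι (x ÷ n) ⊖ ι 2 ⊗ ι (x ÷ 2 ÷ n)

  remainder-≡ : ∀ x n → 1 ≤ n → remainder x n ≡ ι ((x ÷ n) % 2)
  remainder-≡ x n p = trans (cong₂ (λ a b → ι a ⊖ ι 2 ⊗ ι b) (m≡m%n+[m/n]*n (x ÷ n) 2) swap)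
    (trans (cong (_⊖ ι 2 ⊗ ι (x ÷ n ÷ 2)) (trans (ι-+ ((x ÷ n) % 2) _)
        (cong (ι ((x ÷ n) % 2) ⊕_) (ι-* (x ÷ n ÷ 2) 2))))
      (lin 2 (λ a b → ⊢ a :+ b :* con 2 :- con 2 :* b :≡ a) (ι ((x ÷ n) % 2)) (ι (x ÷ n ÷ 2))))
    where
    swap : x ÷ 2 ÷ n ≡ x ÷ n ÷ 2
    swap = trans (÷-÷ x 2 n) (trans (cong (x ÷_) (ℕₚ.*-comm 2 n)) (sym (÷-÷ x n 2)))

  T-difference : ∀ x → x ≤ X → ∑ X (λ n → Λ n ⊗ remainder x n) ≡ T x ⊖ ι 2 ⊗ T (x ÷ 2)
  T-difference x le = trans (∑-cong′ X (λ n → lin 3 (λ a b c → ⊢ a :* (b :- con 2 :* c) :≡ a :* b :- con 2 :*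
      (a :* c)) (Λ n) _ _))
    (trans (∑-⊖ X _ _) (cong₂ _⊖_ (T-Λ x le) (trans (∑-⊗ˡ X (ι 2) _)
        (cong (ι 2 ⊗_) (T-Λ (x ÷ 2) (ℕₚ.≤-trans (÷-≤ x 2 (s≤s z≤n)) le))))))

  ψ-step : ∀ x → x ≤ X → ψ x ⊖ ψ (x ÷ 2) ≼ T x ⊖ ι 2 ⊗ T (x ÷ 2)
  ψ-step x le = subst₂ _≼_ (trans (∑-⊖ X _ _) (cong₂ _⊖_ (ψ-cut le)
      (ψ-cut (ℕₚ.≤-trans (÷-≤ x 2 (s≤s z≤n)) le)))) (T-difference x le)
    (∑-mono X (λ n p _ → ≼-trans (≼-reflexive (lin 3 (λ a b c → ⊢ a :* b :- a :* c :≡ a :* (b :- c)) (Λ n) _ _))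
        (⊗-monoˡ (Λ-nonneg n) (pointwise n p))))
    where
    pointwise : ∀ n → 1 ≤ n → 𝟙 (n ≤? x) ⊖ 𝟙 (n ≤? x ÷ 2) ≼ remainder x n
    pointwise n p rewrite remainder-≡ x n p with n ≤? x | n ≤? x ÷ 2
    ... | _     | yes h = lin 3 (λ a b c → a :≤ con 1 ⇒ b :≡ con 1 ⇒ con 0 :≤ c ⇒ ⊢ a :- b :≤ c) _ _ _
        (𝟙-≼1 (n ≤? x)) (𝟙-yes (n ≤? x ÷ 2) h) (0≼ι _)
    ... | no h  | no _  = lin 3 (λ a b c → a :≡ con 0 ⇒ con 0 :≤ b ⇒ con 0 :≤ c ⇒ ⊢ a :- b :≤ c) _ _ _
        (𝟙-no (n ≤? x) h) (𝟙-nonneg (n ≤? x ÷ 2)) (0≼ι _)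
    ... | yes h | no ¬h = lin 3 (λ a b c → a :≤ con 1 ⇒ con 0 :≤ b ⇒ con 1 :≤ c ⇒ ⊢ a :- b :≤ c) _ _ _
        (𝟙-≼1 (n ≤? x)) (𝟙-nonneg (n ≤? x ÷ 2)) (≼-reflexive (cong (λ a → ι (a % 2)) (sym one)))
      where
      one : x ÷ n ≡ 1
      one = ℕₚ.≤-antisym (ℕₚ.≤-pred (ℕₚ.≰⇒> (λ q → ¬h (÷-to 2 (subst (_≤ x) (ℕₚ.*-comm 2 n) (÷-from n q))
          (s≤s z≤n))))) (÷-≥1 n p h)

  ψ-≽ : ∀ x → x ≤ X → T x ⊖ ι 2 ⊗ T (x ÷ 2) ≼ ψ x
  ψ-≽ x le = subst₂ _≼_ (T-difference x le) (ψ-cut le) (∑-mono X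
      (λ n p _ → ⊗-monoˡ (Λ-nonneg n) (pointwise n p)))
    where
    pointwise : ∀ n → 1 ≤ n → remainder x n ≼ 𝟙 (n ≤? x)
    pointwise n p rewrite remainder-≡ x n p with n ≤? x
    ... | yes h = ≼-trans (ι-mono (ℕₚ.≤-pred (m%n<n (x ÷ n) 2))) (≼-reflexive (sym (𝟙-yes (n ≤? x) h)))
    ... | no h  = subst (λ a → ι (a % 2) ≼ 𝟙 (n ≤? x)) (sym (÷-large n (ℕₚ.≰⇒> h))) (𝟙-nonneg (n ≤? x))

  T-difference-upper : ∀ x → 2 ≤ x → x ≤ X → T x ⊖ ι 2 ⊗ T (x ÷ 2) ≼ ι 3 ⊗ ι x
  T-difference-upper x p le = lin 6
    (λ tx ty lx ly x y → tx :≤ x :* lx :- x :+ con 1 :+ lx ⇒ y :* ly :- y :+ con 1 :≤ ty ⇒ (lx :- ly) :* y :≤ x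
        :- y ⇒
       con 0 :≤ (con 2 :* y :+ con 1 :- x) :* lx ⇒ lx :≤ x :- con 1 ⇒ con 2 :* y :≤ x ⇒ ⊢ tx :- con 2 :* ty :≤
           con 3 :* x)
    (T x) (T y) (L x) (L y) (ι x) (ι y)
    (T-upper x 1≤x le) (T-lower y 1≤y y≤X) (L-diff-≼ y x 1≤y y≤x le)
    (⊗-nonneg (0≼-gap x≼) (L-nonneg x 1≤x le)) (L-≼ x 1≤x le) (subst (_≼ ι x) (ι-* 2 y)
        (ι-mono (proj₁ (half-bounds x))))
    where
    y = x ÷ 2
    1≤x = ℕₚ.≤-trans (s≤s z≤n) p
    1≤y = ÷-≥1 {x} 2 (s≤s z≤n) p
    y≤x = ÷-≤ x 2 (s≤s z≤n)
    y≤X = ℕₚ.≤-trans y≤x le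
    x≼ : ι x ≼ ι 2 ⊗ ι y ⊕ ι 1
    x≼ = subst (ι x ≼_) (trans (ι-+ (2 * y) 1) (cong (_⊕ ι 1) (ι-* 2 y))) (ι-mono (proj₂ (half-bounds x)))

  -- Repeated halving: `3x + 3x/2 + ...` stays below `6x`.
  ψ-upper : ∀ x → x ≤ X → ψ x ≼ ι 6 ⊗ ι x
  ψ-upper = <-rec _ go
    where
    go : ∀ x → (∀ {y} → y < x → y ≤ X → ψ y ≼ ι 6 ⊗ ι y) → x ≤ X → ψ x ≼ ι 6 ⊗ ι x
    go zero          ih le = lin 0 (⊢ con 0 :≤ con 6 :* con 0)
    go (suc zero)    ih le = lin 2 (λ a b → a :≤ b ⇒ b :≡ con 0 ⇒ ⊢ con 0 :+ a :≤ con 6 :* con 1) _ _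
        (Λ≼L 1 ℕₚ.≤-refl le) L-1
    go x@(suc (suc n)) ih le = lin 5 (λ a b t x y → a :- b :≤ t ⇒ t :≤ con 3 :* x ⇒ b :≤ con 6 :* y ⇒ con 2 :* y
        :≤ x ⇒ ⊢ a :≤ con 6 :* x)
      (ψ x) (ψ (x ÷ 2)) _ (ι x) (ι (x ÷ 2)) (ψ-step x le) (T-difference-upper x (s≤s (s≤s z≤n)) le)
      (ih (m/n<m x 2 (s≤s (s≤s z≤n))) (ℕₚ.≤-trans (÷-≤ x 2 (s≤s z≤n)) le))
      (subst (_≼ ι x) (ι-* 2 (x ÷ 2)) (ι-mono (proj₁ (half-bounds x))))

  -- The main term is `x log 2`, and `log 2` is bounded below by `1/2`; hence the factor 2 before
  -- `ψ x`.
  ψ-lower : ∀ x → 2 ≤ x → x ≤ X → ι x ≼ ι 2 ⊗ ψ x ⊕ ι 4 ⊗ L x ⊕ ι 4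
  ψ-lower x p le = lin 8
    (λ tx ty lx ly x y l2 s → x :* lx :- x :+ con 1 :≤ tx ⇒ ty :≤ y :* ly :- y :+ con 1 :+ ly ⇒ tx :- con 2 :*
        ty :≤ s ⇒
       con 0 :≤ (x :- con 2 :* y) :* ly ⇒ con 0 :≤ x :* (lx :- (l2 :+ ly)) ⇒ con 0 :≤ x :*
           (con 2 :* l2 :- con 1) ⇒ x :≤ con 2 :* y :+ con 1 ⇒ ly :≤ lx ⇒
       ⊢ x :≤ con 2 :* s :+ con 4 :* lx :+ con 4)
    (T x) (T y) (L x) (L y) (ι x) (ι y) (L 2) (ψ x)
    (T-lower x 1≤x le) (T-upper y 1≤y y≤X) (ψ-≽ x le)
    (⊗-nonneg (0≼-gap (subst (_≼ ι x) (ι-* 2 y) (ι-mono (proj₁ (half-bounds x))))) (L-nonneg y 1≤y y≤X))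
    (⊗-nonneg (0≼ι x) (0≼-gap (subst (_≼ L x) (L-* 2 y (s≤s z≤n) 1≤y)
        (L-mono (2 * y) x (ℕₚ.≤-trans 1≤y (ℕₚ.m≤m+n y _)) (proj₁ (half-bounds x)) le))))
    (⊗-nonneg (0≼ι x) (0≼-gap (lin 2 (λ a b → con 1 :≤ (a :- b) :* con 2 ⇒ b :≡ con 0 ⇒ ⊢ con 1 :≤ con 2 :* a)
        (L 2) (L 1) (L-lower 1 ℕₚ.≤-refl (ℕₚ.≤-trans p le)) L-1)))
    (subst (ι x ≼_) (trans (ι-+ (2 * y) 1) (cong (_⊕ ι 1) (ι-* 2 y))) (ι-mono (proj₂ (half-bounds x))))
    (L-mono y x 1≤y y≤x le)
    where
    y = x ÷ 2
    1≤x = ℕₚ.≤-trans (s≤s z≤n) p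
    1≤y = ÷-≥1 {x} 2 (s≤s z≤n) p
    y≤x = ÷-≤ x 2 (s≤s z≤n)
    y≤X = ℕₚ.≤-trans y≤x le

  M : ℕ → Q
  M x = ∑ x (λ n → Λ n ⊗ inv n)

  T-Λ′ : ∀ x → x ≤ X → ∑ x (λ n → Λ n ⊗ ι (x ÷ n)) ≡ T x
  T-Λ′ x le = trans (sym (∑-trunc _ le (λ n lt _ → trans (cong (λ a → Λ n ⊗ ι a) (÷-large n lt)) (⊗-zeroʳ _))))
      (T-Λ x le)

  xM-≽ : ∀ x → x ≤ X → T x ≼ ι x ⊗ M x
  xM-≽ x le = subst₂ _≼_ (T-Λ′ x le) (∑-⊗ˡ x (ι x) _) (∑-mono x (λ n p _ →
    ≼-trans (⊗-monoˡ (Λ-nonneg n) (ι-÷-≼ x n p)) (≼-reflexive (⊗-left-comm _ _ _))))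

  -- Removing the floor from `ι (x ÷ n)` in `T-Λ′` costs at most `Λ n`, in total `ψ x`.
  xM-≼ : ∀ x → x ≤ X → ι x ⊗ M x ≼ T x ⊕ ψ x
  xM-≼ x le = subst₂ _≼_ (∑-⊗ˡ x (ι x) _) (trans (∑-⊕ x _ _) (cong (_⊕ ψ x) (T-Λ′ x le))) (∑-mono x (λ n p _ →
    ≼-trans (≼-reflexive (⊗-left-comm _ _ _)) (≼-trans (⊗-monoˡ (Λ-nonneg n) (≼-ι-÷ x n p))
      (≼-reflexive (lin 2 (λ a b → ⊢ a :* (b :+ con 1) :≡ a :* b :+ a) (Λ n) _)))))

  mertens-upper : ∀ x → 1 ≤ x → x ≤ X → ι x ⊗ M x ≼ ι x ⊗ (L x ⊕ ι 6)
  mertens-upper x p le = lin 5 (λ a t s x l → a :≤ t :+ s ⇒ t :≤ x :* l :- x :+ con 1 :+ l ⇒ s :≤ con 6 :* x ⇒ l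
      :≤ x :- con 1 ⇒ ⊢ a :≤ x :* (l :+ con 6))
    _ (T x) (ψ x) (ι x) (L x) (xM-≼ x le) (T-upper x p le) (ψ-upper x le) (L-≼ x p le)

  mertens-lower : ∀ x → 1 ≤ x → x ≤ X → ι x ⊗ (L x ⊖ ι 1) ≼ ι x ⊗ M x
  mertens-lower x p le = lin 4 (λ a t x l → t :≤ a ⇒ x :* l :- x :+ con 1 :≤ t ⇒ ⊢ x :* (l :- con 1) :≤ a)
    _ (T x) (ι x) (L x) (xM-≽ x le) (T-lower x p le)

-- Selberg's identity

harmonic : ℕ → Q
harmonic x = ∑ x inv

module SelbergFormula {X : ℕ} {L : ℕ → Q} (isLog : IsLog X L) (1≤X : 1 ≤ X) where
  open Estimates isLog public

  module Identity {f : ℕ → Q} (cm : CompletelyMultiplicative f) where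
    open CompletelyMultiplicative cm

    -- The Tatuzawa-Iseki identity, twisted by `f`. Split `K - L d` as `(K - L (m d)) + L m`: Möbius
    -- inversion reduces the first part to its value at 1, and `Λ * 1 = log` turns `L m` into `Λ`,
    -- after which inversion leaves the sum over `n`.
    selberg-identity : ∀ K {F : ℕ → Q} → Supp X F →
      K ⊗ F 1 ⊕ ∑ X (λ n → f n ⊗ Λ n ⊗ F n) ≡ ∑ X (λ d → μ X X d ⊗ f d ⊗
          ((K ⊖ L d) ⊗ ∑ X (λ m → f m ⊗ F (m * d))))
    selberg-identity K {F} s = sym (begin
      ∑ X (λ d → μ X X d ⊗ f d ⊗ ((K ⊖ L d) ⊗ ∑ X (λ m → f m ⊗ F (m * d))))
        ≡⟨ ∑-cong X (λ d p _ → expand d p) ⟩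
      ∑ X (λ d → μ X X d ⊗ ∑ X (λ m → Γ₁ (m * d)) ⊕ μ X X d ⊗ ∑ X (λ m → L m ⊗ Γ₂ (m * d)))
        ≡⟨ ∑-⊕ X _ _ ⟩
      ∑ X (λ d → μ X X d ⊗ ∑ X (λ m → Γ₁ (m * d))) ⊕ ∑ X (λ d → μ X X d ⊗ ∑ X (λ m → L m ⊗ Γ₂ (m * d)))
        ≡⟨ cong₂ _⊕_ (trans (μ-inversion X 1≤X Γ₁-supp) Γ₁-1) second ⟩
      K ⊗ F 1 ⊕ ∑ X (λ n → f n ⊗ Λ n ⊗ F n) ∎)
      where
      open ≡-Reasoning
      Γ₁ Γ₂ : ℕ → Q
      Γ₁ k = (K ⊖ L k) ⊗ (f k ⊗ F k)
      Γ₂ k = f k ⊗ F k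
      Γ₂-supp : Supp X Γ₂
      Γ₂-supp n lt = trans (cong (f n ⊗_) (s n lt)) (⊗-zeroʳ _)
      Γ₁-supp : Supp X Γ₁
      Γ₁-supp n lt = trans (cong ((K ⊖ L n) ⊗_) (Γ₂-supp n lt)) (⊗-zeroʳ _)
      Γ₁-1 : Γ₁ 1 ≡ K ⊗ F 1
      Γ₁-1 = trans (cong₂ (λ a b → (K ⊖ a) ⊗ (b ⊗ F 1)) L-1 f-1)
          (lin 2 (λ k a → ⊢ (k :- con 0) :* (con 1 :* a) :≡ k :* a) K (F 1))
      expand : ∀ d → 1 ≤ d → μ X X d ⊗ f d ⊗ ((K ⊖ L d) ⊗ ∑ X (λ m → f m ⊗ F (m * d)))
        ≡ μ X X d ⊗ ∑ X (λ m → Γ₁ (m * d)) ⊕ μ X X d ⊗ ∑ X (λ m → L m ⊗ Γ₂ (m * d))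
      expand d p = trans (lin 4 (λ a b c e → ⊢ a :* b :* (c :* e) :≡ a :* ((b :* c) :* e)) (μ X X d) (f d)
          (K ⊖ L d) _)
        (trans (cong (μ X X d ⊗_) (trans (sym (∑-⊗ˡ X (f d ⊗ (K ⊖ L d)) _))
            (trans (∑-cong X (λ m q _ → term m q)) (∑-⊕ X _ _))))
          (⊗-distribˡ _ _ _))
        where
        term : ∀ m → 1 ≤ m → f d ⊗ (K ⊖ L d) ⊗ (f m ⊗ F (m * d)) ≡ Γ₁ (m * d) ⊕ L m ⊗ Γ₂ (m * d)
        term m q = trans (lin 6 (λ a b k l n e → ⊢ a :* (k :- l) :* (b :* e) :≡ (k :- (n :+ l)) :*
            ((b :* a) :* e) :+ n :* ((b :* a) :* e))
            (f d) (f m) K (L d) (L m) (F (m * d)))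
          (cong₂ (λ u v → (K ⊖ u) ⊗ (v ⊗ F (m * d)) ⊕ L m ⊗ (v ⊗ F (m * d))) (sym (L-* m d q p))
              (sym (f-* m d)))
      second : ∑ X (λ d → μ X X d ⊗ ∑ X (λ m → L m ⊗ Γ₂ (m * d))) ≡ ∑ X (λ n → f n ⊗ Λ n ⊗ F n)
      second = begin
        ∑ X (λ d → μ X X d ⊗ ∑ X (λ m → L m ⊗ Γ₂ (m * d)))
          ≡⟨ ∑-cong X (λ d p _ → trans (cong (μ X X d ⊗_) (sym (Λ-conv (Supp-dilate d p Γ₂-supp))))
              (sym (∑-⊗ˡ X _ _))) ⟩
        ∑ X (λ d → ∑ X (λ n → μ X X d ⊗ (Λ n ⊗ ∑ X (λ m → Γ₂ (m * n * d)))))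
          ≡⟨ ∑-swap X X _ ⟩
        ∑ X (λ n → ∑ X (λ d → μ X X d ⊗ (Λ n ⊗ ∑ X (λ m → Γ₂ (m * n * d)))))
          ≡⟨ ∑-cong X (λ n p _ → trans (∑-cong′ X (λ d → trans (⊗-left-comm _ _ _)
              (cong (λ z → Λ n ⊗ (μ X X d ⊗ z)) (∑-cong′ X (λ m → cong Γ₂ (reorder m n d))))))
               (trans (∑-⊗ˡ X (Λ n) _) (trans (cong (Λ n ⊗_) (μ-inversion X 1≤X (Supp-dilate n p Γ₂-supp)))
                   (finish n)))) ⟩
        ∑ X (λ n → f n ⊗ Λ n ⊗ F n) ∎
        where
        reorder : ∀ m n d → m * n * d ≡ m * d * n
        reorder m n d = trans (ℕₚ.*-assoc m n d) (trans (cong (m *_) (ℕₚ.*-comm n d)) (sym (ℕₚ.*-assoc m d n)))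
        finish : ∀ n → Λ n ⊗ Γ₂ (1 * n) ≡ f n ⊗ Λ n ⊗ F n
        finish n = trans (cong (λ k → Λ n ⊗ Γ₂ k) (ℕₚ.*-identityˡ n))
            (lin 3 (λ a b c → ⊢ a :* (b :* c) :≡ b :* a :* c) (Λ n) (f n) (F n))

    -- `K = L x` makes the weights nonnegative and small for `d` near `x`: if `B d` is of order
    -- `log (x/d) + 1`, the right side is `O(x)` by `∑ℓ` and `∑ℓ²`.
    selberg-bound : ∀ {x} {F : ℕ → Q} (B : ℕ → Q) → 1 ≤ x → x ≤ X → (∀ n → x < n → F n ≡ ι 0) →
      (∀ d → 1 ≤ d → d ≤ x → ∥ ∑ X (λ m → f m ⊗ F (m * d)) ∥ ≼ B d) →
      ∥ L x ⊗ F 1 ⊕ ∑ X (λ n → f n ⊗ Λ n ⊗ F n) ∥ ≼ ∑ x (λ d → (L x ⊖ L d) ⊗ B d)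
    selberg-bound {x} {F} B p le s h = subst (λ z → ∥ z ∥ ≼ ∑ x (λ d → (L x ⊖ L d) ⊗ B d))
        (sym (trans (selberg-identity (L x) supp) (∑-trunc _ le beyond)))
      (≼-trans (∥∑∥ x _) (∑-mono x bound))
      where
      supp : Supp X F
      supp n lt = s n (ℕₚ.≤-<-trans le lt)
      beyond : ∀ d → x < d → d ≤ X → μ X X d ⊗ f d ⊗ ((L x ⊖ L d) ⊗ ∑ X (λ m → f m ⊗ F (m * d))) ≡ ι 0
      beyond d lt _ = trans (cong (λ z → μ X X d ⊗ f d ⊗ ((L x ⊖ L d) ⊗ z)) (∑-zero X (λ m q _ →
          trans (cong (f m ⊗_) (s (m * d) (ℕₚ.≤-trans lt (subst (_≤ m * d) (ℕₚ.*-identityˡ d)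
              (ℕₚ.*-monoˡ-≤ d q))))) (⊗-zeroʳ _))))
        (lin 3 (λ a b c → ⊢ a :* b :* (c :* con 0) :≡ con 0) (μ X X d) (f d) (L x ⊖ L d))
      bound : ∀ d → 1 ≤ d → d ≤ x → ∥ μ X X d ⊗ f d ⊗ ((L x ⊖ L d) ⊗ ∑ X (λ m → f m ⊗ F (m * d))) ∥ ≼
          (L x ⊖ L d) ⊗ B d
      bound d q r = ≼-trans (≼-reflexive (cong ∥_∥ (⊗-assoc _ _ _)))
          (≼-trans (∥∥-contract _ (μ-bound X X d q (ℕₚ.≤-trans r le)))
        (≼-trans (∥∥-contract _ (f-bound d)) (≼-trans (≼-reflexive
            (trans (∥∥-⊗ _ _) (cong (_⊗ _) (∥∥-nonneg 0≼ℓ)))) (⊗-monoˡ 0≼ℓ (h d q r)))))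
        where
        0≼ℓ : ι 0 ≼ L x ⊖ L d
        0≼ℓ = 0≼-gap (L-mono d x q r le)

    R : ℕ → Q
    R x = ∑ x (λ n → f n ⊗ Λ n)

    R-floor : ∀ y → y ≤ X → ∑ y (λ m → f m ⊗ R (y ÷ m)) ≡ ∑ y (λ k → f k ⊗ L k)
    R-floor y le = begin
      ∑ y (λ m → f m ⊗ R (y ÷ m))
        ≡⟨ sym (∑-trunc _ le (λ m lt _ → trans (cong (λ k → f m ⊗ R k) (÷-large m lt)) (⊗-zeroʳ _))) ⟩
      ∑ X (λ m → f m ⊗ R (y ÷ m))
        ≡⟨ ∑-cong X (λ m p _ → trans (cong (f m ⊗_) (sym (∑-floor X m (λ n → f n ⊗ Λ n) p le)))
            (sym (∑-⊗ˡ X _ _))) ⟩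
      ∑ X (λ m → ∑ X (λ n → f m ⊗ (𝟙 (n * m ≤? y) ⊗ (f n ⊗ Λ n))))
        ≡⟨ ∑-swap X X _ ⟩
      ∑ X (λ n → ∑ X (λ m → f m ⊗ (𝟙 (n * m ≤? y) ⊗ (f n ⊗ Λ n))))
        ≡⟨ ∑-cong′ X (λ n → trans (∑-cong′ X (λ m → term n m)) (∑-⊗ˡ X _ _)) ⟩
      ∑ X (λ n → Λ n ⊗ ∑ X (λ m → Γ (m * n)))
        ≡⟨ Λ-conv (λ n lt → trans (cong (_⊗ f n) (𝟙-no (n ≤? y) (λ h → ℕₚ.<⇒≱ lt (ℕₚ.≤-trans h le))))
            (⊗-zeroˡ _)) ⟩
      ∑ X (λ k → L k ⊗ Γ k)
        ≡⟨ trans (∑-cong′ X (λ k → lin 3 (λ a b c → ⊢ a :* (b :* c) :≡ b :* (c :* a)) (L k) (𝟙 (k ≤? y)) (f k)))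
            (∑-cut X _ le) ⟩
      ∑ y (λ k → f k ⊗ L k) ∎
      where
      open ≡-Reasoning
      Γ : ℕ → Q
      Γ k = 𝟙 (k ≤? y) ⊗ f k
      term : ∀ n m → f m ⊗ (𝟙 (n * m ≤? y) ⊗ (f n ⊗ Λ n)) ≡ Λ n ⊗ Γ (m * n)
      term n m = trans (cong (λ k → f m ⊗ (𝟙 (k ≤? y) ⊗ (f n ⊗ Λ n))) (ℕₚ.*-comm n m))
        (trans (lin 4 (λ a b c e → ⊢ a :* (b :* (c :* e)) :≡ e :* (b :* (a :* c))) (f m) (𝟙 (m * n ≤? y)) (f n)
            (Λ n))
          (cong (λ z → Λ n ⊗ (𝟙 (m * n ≤? y) ⊗ z)) (sym (f-* m n))))

  ∑ℓ : ∀ x → 1 ≤ x → x ≤ X → ∑ x (λ d → L x ⊖ L d) ≼ ι x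
  ∑ℓ x p le = ≼-trans (≼-reflexive (trans (∑-⊖ x _ _) (cong (_⊖ T x) (∑-const x (L x)))))
    (lin 3 (λ x l t → x :* l :- x :+ con 1 :≤ t ⇒ ⊢ x :* l :- t :≤ x) (ι x) (L x) (T x) (T-lower x p le))

  -- Passing to `x + 1` adds `δ ≤ 1/x` to each `L x - L d`. The cross terms give at most `2 δ x ≤ 2`
  -- and the squares at most `x δ² ≤ 1`, hence the constant 3.
  ∑ℓ²-step : ∀ x → 1 ≤ x → suc x ≤ X → ∑ x (λ d → (L x ⊖ L d) ⊗ (L x ⊖ L d)) ≼ ι 3 ⊗ ι x →
             ∑ (suc x) (λ d → (L (suc x) ⊖ L d) ⊗ (L (suc x) ⊖ L d)) ≼ ι 3 ⊗ ι (suc x)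
  ∑ℓ²-step x p le ih = cong (_⊕ (L (suc x) ⊖ L (suc x)) ⊗ (L (suc x) ⊖ L (suc x))) expanded ≡≼
    lin 8 (λ s₂ s₁ t δ x₁ l x₂ u → s₂ :≤ con 3 :* x₁ ⇒ t :≡ con 2 :* δ :* s₁ ⇒ u :≡ x₁ :* (δ :* δ) ⇒ con 0 :≤ δ
        :* (x₁ :- s₁) ⇒ δ :* x₁ :≤ con 1 ⇒ con 0 :≤ (con 1 :- δ) :* (con 1 :- δ :* x₁) ⇒ con 0 :≤ δ ⇒ δ :≤ con 1
        ⇒ con 0 :≤ δ :* (con 1 :- δ :* x₁) ⇒ x₂ :≡ x₁ :+ con 1 ⇒
        ⊢ ((s₂ :+ t) :+ u) :+ (l :- l) :* (l :- l) :≤ con 3 :* x₂)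
      (∑ x (λ d → (L x ⊖ L d) ⊗ (L x ⊖ L d))) (∑ x (λ d → L x ⊖ L d)) (∑ x (λ d → ι 2 ⊗ δ ⊗ (L x ⊖ L d))) δ
          (ι x) (L (suc x)) (ι (suc x)) (∑ x (λ _ → δ ⊗ δ))
      ih (∑-⊗ˡ x (ι 2 ⊗ δ) _) (∑-const x (δ ⊗ δ))
      (⊗-nonneg 0≼δ (0≼-gap (∑ℓ x p (ℕₚ.<⇒≤ le)))) δx≼1 (⊗-nonneg (0≼-gap δ≼1) (0≼-gap δx≼1)) 0≼δ δ≼1
          (⊗-nonneg 0≼δ (0≼-gap δx≼1)) (ι-suc x)
    where
    δ = L (suc x) ⊖ L x
    0≼δ = 0≼-gap (L-suc-≼ x p le)
    δx≼1 = L-upper x p le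
    δ≼1 : δ ≼ ι 1
    δ≼1 = lin 2 (λ δ x → con 0 :≤ δ :* (x :- con 1) ⇒ δ :* x :≤ con 1 ⇒ ⊢ δ :≤ con 1) δ (ι x)
        (⊗-nonneg 0≼δ (0≼-gap (1≼ι p))) δx≼1
    split : ∀ d → (L (suc x) ⊖ L d) ⊗ (L (suc x) ⊖ L d) ≡ ((L x ⊖ L d) ⊗ (L x ⊖ L d) ⊕ ι 2 ⊗ δ ⊗ (L x ⊖ L d)) ⊕
        δ ⊗ δ
    split d = lin 3 (λ a b c → ⊢ (a :- c) :* (a :- c) :≡ ((b :- c) :* (b :- c) :+ con 2 :* (a :- b) :* (b :- c))
        :+ (a :- b) :* (a :- b)) (L (suc x)) (L x) (L d)
    expanded : ∑ x (λ d → (L (suc x) ⊖ L d) ⊗ (L (suc x) ⊖ L d)) ≡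
      (∑ x (λ d → (L x ⊖ L d) ⊗ (L x ⊖ L d)) ⊕ ∑ x (λ d → ι 2 ⊗ δ ⊗ (L x ⊖ L d))) ⊕ ∑ x (λ _ → δ ⊗ δ)
    expanded = trans (∑-cong′ x split) (trans (∑-⊕ x _ _) (cong (_⊕ ∑ x (λ _ → δ ⊗ δ)) (∑-⊕ x _ _)))

  ∑ℓ² : ∀ x → 1 ≤ x → x ≤ X → ∑ x (λ d → (L x ⊖ L d) ⊗ (L x ⊖ L d)) ≼ ι 3 ⊗ ι x
  ∑ℓ² (suc zero)    p le = lin 1 (λ a → ⊢ con 0 :+ (a :- a) :* (a :- a) :≤ con 3 :* con 1) (L 1)
  ∑ℓ² (suc (suc n)) p le = ∑ℓ²-step (suc n) (s≤s z≤n) le (∑ℓ² (suc n) (s≤s z≤n) (ℕₚ.<⇒≤ le))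

  -- A rational stand-in for Euler's constant

  γ : Q
  γ = harmonic X ⊖ L X

  private
    inv≼Δ : ∀ n → 1 ≤ n → n < X → inv (suc n) ≼ L (suc n) ⊖ L n
    inv≼Δ n p q = subst (_≼ L (suc n) ⊖ L n) (⊗-identityˡ _) (inv-≼ (suc n) (s≤s z≤n) (L-lower n p q))
    Δ≼inv : ∀ n → 1 ≤ n → n < X → L (suc n) ⊖ L n ≼ inv n
    Δ≼inv n p q = subst (L (suc n) ⊖ L n ≼_) (⊗-identityˡ _) (≼-inv n p (L-upper n p q))

  -- With `H-L-lower`, this traps `H(n) - L(n)` between `γ` and `γ + 1/n`.
  H-L-upper : ∀ n k → 1 ≤ n → n + k ≤ X → harmonic (n + k) ⊖ L (n + k) ≼ harmonic n ⊖ L n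
  H-L-upper n zero    p le rewrite ℕₚ.+-identityʳ n = ≼-refl
  H-L-upper n (suc k) p le rewrite ℕₚ.+-suc n k = lin 6 (λ h l l′ i h₀ l₀ → h :- l :≤ h₀ :- l₀ ⇒ i :≤ l′ :- l ⇒
      ⊢ (h :+ i) :- l′ :≤ h₀ :- l₀)
    (harmonic (n + k)) (L (n + k)) (L (suc (n + k))) (inv (suc (n + k))) (harmonic n) (L n)
        (H-L-upper n k p (ℕₚ.<⇒≤ le)) (inv≼Δ (n + k) (ℕₚ.≤-trans p (ℕₚ.m≤m+n n k)) le)

  H-L-lower : ∀ n k → 1 ≤ n → n + k ≤ X → harmonic n ⊖ L n ⊖ inv n ≼ harmonic (n + k) ⊖ L (n + k) ⊖ inv (n + k)
  H-L-lower n zero    p le rewrite ℕₚ.+-identityʳ n = ≼-refl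
  H-L-lower n (suc k) p le rewrite ℕₚ.+-suc n k = lin 6 (λ h l l′ i i′ h₀ → h₀ :≤ h :- l :- i ⇒ l′ :- l :≤ i ⇒ ⊢
      h₀ :≤ (h :+ i′) :- l′ :- i′)
    (harmonic (n + k)) (L (n + k)) (L (suc (n + k))) (inv (n + k)) (inv (suc (n + k))) _
        (H-L-lower n k p (ℕₚ.<⇒≤ le)) (Δ≼inv (n + k) (ℕₚ.≤-trans p (ℕₚ.m≤m+n n k)) le)

  γ-≼ : ∀ x → 1 ≤ x → x ≤ X → γ ≼ harmonic x ⊖ L x
  γ-≼ x p le with ℕₚ.m≤n⇒∃[o]m+o≡n le
  ... | k , e = subst (λ z → harmonic z ⊖ L z ≼ harmonic x ⊖ L x) e (H-L-upper x k p (ℕₚ.≤-reflexive e))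

  ≼-γ : ∀ x → 1 ≤ x → x ≤ X → harmonic x ⊖ L x ≼ γ ⊕ inv x
  ≼-γ x p le with ℕₚ.m≤n⇒∃[o]m+o≡n le
  ... | k , e = lin 4 (λ a b c i → a :- i :≤ b :- c ⇒ con 0 :≤ c ⇒ ⊢ a :≤ b :+ i) (harmonic x ⊖ L x) γ (inv X)
      (inv x)
    (subst (λ z → harmonic x ⊖ L x ⊖ inv x ≼ harmonic z ⊖ L z ⊖ inv z) e (H-L-lower x k p (ℕₚ.≤-reflexive e)))
        (inv-nonneg X 1≤X)

  inv-1 : inv 1 ≡ ι 1
  inv-1 = trans (sym (⊗-identityʳ _)) (inv-ι′ 1 ℕₚ.≤-refl)

  γ≼1 : γ ≼ ι 1
  γ≼1 = lin 3 (λ g i l → g :≤ (con 0 :+ i) :- l ⇒ i :≡ con 1 ⇒ l :≡ con 0 ⇒ ⊢ g :≤ con 1) γ (inv 1) (L 1)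
      (γ-≼ 1 ℕₚ.≤-refl 1≤X) inv-1 L-1

  0≼γ : ι 0 ≼ γ
  0≼γ = lin 3 (λ g i l → (con 0 :+ i) :- l :≤ g :+ i ⇒ l :≡ con 0 ⇒ ⊢ con 0 :≤ g) γ (inv 1) (L 1)
      (≼-γ 1 ℕₚ.≤-refl 1≤X) L-1

-- Selberg's formula for Λ

one : ℕ → Q
one _ = ι 1

one-cm : CompletelyMultiplicative one
one-cm = record { f-1 = refl ; f-* = λ _ _ → sym (⊗-identityˡ _) ; f-bound = λ _ → ≼-reflexive (∥∥-nonneg 0≼1) }

inv-* : ∀ m n → 1 ≤ m → 1 ≤ n → inv (m * n) ≡ inv m ⊗ inv n
inv-* m n p q = begin
  inv (m * n)                                             ≡⟨ sym
      (trans (cong₂ (λ a b → inv (m * n) ⊗ a ⊗ b) (inv-ι′ m p) (inv-ι′ n q))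
      (trans (⊗-identityʳ _) (⊗-identityʳ _))) ⟩
  inv (m * n) ⊗ (inv m ⊗ ι m) ⊗ (inv n ⊗ ι n)             ≡⟨ lin 5
      (λ k a m b n → ⊢ k :* (a :* m) :* (b :* n) :≡ k :* (m :* n) :* (a :* b)) _ _ _ _ _ ⟩
  inv (m * n) ⊗ (ι m ⊗ ι n) ⊗ (inv m ⊗ inv n)             ≡⟨ cong (λ z → inv (m * n) ⊗ z ⊗ (inv m ⊗ inv n))
      (sym (ι-* m n)) ⟩
  inv (m * n) ⊗ ι (m * n) ⊗ (inv m ⊗ inv n)               ≡⟨ trans
      (cong (_⊗ (inv m ⊗ inv n)) (inv-ι′ (m * n) (ℕₚ.*-mono-≤ p q))) (⊗-identityˡ _) ⟩
  inv m ⊗ inv n                                           ∎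
  where open ≡-Reasoning

module UntwistedFormula {X : ℕ} {L : ℕ → Q} (isLog : IsLog X L) (1≤X : 1 ≤ X) where
  open SelbergFormula isLog 1≤X public

  module One = Identity one-cm

  T-ψ : ∀ y → y ≤ X → ∑ y (λ m → ψ (y ÷ m)) ≡ T y
  T-ψ y le = trans (∑-cong′ y (λ m → trans (∑-cong′ (y ÷ m) (λ n → sym (⊗-identityˡ _))) (sym (⊗-identityˡ _))))
    (trans (One.R-floor y le) (∑-cong′ y (λ k → ⊗-identityˡ _)))

  L-floor : ∀ x d → 1 ≤ d → d ≤ x → x ≤ X → L (x ÷ d) ≼ L x ⊖ L d
  L-floor x d p q le = lin 4 (λ a b c e → e :≡ c :+ a ⇒ e :≤ b ⇒ ⊢ c :≤ b :- a) (L d) (L x) (L (x ÷ d))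
      (L (x ÷ d * d))
    (L-* (x ÷ d) d (÷-≥1 d p q) p)
    (L-mono (x ÷ d * d) x (ℕₚ.*-mono-≤ (÷-≥1 d p q) p) (÷-from d ℕₚ.≤-refl) le)

  P : ℕ → Q
  P x = ∑ x (λ n → Λ n ⊗ ψ (x ÷ n))

  module _ (x : ℕ) (1≤x : 1 ≤ x) (x≤X : x ≤ X) where
    private
      -- The constant that cancels the main terms of `transform`: for `y = ⌊x/d⌋`, the
      -- approximations `T y ≈ y log y - y` and `(x/d) H(y) ≈ y (log y + γ)` differ by `-(1 + γ) y`.
      c : Q
      c = ι 1 ⊕ γ
      h : ℕ → Q
      h n = ψ (x ÷ n) ⊖ ι x ⊗ inv n ⊕ c
      F : ℕ → Q
      F n = 𝟙 (n ≤? x) ⊗ h n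

    transform : ∀ d → 1 ≤ d → d ≤ x → ∑ X (λ m → ι 1 ⊗ F (m * d)) ≡ T (x ÷ d) ⊖ (ι x ⊗ inv d) ⊗ harmonic (x ÷ d)
        ⊕ ι (x ÷ d) ⊗ c
    transform d p q = begin
      ∑ X (λ m → ι 1 ⊗ F (m * d))                              ≡⟨ ∑-cong′ X (λ m → ⊗-identityˡ _) ⟩
      ∑ X (λ m → 𝟙 (m * d ≤? x) ⊗ h (m * d))                   ≡⟨ ∑-floor X d (λ m → h (m * d)) p x≤X ⟩
      ∑ y (λ m → h (m * d))                                    ≡⟨ ∑-cong y
          (λ m r _ → cong₂ (λ a b → ψ a ⊖ b ⊕ c) (trans (cong (x ÷_) (ℕₚ.*-comm m d)) (sym (÷-÷ x d m)))
                                                                     (trans (cong (ι x ⊗_)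
                                                                         (trans (inv-* m d r p) (⊗-comm _ _)))
                                                                         (sym (⊗-assoc _ _ _)))) ⟩
      ∑ y (λ m → ψ (y ÷ m) ⊖ (ι x ⊗ inv d) ⊗ inv m ⊕ c)        ≡⟨ trans (∑-⊕ y _ _)
          (cong₂ _⊕_ (∑-⊖ y _ _) (∑-const y c)) ⟩
      ∑ y (λ m → ψ (y ÷ m)) ⊖ ∑ y (λ m → (ι x ⊗ inv d) ⊗ inv m) ⊕ ι y ⊗ c  ≡⟨ cong₂ (λ a b → a ⊖ b ⊕ ι y ⊗ c)
          (T-ψ y (ℕₚ.≤-trans (÷-≤ x d p) x≤X)) (∑-⊗ˡ y _ inv) ⟩
      T y ⊖ (ι x ⊗ inv d) ⊗ harmonic y ⊕ ι y ⊗ c                      ∎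
      where
      open ≡-Reasoning
      y = x ÷ d

    transform-bound : ∀ d → 1 ≤ d → d ≤ x → ∥ ∑ X (λ m → ι 1 ⊗ F (m * d)) ∥ ≼ L x ⊖ L d ⊕ ι 2
    transform-bound d p q = subst (λ z → ∥ z ∥ ≼ L x ⊖ L d ⊕ ι 2) (sym (transform d p q)) (∥∥-≼
      (lin 7 (λ t r h y g l lx → t :≤ y :* l :- y :+ con 1 :+ l ⇒ con 0 :≤ (r :- y) :* h ⇒ con 0 :≤ y :*
          (h :- l :- g) ⇒ l :≤ lx ⇒
          ⊢ t :- r :* h :+ y :* (con 1 :+ g) :≤ lx :+ con 2)
        (T y) r (harmonic y) (ι y) γ (L y) (L x ⊖ L d) (T-upper y 1≤y y≤X)
            (⊗-nonneg (0≼-gap (ι-÷-≼ x d p)) 0≼harmonic) (⊗-nonneg (0≼ι y) (0≼-gap (γ-≼ y 1≤y y≤X)))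
            (L-floor x d p q x≤X))
      (lin 8 (λ t r h y g l lx i → y :* l :- y :+ con 1 :≤ t ⇒ con 0 :≤ (y :+ con 1 :- r) :* h ⇒ con 0 :≤ y :*
          (g :+ i :- (h :- l)) ⇒ i :* y :≡ con 1 ⇒ h :- l :≤ g :+ i ⇒ i :≤ con 1 ⇒ g :≤ con 1 ⇒ l :≤ lx ⇒
          ⊢ :- (t :- r :* h :+ y :* (con 1 :+ g)) :≤ lx :+ con 2)
        (T y) r (harmonic y) (ι y) γ (L y) (L x ⊖ L d) (inv y) (T-lower y 1≤y y≤X)
            (⊗-nonneg (0≼-gap (≼-ι-÷ x d p)) 0≼harmonic) (⊗-nonneg (0≼ι y) (0≼-gap (≼-γ y 1≤y y≤X)))
        (inv-ι′ y 1≤y) (≼-γ y 1≤y y≤X) (inv-≼1 y 1≤y) γ≼1 (L-floor x d p q x≤X)))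
      where
      y = x ÷ d
      r = ι x ⊗ inv d
      1≤y = ÷-≥1 d p q
      y≤X = ℕₚ.≤-trans (÷-≤ x d p) x≤X
      0≼harmonic : ι 0 ≼ harmonic y
      0≼harmonic = ∑-nonneg y (λ i a _ → inv-nonneg i a)

    selberg-raw : ∥ L x ⊗ (ψ x ⊖ ι x ⊕ c) ⊕ (P x ⊖ ι x ⊗ M x ⊕ c ⊗ ψ x) ∥ ≼ ι 5 ⊗ ι x
    selberg-raw = subst (λ z → ∥ z ∥ ≼ ι 5 ⊗ ι x) (cong₂ _⊕_ (cong (L x ⊗_) F1) sumF)
      (≼-trans (One.selberg-bound (λ d → L x ⊖ L d ⊕ ι 2) 1≤x x≤X
          (λ n lt → trans (cong (_⊗ h n) (𝟙-no (n ≤? x) (ℕₚ.<⇒≱ lt))) (⊗-zeroˡ _)) transform-bound)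
        ((trans (∑-cong′ x (λ d → ⊗-distribˡ _ _ _)) (trans (∑-⊕ x _ _)
            (cong (∑ x (λ d → (L x ⊖ L d) ⊗ (L x ⊖ L d)) ⊕_) (∑-⊗ʳ x (ι 2) _)))) ≡≼
          lin 3 (λ a b x → a :≤ con 3 :* x ⇒ b :≤ x ⇒ ⊢ a :+ b :* con 2 :≤ con 5 :* x) _ _ (ι x) (∑ℓ² x 1≤x x≤X)
              (∑ℓ x 1≤x x≤X)))
      where
      F1 : F 1 ≡ ψ x ⊖ ι x ⊕ c
      F1 = trans (cong₂ _⊗_ (𝟙-yes (1 ≤? x) 1≤x) (cong₂ (λ a b → ψ a ⊖ b ⊕ c) (÷-1 x)
          (trans (cong (ι x ⊗_) inv-1) (⊗-identityʳ _)))) (⊗-identityˡ _)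
      sumF : ∑ X (λ n → ι 1 ⊗ Λ n ⊗ F n) ≡ P x ⊖ ι x ⊗ M x ⊕ c ⊗ ψ x
      sumF = trans (∑-cong′ X (λ n → lin 3 (λ a b e → ⊢ con 1 :* a :* (b :* e) :≡ b :* (a :* e)) (Λ n)
          (𝟙 (n ≤? x)) (h n)))
        (trans (∑-cut X _ x≤X) (trans (∑-cong′ x (λ n → lin 5 (λ a p x i c → ⊢ a :* (p :- x :* i :+ c) :≡ a :* p
            :- x :* (a :* i) :+ c :* a) (Λ n) (ψ (x ÷ n)) (ι x) (inv n) c))
          (trans (∑-⊕ x _ _) (cong₂ _⊕_ (trans (∑-⊖ x _ _) (cong (P x ⊖_) (∑-⊗ˡ x (ι x) _))) (∑-⊗ˡ x c Λ)))))

    private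
      products : ι 0 ≼ L x × ι 0 ≼ (ι 1 ⊖ γ) ⊗ L x × ι 0 ≼ γ ⊗ L x × ι 0 ≼ (ι 1 ⊖ γ) ⊗ ψ x × ι 0 ≼ γ ⊗ ψ x
      products = 0≼L , ⊗-nonneg (0≼-gap γ≼1) 0≼L , ⊗-nonneg 0≼γ 0≼L , ⊗-nonneg (0≼-gap γ≼1) (ψ-nonneg x) ,
          ⊗-nonneg 0≼γ (ψ-nonneg x)
        where 0≼L = L-nonneg x 1≤x x≤X

    -- One `x log x` comes from the term `-x` of the test function, the other from `x M(x)` by
    -- Mertens; the rest is `O(x)`.
    selberg-upper : L x ⊗ ψ x ⊕ P x ≼ ι 2 ⊗ ι x ⊗ L x ⊕ ι 25 ⊗ ι x
    selberg-upper with products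
    ... | 0≼L , a , b , e , f = lin 7 (λ l s x g p w m → l :* (s :- x :+ (con 1 :+ g)) :+
        (p :- m :+ (con 1 :+ g) :* s) :≤ w ⇒ w :≡ con 5 :* x ⇒
        m :≤ x :* (l :+ con 6) ⇒ con 0 :≤ l ⇒ con 0 :≤ g :* l ⇒ con 0 :≤ g :* s ⇒ con 0 :≤ s ⇒ con 0 :≤ x ⇒ ⊢ l
            :* s :+ p :≤ con 2 :* x :* l :+ con 25 :* x)
      (L x) (ψ x) (ι x) γ (P x) (ι 5 ⊗ ι x) (ι x ⊗ M x) (≼-trans (≼-∥∥ _) selberg-raw) refl
          (mertens-upper x 1≤x x≤X) 0≼L b f (ψ-nonneg x) (0≼ι x)

    selberg-lower : ι 2 ⊗ ι x ⊗ L x ≼ L x ⊗ ψ x ⊕ P x ⊕ ι 25 ⊗ ι x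
    selberg-lower with products
    ... | 0≼L , a , b , e , f = lin 7 (λ l s x g p w m → :- (l :* (s :- x :+ (con 1 :+ g)) :+
        (p :- m :+ (con 1 :+ g) :* s)) :≤ w ⇒ w :≡ con 5 :* x ⇒
        x :* (l :- con 1) :≤ m ⇒ con 0 :≤ (con 1 :- g) :* l ⇒ con 0 :≤ (con 1 :- g) :* s ⇒ s :≤ con 6 :* x ⇒ l
            :≤ x :- con 1 ⇒ con 0 :≤ x ⇒ ⊢ con 2 :* x :* l :≤ l :* s :+ p :+ con 25 :* x)
      (L x) (ψ x) (ι x) γ (P x) (ι 5 ⊗ ι x) (ι x ⊗ M x) (≼-trans (⊝-∥∥ _) selberg-raw) refl
          (mertens-lower x 1≤x x≤X) a e (ψ-upper x x≤X) (L-≼ x 1≤x x≤X) (0≼ι x)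

  -- The cost of replacing `log x` by `log n` in the weights of `ψ(x) log x`. Its continuous form is
  -- the integral of `ψ(u)/u`, which explains the bound `O(x)`.
  V : ℕ → Q
  V x = ∑ x (λ n → Λ n ⊗ (L x ⊖ L n))

  V-nonneg : ∀ x → x ≤ X → ι 0 ≼ V x
  V-nonneg x le = ∑-nonneg x (λ n p q → ⊗-nonneg (Λ-nonneg n) (0≼-gap (L-mono n x p q le)))

  V-step : ∀ n → 1 ≤ n → suc n ≤ X → V n ≼ ι 6 ⊗ ι n → V (suc n) ≼ ι 6 ⊗ ι (suc n)
  V-step n p le ih = (cong (_⊕ Λ (suc n) ⊗ (L (suc n) ⊖ L (suc n)))
      (trans (∑-cong′ n (λ k → lin 4 (λ a b c e → ⊢ a :* (b :- e) :≡ a :* (c :- e) :+ (b :- c) :* a) (Λ k)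
      (L (suc n)) (L n) (L k)))
      (trans (∑-⊕ n _ _) (cong (V n ⊕_) (∑-⊗ˡ n (L (suc n) ⊖ L n) Λ))))) ≡≼
    lin 7 (λ v l l′ s n a n′ → v :≤ con 6 :* n ⇒ con 0 :≤ (l′ :- l) :* (con 6 :* n :- s) ⇒ (l′ :- l) :* n :≤ con
        1 ⇒ n′ :≡ n :+ con 1 ⇒ ⊢ (v :+ (l′ :- l) :* s) :+ a :* (l′ :- l′) :≤ con 6 :* n′)
      (V n) (L n) (L (suc n)) (ψ n) (ι n) (Λ (suc n)) (ι (suc n)) ih
      (⊗-nonneg (0≼-gap (L-suc-≼ n p le)) (0≼-gap (ψ-upper n (ℕₚ.<⇒≤ le)))) (L-upper n p le) (ι-suc n)

  V-upper : ∀ x → x ≤ X → V x ≼ ι 6 ⊗ ι x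
  V-upper zero          le = lin 0 (⊢ con 0 :≤ con 6 :* con 0)
  V-upper (suc zero)    le = lin 2 (λ a b → ⊢ con 0 :+ a :* (b :- b) :≤ con 6 :* con 1) (Λ 1) (L 1)
  V-upper (suc (suc m)) le = V-step (suc m) (s≤s z≤n) le (V-upper (suc m) (ℕₚ.<⇒≤ le))

  S₂ : ℕ → Q
  S₂ x = ∑ x (λ n → Λ n ⊗ L n) ⊕ P x

  V-≡ : ∀ x → V x ≡ ψ x ⊗ L x ⊖ ∑ x (λ n → Λ n ⊗ L n)
  V-≡ x = trans (∑-cong′ x (λ n → lin 3 (λ a b c → ⊢ a :* (b :- c) :≡ a :* b :- a :* c) (Λ n) (L x) (L n)))
      (trans (∑-⊖ x _ _) (cong (_⊖ ∑ x (λ n → Λ n ⊗ L n)) (∑-⊗ʳ x (L x) Λ)))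

  S₂-bound : ∀ x → x ≤ X → ∥ S₂ x ⊖ ι 2 ⊗ T x ∥ ≼ ι 33 ⊗ ι x
  S₂-bound zero    le = ≼-reflexive (trans (cong ∥_∥ (lin 0 (⊢ con 0 :+ con 0 :- con 2 :* con 0 :≡ con 0)))
      (trans (∥∥-nonneg ≼-refl) (lin 0 (⊢ con 0 :≡ con 33 :* con 0))))
  S₂-bound x@(suc _) le = ∥∥-≼
    (lin 7 (λ s p t l f v x → l :* f :+ p :≤ con 2 :* x :* l :+ con 25 :* x ⇒ v :≡ f :* l :- s ⇒ con 0 :≤ v ⇒ x
        :* l :- x :+ con 1 :≤ t ⇒ con 0 :≤ x ⇒
        ⊢ (s :+ p) :- con 2 :* t :≤ con 33 :* x)
      S (P x) (T x) (L x) (ψ x) (V x) (ι x) (selberg-upper x 1≤x le) (V-≡ x) (V-nonneg x le) (T-lower x 1≤x le)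
          (0≼ι x))
    (lin 7 (λ s p t l f v x → con 2 :* x :* l :≤ l :* f :+ p :+ con 25 :* x ⇒ v :≡ f :* l :- s ⇒ v :≤ con 6 :* x
        ⇒ t :≤ x :* l :- x :+ con 1 :+ l ⇒ l :≤ x :- con 1 ⇒ con 0 :≤ x ⇒
        ⊢ :- ((s :+ p) :- con 2 :* t) :≤ con 33 :* x)
      S (P x) (T x) (L x) (ψ x) (V x) (ι x) (selberg-lower x 1≤x le) (V-≡ x) (V-upper x le) (T-upper x 1≤x le)
          (L-≼ x 1≤x le) (0≼ι x))
    where
    1≤x = s≤s z≤n
    S = ∑ x (λ n → Λ n ⊗ L n)

  P-mono : ∀ {z t} → z ≤ t → P z ≼ P t
  P-mono {z} {t} h = ≼-trans (∑-mono z (λ n p _ → ⊗-monoˡ (Λ-nonneg n)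
      (ψ-mono {z ÷ n} {t ÷ n} (÷-to n (ℕₚ.≤-trans (÷-from n ℕₚ.≤-refl) h) p))))
    (∑-monoʳ _ h (λ n _ _ → ⊗-nonneg (Λ-nonneg n) (ψ-nonneg (t ÷ n))))

  -- Subtract the lower Selberg bound at `z` from the upper one at `t`. As `P` increases, its
  -- difference can be discarded, and `t ≤ 2 z` makes `t (L t - L z)` an `O(t)`.
  brun-titchmarsh : ∀ z t → 1 ≤ z → z ≤ t → t ≤ 2 * z → t ≤ X →
    (ψ t ⊖ ψ z) ⊗ L z ≼ ι 2 ⊗ (ι t ⊖ ι z) ⊗ L z ⊕ ι 54 ⊗ ι t
  brun-titchmarsh z t p h h₂ le = lin 8
    (λ ft fz lt lz t z pt pz → lt :* ft :+ pt :≤ con 2 :* t :* lt :+ con 25 :* t ⇒ con 2 :* z :* lz :≤ lz :* fz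
        :+ pz :+ con 25 :* z ⇒ pz :≤ pt ⇒
       con 0 :≤ ft :* (lt :- lz) ⇒ (lt :- lz) :* z :≤ t :- z ⇒ con 0 :≤ (con 2 :* z :- t) :* (lt :- lz) ⇒ z :≤ t
           ⇒ con 0 :≤ z ⇒
       ⊢ (ft :- fz) :* lz :≤ con 2 :* (t :- z) :* lz :+ con 54 :* t)
    (ψ t) (ψ z) (L t) (L z) (ι t) (ι z) (P t) (P z)
    (selberg-upper t (ℕₚ.≤-trans p h) le) (selberg-lower z p (ℕₚ.≤-trans h le)) (P-mono h)
    (⊗-nonneg (ψ-nonneg t) 0≼Δ) (L-diff-≼ z t p h le) (⊗-nonneg (0≼-gap (subst (ι t ≼_) (ι-* 2 z) (ι-mono h₂)))
        0≼Δ) (ι-mono h) (0≼ι z)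
    where
    0≼Δ = 0≼-gap (L-mono z t p h le)

-- The character modulo 4

χ : ℕ → Q
χ 0 = ι 0
χ 1 = ι 1
χ 2 = ι 0
χ 3 = ⊝ ι 1
χ (suc (suc (suc (suc n)))) = χ n

χ-period : ∀ k n → χ (4 * k + n) ≡ χ n
χ-period zero    n = refl
χ-period (suc k) n = trans (cong (λ m → χ (m + n)) (ℕₚ.*-distribˡ-+ 4 1 k)) (χ-period k n)

χ-2* : ∀ n → χ (2 * n) ≡ ι 0
χ-2* 0 = refl
χ-2* 1 = refl
χ-2* (suc (suc n)) = trans (cong χ (ℕₚ.*-distribˡ-+ 2 2 n)) (χ-2* n)

χ-3* : ∀ n → χ (3 * n) ≡ ⊝ χ n
χ-3* 0 = lin 0 (⊢ con 0 :≡ :- con 0)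
χ-3* 1 = refl
χ-3* 2 = lin 0 (⊢ con 0 :≡ :- con 0)
χ-3* 3 = lin 0 (⊢ con 1 :≡ :- (:- con 1))
χ-3* (suc (suc (suc (suc n)))) = trans (cong χ (ℕₚ.*-distribˡ-+ 3 4 n)) (χ-3* n)

-- Periodicity reduces to `m < 4`; there doubling kills `χ` and tripling changes its sign.
χ-* : ∀ m n → χ (m * n) ≡ χ m ⊗ χ n
χ-* 0 n = sym (⊗-zeroˡ _)
χ-* 1 n = trans (cong χ (ℕₚ.*-identityˡ n)) (sym (⊗-identityˡ _))
χ-* 2 n = trans (χ-2* n) (sym (⊗-zeroˡ _))
χ-* 3 n = trans (χ-3* n) (lin 1 (λ a → ⊢ :- a :≡ :- con 1 :* a) (χ n))
χ-* (suc (suc (suc (suc m)))) n = trans (cong χ (ℕₚ.*-distribʳ-+ n 4 m)) (trans (χ-period n (m * n)) (χ-* m n))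

χ-bound : ∀ n → ∥ χ n ∥ ≼ ι 1
χ-bound 0 = ≼-trans (≼-reflexive (∥∥-nonneg ≼-refl)) 0≼1
χ-bound 1 = ≼-reflexive (∥∥-nonneg 0≼1)
χ-bound 2 = ≼-trans (≼-reflexive (∥∥-nonneg ≼-refl)) 0≼1
χ-bound 3 = ≼-reflexive (trans (∥∥-neg (ι 1)) (∥∥-nonneg 0≼1))
χ-bound (suc (suc (suc (suc n)))) = χ-bound n

χ-cm : CompletelyMultiplicative χ
χ-cm = record { f-1 = refl ; f-* = χ-* ; f-bound = χ-bound }

-- β n is the sum of χ over [1, n].

β : ℕ → Q
β 0 = ι 0
β 1 = ι 1
β 2 = ι 1
β 3 = ι 0
β (suc (suc (suc (suc n)))) = β n

β-suc : ∀ n → β (suc n) ≡ β n ⊕ χ (suc n)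
β-suc 0 = lin 0 (⊢ con 1 :≡ con 0 :+ con 1)
β-suc 1 = lin 0 (⊢ con 1 :≡ con 1 :+ con 0)
β-suc 2 = lin 0 (⊢ con 0 :≡ con 1 :+ :- con 1)
β-suc 3 = lin 0 (⊢ con 0 :≡ con 0 :+ con 0)
β-suc (suc (suc (suc (suc n)))) = β-suc n

β-nonneg : ∀ n → ι 0 ≼ β n
β-nonneg 0 = ≼-refl
β-nonneg 1 = 0≼1
β-nonneg 2 = 0≼1
β-nonneg 3 = ≼-refl
β-nonneg (suc (suc (suc (suc n)))) = β-nonneg n

β≼1 : ∀ n → β n ≼ ι 1
β≼1 0 = 0≼1
β≼1 1 = ≼-refl
β≼1 2 = ≼-refl
β≼1 3 = 0≼1
β≼1 (suc (suc (suc (suc n)))) = β≼1 n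

-- D n is the remainder in the Abel summation of S n.

module Remainder (g : ℕ → Q) where

  S D : ℕ → Q
  S n = ∑ n (λ k → χ k ⊗ g k)
  D n = β n ⊗ g n ⊖ S n

  D-suc : ∀ n → D (suc n) ≡ D n ⊕ β n ⊗ (g (suc n) ⊖ g n)
  D-suc n = trans (cong (λ b → b ⊗ g (suc n) ⊖ S (suc n)) (β-suc n))
    (lin 5 (λ b c g g′ s → ⊢ (b :+ c) :* g′ :- (s :+ c :* g′) :≡ (b :* g :- s) :+ b :* (g′ :- g)) (β n)
        (χ (suc n)) (g n) (g (suc n)) (S n))

  -- As `0 ≤ β ≤ 1`, each increment of `D` lies between the increment of `g` and 0.
  decreasing : ∀ n k → (∀ i → n ≤ i → g (suc i) ≼ g i) → D (n + k) ≼ D n × D n ≼ D (n + k) ⊕ (g n ⊖ g (n + k))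
  decreasing n zero    h rewrite ℕₚ.+-identityʳ n = ≼-refl , ≼-reflexive
      (lin 2 (λ a b → ⊢ a :≡ a :+ (b :- b)) (D n) (g n))
  decreasing n (suc k) h rewrite ℕₚ.+-suc n k with decreasing n k h
  ... | p , q = lin 5 (λ d d₀ d′ b e → d :≤ d₀ ⇒ d′ :≡ d :+ b :* e ⇒ con 0 :≤ b :* :- e ⇒ ⊢ d′ :≤ d₀)
      (D (n + k)) (D n) (D (suc (n + k))) (β (n + k)) Δ p (D-suc (n + k)) (⊗-nonneg (β-nonneg (n + k)) 0≼)
              , lin 7 (λ d d₀ d′ b g₀ g₁ g₂ → d₀ :≤ d :+ (g₀ :- g₁) ⇒ d′ :≡ d :+ b :* (g₂ :- g₁) ⇒ con 0 :≤
                  (con 1 :- b) :* :- (g₂ :- g₁) ⇒ ⊢ d₀ :≤ d′ :+ (g₀ :- g₂))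
                  (D (n + k)) (D n) (D (suc (n + k))) (β (n + k)) (g n) (g (n + k)) (g (suc (n + k))) q
                      (D-suc (n + k)) (⊗-nonneg (0≼-gap (β≼1 (n + k))) 0≼)
    where
    Δ = g (suc (n + k)) ⊖ g (n + k)
    0≼ : ι 0 ≼ ⊝ Δ
    0≼ = lin 2 (λ a b → a :≤ b ⇒ ⊢ con 0 :≤ :- (a :- b)) _ _ (h (n + k) (ℕₚ.m≤m+n n k))

module χ-inv = Remainder inv

L₁ : ℕ → Q
L₁ = χ-inv.S

inv-decreasing : ∀ i → 1 ≤ i → inv (suc i) ≼ inv i
inv-decreasing i p = inv-antitone i (suc i) p (ℕₚ.n≤1+n i)

L₁-tail : ∀ n k → 1 ≤ n → ∥ L₁ (n + k) ⊖ L₁ n ∥ ≼ inv n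
L₁-tail n k p with χ-inv.decreasing n k (λ i q → inv-decreasing i (ℕₚ.≤-trans p q))
... | a , b = ∥∥-≼
    (lin 6 (λ s s₀ b b₀ g g₀ → b₀ :* g₀ :- s₀ :≤ (b :* g :- s) :+ (g₀ :- g) ⇒ con 0 :≤ (con 1 :- b) :* g ⇒ con 0
        :≤ b₀ :* g₀ ⇒ ⊢ s :- s₀ :≤ g₀)
      (L₁ (n + k)) (L₁ n) (β (n + k)) (β n) (inv (n + k)) (inv n) b (⊗-nonneg (0≼-gap (β≼1 (n + k))) 0≼g)
          (⊗-nonneg (β-nonneg n) (inv-nonneg n p)))
    (lin 6 (λ s s₀ b b₀ g g₀ → b :* g :- s :≤ b₀ :* g₀ :- s₀ ⇒ con 0 :≤ b :* g ⇒ con 0 :≤ (con 1 :- b₀) :* g₀ ⇒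
        ⊢ :- (s :- s₀) :≤ g₀)
      (L₁ (n + k)) (L₁ n) (β (n + k)) (β n) (inv (n + k)) (inv n) a (⊗-nonneg (β-nonneg (n + k)) 0≼g)
          (⊗-nonneg (0≼-gap (β≼1 n)) (inv-nonneg n p)))
  where
  0≼g = inv-nonneg (n + k) (ℕₚ.≤-trans p (ℕₚ.m≤m+n n k))

-- L(1,χ) ≥ 1 - 1/3

L₁-positive : ∀ k → ι 2 ≼ ι 3 ⊗ L₁ (3 + k)
L₁-positive k = lin 6 (λ s b g i₁ i₂ i₃ → b :* g :- s :≤ con 0 :* i₃ :-
    (((con 0 :+ con 1 :* i₁) :+ con 0 :* i₂) :+ :- con 1 :* i₃) ⇒ con 0 :≤ b :* g ⇒ i₁ :* con 1 :≡ con 1 ⇒ i₃ :*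
    con 3 :≡ con 1 ⇒ ⊢ con 2 :≤ con 3 :* s)
  (L₁ (3 + k)) (β (3 + k)) (inv (3 + k)) (inv 1) (inv 2) (inv 3)
      (proj₁ (χ-inv.decreasing 3 k (λ i q → inv-decreasing i (ℕₚ.≤-trans (s≤s z≤n) q))))
  (⊗-nonneg (β-nonneg (3 + k)) (inv-nonneg (3 + k) (s≤s z≤n))) (inv-ι′ 1 ℕₚ.≤-refl) (inv-ι′ 3 (s≤s z≤n))

-- Selberg's formula for χΛ

∥∥-⊖ : ∀ a b → ∥ a ⊖ b ∥ ≼ ∥ a ∥ ⊕ ∥ b ∥
∥∥-⊖ a b = ≼-trans (∥∥-triangle a (⊝ b)) (≼-reflexive (cong (∥ a ∥ ⊕_) (∥∥-neg b)))

module TwistedFormula {X : ℕ} {L : ℕ → Q} (isLog : IsLog X L) (1≤X : 1 ≤ X) (3≤X : 3 ≤ X) where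
  open UntwistedFormula isLog 1≤X public
  private module χ-L = Remainder L
  open Identity χ-cm public using (R; R-floor; selberg-bound)

  -- Here `g = L` increases, and `D` increases more slowly because `0 ≤ β ≤ 1`. The boundedness of
  -- `β` is the reason that the twisted formula has no main term.
  χL-remainder : ∀ y → 1 ≤ y → y ≤ X → ι 0 ≼ χ-L.D y × χ-L.D y ≼ L y
  χL-remainder (suc zero) p le = lin 1 (λ l → ⊢ con 0 :≤ con 1 :* l :- (con 0 :+ con 1 :* l)) (L 1) ,
    lin 1 (λ l → l :≡ con 0 ⇒ ⊢ con 1 :* l :- (con 0 :+ con 1 :* l) :≤ l) (L 1) L-1
  χL-remainder (suc (suc n)) p le with χL-remainder (suc n) (s≤s z≤n) (ℕₚ.<⇒≤ le)
  ... | a , b = lin 3 (λ d d′ e → con 0 :≤ d ⇒ d′ :≡ d :+ e ⇒ con 0 :≤ e ⇒ ⊢ con 0 :≤ d′) (χ-L.D y)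
      (χ-L.D (suc y)) _ a (χ-L.D-suc y) (⊗-nonneg (β-nonneg y) 0≼Δ)
              , lin 5 (λ d d′ b l l′ → d :≤ l ⇒ d′ :≡ d :+ b :* (l′ :- l) ⇒ con 0 :≤ (con 1 :- b) :* (l′ :- l) ⇒
                  ⊢ d′ :≤ l′) (χ-L.D y) (χ-L.D (suc y)) (β y) (L y) (L (suc y)) b (χ-L.D-suc y)
                  (⊗-nonneg (0≼-gap (β≼1 y)) 0≼Δ)
    where
    y = suc n
    0≼Δ = 0≼-gap (L-suc-≼ y (s≤s z≤n) le)

  χL-bound : ∀ y → 1 ≤ y → y ≤ X → ∥ ∑ y (λ k → χ k ⊗ L k) ∥ ≼ L y
  χL-bound y p le with χL-remainder y p le
  ... | a , b = ∥∥-≼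
    (lin 3 (λ s b l → con 0 :≤ b :* l :- s ⇒ con 0 :≤ (con 1 :- b) :* l ⇒ ⊢ s :≤ l) (∑ y (λ k → χ k ⊗ L k))
        (β y) (L y) a (⊗-nonneg (0≼-gap (β≼1 y)) (L-nonneg y p le)))
    (lin 3 (λ s b l → b :* l :- s :≤ l ⇒ con 0 :≤ b :* l ⇒ ⊢ :- s :≤ l) (∑ y (λ k → χ k ⊗ L k)) (β y) (L y) b
        (⊗-nonneg (β-nonneg y) (L-nonneg y p le)))

  χΛ-bound : ∀ n → ∥ χ n ⊗ Λ n ∥ ≼ Λ n
  χΛ-bound n = ≼-trans (∥∥-contract (Λ n) (χ-bound n)) (≼-reflexive (∥∥-nonneg (Λ-nonneg n)))

  R-bound : ∀ x → ∥ R x ∥ ≼ ψ x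
  R-bound x = ≼-trans (∥∑∥ x _) (∑-mono x (λ n _ _ → χΛ-bound n))

  R-diff : ∀ {a b} → a ≤ b → ∥ R b ⊖ R a ∥ ≼ ψ b ⊖ ψ a
  R-diff {a} {b} h with ℕₚ.m≤n⇒∃[o]m+o≡n h
  ... | k , refl = ≼-trans (≼-reflexive (cong ∥_∥ (trans (cong (_⊖ R a) (∑-split a k _)) (cancel (R a) _))))
    (≼-trans (≼-trans (∥∑∥ k _) (∑-mono k (λ n _ _ → χΛ-bound (a + n))))
        (≼-reflexive (sym (trans (cong (_⊖ ψ a) (∑-split a k Λ)) (cancel (ψ a) _)))))
    where
    cancel : ∀ u v → (u ⊕ v) ⊖ u ≡ v
    cancel u v = lin 2 (λ u v → ⊢ (u :+ v) :- u :≡ v) u v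

  U : ℕ → Q
  U x = ∑ x (λ n → χ n ⊗ Λ n ⊗ R (x ÷ n))

  -- The test function is `R (x ÷ n)`. Its transform at `d` is the sum of `χ log` over `[1, x/d]`,
  -- at most `log (x/d)` in absolute value, so that the error is exactly the sum in `∑ℓ²`.
  selberg-twisted : ∀ x → 1 ≤ x → x ≤ X → ∥ L x ⊗ R x ⊕ U x ∥ ≼ ι 3 ⊗ ι x
  selberg-twisted x p le = subst (λ z → ∥ z ∥ ≼ ι 3 ⊗ ι x)
    (cong₂ _⊕_ (cong (λ k → L x ⊗ R k) (÷-1 x)) (∑-trunc _ le (λ n lt _ → trans
        (cong (λ k → χ n ⊗ Λ n ⊗ R k) (÷-large n lt)) (⊗-zeroʳ _))))
    (≼-trans (selberg-bound (λ d → L x ⊖ L d) p le (λ n lt → cong R (÷-large n lt)) twisted-transform)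
        (∑ℓ² x p le))
    where
    twisted-transform : ∀ d → 1 ≤ d → d ≤ x → ∥ ∑ X (λ m → χ m ⊗ R (x ÷ (m * d))) ∥ ≼ L x ⊖ L d
    twisted-transform d q r = ≼-trans (≼-reflexive (cong ∥_∥ eq))
        (≼-trans (χL-bound y (÷-≥1 d q r) y≤X) (L-floor x d q r le))
      where
      y = x ÷ d
      y≤X = ℕₚ.≤-trans (÷-≤ x d q) le
      eq : ∑ X (λ m → χ m ⊗ R (x ÷ (m * d))) ≡ ∑ y (λ k → χ k ⊗ L k)
      eq = trans (∑-cong′ X (λ m → cong (λ k → χ m ⊗ R k) (trans (cong (x ÷_) (ℕₚ.*-comm m d))
          (sym (÷-÷ x d m)))))
        (trans (∑-trunc _ y≤X (λ m lt _ → trans (cong (λ k → χ m ⊗ R k) (÷-large m lt)) (⊗-zeroʳ _)))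
            (R-floor y y≤X))

  private module χ-Linv = Remainder (λ k → L k ⊗ inv k)

  -- `log k / k` is not monotone, so `decreasing` is out of reach. The majorant vanishes at `y = 1`
  -- and its increments dominate those of `log k / k`: the derivatives are `(1 + log t)/t²` and
  -- `(1 - log t)/t²`.
  χLinv-step : ∀ y → 1 ≤ y → suc y ≤ X → ∥ χ-Linv.D y ∥ ≼ ι 2 ⊖ (L y ⊕ ι 2) ⊗ inv y → ∥ χ-Linv.D (suc y) ∥ ≼ ι 2
      ⊖ (L (suc y) ⊕ ι 2) ⊗ inv (suc y)
  χLinv-step y 1≤y le ih = ∥∥-≼ (half upper (≼-∥∥ _)) (half′ lower (⊝-∥∥ _))
    where
    l = L y
    l′ = L (suc y)
    i = inv y
    i′ = inv (suc y)
    0≼i′ = inv-nonneg (suc y) (s≤s z≤n)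
    0≼i = inv-nonneg y 1≤y
    i-i′ : i ⊖ i′ ≡ i ⊗ i′
    i-i′ = trans (cong₂ _⊖_ (sym (trans (cong (i ⊗_) (inv-ι′ (suc y) (s≤s z≤n))) (⊗-identityʳ _)))
        (sym (trans (cong (i′ ⊗_) (inv-ι′ y 1≤y)) (⊗-identityʳ _))))
      (trans (cong (λ z → i ⊗ (i′ ⊗ z) ⊖ i′ ⊗ (i ⊗ ι y)) (ι-suc y))
          (lin 3 (λ i j n → ⊢ i :* (j :* (n :+ con 1)) :- j :* (i :* n) :≡ i :* j) i i′ (ι y)))
    δ≼i : l′ ⊖ l ≼ i
    δ≼i = subst (l′ ⊖ l ≼_) (⊗-identityˡ _) (≼-inv y 1≤y (L-upper y 1≤y le))
    Δ : Q
    Δ = l′ ⊗ i′ ⊖ l ⊗ i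
    gap′ : Q
    gap′ = (l ⊕ ι 2) ⊗ i ⊖ (l′ ⊕ ι 2) ⊗ i′
    0≼l = L-nonneg y 1≤y (ℕₚ.<⇒≤ le)
    Δ≼ : Δ ≼ gap′
    Δ≼ = lin 4 (λ l m i j → l :* (i :- j) :≡ l :* (i :* j) ⇒ i :- j :≡ i :* j ⇒ con 0 :≤ (i :- (m :- l)) :* j ⇒
        con 0 :≤ l :* (i :* j) ⇒ ⊢ m :* j :- l :* i :≤ (l :+ con 2) :* i :- (m :+ con 2) :* j)
      l l′ i i′ (cong (l ⊗_) i-i′) i-i′ (⊗-nonneg (0≼-gap δ≼i) 0≼i′) (⊗-nonneg 0≼l (⊗-nonneg 0≼i 0≼i′))
    -Δ≼ : ⊝ Δ ≼ gap′
    -Δ≼ = lin 4 (λ l m i j → i :- j :≡ i :* j ⇒ con 0 :≤ i :* j ⇒ ⊢ :- (m :* j :- l :* i) :≤ (l :+ con 2) :* i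
        :- (m :+ con 2) :* j)
      l l′ i i′ i-i′ (⊗-nonneg 0≼i 0≼i′)
    0≼gap′ : ι 0 ≼ gap′
    0≼gap′ = lin 2 (λ a b → a :≤ b ⇒ :- a :≤ b ⇒ ⊢ con 0 :≤ b) Δ gap′ Δ≼ -Δ≼
    upper : β y ⊗ Δ ≼ gap′
    upper = lin 3 (λ b d g → con 0 :≤ b :* (g :- d) ⇒ con 0 :≤ (con 1 :- b) :* g ⇒ ⊢ b :* d :≤ g) (β y) Δ gap′
        (⊗-nonneg (β-nonneg y) (0≼-gap Δ≼)) (⊗-nonneg (0≼-gap (β≼1 y)) 0≼gap′)
    lower : ⊝ (β y ⊗ Δ) ≼ gap′
    lower = lin 3 (λ b d g → con 0 :≤ b :* (g :- :- d) ⇒ con 0 :≤ (con 1 :- b) :* g ⇒ ⊢ :- (b :* d) :≤ g) (β y)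
        Δ gap′ (⊗-nonneg (β-nonneg y) (0≼-gap -Δ≼)) (⊗-nonneg (0≼-gap (β≼1 y)) 0≼gap′)
    half : β y ⊗ Δ ≼ gap′ → χ-Linv.D y ≼ ∥ χ-Linv.D y ∥ → χ-Linv.D (suc y) ≼ ι 2 ⊖ (l′ ⊕ ι 2) ⊗ i′
    half u v = lin 6 (λ d d′ e n a b → d′ :≡ d :+ e ⇒ d :≤ n ⇒ n :≤ con 2 :- a ⇒ e :≤ a :- b ⇒ ⊢ d′ :≤ con 2 :-
        b)
      (χ-Linv.D y) (χ-Linv.D (suc y)) (β y ⊗ Δ) ∥ χ-Linv.D y ∥ ((l ⊕ ι 2) ⊗ i) ((l′ ⊕ ι 2) ⊗ i′)
          (χ-Linv.D-suc y) v ih u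
    half′ : ⊝ (β y ⊗ Δ) ≼ gap′ → ⊝ χ-Linv.D y ≼ ∥ χ-Linv.D y ∥ → ⊝ χ-Linv.D (suc y) ≼ ι 2 ⊖ (l′ ⊕ ι 2) ⊗ i′
    half′ u v = lin 6 (λ d d′ e n a b → d′ :≡ d :+ e ⇒ :- d :≤ n ⇒ n :≤ con 2 :- a ⇒ :- e :≤ a :- b ⇒ ⊢ :- d′ :≤
        con 2 :- b)
      (χ-Linv.D y) (χ-Linv.D (suc y)) (β y ⊗ Δ) ∥ χ-Linv.D y ∥ ((l ⊕ ι 2) ⊗ i) ((l′ ⊕ ι 2) ⊗ i′)
          (χ-Linv.D-suc y) v ih u

  χLinv-remainder : ∀ y → 1 ≤ y → y ≤ X → ∥ χ-Linv.D y ∥ ≼ ι 2 ⊖ (L y ⊕ ι 2) ⊗ inv y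
  χLinv-remainder (suc zero) p le = ≼-reflexive (trans (cong ∥_∥
      (lin 2 (λ l i → ⊢ con 1 :* (l :* i) :- (con 0 :+ con 1 :* (l :* i)) :≡ con 0) (L 1) (inv 1)))
    (trans (∥∥-nonneg ≼-refl) (lin 2 (λ l i → l :≡ con 0 ⇒ i :≡ con 1 ⇒ l :* i :≡ con 0 :* i ⇒ ⊢ con 0 :≡ con 2
        :- (l :+ con 2) :* i) (L 1) (inv 1) L-1 inv-1 (cong (_⊗ inv 1) L-1))))
  χLinv-remainder (suc (suc n)) p le = χLinv-step (suc n) (s≤s z≤n) le
      (χLinv-remainder (suc n) (s≤s z≤n) (ℕₚ.<⇒≤ le))

  χLinv-bound : ∀ y → 1 ≤ y → y ≤ X → ∥ ∑ y (λ k → χ k ⊗ (L k ⊗ inv k)) ∥ ≼ ι 2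
  χLinv-bound y p le = ∥∥-≼
    (lin 6 (λ s b g l i n → n :≤ con 2 :- (l :+ con 2) :* i ⇒ :- (b :* g :- s) :≤ n ⇒ g :≡ l :* i ⇒ con 0 :≤
        (con 1 :- b) :* g ⇒ con 0 :≤ i ⇒ ⊢ s :≤ con 2)
      (∑ y (λ k → χ k ⊗ (L k ⊗ inv k))) (β y) (L y ⊗ inv y) (L y) (inv y) ∥ χ-Linv.D y ∥
          (χLinv-remainder y p le) (⊝-∥∥ _) refl (⊗-nonneg (0≼-gap (β≼1 y)) 0≼g) 0≼i)
    (lin 6 (λ s b g l i n → n :≤ con 2 :- (l :+ con 2) :* i ⇒ b :* g :- s :≤ n ⇒ con 0 :≤ l :* i ⇒ con 0 :≤ b :*
        g ⇒ con 0 :≤ i ⇒ ⊢ :- s :≤ con 2)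
      (∑ y (λ k → χ k ⊗ (L k ⊗ inv k))) (β y) (L y ⊗ inv y) (L y) (inv y) ∥ χ-Linv.D y ∥
          (χLinv-remainder y p le) (≼-∥∥ _) 0≼g (⊗-nonneg (β-nonneg y) 0≼g) 0≼i)
    where
    0≼i = inv-nonneg y p
    0≼g = ⊗-nonneg (L-nonneg y p le) 0≼i

  Mχ : ℕ → Q
  Mχ x = ∑ x (λ n → χ n ⊗ Λ n ⊗ inv n)

  -- The convolution identity `χ * χΛ = χ log`, with weights `1/k`.
  L₁-floor : ∀ x → x ≤ X → ∑ x (λ n → χ n ⊗ Λ n ⊗ inv n ⊗ L₁ (x ÷ n)) ≡ ∑ x (λ k → χ k ⊗ (L k ⊗ inv k))
  L₁-floor x le = begin
    ∑ x (λ n → χ n ⊗ Λ n ⊗ inv n ⊗ L₁ (x ÷ n))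
      ≡⟨ sym (∑-trunc _ le (λ n lt _ → trans (cong (λ k → χ n ⊗ Λ n ⊗ inv n ⊗ L₁ k) (÷-large n lt))
          (⊗-zeroʳ _))) ⟩
    ∑ X (λ n → χ n ⊗ Λ n ⊗ inv n ⊗ L₁ (x ÷ n))
      ≡⟨ ∑-cong X (λ n p _ → trans (lin 4 (λ a b c e → ⊢ a :* b :* c :* e :≡ b :* ((a :* c) :* e)) (χ n) (Λ n)
          (inv n) _)
           (cong (Λ n ⊗_) (trans (sym (∑-⊗ˡ (x ÷ n) _ _)) (trans (sym (∑-floor X n _ p le))
               (∑-cong X (λ m q _ → term n m p q)))))) ⟩
    ∑ X (λ n → Λ n ⊗ ∑ X (λ m → Γ (m * n)))
      ≡⟨ Λ-conv (λ n lt → trans (cong (_⊗ (χ n ⊗ inv n)) (𝟙-no (n ≤? x) (λ h → ℕₚ.<⇒≱ lt (ℕₚ.≤-trans h le))))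
          (⊗-zeroˡ _)) ⟩
    ∑ X (λ k → L k ⊗ Γ k)
      ≡⟨ trans (∑-cong′ X (λ k → lin 4 (λ a b c e → ⊢ a :* (b :* (c :* e)) :≡ b :* (c :* (a :* e))) (L k)
          (𝟙 (k ≤? x)) (χ k) (inv k))) (∑-cut X _ le) ⟩
    ∑ x (λ k → χ k ⊗ (L k ⊗ inv k)) ∎
    where
    open ≡-Reasoning
    Γ : ℕ → Q
    Γ k = 𝟙 (k ≤? x) ⊗ (χ k ⊗ inv k)
    term : ∀ n m → 1 ≤ n → 1 ≤ m → 𝟙 (m * n ≤? x) ⊗ ((χ n ⊗ inv n) ⊗ (χ m ⊗ inv m)) ≡ Γ (m * n)
    term n m p q = cong (𝟙 (m * n ≤? x) ⊗_) (trans (lin 4 (λ a b c e → ⊢ (a :* b) :* (c :* e) :≡ (c :* a) :*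
        (e :* b)) (χ n) (inv n) (χ m) (inv m))
      (cong₂ _⊗_ (sym (χ-* m n)) (sym (inv-* m n q p))))

  -- In `L₁-floor`, replacing `L₁ (x ÷ n)` by `L₁ X`, the substitute for `L(1,χ)`, changes this
  -- factor by at most `2n/x`, and the whole sum by at most `2 ψ(x)/x ≤ 12`. Adding 2 from
  -- `χLinv-bound` gives 14, and dividing by `L₁ X ≥ 2/3` gives 21.
  mertens-twisted : ∀ x → 1 ≤ x → x ≤ X → ∥ Mχ x ∥ ≼ ι 21
  mertens-twisted x p le = lin 2 (λ b n → con 0 :≤ (con 3 :* b :- con 2) :* n ⇒ b :* n :≤ con 14 ⇒ ⊢ n :≤ con
      21) L∞ ∥ Mχ x ∥
    (⊗-nonneg (0≼-gap 2≼3L∞) (0≼∥∥ _)) main′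
    where
    L∞ : Q
    L∞ = L₁ X
    2≼3L∞ : ι 2 ≼ ι 3 ⊗ L∞
    2≼3L∞ with ℕₚ.m≤n⇒∃[o]m+o≡n 3≤X
    ... | k , e = subst (λ z → ι 2 ≼ ι 3 ⊗ L₁ z) e (L₁-positive k)
    error : Q
    error = ∑ x (λ n → χ n ⊗ Λ n ⊗ inv n ⊗ (L₁ X ⊖ L₁ (x ÷ n)))
    decompose : L∞ ⊗ Mχ x ≡ ∑ x (λ k → χ k ⊗ (L k ⊗ inv k)) ⊕ error
    decompose = trans (sym (∑-⊗ˡ x L∞ _)) (trans (∑-cong′ x (λ n → lin 3
        (λ a b c → ⊢ b :* a :≡ a :* c :+ a :* (b :- c)) (χ n ⊗ Λ n ⊗ inv n) L∞ (L₁ (x ÷ n))))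
      (trans (∑-⊕ x _ _) (cong (_⊕ error) (L₁-floor x le))))
    inv-floor : ∀ n → 1 ≤ n → n ≤ x → inv (x ÷ n) ≼ ι 2 ⊗ ι n ⊗ inv x
    inv-floor n q r = ≼-inv x p (lin 4 (λ i y n x → i :* y :≡ con 1 ⇒ con 0 :≤ i :* (con 2 :* n :* y :- x) ⇒
        (i :* y) :* n :≡ con 1 :* n ⇒ ⊢ i :* x :≤ con 2 :* n)
      (inv y) (ι y) (ι n) (ι x) (inv-ι′ y 1≤y) (⊗-nonneg (inv-nonneg y 1≤y) (0≼-gap x≼))
          (cong (_⊗ ι n) (inv-ι′ y 1≤y)))
      where
      y = x ÷ n
      1≤y = ÷-≥1 n q r
      x≼ : ι x ≼ ι 2 ⊗ ι n ⊗ ι y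
      x≼ = lin 4 (λ x y n z → x :≤ z ⇒ z :≡ (y :+ con 1) :* n ⇒ con 0 :≤ (y :- con 1) :* n ⇒ ⊢ x :≤ con 2 :* n
          :* y) (ι x) (ι y) (ι n) (ι ((y + 1) * n))
        (ι-mono (ℕₚ.<⇒≤ (÷-< x n q))) (trans (ι-* (y + 1) n) (cong (_⊗ ι n) (ι-+ y 1)))
            (⊗-nonneg (0≼-gap (1≼ι 1≤y)) (0≼ι n))
    tail : ∀ n → 1 ≤ n → n ≤ x → ∥ L₁ X ⊖ L₁ (x ÷ n) ∥ ≼ inv (x ÷ n)
    tail n q r with ℕₚ.m≤n⇒∃[o]m+o≡n (ℕₚ.≤-trans (÷-≤ x n q) le)
    ... | k , e = subst (λ z → ∥ L₁ z ⊖ L₁ (x ÷ n) ∥ ≼ inv (x ÷ n)) e (L₁-tail (x ÷ n) k (÷-≥1 n q r))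
    term-bound : ∀ n → 1 ≤ n → n ≤ x → ∥ χ n ⊗ Λ n ⊗ inv n ⊗ (L₁ X ⊖ L₁ (x ÷ n)) ∥ ≼ ι 2 ⊗ inv x ⊗ Λ n
    term-bound n q r = ≼-trans (≼-reflexive (trans (∥∥-⊗ _ _) (cong (_⊗ ∥ L₁ X ⊖ L₁ (x ÷ n) ∥)
        (trans (∥∥-⊗ _ _) (cong (∥ χ n ⊗ Λ n ∥ ⊗_) (∥∥-nonneg (inv-nonneg n q)))))))
      (≼-trans (⊗-mono (⊗-nonneg (0≼∥∥ _) (inv-nonneg n q)) (inv-nonneg _ (÷-≥1 n q r))
          (⊗-monoʳ (inv-nonneg n q) (χΛ-bound n)) (tail n q r))
      (≼-trans (⊗-monoˡ (⊗-nonneg (Λ-nonneg n) (inv-nonneg n q)) (inv-floor n q r))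
        (≼-reflexive (trans (lin 4 (λ a i n j → ⊢ a :* i :* (con 2 :* n :* j) :≡ (i :* n) :* (con 2 :* j :* a))
            (Λ n) (inv n) (ι n) (inv x)) (trans (cong (_⊗ (ι 2 ⊗ inv x ⊗ Λ n)) (inv-ι′ n q))
            (⊗-identityˡ _))))))
    error-bound : ∥ error ∥ ≼ ι 12
    error-bound = ≼-trans (∥∑∥ x _) (≼-trans (∑-mono x term-bound) (∑-⊗ˡ x _ Λ ≡≼
      lin 3 (λ i s x → con 0 :≤ i :* (con 6 :* x :- s) ⇒ i :* x :≡ con 1 ⇒ ⊢ con 2 :* i :* s :≤ con 12) (inv x)
          (ψ x) (ι x) (⊗-nonneg (inv-nonneg x p) (0≼-gap (ψ-upper x le))) (inv-ι′ x p)))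
    main : ∥ L∞ ⊗ Mχ x ∥ ≼ ι 14
    main = ≼-trans (≼-reflexive (cong ∥_∥ decompose)) (≼-trans (∥∥-triangle _ _)
      (lin 2 (λ a b → a :≤ con 2 ⇒ b :≤ con 12 ⇒ ⊢ a :+ b :≤ con 14) _ _ (χLinv-bound x p le) error-bound))
    0≼L∞ : ι 0 ≼ L∞
    0≼L∞ = lin 1 (λ b → con 2 :≤ con 3 :* b ⇒ ⊢ con 0 :≤ b) L∞ 2≼3L∞
    main′ : L∞ ⊗ ∥ Mχ x ∥ ≼ ι 14
    main′ = subst (_≼ ι 14) (trans (∥∥-⊗ _ _) (cong (_⊗ ∥ Mχ x ∥) (∥∥-nonneg 0≼L∞))) main

-- The iterated formula

-- Compares two systems of weights through their partial sums, which is what Selberg's formula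
-- controls.
abel-difference : ∀ n (c c′ g : ℕ → Q) → g (suc n) ≡ ι 0 →
  ∑ n (λ i → c i ⊗ g i) ⊖ ∑ n (λ i → c′ i ⊗ g i) ≡ ∑ n (λ k → (∑ k c ⊖ ∑ k c′) ⊗ (g k ⊖ g (suc k)))
abel-difference n c c′ g e = trans (sym (∑-⊖ n _ _)) (trans (∑-cong′ n
    (λ i → lin 3 (λ a b g → ⊢ a :* g :- b :* g :≡ (a :- b) :* g) (c i) (c′ i) (g i)))
  (trans (abel n (λ i → c i ⊖ c′ i) g) (trans (cong₂ _⊕_ (∑-cong′ n
      (λ k → cong (_⊗ (g k ⊖ g (suc k))) (∑-⊖ k c c′)))
    (trans (cong (∑ n (λ i → c i ⊖ c′ i) ⊗_) e) (⊗-zeroʳ _))) (⊕-identityʳ _))))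

∑-ones : ∀ k → ∑ k (λ _ → ι 1) ≡ ι k
∑-ones k = trans (∑-const k (ι 1)) (⊗-identityʳ _)

∥∥-reverse : ∀ a b → ∥ ∥ a ∥ ⊖ ∥ b ∥ ∥ ≼ ∥ a ⊖ b ∥
∥∥-reverse a b = ∥∥-≼
  (lin 3 (λ a b d → a :≤ d :+ b ⇒ ⊢ a :- b :≤ d) (∥ a ∥) (∥ b ∥) (∥ a ⊖ b ∥)
      (subst (λ z → ∥ z ∥ ≼ ∥ a ⊖ b ∥ ⊕ ∥ b ∥) (lin 2 (λ a b → ⊢ (a :- b) :+ b :≡ a) a b)
      (∥∥-triangle (a ⊖ b) b)))
  (lin 3 (λ a b d → b :≤ d :+ a ⇒ ⊢ :- (a :- b) :≤ d) (∥ a ∥) (∥ b ∥) (∥ a ⊖ b ∥)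
    (subst₂ (λ z w → ∥ z ∥ ≼ w ⊕ ∥ a ∥) (lin 2 (λ a b → ⊢ :- (a :- b) :+ a :≡ b) a b) (∥∥-neg (a ⊖ b))
        (∥∥-triangle (⊝ (a ⊖ b)) a)))

module IteratedFormula {X : ℕ} {L : ℕ → Q} (isLog : IsLog X L) (1≤X : 1 ≤ X) (3≤X : 3 ≤ X) where
  open TwistedFormula isLog 1≤X 3≤X public

  -- The convolution `Λ * Λ`.
  ΛΛ : ℕ → Q
  ΛΛ k = ∑ X (λ n → Λ n ⊗ ∑ X (λ m → 𝟙 (k ≟ m * n) ⊗ Λ m))

  ΛΛ-sum : ∀ {G : ℕ → Q} → Supp X G → ∑ X (λ n → Λ n ⊗ ∑ X (λ m → Λ m ⊗ G (m * n))) ≡ ∑ X (λ k → ΛΛ k ⊗ G k)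
  ΛΛ-sum {G} s = trans (∑-cong X (λ n p _ → trans (cong (Λ n ⊗_) (push X Λ n p s)) (sym (∑-⊗ˡ X _ _))))
    (trans (∑-swap X X _) (∑-cong′ X (λ k → trans (∑-cong′ X (λ n → sym (⊗-assoc _ _ _))) (∑-⊗ʳ X (G k) _))))

  ΛΛ-partial : ∀ k → k ≤ X → ∑ k ΛΛ ≡ P k
  ΛΛ-partial k le = trans (sym (trans (∑-cong′ X (λ j → ⊗-comm _ _)) (∑-cut X ΛΛ le)))
    (trans (sym (ΛΛ-sum (θ-supp le))) (trans (∑-cong X (λ n p _ → cong (Λ n ⊗_)
        (trans (∑-cong′ X (λ m → ⊗-comm _ _)) (∑-floor X n Λ p le))))
      (∑-trunc _ le (λ n lt _ → trans (cong (λ z → Λ n ⊗ ψ z) (÷-large n lt)) (⊗-zeroʳ _)))))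

  module _ (x : ℕ) (1≤x : 1 ≤ x) (x≤X : x ≤ X) where
    private
      g : ℕ → Q
      g n = ∥ R (x ÷ n) ∥
      ρ : ℕ → Q
      ρ n = ψ (x ÷ n)

    RΛ : ℕ → Q
    RΛ y = ∑ y (λ m → Λ m ⊗ ∥ R (y ÷ m) ∥)

    g-large : ∀ n → x < n → g n ≡ ι 0
    g-large n lt = trans (cong (λ k → ∥ R k ∥) (÷-large n lt)) (∥∥-nonneg ≼-refl)

    G : Q
    G = ∑ x (λ n → Λ n ⊗ L n ⊗ g n) ⊕ ∑ x (λ n → Λ n ⊗ RΛ (x ÷ n))

    G-≡ : G ≡ ∑ x (λ k → (Λ k ⊗ L k ⊕ ΛΛ k) ⊗ g k)
    G-≡ = trans (cong (∑ x (λ n → Λ n ⊗ L n ⊗ g n) ⊕_) double)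
        (trans (sym (∑-⊕ x _ _)) (∑-cong′ x (λ k → sym (⊗-distribʳ _ _ _))))
      where
      g-supp : Supp X g
      g-supp n lt = g-large n (ℕₚ.≤-<-trans x≤X lt)
      double : ∑ x (λ n → Λ n ⊗ RΛ (x ÷ n)) ≡ ∑ x (λ k → ΛΛ k ⊗ g k)
      double = trans (sym (∑-trunc _ x≤X (λ n lt _ → trans (cong (λ z → Λ n ⊗ RΛ z) (÷-large n lt))
          (⊗-zeroʳ _))))
        (trans (∑-cong X (λ n p _ → cong (Λ n ⊗_) (trans (∑-cong′ (x ÷ n)
            (λ m → cong (λ k → Λ m ⊗ ∥ R k ∥) (trans (÷-÷ x n m) (cong (x ÷_) (ℕₚ.*-comm n m)))))
            (sym (∑-trunc _ (ℕₚ.≤-trans (÷-≤ x n p) x≤X) (λ m lt _ → trans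
                (cong (Λ m ⊗_) (g-large (m * n) (ℕₚ.≰⇒> (λ h → ℕₚ.<⇒≱ lt (÷-to n h p))))) (⊗-zeroʳ _)))))))
          (trans (ΛΛ-sum g-supp) (∑-trunc _ x≤X (λ k lt _ → trans (cong (ΛΛ k ⊗_) (g-large k lt))
              (⊗-zeroʳ _)))))

    -- Replaces the weights Λ log + Λ * Λ by 2 log: their partial sums differ by O(x), and g has small variation.

    G-bound : G ≼ ι 2 ⊗ ∑ x (λ n → L n ⊗ g n) ⊕ ι 33 ⊗ T x
    G-bound = lin 4 (λ a b c d → a :- b :≡ c ⇒ c :≤ d ⇒ ⊢ a :≤ b :+ d) G (ι 2 ⊗ ∑ x (λ n → L n ⊗ g n))
        difference (ι 33 ⊗ T x)
      (trans (cong₂ _⊖_ G-≡ (trans (sym (∑-⊗ˡ x (ι 2) _)) (∑-cong′ x (λ n → sym (⊗-assoc _ _ _)))))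
        (abel-difference x (λ k → Λ k ⊗ L k ⊕ ΛΛ k) (λ k → ι 2 ⊗ L k) g (g-large (suc x) ℕₚ.≤-refl)))
      (≼-trans (≼-∥∥ _) (≼-trans (∥∑∥ x _) (≼-trans (∑-mono x step) (≼-reflexive total))))
      where
      difference : Q
      difference = ∑ x (λ k → (∑ k (λ j → Λ j ⊗ L j ⊕ ΛΛ j) ⊖ ∑ k (λ j → ι 2 ⊗ L j)) ⊗ (g k ⊖ g (suc k)))
      partial : ∀ k → k ≤ X → ∑ k (λ j → Λ j ⊗ L j ⊕ ΛΛ j) ⊖ ∑ k (λ j → ι 2 ⊗ L j) ≡ S₂ k ⊖ ι 2 ⊗ T k
      partial k le = cong₂ _⊖_ (trans (∑-⊕ k _ _) (cong (∑ k (λ n → Λ n ⊗ L n) ⊕_) (ΛΛ-partial k le)))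
          (∑-⊗ˡ k (ι 2) L)
      variation : ∀ k → 1 ≤ k → ∥ g k ⊖ g (suc k) ∥ ≼ ρ k ⊖ ρ (suc k)
      variation k p = ≼-trans (∥∥-reverse _ _) (R-diff (÷-anti x p (ℕₚ.n≤1+n k)))
      step : ∀ k → 1 ≤ k → k ≤ x → ∥ (∑ k (λ j → Λ j ⊗ L j ⊕ ΛΛ j) ⊖ ∑ k (λ j → ι 2 ⊗ L j)) ⊗ (g k ⊖ g (suc k))
          ∥ ≼ ι 33 ⊗ (∑ k (λ _ → ι 1) ⊗ (ρ k ⊖ ρ (suc k)))
      step k p q = ≼-trans (≼-reflexive (∥∥-⊗ _ _)) (≼-trans (⊗-mono (0≼∥∥ _) (≼-trans (0≼∥∥ _) (variation k p))
          (subst (λ z → ∥ z ∥ ≼ ι 33 ⊗ ι k) (sym (partial k (ℕₚ.≤-trans q x≤X)))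
              (S₂-bound k (ℕₚ.≤-trans q x≤X))) (variation k p))
        (≼-reflexive (trans (⊗-assoc _ _ _) (cong (λ z → ι 33 ⊗ (z ⊗ (ρ k ⊖ ρ (suc k)))) (sym (∑-ones k))))))
      -- Summation by parts in reverse: `Σ k (ρ k - ρ (k + 1)) = Σ ρ k`, and the sum of `ψ (x ÷ k)`
      -- is `T x`.
      total : ∑ x (λ k → ι 33 ⊗ (∑ k (λ _ → ι 1) ⊗ (ρ k ⊖ ρ (suc k)))) ≡ ι 33 ⊗ T x
      total = trans (∑-⊗ˡ x (ι 33) _) (cong (ι 33 ⊗_) (trans (sym
          (trans (abel x (λ _ → ι 1) ρ) (trans (cong (∑ x (λ k → ∑ k (λ _ → ι 1) ⊗ (ρ k ⊖ ρ (suc k))) ⊕_)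
          (trans (cong (λ k → ∑ x (λ _ → ι 1) ⊗ ψ k) (÷-large (suc x) ℕₚ.≤-refl)) (⊗-zeroʳ _)))
          (⊕-identityʳ _))))
        (trans (∑-cong′ x (λ k → ⊗-identityˡ _)) (T-ψ x x≤X))))

    -- In the term of `n`, split `log x` as `log n + log y + δ` with `y = ⌊x/n⌋`. The part `log n`
    -- is kept; `selberg-twisted` at `y` turns `R(y) log y` into `-U(y)` with error `3y`; the defect
    -- `δ` of the floor is at most `1/y`, harmless against `|R(y)| ≤ 6y`.
    LU-bound : ∥ L x ⊗ U x ∥ ≼ G ⊕ ι 3 ⊗ (ι x ⊗ M x) ⊕ ι 6 ⊗ ψ x
    LU-bound = ≼-trans (≼-reflexive (cong ∥_∥ (sym (∑-⊗ˡ x (L x) _))))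
        (≼-trans (∥∑∥ x _) (≼-trans (∑-mono x term) (≼-reflexive
      (trans (∑-⊕ x _ _) (cong₂ _⊕_ (trans (∑-⊕ x _ _) (cong₂ _⊕_ (∑-⊕ x _ _)
          (trans (∑-⊗ˡ x (ι 3) _) (cong (ι 3 ⊗_) (∑-⊗ˡ x (ι x) _))))) (∑-⊗ˡ x (ι 6) Λ))))))
      where
      term : ∀ n → 1 ≤ n → n ≤ x → ∥ L x ⊗ (χ n ⊗ Λ n ⊗ R (x ÷ n)) ∥ ≼
          ((Λ n ⊗ L n ⊗ g n ⊕ Λ n ⊗ RΛ (x ÷ n)) ⊕ ι 3 ⊗ (ι x ⊗ (Λ n ⊗ inv n))) ⊕ ι 6 ⊗ Λ n
      term n p q = ≼-trans (≼-reflexive (cong ∥_∥ (lin 4 (λ l c a r → ⊢ l :* (c :* a :* r) :≡ c :*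
          (a :* (l :* r))) (L x) (χ n) (Λ n) (R y))))
        (≼-trans (∥∥-contract _ (χ-bound n)) (≼-trans (≼-reflexive
            (trans (∥∥-⊗ _ _) (cong (_⊗ ∥ L x ⊗ R y ∥) (∥∥-nonneg (Λ-nonneg n)))))
          (≼-trans (⊗-monoˡ (Λ-nonneg n) inner) (≼-reflexive (lin 6
              (λ a l g w x i → ⊢ a :* (((l :* g :+ w) :+ con 3 :* (x :* i)) :+ con 6) :≡
              ((a :* l :* g :+ a :* w) :+ con 3 :* (x :* (a :* i))) :+ con 6 :* a)
            (Λ n) (L n) (g n) (RΛ y) (ι x) (inv n))))))
        where
        y = x ÷ n
        1≤y = ÷-≥1 n p q
        y≤x = ÷-≤ x n p
        y≤X = ℕₚ.≤-trans y≤x x≤X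
        δ = L x ⊖ L n ⊖ L y
        0≼δ : ι 0 ≼ δ
        0≼δ = lin 3 (λ a b c → c :≤ a :- b ⇒ ⊢ con 0 :≤ a :- b :- c) (L x) (L n) (L y) (L-floor x n p q x≤X)
        δy≼1 : δ ⊗ ι y ≼ ι 1
        δy≼1 = ⊗-cancel-≼ n p (lin 6 (λ x lx ln ly n y → (lx :- (ly :+ ln)) :* (y :* n) :≤ x :- y :* n ⇒ x :≤
            (y :+ con 1) :* n ⇒ ⊢ n :* ((lx :- ln :- ly) :* y) :≤ n :* con 1)
          (ι x) (L x) (L n) (L y) (ι n) (ι y)
          (subst₂ (λ u v → (L x ⊖ u) ⊗ v ≼ ι x ⊖ v) (L-* y n 1≤y p) (ι-* y n)
              (L-diff-≼ (y * n) x (ℕₚ.*-mono-≤ 1≤y p) (÷-from n ℕₚ.≤-refl) x≤X))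
          (subst (ι x ≼_) (trans (ι-* (y + 1) n) (cong (_⊗ ι n) (ι-+ y 1))) (ι-mono (ℕₚ.<⇒≤ (÷-< x n p)))))
        U-bound : ∥ U y ∥ ≼ RΛ y
        U-bound = ≼-trans (∥∑∥ y _) (∑-mono y (λ m _ _ → ≼-trans (≼-reflexive (∥∥-⊗ _ _))
            (⊗-monoʳ (0≼∥∥ _) (χΛ-bound m))))
        δR-bound : ∥ δ ⊗ R y ∥ ≼ ι 6
        δR-bound = ≼-trans (≼-reflexive (trans (∥∥-⊗ _ _) (cong (_⊗ ∥ R y ∥) (∥∥-nonneg 0≼δ))))
          (lin 3 (λ d r y → con 0 :≤ d :* (con 6 :* y :- r) ⇒ d :* y :≤ con 1 ⇒ ⊢ d :* r :≤ con 6) δ ∥ R y ∥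
              (ι y) (⊗-nonneg 0≼δ (0≼-gap (≼-trans (R-bound y) (ψ-upper y y≤X)))) δy≼1)
        inner : ∥ L x ⊗ R y ∥ ≼ ((L n ⊗ g n ⊕ RΛ y) ⊕ ι 3 ⊗ (ι x ⊗ inv n)) ⊕ ι 6
        inner = ≼-trans (≼-reflexive (cong ∥_∥ (lin 5 (λ lx ln ly r u → ⊢ lx :* r :≡
            ((ln :* r :+ (ly :* r :+ u)) :- u) :+ (lx :- ln :- ly) :* r) (L x) (L n) (L y) (R y) (U y))))
          (≼-trans (∥∥-triangle _ _) (⊕-mono (≼-trans (∥∥-⊖ _ _) (≼-trans (⊕-mono (∥∥-triangle _ _) U-bound)
              (lin 6 (λ a b w c y z → a :≡ c ⇒ b :≤ con 3 :* y ⇒ y :≤ z ⇒ ⊢ (a :+ b) :+ w :≤ (c :+ w) :+ con 3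
                  :* z) _ _ (RΛ y) (L n ⊗ g n) (ι y) (ι x ⊗ inv n)
                (trans (∥∥-⊗ _ _) (cong (_⊗ ∥ R y ∥) (∥∥-nonneg (L-nonneg n p (ℕₚ.≤-trans q x≤X)))))
                    (selberg-twisted y 1≤y y≤X) (ι-÷-≼ x n p)))) δR-bound))

    iterated : L x ⊗ (L x ⊗ ∥ R x ∥) ≼ ι 2 ⊗ ∑ x (λ n → L n ⊗ ∥ R (x ÷ n) ∥) ⊕ ι 60 ⊗ (ι x ⊗ (L x ⊕ ι 1))
    iterated = lin 9 (λ r lu gs s t xm f x l → r :≤ l :* (con 3 :* x) :+ lu ⇒ lu :≤ gs :+ con 3 :* xm :+ con 6
        :* f ⇒ gs :≤ con 2 :* s :+ con 33 :* t ⇒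
        xm :≤ x :* (l :+ con 6) ⇒ f :≤ con 6 :* x ⇒ t :≤ x :* l :- x :+ con 1 :+ l ⇒ l :≤ x :- con 1 ⇒ con 0 :≤
            x :* l ⇒ con 0 :≤ x ⇒ ⊢ r :≤ con 2 :* s :+ con 60 :* (x :* (l :+ con 1)))
      (L x ⊗ (L x ⊗ ∥ R x ∥)) ∥ L x ⊗ U x ∥ G (∑ x (λ n → L n ⊗ ∥ R (x ÷ n) ∥)) (T x) (ι x ⊗ M x) (ψ x) (ι x)
          (L x)
      first LU-bound G-bound (mertens-upper x 1≤x x≤X) (ψ-upper x x≤X) (T-upper x 1≤x x≤X) (L-≼ x 1≤x x≤X)
          (⊗-nonneg (0≼ι x) 0≼L) (0≼ι x)
      where
      0≼L = L-nonneg x 1≤x x≤X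
      abs-L : ∀ z → ∥ L x ⊗ z ∥ ≡ L x ⊗ ∥ z ∥
      abs-L z = trans (∥∥-⊗ _ _) (cong (_⊗ ∥ z ∥) (∥∥-nonneg 0≼L))
      first : L x ⊗ (L x ⊗ ∥ R x ∥) ≼ L x ⊗ (ι 3 ⊗ ι x) ⊕ ∥ L x ⊗ U x ∥
      first = ≼-trans (≼-reflexive (trans (sym (trans (abs-L (L x ⊗ R x)) (cong (L x ⊗_) (abs-L (R x)))))
          (cong ∥_∥ (lin 3 (λ l r u → ⊢ l :* (l :* r) :≡ l :* (l :* r :+ u) :- l :* u) (L x) (R x) (U x)))))
        (≼-trans (∥∥-⊖ _ _) (⊕-mono (≼-trans (≼-reflexive (abs-L _)) (⊗-monoˡ 0≼L (selberg-twisted x 1≤x x≤X)))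
            ≼-refl))

-- Windows in which R is small

cancel-≼ : ∀ {l a b} → ι 1 ≼ l → l ⊗ a ≼ l ⊗ b → a ≼ b
cancel-≼ {l} {a} {b} p h with ≼-total a b
... | inj₁ q = q
... | inj₂ q = lin 3 (λ a b l → con 0 :≤ (a :- b) :* (l :- con 1) ⇒ l :* a :≤ l :* b ⇒ ⊢ a :≤ b) a b l
    (⊗-nonneg (0≼-gap q) (0≼-gap p)) h

search : ∀ {A : ℕ → Set} → (∀ n → Dec (A n)) → ∀ y m → (∃ λ k → k ≤ m × A (y + k)) ⊎ (∀ k → k ≤ m → ¬ A (y + k))
search d y zero with d (y + 0)
... | yes a = inj₁ (0 , z≤n , a)
... | no ¬a = inj₂ (λ { zero z≤n → ¬a })
search d y (suc m) with search d y m
... | inj₁ (k , p , a) = inj₁ (k , ℕₚ.m≤n⇒m≤1+n p , a)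
... | inj₂ none with d (y + suc m)
...   | yes a = inj₁ (suc m , ℕₚ.≤-refl , a)
...   | no ¬a = inj₂ (λ k p → extend k (ℕₚ.m≤n⇒m<n∨m≡n p))
  where
  extend : ∀ k → k < suc m ⊎ k ≡ suc m → _
  extend k (inj₁ (s≤s p)) = none k p
  extend k (inj₂ refl)    = ¬a

module Windows {X : ℕ} {L : ℕ → Q} (isLog : IsLog X L) (1≤X : 1 ≤ X) (3≤X : 3 ≤ X) where
  open IteratedFormula isLog 1≤X 3≤X public

  half≼L2 : ι 1 ≼ ι 2 ⊗ L 2
  half≼L2 = lin 2 (λ a b → con 1 :≤ (a :- b) :* con 2 ⇒ b :≡ con 0 ⇒ ⊢ con 1 :≤ con 2 :* a) (L 2) (L 1)
      (L-lower 1 ℕₚ.≤-refl (ℕₚ.≤-trans (s≤s (s≤s z≤n)) 3≤X)) L-1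

  L-2^ : ∀ n → ι n ≼ ι 2 ⊗ L (2 ^ n)
  L-2^ zero    = lin 1 (λ a → a :≡ con 0 ⇒ ⊢ con 0 :≤ con 2 :* a) (L 1) L-1
  L-2^ (suc n) = ι-suc n ≡≼ lin 4 (λ a b c n → c :≡ a :+ b ⇒ con 1 :≤ con 2 :* a ⇒ n :≤ con 2 :* b ⇒ ⊢ n :+ con
      1 :≤ con 2 :* c) (L 2) (L (2 ^ n)) (L (2 * 2 ^ n)) (ι n)
    (L-* 2 (2 ^ n) (s≤s z≤n) (^≥1 n (s≤s z≤n))) half≼L2 (L-2^ n)

  -- Thresholds take the form `2 ^ (2 * T)` because `log 2` is bounded below by `1/2`.
  L-large : ∀ T x → 2 ^ (2 * T) ≤ x → x ≤ X → ι T ≼ L x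
  L-large T x p le = lin 4 (λ t t₂ a b → t₂ :≡ con 2 :* t ⇒ t₂ :≤ con 2 :* a ⇒ a :≤ b ⇒ ⊢ t :≤ b) (ι T)
      (ι (2 * T)) (L (2 ^ (2 * T))) (L x)
    (ι-* 2 T) (L-2^ (2 * T)) (L-mono (2 ^ (2 * T)) x (^≥1 (2 * T) (s≤s z≤n)) p le)

  -- The tangent of the logarithm at `N` has slope `1/N`.
  L-small : ∀ N n → 1 ≤ N → N ≤ n → n ≤ X → ι N ⊗ L n ≼ ι n ⊕ ι N ⊗ ι N
  L-small N n p h le = lin 4 (λ w n lw ln → (ln :- lw) :* w :≤ n :- w ⇒ con 0 :≤ w :* (w :- con 1 :- lw) ⇒ con 0
      :≤ w ⇒ ⊢ w :* ln :≤ n :+ w :* w) (ι N) (ι n) (L N) (L n)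
    (L-diff-≼ N n p h le) (⊗-nonneg (0≼ι N) (0≼-gap (L-≼ N p (ℕₚ.≤-trans h le)))) (0≼ι N)

  -- By partial summation this is the sum of `R(n) / (n (n + 1))` over `n ≤ x`. It is bounded by
  -- `mertens-twisted`, yet would grow like a logarithm if `R` kept one sign and size `n/N`.
  Φ : ℕ → Q
  Φ x = Mχ x ⊖ R x ⊗ inv (suc x)

  Φ-suc : ∀ x → Φ (suc x) ≡ Φ x ⊕ R (suc x) ⊗ (inv (suc x) ⊖ inv (suc (suc x)))
  Φ-suc x = lin 6 (λ m r c a i j → ⊢ (m :+ c :* a :* i) :- (r :+ c :* a) :* j :≡ (m :- r :* i) :+ (r :+ c :* a)
      :* (i :- j))
    (Mχ x) (R x) (χ (suc x)) (Λ (suc x)) (inv (suc x)) (inv (suc (suc x)))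

  Φ-bound : ∀ x → 1 ≤ x → x ≤ X → ∥ Φ x ∥ ≼ ι 27
  Φ-bound x p le = ≼-trans (∥∥-⊖ _ _) (lin 2 (λ a b → a :≤ con 21 ⇒ b :≤ con 6 ⇒ ⊢ a :+ b :≤ con 27) _ _
      (mertens-twisted x p le)
    (≼-trans (≼-reflexive (trans (∥∥-⊗ _ _) (cong (∥ R x ∥ ⊗_) (∥∥-nonneg 0≼i))))
      (lin 4 (λ r i x x′ → con 0 :≤ i :* (con 6 :* x :- r) ⇒ i :* x′ :≡ con 1 ⇒ x′ :≡ x :+ con 1 ⇒ con 0 :≤ i ⇒
          i :* x′ :≡ i :* (x :+ con 1) ⇒ ⊢ r :* i :≤ con 6) (∥ R x ∥) (inv (suc x)) (ι x) (ι (suc x))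
        (⊗-nonneg 0≼i (0≼-gap (≼-trans (R-bound x) (ψ-upper x le)))) (inv-ι′ (suc x) (s≤s z≤n)) (ι-suc x) 0≼i
            (cong (inv (suc x) ⊗_) (ι-suc x)))))
    where
    0≼i = inv-nonneg (suc x) (s≤s z≤n)

  -- In the following lemmas s is a sign, 1 or -1.

  growth : ∀ N s y m → 1 ≤ y → y + m + 2 ≤ X → (∀ k → k ≤ m → ι (y + k) ≼ ι N ⊗ (s ⊗ R (y + k))) →
    ι N ⊗ (s ⊗ Φ y) ⊖ L (y + 2) ≼ ι N ⊗ (s ⊗ Φ (y + m)) ⊖ L (y + m + 2)
  growth N s y zero    p le h rewrite ℕₚ.+-identityʳ y = ≼-refl
  growth N s y (suc m) p le h = ≼-trans (growth N s y m p (ℕₚ.≤-trans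
      (ℕₚ.+-monoˡ-≤ 2 (ℕₚ.+-monoʳ-≤ y (ℕₚ.n≤1+n m))) le) (λ k q → h k (ℕₚ.m≤n⇒m≤1+n q)))
    (step (y + m) (y + suc m) (ℕₚ.+-suc y m) (ℕₚ.≤-trans p (ℕₚ.m≤m+n y m)) le (h (suc m) ℕₚ.≤-refl))
    where
    -- For `n = x + 1`, the quantity `N s Φ` grows by at least `1/(n + 1)`, which dominates
    -- `L (n + 2) - L (n + 1)`; hence the shift by 2.
    step : ∀ x x′ → x′ ≡ suc x → 1 ≤ x → x′ + 2 ≤ X → ι x′ ≼ ι N ⊗ (s ⊗ R x′) → ι N ⊗ (s ⊗ Φ x) ⊖ L (x + 2) ≼ ι
        N ⊗ (s ⊗ Φ x′) ⊖ L (x′ + 2)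
    step x .(suc x) refl q r hyp = lin 10 (λ n s f f′ rr i j l l′ k → f′ :≡ f :+ rr :* (i :- j) ⇒ n :* (s :* f′)
        :≡ n :* (s :* (f :+ rr :* (i :- j))) ⇒ con 0 :≤ (i :- j) :* (n :* (s :* rr) :- k) ⇒
        i :* k :≡ con 1 ⇒ j :* (k :+ con 1) :≡ con 1 ⇒ l′ :- l :≤ j ⇒ ⊢ n :* (s :* f) :- l :≤ n :* (s :* f′) :-
            l′)
      (ι N) s (Φ x) (Φ (suc x)) (R (suc x)) (inv (suc x)) (inv (suc (suc x))) (L (x + 2)) (L (suc x + 2))
          (ι (suc x))
      (Φ-suc x) (cong (λ z → ι N ⊗ (s ⊗ z)) (Φ-suc x)) (⊗-nonneg (0≼-gap (inv-decreasing (suc x) (s≤s z≤n)))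
          (0≼-gap hyp))
      (inv-ι′ (suc x) (s≤s z≤n)) (subst (λ z → inv (suc (suc x)) ⊗ z ≡ ι 1) (ι-suc (suc x))
          (inv-ι′ (suc (suc x)) (s≤s z≤n)))
      (subst (λ z → L (suc z) ⊖ L z ≼ inv (suc (suc x))) (ℕₚ.+-comm 2 x)
          (subst (L (suc (suc (suc x))) ⊖ L (suc (suc x)) ≼_) (⊗-identityˡ _)
          (≼-inv (suc (suc x)) (s≤s z≤n) (L-upper (suc (suc x)) (s≤s z≤n)
          (subst (_≤ X) (cong suc (ℕₚ.+-comm x 2)) r)))))

  R-suc : ∀ k → suc k ≤ X → ∥ R (suc k) ⊖ R k ∥ ≼ L (suc k)
  R-suc k le = ≼-trans (R-diff (ℕₚ.n≤1+n k)) (lin 3 (λ a b l → b :≤ l ⇒ ⊢ (a :+ b) :- a :≤ l) (ψ k) (Λ (suc k))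
      (L (suc k)) (Λ≼L (suc k) (s≤s z≤n) le))

  -- R jumps by at most log k, so it cannot change its sign without being small.

  sign-step : ∀ N s k → 1 ≤ N → N * N + N + 1 ≤ k → suc k ≤ X → (∀ a → ∥ s ⊗ a ∥ ≡ ∥ a ∥) →
    ι k ≼ ι N ⊗ (s ⊗ R k) → ι (suc k) ≼ ι N ⊗ ∥ R (suc k) ∥ → ι (suc k) ≼ ι N ⊗ (s ⊗ R (suc k))
  sign-step N s k p big le abs-s h h′ with ≼-total (ι 0) (s ⊗ R (suc k))
  ... | inj₁ q = subst (λ z → ι (suc k) ≼ ι N ⊗ z) (trans (sym (abs-s _)) (∥∥-nonneg q)) h′
  -- A change of sign would be a jump of `N s R` by at least `2k + 1`, against the bound
  -- `N log (k + 1) ≤ k + 1 + N²`.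
  ... | inj₂ q = contradiction (lin 6 (λ k k′ n r r′ l → k :≤ n :* r ⇒ k′ :≤ n :* (:- r′) ⇒ k′ :≡ k :+ con 1 ⇒
      con 0 :≤ n :* (l :- (r :- r′)) ⇒ n :* l :≤ k′ :+ n :* n ⇒ n :* n :+ n :+ con 1 :≤ k ⇒ con 0 :≤ n ⇒ ⊢ con 1
      :≤ con 0)
      (ι k) (ι (suc k)) (ι N) (s ⊗ R k) (s ⊗ R (suc k)) (L (suc k)) h
      (subst (λ z → ι (suc k) ≼ ι N ⊗ z) (trans (sym (abs-s _))
          (trans (sym (∥∥-neg _)) (∥∥-nonneg (lin 1 (λ a → a :≤ con 0 ⇒ ⊢ con 0 :≤ :- a) _ q)))) h′)
      (ι-suc k) (⊗-nonneg (0≼ι N) (0≼-gap diff)) (L-small N (suc k) p N≤ le)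
      (subst (_≼ ι k) (trans (ι-+ (N * N + N) 1) (cong (_⊕ ι 1)
          (trans (ι-+ (N * N) N) (cong (_⊕ ι N) (ι-* N N))))) (ι-mono big)) (0≼ι N)) 1⋠0
    where
    N≤ : N ≤ suc k
    N≤ = ℕₚ.≤-trans (ℕₚ.≤-trans (ℕₚ.m≤n+m N (N * N)) (ℕₚ.m≤m+n _ 1)) (ℕₚ.≤-trans big (ℕₚ.n≤1+n k))
    diff : s ⊗ R k ⊖ s ⊗ R (suc k) ≼ L (suc k)
    diff = ≼-trans (≼-∥∥ _) (≼-trans (≼-reflexive (trans (sym (∥∥-neg _))
        (trans (cong ∥_∥ (lin 3 (λ s a b → ⊢ :- (s :* a :- s :* b) :≡ s :* (b :- a)) s (R k) (R (suc k))))
        (abs-s _)))) (R-suc k le))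

  sign-constant : ∀ N s y m → 1 ≤ N → N * N + N + 1 ≤ y → y + m ≤ X → (∀ a → ∥ s ⊗ a ∥ ≡ ∥ a ∥) → ι y ≼ ι N ⊗
      (s ⊗ R y) →
    (∀ k → k ≤ m → ι (y + k) ≼ ι N ⊗ ∥ R (y + k) ∥) → ∀ k → k ≤ m → ι (y + k) ≼ ι N ⊗ (s ⊗ R (y + k))
  sign-constant N s y m p big le abs-s h₀ h zero    q rewrite ℕₚ.+-identityʳ y = h₀
  sign-constant N s y m p big le abs-s h₀ h (suc k) q = subst (λ z → ι z ≼ ι N ⊗ (s ⊗ R z)) (sym (ℕₚ.+-suc y k))
    (sign-step N s (y + k) p (ℕₚ.≤-trans big (ℕₚ.m≤m+n y k)) (ℕₚ.≤-trans (ℕₚ.≤-reflexive (sym (ℕₚ.+-suc y k)))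
        (ℕₚ.≤-trans (ℕₚ.+-monoʳ-≤ y q) le)) abs-s
      (sign-constant N s y m p big le abs-s h₀ h k (ℕₚ.≤-trans (ℕₚ.n≤1+n k) q))
          (subst (λ z → ι z ≼ ι N ⊗ ∥ R z ∥) (ℕₚ.+-suc y k) (h (suc k) q)))

  -- The twisted Mertens bound forces a small value of R in a window of bounded ratio.

  too-long : ∀ N s y m → 1 ≤ N → 1 ≤ y → y + m + 2 ≡ 2 ^ (108 * N + 2) * (4 * y) → y + m + 2 ≤ X →
      (∀ a → ∥ s ⊗ a ∥ ≡ ∥ a ∥) →
    (∀ k → k ≤ m → ι (y + k) ≼ ι N ⊗ (s ⊗ R (y + k))) → ι 1 ≼ ι 0
  too-long N s y m 1≤N p e le abs-s h = lin 8 (λ n f f′ l l′ j l₂ l₄ → n :* f :- l :≤ n :* f′ :- l′ ⇒ con 0 :≤ n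
      :* (f :+ con 27) ⇒ con 0 :≤ n :* (con 27 :- f′) ⇒ l′ :≡ l₂ :+ l₄ ⇒ l :≤ l₄ ⇒ j :≤ con 2 :* l₂ ⇒ j :≡ con
      108 :* n :+ con 2 ⇒
      ⊢ con 1 :≤ con 0)
    (ι N) (s ⊗ Φ y) (s ⊗ Φ (y + m)) (L (y + 2)) (L (y + m + 2)) (ι j₀) (L (2 ^ j₀)) (L (4 * y))
    (growth N s y m p le h)
    (⊗-nonneg (0≼ι N) (lin 2 (λ a b → :- a :≤ b ⇒ b :≤ con 27 ⇒ ⊢ con 0 :≤ a :+ con 27) _ _ (⊝-∥∥ (s ⊗ Φ y))
        (subst (_≼ ι 27) (sym (abs-s _)) (Φ-bound y p (ℕₚ.≤-trans (ℕₚ.≤-trans (ℕₚ.m≤m+n y m) (ℕₚ.m≤m+n _ 2))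
        le)))))
    (⊗-nonneg (0≼ι N) (0≼-gap (≼-trans (≼-∥∥ _) (subst (_≼ ι 27) (sym (abs-s _))
        (Φ-bound (y + m) (ℕₚ.≤-trans p (ℕₚ.m≤m+n y m)) (ℕₚ.≤-trans (ℕₚ.m≤m+n _ 2) le))))))
    (trans (cong L e) (L-* (2 ^ j₀) (4 * y) (^≥1 j₀ (s≤s z≤n)) (ℕₚ.≤-trans p (ℕₚ.m≤m+n y _))))
    (L-mono (y + 2) (4 * y) (ℕₚ.≤-trans p (ℕₚ.m≤m+n y 2)) y+2≤4y
        (ℕₚ.≤-trans (ℕₚ.≤-trans (ℕₚ.m≤n*m (4 * y) (2 ^ j₀) {{>-nonZero (^≥1 j₀ (s≤s z≤n))}})
        (ℕₚ.≤-reflexive (sym e))) le))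
    (L-2^ j₀) (trans (ι-+ (108 * N) 2) (cong (_⊕ ι 2) (ι-* 108 N)))
    where
    -- `N s Φ` varies by at most `2 * 27 * N`, while `L` grows by at least `j₀ / 2 = 54 N + 1` from
    -- `4 * y` to `2 ^ j₀ * (4 * y)`.
    j₀ = 108 * N + 2
    y+2≤4y : y + 2 ≤ 4 * y
    y+2≤4y = ℕₚ.+-monoʳ-≤ y (ℕₚ.≤-trans (ℕₚ.*-monoʳ-≤ 2 p) (ℕₚ.*-monoˡ-≤ y (s≤s (s≤s (z≤n {1})))))

  small-value : ∀ N y m → 1 ≤ N → N * N + N + 1 ≤ y → y + m + 2 ≡ 2 ^ (108 * N + 2) * (4 * y) → y + m + 2 ≤ X →
    ∃ λ k → k ≤ m × ι N ⊗ ∥ R (y + k) ∥ ≼ ι (y + k)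
  small-value N y m p big e le with search (λ z → (ι N ⊗ ∥ R z ∥) ≼? ι z) y m
  ... | inj₁ r = r
  ... | inj₂ none = contradiction absurd 1⋠0
    where
    1≤y = ℕₚ.≤-trans (ℕₚ.m≤n+m 1 (N * N + N)) big
    y+m≤X = ℕₚ.≤-trans (ℕₚ.m≤m+n (y + m) 2) le
    large : ∀ k → k ≤ m → ι (y + k) ≼ ι N ⊗ ∥ R (y + k) ∥
    large k q with ≼-total (ι (y + k)) (ι N ⊗ ∥ R (y + k) ∥)
    ... | inj₁ r = r
    ... | inj₂ r = contradiction r (none k q)
    large-y : ι y ≼ ι N ⊗ ∥ R y ∥
    large-y = subst (λ z → ι z ≼ ι N ⊗ ∥ R z ∥) (ℕₚ.+-identityʳ y) (large 0 z≤n)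
    abs₊ : ∀ a → ∥ ι 1 ⊗ a ∥ ≡ ∥ a ∥
    abs₊ a = cong ∥_∥ (⊗-identityˡ a)
    abs₋ : ∀ a → ∥ ⊝ ι 1 ⊗ a ∥ ≡ ∥ a ∥
    abs₋ a = trans (cong ∥_∥ (lin 1 (λ a → ⊢ :- con 1 :* a :≡ :- a) a)) (∥∥-neg a)
    absurd : ι 1 ≼ ι 0
    absurd with ≼-total (ι 0) (R y)
    ... | inj₁ q = too-long N (ι 1) y m p 1≤y e le abs₊ (sign-constant N (ι 1) y m p big y+m≤X abs₊
                     (subst (λ z → ι y ≼ ι N ⊗ z) (trans (∥∥-nonneg q) (sym (⊗-identityˡ _))) large-y) large)
    ... | inj₂ q = too-long N (⊝ ι 1) y m p 1≤y e le abs₋ (sign-constant N (⊝ ι 1) y m p big y+m≤X abs₋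
                     (subst (λ z → ι y ≼ ι N ⊗ z) (trans (sym (∥∥-neg _))
                         (trans (∥∥-nonneg (lin 1 (λ a → a :≤ con 0 ⇒ ⊢ con 0 :≤ :- a) _ q))
                         (lin 1 (λ a → ⊢ :- a :≡ :- con 1 :* a) (R y)))) large-y) large)

  -- By Brun–Titchmarsh, R stays small on [z, z + z/4N].

  small-interval : ∀ N z t → 1 ≤ N → 1 ≤ z → 2 ^ (2 * (216 * N)) ≤ z → z ≤ t → t ≤ z + z ÷ (4 * N) → t ≤ X →
    ι N ⊗ ∥ R z ∥ ≼ ι z → ι N ⊗ ∥ R t ∥ ≼ ι 2 ⊗ ι t
  small-interval N z t p q big h h₂ le small = lin 6 (λ n r r₀ f z t → con 0 :≤ n :* (r₀ :+ f :- r) ⇒ n :* r₀ :≤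
      z ⇒ n :* f :≤ z ⇒ z :≤ t ⇒ ⊢ n :* r :≤ con 2 :* t)
      (ι N) (∥ R t ∥) (∥ R z ∥) (ψ t ⊖ ψ z) (ι z) (ι t) (⊗-nonneg (0≼ι N) (0≼-gap close)) small
          (cancel-≼ 1≼L short) (ι-mono h)
    where
    1≤4N : 1 ≤ 4 * N
    1≤4N = ℕₚ.*-mono-≤ (s≤s (z≤n {3})) p
    t≤2z : t ≤ 2 * z
    t≤2z = ℕₚ.≤-trans h₂ (ℕₚ.+-monoʳ-≤ z (ℕₚ.≤-trans (÷-≤ z (4 * N) 1≤4N) (ℕₚ.m≤m+n z 0)))
    close : ∥ R t ∥ ≼ ∥ R z ∥ ⊕ (ψ t ⊖ ψ z)
    close = ≼-trans (≼-reflexive (cong ∥_∥ (lin 2 (λ a b → ⊢ a :≡ b :+ (a :- b)) (R t) (R z))))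
        (≼-trans (∥∥-triangle _ _) (⊕-mono ≼-refl (R-diff h)))
    -- Brun-Titchmarsh bounds `N (ψ t - ψ z) L z` by `2 N (t - z) L z + 54 N t`. The first term is
    -- at most `z L z / 2` since `t - z ≤ z / 4N`; so is the second, as `t ≤ 2 z`, once
    -- `L z ≥ 216 N`.
    216N≼L : ι 216 ⊗ ι N ≼ L z
    216N≼L = subst (_≼ L z) (ι-* 216 N) (L-large (216 * N) z big (ℕₚ.≤-trans h le))
    1≼L : ι 1 ≼ L z
    1≼L = lin 2 (λ n l → con 216 :* n :≤ l ⇒ con 1 :≤ n ⇒ ⊢ con 1 :≤ l) (ι N) (L z) 216N≼L (1≼ι p)
    gap-t : (ι t ⊖ ι z) ⊗ (ι 4 ⊗ ι N) ≼ ι z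
    gap-t = lin 4 (λ t z d n → t :≤ z :+ d ⇒ d :* (con 4 :* n) :≤ z ⇒ con 0 :≤ n :* (z :+ d :- t) ⇒ ⊢ (t :- z)
        :* (con 4 :* n) :≤ z) (ι t) (ι z) (ι (z ÷ (4 * N))) (ι N)
      t≼ (subst (_≼ ι z) (trans (ι-* (z ÷ (4 * N)) (4 * N)) (cong (ι (z ÷ (4 * N)) ⊗_) (ι-* 4 N)))
          (ι-mono (÷-from (4 * N) ℕₚ.≤-refl))) (⊗-nonneg (0≼ι N) (0≼-gap t≼))
      where
      t≼ : ι t ≼ ι z ⊕ ι (z ÷ (4 * N))
      t≼ = subst (ι t ≼_) (ι-+ z _) (ι-mono h₂)
    short : L z ⊗ (ι N ⊗ (ψ t ⊖ ψ z)) ≼ L z ⊗ ι z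
    short = lin 5 (λ l n f t z → con 0 :≤ n :* (con 2 :* (t :- z) :* l :+ con 54 :* t :- f :* l) ⇒ con 0 :≤ l :*
        (z :- (t :- z) :* (con 4 :* n)) ⇒ con 0 :≤ (l :- con 216 :* n) :* z ⇒ con 0 :≤ n :* (con 2 :* z :- t) ⇒
        ⊢ l :* (n :* f) :≤ l :* z) (L z) (ι N) (ψ t ⊖ ψ z) (ι t) (ι z)
      (⊗-nonneg (0≼ι N) (0≼-gap (brun-titchmarsh z t q h t≤2z le))) (⊗-nonneg (≼-trans 0≼1 1≼L) (0≼-gap gap-t))
          (⊗-nonneg (0≼-gap 216N≼L) (0≼ι z))
      (⊗-nonneg (0≼ι N) (0≼-gap (subst (ι t ≼_) (ι-* 2 z) (ι-mono t≤2z))))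

-- The saving in one window

∑-range-lower : ∀ {w : ℕ → Q} c a k → (∀ n → a < n → n ≤ a + k → c ≼ w n) → ∑ a w ⊕ ι k ⊗ c ≼ ∑ (a + k) w
∑-range-lower {w} c a k h = subst (∑ a w ⊕ ι k ⊗ c ≼_) (sym (∑-split a k w)) (⊕-mono ≼-refl
  (subst (_≼ ∑ k (λ i → w (a + i))) (∑-const k c) (∑-mono k (λ i p q → h (a + i)
      (subst (_≤ a + i) (ℕₚ.+-comm a 1) (ℕₚ.+-monoʳ-≤ a p)) (ℕₚ.+-monoʳ-≤ a q)))))

last-true : ∀ {A : ℕ → Set} → (∀ n → Dec (A n)) → A 0 → ∀ m → ¬ A m → ∃ λ i → A i × ¬ A (suc i)
last-true d a zero    ¬a = contradiction a ¬a
last-true d a (suc m) ¬a with d m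
... | yes b = m , b , ¬a
... | no ¬b = last-true d a m ¬b

^4-mono : ∀ {a b} → a ≤ b → a ^ 4 ≤ b ^ 4
^4-mono h = ℕₚ.^-monoˡ-≤ 4 h

module Contract {X : ℕ} {L : ℕ → Q} (isLog : IsLog X L) (1≤X : 1 ≤ X) (3≤X : 3 ≤ X) where
  open Windows isLog 1≤X 3≤X public

  L-^ : ∀ a n → 1 ≤ a → L (a ^ n) ≡ ι n ⊗ L a
  L-^ a zero    p = trans L-1 (sym (⊗-zeroˡ _))
  L-^ a (suc n) p = trans (L-* a (a ^ n) p (^≥1 n p)) (trans (cong (L a ⊕_) (L-^ a n p))
      (trans (lin 2 (λ l n → ⊢ l :+ n :* l :≡ (n :+ con 1) :* l) (L a) (ι n)) (cong (_⊗ L a) (sym (ι-suc n)))))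

  2∑Linv-step : ∀ y → 1 ≤ y → suc y ≤ X → ι 2 ⊗ ∑ y (λ n → L n ⊗ inv n) ≼ L y ⊗ L y ⊕ L y → ι 2 ⊗ ∑ (suc y)
      (λ n → L n ⊗ inv n) ≼ L (suc y) ⊗ L (suc y) ⊕ L (suc y)
  2∑Linv-step y p le ih = lin 4 (λ s l l′ i → con 2 :* s :≤ l :* l :+ l ⇒ con 0 :≤ (l′ :- l :- i) :* l′ ⇒ con 0
      :≤ (l′ :- l :- i) :* l ⇒ con 0 :≤ (l′ :- l) :* (con 1 :- i) ⇒ ⊢ con 2 :* (s :+ l′ :* i) :≤ l′ :* l′ :+ l′)
      (∑ y (λ n → L n ⊗ inv n)) (L y) (L (suc y)) i ih
      (⊗-nonneg 0≼Δ-i (L-nonneg (suc y) (s≤s z≤n) le)) (⊗-nonneg 0≼Δ-i (L-nonneg y p (ℕₚ.<⇒≤ le)))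
      (⊗-nonneg (0≼-gap (L-suc-≼ y p le)) (0≼-gap (inv-≼1 (suc y) (s≤s z≤n))))
    where
    i = inv (suc y)
    0≼Δ-i : ι 0 ≼ L (suc y) ⊖ L y ⊖ i
    0≼Δ-i = 0≼-gap (subst (_≼ L (suc y) ⊖ L y) (⊗-identityˡ _) (inv-≼ (suc y) (s≤s z≤n) (L-lower y p le)))

  2∑Linv : ∀ x → 1 ≤ x → x ≤ X → ι 2 ⊗ ∑ x (λ n → L n ⊗ inv n) ≼ L x ⊗ L x ⊕ L x
  2∑Linv (suc zero)    p le = lin 2 (λ l i → l :≡ con 0 ⇒ l :* i :≡ con 0 :* i ⇒ l :* l :≡ con 0 :* l ⇒ ⊢ con 2
      :* (con 0 :+ l :* i) :≤ l :* l :+ l) (L 1) (inv 1) L-1 (cong (_⊗ inv 1) L-1) (cong (_⊗ L 1) L-1)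
  2∑Linv (suc (suc n)) p le = 2∑Linv-step (suc n) (s≤s z≤n) le (2∑Linv (suc n) (s≤s z≤n) (ℕₚ.<⇒≤ le))

  L-floor-lower : ∀ x n → 1 ≤ n → n ≤ x → x ≤ X → L x ≼ L n ⊕ L (x ÷ n) ⊕ ι 1
  L-floor-lower x n p q le = lin 3 (λ lx ln lt → lx :- (lt :+ ln) :≤ con 1 ⇒ ⊢ lx :≤ ln :+ lt :+ con 1) (L x)
      (L n) (L t) (⊗-cancel-≼ n p
      (lin 4 (λ d x t n → d :* (t :* n) :≤ x :- t :* n ⇒ x :≤ (t :+ con 1) :* n ⇒ con 0 :≤ d :*
          ((t :- con 1) :* n) ⇒ ⊢ n :* d :≤ n :* con 1) (L x ⊖ (L t ⊕ L n)) (ι x) (ι t) (ι n) diff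
        (subst (ι x ≼_) (trans (ι-* (t + 1) n) (cong (_⊗ ι n) (ι-+ t 1))) (ι-mono (ℕₚ.<⇒≤ (÷-< x n p))))
        (⊗-nonneg (0≼-gap (subst (_≼ L x) (L-* t n 1≤t p) (L-mono (t * n) x (ℕₚ.*-mono-≤ 1≤t p)
            (÷-from n ℕₚ.≤-refl) le))) (⊗-nonneg (0≼-gap (1≼ι 1≤t)) (0≼ι n)))))
    where
    t = x ÷ n
    1≤t = ÷-≥1 n p q
    diff = subst₂ (λ u v → (L x ⊖ u) ⊗ v ≼ ι x ⊖ v) (L-* t n 1≤t p) (ι-* t n)
        (L-diff-≼ (t * n) x (ℕₚ.*-mono-≤ 1≤t p) (÷-from n ℕₚ.≤-refl) le)

  module Step (N : ℕ) (1≤N : 1 ≤ N) where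

    -- `small-value` finds `z` below `4 K′ y`; the factor 16 leaves room for the interval that ends
    -- at `z + z / 4N`.
    K : ℕ
    K = 2 ^ (108 * N + 2) * 16

    K′ : ℕ
    K′ = 2 ^ (108 * N + 2)

    window : ∀ y → N * N + N + 1 ≤ y → 2 ^ (2 * (216 * N)) ≤ y → K * y ≤ X →
      ∃ λ z → y ≤ z × suc (z + z ÷ (4 * N)) ≤ K * y × (∀ t → z ≤ t → t ≤ z + z ÷ (4 * N) → ι N ⊗ ∥ R t ∥ ≼ ι 2 ⊗
          ι t)
    window y big big′ le with ℕₚ.m≤n⇒∃[o]m+o≡n y+2≤
      where
      y+2≤ : y + 2 ≤ K′ * (4 * y)
      y+2≤ = ℕₚ.≤-trans (ℕₚ.+-monoʳ-≤ y (ℕₚ.≤-trans (ℕₚ.*-monoʳ-≤ 2 (ℕₚ.≤-trans (ℕₚ.m≤n+m 1 (N * N + N)) big))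
          (ℕₚ.*-monoˡ-≤ y (s≤s (s≤s (z≤n {1}))))))
        (ℕₚ.m≤n*m (4 * y) K′ {{>-nonZero (^≥1 (108 * N + 2) (s≤s z≤n))}})
    ... | m , e with small-value N y m 1≤N big e′ (ℕₚ.≤-trans (ℕₚ.≤-reflexive e′) 4K′y≤X)
      where
      e′ : y + m + 2 ≡ K′ * (4 * y)
      e′ = trans (trans (ℕₚ.+-assoc y m 2) (trans (cong (y +_) (ℕₚ.+-comm m 2)) (sym (ℕₚ.+-assoc y 2 m)))) e
      4K′y≤X : K′ * (4 * y) ≤ X
      4K′y≤X = ℕₚ.≤-trans (ℕₚ.≤-reflexive (sym (ℕₚ.*-assoc K′ 4 y)))
          (ℕₚ.≤-trans (ℕₚ.*-monoˡ-≤ y (ℕₚ.*-monoʳ-≤ K′ {4} {16} (s≤s (s≤s (s≤s (s≤s z≤n)))))) le)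
    ...   | k , k≤m , small = y + k , ℕₚ.m≤m+n y k , fits , λ t a b → small-interval N (y + k) t 1≤N 1≤z
        (ℕₚ.≤-trans big′ (ℕₚ.m≤m+n y k)) a b (ℕₚ.≤-trans b (ℕₚ.≤-trans (ℕₚ.n≤1+n _) (ℕₚ.≤-trans fits le))) small
      where
      z = y + k
      1≤y : 1 ≤ y
      1≤y = ℕₚ.≤-trans (ℕₚ.m≤n+m 1 (N * N + N)) big
      1≤z = ℕₚ.≤-trans 1≤y (ℕₚ.m≤m+n y k)
      z+2≤ : z + 2 ≤ K′ * (4 * y)
      z+2≤ = ℕₚ.≤-trans (ℕₚ.+-monoˡ-≤ 2 (ℕₚ.+-monoʳ-≤ y k≤m)) (ℕₚ.≤-reflexive
          (trans (trans (ℕₚ.+-assoc y m 2) (trans (cong (y +_) (ℕₚ.+-comm m 2)) (sym (ℕₚ.+-assoc y 2 m)))) e))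
      fits : suc (z + z ÷ (4 * N)) ≤ K * y
      fits = ℕₚ.≤-trans (s≤s (ℕₚ.+-monoʳ-≤ z (÷-≤ z (4 * N) (ℕₚ.*-mono-≤ (s≤s (z≤n {3})) 1≤N))))
          (ℕₚ.≤-trans (ℕₚ.+-mono-≤ (ℕₚ.≤-trans (ℕₚ.≤-trans (ℕₚ.n≤1+n (suc z)) (ℕₚ.≤-reflexive (ℕₚ.+-comm 2 z)))
          z+2≤) (ℕₚ.≤-trans (ℕₚ.m≤m+n z 2) z+2≤))
        (ℕₚ.≤-trans (ℕₚ.≤-reflexive (trans (sym (ℕₚ.*-distribˡ-+ K′ (4 * y) (4 * y)))
            (cong (K′ *_) (sym (ℕₚ.*-distribʳ-+ y 4 4)))))
          (ℕₚ.≤-trans (ℕₚ.*-monoʳ-≤ K′ (ℕₚ.*-monoˡ-≤ y {8} {16}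
              (s≤s (s≤s (s≤s (s≤s (s≤s (s≤s (s≤s (s≤s z≤n))))))))))
              (ℕₚ.≤-reflexive (sym (ℕₚ.*-assoc K′ 16 y))))))

    module Savings (x : ℕ) (M : Q) (Y : ℕ) (1≤x : 1 ≤ x) (x≤X : x ≤ X) (Y₁ : N * N + N + 1 ≤ Y)
        (Y₂ : 2 ^ (2 * (216 * N)) ≤ Y) (Y₃ : 8 * N ≤ Y)
      (0≼M : ι 0 ≼ M) (4≼MN : ι 4 ≼ M ⊗ ι N) (bounded : ∀ t → Y ≤ t → t ≤ x → ∥ R t ∥ ≼ M ⊗ ι t) (4≼L : ι 4 ≼ L x) where

      1≤Y : 1 ≤ Y
      1≤Y = ℕₚ.≤-trans (ℕₚ.m≤n+m 1 (N * N + N)) Y₁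

      0≼L : ι 0 ≼ L x
      0≼L = L-nonneg x 1≤x x≤X

      w : ℕ → Q
      w n = L n ⊗ (M ⊗ (ι x ⊗ inv n)) ⊖ L n ⊗ ∥ R (x ÷ n) ∥

      w-nonneg : ∀ n → 1 ≤ n → Y ≤ x ÷ n → n ≤ x → ι 0 ≼ w n
      w-nonneg n p h q = 0≼-gap (⊗-monoˡ (L-nonneg n p (ℕₚ.≤-trans q x≤X))
          (≼-trans (bounded (x ÷ n) h (÷-≤ x n p)) (⊗-monoˡ 0≼M (ι-÷-≼ x n p))))

      -- Of the numbers up to `n₂ = x ÷ z`, at least a fraction `1/(8N + 2)` has `x ÷ n` in the good
      -- interval, and each of these saves `x log x / (N n₂)`; so `n₂` cancels.
      saving : Q
      saving = ι x ⊗ L x ⊗ inv (N * (8 * N + 2))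

      -- The numbers `n` with `x ÷ n` in `[z, z + z/4N]` fill the range from `x ÷ (z + z/4N + 1)`,
      -- exclusive, to `x ÷ z`. Without rounding their share would be about `1/(4N + 1)`;
      -- `8 N z ≤ x` makes `x ÷ z` so large that half of this survives.
      count-good : ∀ z → 1 ≤ z → 8 * N * z ≤ x → ι (x ÷ z) ≼ (ι 8 ⊗ ι N ⊕ ι 2) ⊗
          (ι (x ÷ z) ⊖ ι (x ÷ suc (z + z ÷ (4 * N))))
      count-good z p h = lin 3 (λ n a b → (con 4 :* n :+ con 1) :* b :≤ con 4 :* n :* (a :+ con 1) ⇒ con 8 :* n
          :≤ a ⇒ ⊢ a :≤ (con 8 :* n :+ con 2) :* (a :- b)) (ι N) (ι (x ÷ z)) (ι (x ÷ suc (z + d)))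
          (⊗-cancel-≼ z p main) (subst (_≼ ι (x ÷ z)) (ι-* 8 N) (ι-mono (÷-to z h p)))
        where
        d = z ÷ (4 * N)
        main : ι z ⊗ ((ι 4 ⊗ ι N ⊕ ι 1) ⊗ ι (x ÷ suc (z + d))) ≼ ι z ⊗ (ι 4 ⊗ ι N ⊗ (ι (x ÷ z) ⊕ ι 1))
        main = lin 6 (λ n z d a b x → con 0 :≤ con 4 :* n :* (x :- b :* (z :+ d :+ con 1)) ⇒ con 0 :≤ b :*
            ((d :+ con 1) :* (con 4 :* n) :- z) ⇒ con 0 :≤ con 4 :* n :* ((a :+ con 1) :* z :- x) ⇒
            ⊢ z :* ((con 4 :* n :+ con 1) :* b) :≤ z :* (con 4 :* n :* (a :+ con 1)))
          (ι N) (ι z) (ι d) (ι (x ÷ z)) (ι (x ÷ suc (z + d))) (ι x)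
          (⊗-nonneg (⊗-nonneg (0≼ι 4) (0≼ι N)) (0≼-gap (subst (_≼ ι x)
              (trans (ι-* _ (suc (z + d))) (cong (ι (x ÷ suc (z + d)) ⊗_)
              (trans (ι-suc (z + d)) (cong (_⊕ ι 1) (ι-+ z d))))) (ι-mono (÷-from (suc (z + d)) ℕₚ.≤-refl)))))
          (⊗-nonneg (0≼ι _) (0≼-gap (subst (ι z ≼_) (trans (ι-* (d + 1) (4 * N))
              (cong₂ _⊗_ (ι-+ d 1) (ι-* 4 N))) (ι-mono (ℕₚ.<⇒≤
              (÷-< z (4 * N) (ℕₚ.*-mono-≤ (s≤s (z≤n {3})) 1≤N)))))))
          (⊗-nonneg (⊗-nonneg (0≼ι 4) (0≼ι N)) (0≼-gap (subst (ι x ≼_)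
              (trans (ι-* (x ÷ z + 1) z) (cong (_⊗ ι z) (ι-+ (x ÷ z) 1))) (ι-mono (ℕₚ.<⇒≤ (÷-< x z p))))))

      0≼xL : ι 0 ≼ ι x ⊗ L x
      0≼xL = ⊗-nonneg (0≼ι x) 0≼L

      8N+2≥1 : 1 ≤ 8 * N + 2
      8N+2≥1 = ℕₚ.≤-trans (s≤s z≤n) (ℕₚ.m≤n+m 2 (8 * N))

      saving-≼ : ∀ n₁ n₂ → 1 ≤ n₂ → ι n₂ ≼ (ι 8 ⊗ ι N ⊕ ι 2) ⊗ (ι n₂ ⊖ ι n₁) → saving ≼ (ι n₂ ⊖ ι n₁) ⊗
          (ι x ⊗ L x ⊗ (inv N ⊗ inv n₂))
      saving-≼ n₁ n₂ p h = ⊗-cancel-≼ (8 * N + 2) 8N+2≥1 (≼-trans (≼-reflexive unfold) (≼-trans scaled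
          (≼-reflexive (cong (_⊗ ((ι n₂ ⊖ ι n₁) ⊗ (q ⊗ (inv N ⊗ j)))) (sym 8N+2)))))
        where
        q = ι x ⊗ L x
        j = inv n₂
        8N+2 : ι (8 * N + 2) ≡ ι 8 ⊗ ι N ⊕ ι 2
        8N+2 = trans (ι-+ (8 * N) 2) (cong (_⊕ ι 2) (ι-* 8 N))
        unfold : ι (8 * N + 2) ⊗ saving ≡ q ⊗ inv N
        unfold = trans (cong (λ k → ι (8 * N + 2) ⊗ (q ⊗ k)) (inv-* N (8 * N + 2) 1≤N 8N+2≥1))
          (trans (lin 4 (λ a q i j → ⊢ a :* (q :* (i :* j)) :≡ (j :* a) :* (q :* i)) (ι (8 * N + 2)) q (inv N)
              (inv (8 * N + 2)))
            (trans (cong (_⊗ (q ⊗ inv N)) (inv-ι′ (8 * N + 2) 8N+2≥1)) (⊗-identityˡ _)))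
        scaled : q ⊗ inv N ≼ (ι 8 ⊗ ι N ⊕ ι 2) ⊗ ((ι n₂ ⊖ ι n₁) ⊗ (q ⊗ (inv N ⊗ j)))
        scaled = ≼-trans (≼-reflexive (trans (sym (⊗-identityʳ _)) (cong ((q ⊗ inv N) ⊗_) (sym (inv-ι′ n₂ p)))))
          (≼-trans (≼-reflexive (sym (⊗-assoc _ _ _))) (≼-trans
              (⊗-monoˡ (⊗-nonneg (⊗-nonneg 0≼xL (inv-nonneg N 1≤N)) (inv-nonneg n₂ p)) h)
            (≼-reflexive (lin 5 (λ q i j a b → ⊢ q :* i :* j :* (a :* b) :≡ a :* (b :* (q :* (i :* j)))) q
                (inv N) j (ι 8 ⊗ ι N ⊕ ι 2) (ι n₂ ⊖ ι n₁)))))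

      -- Here log n ≥ (log x)/2, and M x/n - |R(x/n)| ≥ (2/N) x/n.

      good-term : ∀ n n₂ → 1 ≤ n → n ≤ n₂ → n ≤ x → ι 4 ⊗ L (x ÷ n) ≼ L x → ι N ⊗ ∥ R (x ÷ n) ∥ ≼ ι 2 ⊗ ι
          (x ÷ n) → ι x ⊗ L x ⊗ (inv N ⊗ inv n₂) ≼ w n
      good-term n n₂ 1≤n n≤n₂ n≤x h₄ small = ≼-trans c≼ (≼-reflexive
          (lin 4 (λ l m u r → ⊢ l :* (m :* u :- r) :≡ l :* (m :* u) :- l :* r) (L n) M u (∥ R t ∥)))
        where
        t = x ÷ n
        u = ι x ⊗ inv n
        0≼u : ι 0 ≼ u
        0≼u = ⊗-nonneg (0≼ι x) (inv-nonneg n 1≤n)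
        half≼ : L x ≼ ι 2 ⊗ L n
        half≼ = lin 3 (λ lx ln lt → lx :≤ ln :+ lt :+ con 1 ⇒ con 4 :* lt :≤ lx ⇒ con 4 :≤ lx ⇒ ⊢ lx :≤ con 2 :*
            ln) (L x) (L n) (L t) (L-floor-lower x n 1≤n n≤x x≤X) h₄ 4≼L
        margin : ι 2 ⊗ u ≼ ι N ⊗ (M ⊗ u ⊖ ∥ R t ∥)
        margin = lin 5 (λ n m u r t → n :* r :≤ con 2 :* t ⇒ t :≤ u ⇒ con 0 :≤ (m :* n :- con 4) :* u ⇒ ⊢ con 2
            :* u :≤ n :* (m :* u :- r)) (ι N) M u (∥ R t ∥) (ι t) small (ι-÷-≼ x n 1≤n)
            (⊗-nonneg (0≼-gap 4≼MN) 0≼u)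
        weaken : ι x ⊗ L x ⊗ inv n₂ ≼ ι N ⊗ (L n ⊗ (M ⊗ u ⊖ ∥ R t ∥))
        weaken = lin 7 (λ x lx j i ln e n → con 0 :≤ ln :* (n :* e :- con 2 :* (x :* i)) ⇒ con 0 :≤
            (con 2 :* ln :- lx) :* (x :* i) ⇒ con 0 :≤ (x :* lx) :* (i :- j) ⇒ ⊢ x :* lx :* j :≤ n :* (ln :* e))
          (ι x) (L x) (inv n₂) (inv n) (L n) (M ⊗ u ⊖ ∥ R t ∥) (ι N)
          (⊗-nonneg (L-nonneg n 1≤n (ℕₚ.≤-trans n≤x x≤X)) (0≼-gap margin)) (⊗-nonneg (0≼-gap half≼) 0≼u)
              (⊗-nonneg 0≼xL (0≼-gap (inv-antitone n n₂ 1≤n n≤n₂)))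
        c≼ : ι x ⊗ L x ⊗ (inv N ⊗ inv n₂) ≼ L n ⊗ (M ⊗ u ⊖ ∥ R t ∥)
        c≼ = ⊗-cancel-≼ N 1≤N (≼-trans (≼-reflexive (trans (lin 4
            (λ a q i j → ⊢ a :* (q :* (i :* j)) :≡ (i :* a) :* (q :* j)) (ι N) (ι x ⊗ L x) (inv N) (inv n₂))
          (trans (cong (_⊗ (ι x ⊗ L x ⊗ inv n₂)) (inv-ι′ N 1≤N)) (⊗-identityˡ _)))) weaken)

      -- The good interval has its own range of `n` between `x ÷ k` and `x ÷ y`; on the rest of that
      -- range only `w ≥ 0` is used.
      block′ : ∀ y k z z′ → Y ≤ y → y ≤ z → z ≤ z′ → suc z′ ≤ k → 8 * N * k ≤ x → ι 4 ⊗ L k ≼ L x → z′ ≡ z + z ÷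
          (4 * N) →
        (∀ t → z ≤ t → t ≤ z′ → ι N ⊗ ∥ R t ∥ ≼ ι 2 ⊗ ι t) → ∑ (x ÷ k) w ⊕ saving ≼ ∑ (x ÷ y) w
      block′ y k z z′ Y≤y y≤z z≤z′ z′<k h₈ h₄ eq small = ≼-trans (⊕-mono first (saving-≼ n₁ n₂ 1≤n₂ enough))
          (≼-trans main last)
        where
        n₁ = x ÷ suc z′
        n₂ = x ÷ z
        1≤y = ℕₚ.≤-trans 1≤Y Y≤y
        1≤z = ℕₚ.≤-trans 1≤y y≤z
        k≤x : k ≤ x
        k≤x = ℕₚ.≤-trans (ℕₚ.m≤n*m k (8 * N) {{>-nonZero (ℕₚ.*-mono-≤ (s≤s (z≤n {7})) 1≤N)}}) h₈
        z≤k : z ≤ k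
        z≤k = ℕₚ.≤-trans z≤z′ (ℕₚ.≤-trans (ℕₚ.n≤1+n z′) z′<k)
        1≤n₂ = ÷-≥1 z 1≤z (ℕₚ.≤-trans z≤k k≤x)
        enough : ι n₂ ≼ (ι 8 ⊗ ι N ⊕ ι 2) ⊗ (ι n₂ ⊖ ι n₁)
        enough = subst (λ v → ι n₂ ≼ (ι 8 ⊗ ι N ⊕ ι 2) ⊗ (ι n₂ ⊖ ι (x ÷ suc v))) (sym eq)
            (count-good z 1≤z (ℕₚ.≤-trans (ℕₚ.*-monoʳ-≤ (8 * N) z≤k) h₈))
        n₁≤n₂ : n₁ ≤ n₂
        n₁≤n₂ = ÷-anti x 1≤z (ℕₚ.≤-trans z≤z′ (ℕₚ.n≤1+n z′))
        n₂≤b : n₂ ≤ x ÷ y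
        n₂≤b = ÷-anti x 1≤y y≤z
        nonneg : ∀ n → 1 ≤ n → n ≤ x ÷ y → ι 0 ≼ w n
        nonneg n p q = w-nonneg n p (ℕₚ.≤-trans Y≤y (÷-to n (subst (_≤ x) (ℕₚ.*-comm n y) (÷-from y q)) p))
            (ℕₚ.≤-trans q (÷-≤ x y 1≤y))
        c : Q
        c = ι x ⊗ L x ⊗ (inv N ⊗ inv n₂)
        first : ∑ (x ÷ k) w ≼ ∑ n₁ w
        first = ∑-monoʳ w (÷-anti x (s≤s z≤n) z′<k) (λ n a q → nonneg n (ℕₚ.≤-trans (s≤s z≤n) a)
            (ℕₚ.≤-trans q (ℕₚ.≤-trans n₁≤n₂ n₂≤b)))
        last : ∑ n₂ w ≼ ∑ (x ÷ y) w
        last = ∑-monoʳ w n₂≤b (λ n a q → nonneg n (ℕₚ.≤-trans (s≤s z≤n) a) q)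
        good : ∀ n → n₁ < n → n ≤ n₂ → c ≼ w n
        good n a q = good-term n n₂ 1≤n q n≤x (≼-trans (⊗-monoˡ (0≼ι 4)
            (L-mono t k (÷-≥1 n 1≤n n≤x) (ℕₚ.≤-trans t≤z′ (ℕₚ.≤-trans (ℕₚ.n≤1+n z′) z′<k))
            (ℕₚ.≤-trans k≤x x≤X))) h₄) (small t z≤t t≤z′)
          where
          t = x ÷ n
          1≤n = ℕₚ.≤-trans (s≤s z≤n) a
          n≤x = ℕₚ.≤-trans q (÷-≤ x z 1≤z)
          z≤t : z ≤ t
          z≤t = ÷-to n (subst (_≤ x) (ℕₚ.*-comm n z) (÷-from z q)) 1≤n
          t≤z′ : t ≤ z′
          t≤z′ = ℕₚ.≤-pred (ℕₚ.≰⇒> (λ h → ℕₚ.<⇒≱ a (÷-to (suc z′)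
              (subst (_≤ x) (ℕₚ.*-comm (suc z′) n) (÷-from n h)) (s≤s z≤n))))
        main : ∑ n₁ w ⊕ (ι n₂ ⊖ ι n₁) ⊗ c ≼ ∑ n₂ w
        main with ℕₚ.m≤n⇒∃[o]m+o≡n n₁≤n₂
        ... | j , e = subst (λ v → ∑ n₁ w ⊕ (ι v ⊖ ι n₁) ⊗ c ≼ ∑ v w) e
            (≼-trans (≼-reflexive (cong (λ v → ∑ n₁ w ⊕ v ⊗ c)
            (trans (cong (_⊖ ι n₁) (ι-+ n₁ j)) (lin 2 (λ a b → ⊢ (a :+ b) :- a :≡ b) (ι n₁) (ι j)))))
            (∑-range-lower c n₁ j (λ n a q → good n a (ℕₚ.≤-trans q (ℕₚ.≤-reflexive e)))))

      block : ∀ y → Y ≤ y → 8 * N * (K * y) ≤ x → ι 4 ⊗ L (K * y) ≼ L x → ∑ (x ÷ (K * y)) w ⊕ saving ≼ ∑ (x ÷ y)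
          w
      block y Y≤y h₈ h₄ = let z , y≤z , z′<Ky , small = window y (ℕₚ.≤-trans Y₁ Y≤y) (ℕₚ.≤-trans Y₂ Y≤y) Ky≤X in
          block′ y (K * y) z (z + z ÷ (4 * N)) Y≤y y≤z (ℕₚ.m≤m+n z _) z′<Ky h₈ h₄ refl small
        where
        Ky≤X : K * y ≤ X
        Ky≤X = ℕₚ.≤-trans (ℕₚ.≤-trans (ℕₚ.m≤n*m (K * y) (8 * N) {{>-nonZero (ℕₚ.*-mono-≤ (s≤s (z≤n {7})) 1≤N)}})
            h₈) x≤X

-- Contraction of the bound for R

*-^ : ∀ a b n → (a * b) ^ n ≡ a ^ n * b ^ n
*-^ a b zero    = refl
*-^ a b (suc n) = trans (cong (a * b *_) (*-^ a b n)) (ℕₚ.[m*n]*[o*p]≡[m*o]*[n*p] a b (a ^ n) (b ^ n))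

≤^4 : ∀ {b} → 1 ≤ b → b ≤ b ^ 4
≤^4 {b} p = ℕₚ.m≤m*n b (b ^ 3) {{>-nonZero (^≥1 3 p)}}

module Improvement {X : ℕ} {L : ℕ → Q} (isLog : IsLog X L) (1≤X : 1 ≤ X) (3≤X : 3 ≤ X) (N : ℕ) (1≤N : 1 ≤ N)
    (x : ℕ) (κ : Q) (Y : ℕ) (1≤x : 1 ≤ x) (x≤X : x ≤ X)
  (Y₁ : N * N + N + 1 ≤ Y) (Y₂ : 2 ^ (2 * (216 * N)) ≤ Y) (Y₃ : 8 * N ≤ Y) (Y₄ : 2 ^ (108 * N + 2) * 16 ≤ Y)
  (0≼M : ι 0 ≼ κ) (4≼MN : ι 4 ≼ κ ⊗ ι N)
  (bounded : ∀ t → Y ≤ t → t ≤ x → ∥ Contract.R isLog 1≤X 3≤X t ∥ ≼ κ ⊗ ι t) (4≼L : ι 4 ≼ L x) where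
  open Contract isLog 1≤X 3≤X
  open Step N 1≤N
  open Savings x κ Y 1≤x x≤X Y₁ Y₂ Y₃ 0≼M 4≼MN bounded 4≼L

  private
    K≥2 : 2 ≤ K
    K≥2 = ℕₚ.≤-trans (s≤s (s≤s (z≤n {14}))) (ℕₚ.m≤n*m 16 (2 ^ (108 * N + 2))
        {{>-nonZero (^≥1 (108 * N + 2) (s≤s z≤n))}})

    K≥1 : 1 ≤ K
    K≥1 = ℕₚ.≤-trans (s≤s z≤n) K≥2

    B_ : ℕ → ℕ
    B_ i = Y * K ^ i

    B-suc : ∀ i → K * B_ i ≡ B_ (suc i)
    B-suc i = trans (sym (ℕₚ.*-assoc K Y (K ^ i))) (trans (cong (_* K ^ i) (ℕₚ.*-comm K Y))
        (ℕₚ.*-assoc Y K (K ^ i)))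

    Y≤B : ∀ i → Y ≤ B_ i
    Y≤B i = ℕₚ.m≤m*n Y (K ^ i) {{>-nonZero (^≥1 i K≥1)}}

    B≥1 : ∀ i → 1 ≤ B_ i
    B≥1 i = ℕₚ.≤-trans 1≤Y (Y≤B i)

    B≤B : ∀ i → B_ i ≤ B_ (suc i)
    B≤B i = ℕₚ.*-monoʳ-≤ Y (ℕₚ.m≤n*m (K ^ i) K {{>-nonZero K≥1}})

  -- Consecutive windows from `Y K^i` to `Y K^(i+1)` occupy disjoint ranges of `n`, so the savings
  -- add up. The fourth power keeps `log (x/n)` below a quarter of `log x`, as `good-term` requires.
  blocks : ∀ i → (Y * K ^ i) ^ 4 ≤ x → ∑ (x ÷ (Y * K ^ i)) w ⊕ ι i ⊗ saving ≼ ∑ (x ÷ Y) w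
  blocks zero h = ≼-reflexive (trans (cong₂ _⊕_ (cong (λ k → ∑ (x ÷ k) w) (ℕₚ.*-identityʳ Y)) (⊗-zeroˡ _))
      (⊕-identityʳ _))
  blocks (suc i) h = cong (λ k → ∑ (x ÷ b) w ⊕ k ⊗ saving) (ι-suc i) ≡≼
    lin 5 (λ a b c s i → a :+ s :≤ b ⇒ b :+ i :* s :≤ c ⇒ ⊢ a :+ (i :+ con 1) :* s :≤ c) (∑ (x ÷ b) w)
        (∑ (x ÷ B_ i) w) (∑ (x ÷ Y) w) saving (ι i)
      (subst (λ k → ∑ (x ÷ k) w ⊕ saving ≼ ∑ (x ÷ B_ i) w) (B-suc i)
          (block (B_ i) (Y≤B i) (subst (λ k → 8 * N * k ≤ x) (sym (B-suc i)) small)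
          (subst (λ k → ι 4 ⊗ L k ≼ L x) (sym (B-suc i)) log-small)))
      (blocks i (ℕₚ.≤-trans (^4-mono (B≤B i)) h))
    where
    b = B_ (suc i)
    small : 8 * N * b ≤ x
    small = ℕₚ.≤-trans (ℕₚ.*-monoˡ-≤ b (ℕₚ.≤-trans Y₃ (Y≤B (suc i))))
        (ℕₚ.≤-trans (ℕₚ.*-monoʳ-≤ b (ℕₚ.m≤m*n b (b ^ 2) {{>-nonZero (^≥1 2 (B≥1 (suc i)))}})) h)
    log-small : ι 4 ⊗ L b ≼ L x
    log-small = subst (_≼ L x) (L-^ b 4 (B≥1 (suc i))) (L-mono (b ^ 4) x (^≥1 4 (B≥1 (suc i))) h x≤X)

  find : Y ^ 4 ≤ x → ∃ λ i → (Y * K ^ i) ^ 4 ≤ x × ¬ (Y * K ^ suc i) ^ 4 ≤ x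
  find h = last-true (λ i → (Y * K ^ i) ^ 4 ≤? x) (subst (λ k → k ^ 4 ≤ x) (sym (ℕₚ.*-identityʳ Y)) h) x
    (λ q → ℕₚ.<⇒≱ (n<p^n K≥2 x) (ℕₚ.≤-trans (ℕₚ.m≤n*m (K ^ x) Y {{>-nonZero 1≤Y}})
        (ℕₚ.≤-trans (≤^4 (B≥1 x)) q)))

  -- The windows stop when `x < (Y K^(i+1))⁴`, so there are at least `(log x - C) / 4K` of them. The
  -- crude `log K ≤ K` and `log Y ≤ Y` affect only constants.
  few : ∀ i → (Y * K ^ i) ^ 4 ≤ x → ¬ (Y * K ^ suc i) ^ 4 ≤ x → L x ≼ ι 4 ⊗ ι K ⊗ ι i ⊕ ι (4 * Y + K ^ 4)
  few i h ¬h = lin 8 (λ lx lv ly lk i k y k₄ → lx :- lv :≤ k₄ ⇒ lv :≡ con 4 :* (ly :+ i :* lk) ⇒ ly :≤ y :- con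
      1 ⇒ con 0 :≤ i :* (k :- con 1 :- lk) ⇒ con 0 :≤ i ⇒ ⊢ lx :≤ con 4 :* k :* i :+ (con 4 :* y :+ k₄))
      (L x) (L v) (L Y) (L K) (ι i) (ι K) (ι Y) (ι (K ^ 4)) jump Lv (L-≼ Y 1≤Y Y≤X)
          (⊗-nonneg (0≼ι i) (0≼-gap (L-≼ K K≥1 (ℕₚ.≤-trans Y₄ Y≤X)))) (0≼ι i)
    ≼≡ cong (ι 4 ⊗ ι K ⊗ ι i ⊕_) (sym (trans (ι-+ (4 * Y) (K ^ 4)) (cong (_⊕ ι (K ^ 4)) (ι-* 4 Y))))
    where
    v = B_ i ^ 4
    1≤v : 1 ≤ v
    1≤v = ^≥1 4 (B≥1 i)
    Y≤X : Y ≤ X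
    Y≤X = ℕₚ.≤-trans (Y≤B i) (ℕₚ.≤-trans (≤^4 (B≥1 i)) (ℕₚ.≤-trans h x≤X))
    Lv : L v ≡ ι 4 ⊗ (L Y ⊕ ι i ⊗ L K)
    Lv = trans (L-^ (B_ i) 4 (B≥1 i)) (cong (ι 4 ⊗_) (trans (L-* Y (K ^ i) 1≤Y (^≥1 i K≥1))
        (cong (L Y ⊕_) (L-^ K i K≥1))))
    jump : L x ⊖ L v ≼ ι (K ^ 4)
    jump = ⊗-cancel-≼ v 1≤v (lin 5 (λ d v x k z → d :* v :≤ x :- v ⇒ x :≤ z ⇒ z :≡ k :* v ⇒ con 0 :≤ v ⇒ ⊢ v :*
        d :≤ v :* k) (L x ⊖ L v) (ι v) (ι x) (ι (K ^ 4)) (ι (B_ (suc i) ^ 4))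
      (L-diff-≼ v x 1≤v h x≤X) (ι-mono (ℕₚ.<⇒≤ (ℕₚ.≰⇒> ¬h))) (trans
          (cong ι (trans (cong (_^ 4) (sym (B-suc i))) (*-^ K (B_ i) 4))) (ι-* (K ^ 4) v)) (0≼ι v))

  weighted-sum : Q
  weighted-sum = ∑ x (λ n → L n ⊗ ∥ R (x ÷ n) ∥)

  ∑w : ∑ x w ≡ κ ⊗ ι x ⊗ ∑ x (λ n → L n ⊗ inv n) ⊖ weighted-sum
  ∑w = trans (∑-⊖ x _ _) (cong (_⊖ weighted-sum) (trans (∑-cong′ x
      (λ n → lin 4 (λ l m x i → ⊢ l :* (m :* (x :* i)) :≡ (m :* x) :* (l :* i)) (L n) κ (ι x) (inv n)))
      (∑-⊗ˡ x (κ ⊗ ι x) _)))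

  -- For `n > x ÷ Y` the hypothesis on `R` is silent, but then `x ÷ n < Y` and Chebyshev gives
  -- `|R (x ÷ n)| ≤ 6 Y`. At most `x` such terms cost `O(x log x)`.
  tail : ∑ (x ÷ Y) w ⊖ ι x ⊗ (ι 6 ⊗ ι Y ⊗ L x) ≼ ∑ x w
  tail with ℕₚ.m≤n⇒∃[o]m+o≡n (÷-≤ x Y 1≤Y)
  ... | k , e = ≼-trans (lin 4 (λ a x k c → con 0 :≤ (x :- k) :* c ⇒ ⊢ a :- x :* c :≤ a :+ k :* :- c)
      (∑ (x ÷ Y) w) (ι x) (ι k) c (⊗-nonneg (0≼-gap (ι-mono (subst (k ≤_) e (ℕₚ.m≤n+m k (x ÷ Y))))) 0≼c))
      (subst (λ v → ∑ (x ÷ Y) w ⊕ ι k ⊗ ⊝ c ≼ ∑ v w) e (∑-range-lower (⊝ c) (x ÷ Y) k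
          (λ n a q → bound n a (ℕₚ.≤-trans q (ℕₚ.≤-reflexive e)))))
    where
    c : Q
    c = ι 6 ⊗ ι Y ⊗ L x
    0≼c : ι 0 ≼ c
    0≼c = ⊗-nonneg (⊗-nonneg (0≼ι 6) (0≼ι Y)) 0≼L
    bound : ∀ n → x ÷ Y < n → n ≤ x → ⊝ c ≼ w n
    bound n a q = lin 5 (λ l r y lx u → con 0 :≤ l :* (con 6 :* y :- r) ⇒ con 0 :≤ (lx :- l) :* y ⇒ con 0 :≤ u ⇒
        ⊢ :- (con 6 :* y :* lx) :≤ u :- l :* r)
      (L n) (∥ R (x ÷ n) ∥) (ι Y) (L x) (L n ⊗ (κ ⊗ (ι x ⊗ inv n)))
      (⊗-nonneg (L-nonneg n 1≤n n≤X) (0≼-gap (≼-trans (R-bound (x ÷ n))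
          (≼-trans (ψ-upper (x ÷ n) (ℕₚ.≤-trans (÷-≤ x n 1≤n) x≤X))
          (⊗-monoˡ (0≼ι 6) (ι-mono (ℕₚ.<⇒≤ (ℕₚ.≰⇒> (λ h → ℕₚ.<⇒≱ a
          (÷-to Y (subst (_≤ x) (ℕₚ.*-comm Y n) (÷-from n h)) 1≤Y))))))))))
      (⊗-nonneg (0≼-gap (L-mono n x 1≤n q x≤X)) (0≼ι Y)) (⊗-nonneg (L-nonneg n 1≤n n≤X)
          (⊗-nonneg 0≼M (⊗-nonneg (0≼ι x) (inv-nonneg n 1≤n))))
      where
      1≤n = ℕₚ.≤-trans (s≤s z≤n) a
      n≤X = ℕₚ.≤-trans q x≤X

  weighted-upper : ∀ i → (Y * K ^ i) ^ 4 ≤ x → ι 2 ⊗ weighted-sum ⊕ ι 2 ⊗ (ι i ⊗ saving) ≼ κ ⊗ ι x ⊗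
      (L x ⊗ L x ⊕ L x) ⊕ ι 12 ⊗ ι Y ⊗ (ι x ⊗ L x)
  weighted-upper i h = lin 10 (λ f g s a b m t y x l → a :+ g :≤ b ⇒ con 0 :≤ a ⇒ b :- x :* (con 6 :* y :* l) :≤
      s ⇒ s :≡ m :* t :- f ⇒ con 0 :≤ m :* (l :* l :+ l :- con 2 :* t) ⇒ ⊢ con 2 :* f :+ con 2 :* g :≤ m :*
      (l :* l :+ l) :+ con 12 :* y :* (x :* l))
    weighted-sum (ι i ⊗ saving) (∑ x w) (∑ (x ÷ B_ i) w) (∑ (x ÷ Y) w) (κ ⊗ ι x) (∑ x (λ n → L n ⊗ inv n)) (ι Y)
        (ι x) (L x)
    (blocks i h) (∑-nonneg (x ÷ B_ i) nonneg) tail ∑w (⊗-nonneg (⊗-nonneg 0≼M (0≼ι x))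
        (0≼-gap (2∑Linv x 1≤x x≤X)))
    where
    nonneg : ∀ n → 1 ≤ n → n ≤ x ÷ B_ i → ι 0 ≼ w n
    nonneg n p q = w-nonneg n p (ℕₚ.≤-trans (Y≤B i) (÷-to n (subst (_≤ x) (ℕₚ.*-comm n (B_ i))
        (÷-from (B_ i) q)) p)) (ℕₚ.≤-trans q (÷-≤ x (B_ i) (B≥1 i)))

  D : ℕ
  D = N * (8 * N + 2)

  -- Chosen so that `Γ₀` times the savings of `i` windows is `4 K i x log x`, which `few` compares
  -- with `x (log x)²`.
  Γ₀ : ℕ
  Γ₀ = D * (4 * K)

  C : ℕ
  C = 4 * Y + K ^ 4

  -- After multiplication by `Γ₀`, the windows remove `2 x (log x)²` from the main term
  -- `j x (log x)²`, and the lower-order terms restore at most half of that. Their coefficients of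
  -- `x log x` are `6 Γ₀` from `j ≤ 6 * Γ₀`, `120 Γ₀` from `iterated`, `2 C` from `few` and
  -- `12 Γ₀ Y` from `tail`; the sum is the threshold for `L x`.
  improve : ∀ j → κ ⊗ ι Γ₀ ≡ ι j → j ≤ 6 * Γ₀ → Y ^ 4 ≤ x → ι (126 * Γ₀ + 2 * C + 12 * (Γ₀ * Y)) ≼ L x → ι Γ₀ ⊗
      ∥ R x ∥ ≼ (ι j ⊖ ι 1) ⊗ ι x
  improve j MG j≤ Y⁴≤x T≼L = let i , h , ¬h = find Y⁴≤x in cancel-≼ 1≼L (cancel-≼ 1≼L (final i h ¬h))
    where
    l = L x
    r = ∥ R x ∥
    1≼L : ι 1 ≼ l
    1≼L = ≼-trans (ι-mono (s≤s z≤n)) 4≼L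
    1≤D : 1 ≤ D
    1≤D = ℕₚ.*-mono-≤ 1≤N 8N+2≥1
    saving-D : ι D ⊗ saving ≡ ι x ⊗ l
    saving-D = trans (lin 3 (λ d q i → ⊢ d :* (q :* i) :≡ (i :* d) :* q) (ι D) (ι x ⊗ l) (inv D))
        (trans (cong (_⊗ (ι x ⊗ l)) (inv-ι′ D 1≤D)) (⊗-identityˡ _))
    Γ₀-≡ : ι Γ₀ ≡ ι D ⊗ (ι 4 ⊗ ι K)
    Γ₀-≡ = trans (ι-* D (4 * K)) (cong (ι D ⊗_) (ι-* 4 K))
    T-≡ : ι (126 * Γ₀ + 2 * C + 12 * (Γ₀ * Y)) ≡ ι 126 ⊗ ι Γ₀ ⊕ ι 2 ⊗ ι C ⊕ ι 12 ⊗ (ι Γ₀ ⊗ ι Y)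
    T-≡ = trans (ι-+ (126 * Γ₀ + 2 * C) _) (cong₂ _⊕_ (trans (ι-+ (126 * Γ₀) (2 * C))
        (cong₂ _⊕_ (ι-* 126 Γ₀) (ι-* 2 C))) (trans (ι-* 12 (Γ₀ * Y)) (cong (ι 12 ⊗_) (ι-* Γ₀ Y))))
    gain : ∀ i → ι Γ₀ ⊗ (ι i ⊗ saving) ≡ (ι 4 ⊗ ι K ⊗ ι i) ⊗ (ι x ⊗ l)
    gain i = trans (cong (_⊗ (ι i ⊗ saving)) Γ₀-≡) (trans (lin 4
        (λ d k i s → ⊢ d :* (con 4 :* k) :* (i :* s) :≡ (con 4 :* k :* i) :* (d :* s)) (ι D) (ι K) (ι i) saving)
        (cong ((ι 4 ⊗ ι K ⊗ ι i) ⊗_) saving-D))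
    upper : ∀ i → (Y * K ^ i) ^ 4 ≤ x → ι Γ₀ ⊗ (l ⊗ (l ⊗ r)) ⊕ ι 2 ⊗ ((ι 4 ⊗ ι K ⊗ ι i) ⊗ (ι x ⊗ l)) ≼ ι j ⊗
        (ι x ⊗ (l ⊗ l ⊕ l)) ⊕ ι 12 ⊗ (ι Γ₀ ⊗ ι Y) ⊗ (ι x ⊗ l) ⊕ ι 60 ⊗ (ι Γ₀ ⊗ (ι x ⊗ (l ⊕ ι 1)))
    upper i h = lin 9 (λ g a f s e p m y z → con 0 :≤ g :* (con 2 :* f :+ con 60 :* z :- a) ⇒ con 0 :≤ g :*
        (m :+ con 12 :* y :- (con 2 :* f :+ con 2 :* s)) ⇒ g :* s :≡ e ⇒ g :* m :≡ p ⇒ ⊢ g :* a :+ con 2 :* e :≤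
        p :+ con 12 :* (g :* y) :+ con 60 :* (g :* z))
        (ι Γ₀) (l ⊗ (l ⊗ r)) weighted-sum (ι i ⊗ saving) _ (ι j ⊗ (ι x ⊗ (l ⊗ l ⊕ l))) (κ ⊗ ι x ⊗ (l ⊗ l ⊕ l))
            (ι Y ⊗ (ι x ⊗ l)) (ι x ⊗ (l ⊕ ι 1))
        (⊗-nonneg (0≼ι Γ₀) (0≼-gap (iterated x 1≤x x≤X))) (⊗-nonneg (0≼ι Γ₀)
            (0≼-gap (≼-trans (weighted-upper i h) (≼-reflexive
            (cong (κ ⊗ ι x ⊗ (l ⊗ l ⊕ l) ⊕_) (⊗-assoc _ _ _)))))) (gain i)
        (trans (lin 4 (λ g m x q → ⊢ g :* (m :* x :* q) :≡ (m :* g) :* (x :* q)) (ι Γ₀) κ (ι x) (l ⊗ l ⊕ l))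
            (cong (_⊗ (ι x ⊗ (l ⊗ l ⊕ l))) MG))
      ≼≡ cong (λ z → ι j ⊗ (ι x ⊗ (l ⊗ l ⊕ l)) ⊕ z ⊕ ι 60 ⊗ (ι Γ₀ ⊗ (ι x ⊗ (l ⊕ ι 1))))
          (lin 3 (λ g y q → ⊢ con 12 :* (g :* (y :* q)) :≡ con 12 :* (g :* y) :* q) (ι Γ₀) (ι Y) (ι x ⊗ l))
    final : ∀ i → (Y * K ^ i) ^ 4 ≤ x → ¬ (Y * K ^ suc i) ^ 4 ≤ x → l ⊗ (l ⊗ (ι Γ₀ ⊗ r)) ≼ l ⊗
        (l ⊗ ((ι j ⊖ ι 1) ⊗ ι x))
    final i h ¬h = lin 8 (λ g r l x j q c y → g :* (l :* (l :* r)) :+ con 2 :* (q :* (x :* l)) :≤ j :*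
        (x :* (l :* l :+ l)) :+ con 12 :* y :* (x :* l) :+ con 60 :* (g :* (x :* (l :+ con 1))) ⇒
        con 0 :≤ (x :* l) :* (q :+ c :- l) ⇒ con 0 :≤ (x :* l) :* (con 6 :* g :- j) ⇒ con 0 :≤ (x :* l) :*
            (l :- (con 126 :* g :+ con 2 :* c :+ con 12 :* y)) ⇒ con 0 :≤ g :* (x :* (l :- con 1)) ⇒
        ⊢ l :* (l :* (g :* r)) :≤ l :* (l :* ((j :- con 1) :* x)))
      (ι Γ₀) r l (ι x) (ι j) (ι 4 ⊗ ι K ⊗ ι i) (ι C) (ι Γ₀ ⊗ ι Y) (upper i h)
      (⊗-nonneg 0≼xL (0≼-gap (few i h ¬h))) (⊗-nonneg 0≼xL (0≼-gap (subst (ι j ≼_) (ι-* 6 Γ₀) (ι-mono j≤))))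
          (⊗-nonneg 0≼xL (0≼-gap (subst (_≼ l) T-≡ T≼L))) (⊗-nonneg (0≼ι Γ₀) (⊗-nonneg (0≼ι x) (0≼-gap 1≼L)))

-- R(x) = o(x)

R-of : {X : ℕ} {L : ℕ → Q} → IsLog X L → ℕ → Q
R-of isLog x = ∑ x (λ n → χ n ⊗ VonMangoldt.Λ isLog n)

gain : ℕ → ℕ
gain N = N * (8 * N + 2) * (4 * (2 ^ (108 * N + 2) * 16))

gain≥1 : ∀ N → 1 ≤ N → 1 ≤ gain N
gain≥1 N p = ℕₚ.*-mono-≤ (ℕₚ.*-mono-≤ p (ℕₚ.≤-trans (s≤s z≤n) (ℕₚ.m≤n+m 2 (8 * N))))
    (ℕₚ.*-mono-≤ (s≤s (z≤n {3})) (ℕₚ.*-mono-≤ (^≥1 (108 * N + 2) (s≤s (z≤n {1}))) (s≤s (z≤n {15}))))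

-- Bounds of |R(x)|/x in units of 1/g, uniformly in the approximate logarithm

Bounded : ℕ → ℕ → Set
Bounded g j = ∃ λ x₀ → ∀ {X L} (isLog : IsLog X L) → 3 ≤ X → ∀ x → x₀ ≤ x → x ≤ X → ι g ⊗ ∥ R-of isLog x ∥ ≼ ι j
    ⊗ ι x

bounded-start : ∀ g → Bounded g (6 * g)
bounded-start g = 0 , λ isLog 3≤X x _ le → let open IteratedFormula isLog (ℕₚ.≤-trans (s≤s z≤n) 3≤X) 3≤X in
  ≼-trans (⊗-monoˡ (0≼ι g) (≼-trans (R-bound x) (ψ-upper x le)))
      (≼-reflexive (trans (lin 2 (λ g x → ⊢ g :* (con 6 :* x) :≡ con 6 :* g :* x) (ι g) (ι x))
      (cong (_⊗ ι x) (sym (ι-* 6 g)))))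

-- One use of `improve` with `M = (j + 1)/g`. The new threshold is computed from `N` and `x₀` alone,
-- hence serves every approximate logarithm.
bounded-step : ∀ N → 1 ≤ N → ∀ j → 4 * gain N ≤ suc j * N → suc j ≤ 6 * gain N → Bounded (gain N) (suc j) →
    Bounded (gain N) j
bounded-step N 1≤N j enough j≤ (x₀ , h) = Y ^ 4 + 2 ^ (2 * T) , result
  where
  g K Y C T : ℕ
  g = gain N
  K = 2 ^ (108 * N + 2) * 16
  Y = x₀ + (N * N + N + 1 + (2 ^ (2 * (216 * N)) + (8 * N + K)))
  C = 4 * Y + K ^ 4
  T = 126 * g + 2 * C + 12 * (g * Y)
  κ : Q
  κ = ι (suc j) ⊗ inv g
  1≤g : 1 ≤ g
  1≤g = gain≥1 N 1≤N
  0≼κ : ι 0 ≼ κ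
  0≼κ = ⊗-nonneg (0≼ι (suc j)) (inv-nonneg g 1≤g)
  κg : κ ⊗ ι g ≡ ι (suc j)
  κg = trans (⊗-assoc _ _ _) (trans (cong (ι (suc j) ⊗_) (inv-ι′ g 1≤g)) (⊗-identityʳ _))
  4≼κN : ι 4 ≼ κ ⊗ ι N
  4≼κN = ⊗-cancel-≼ g 1≤g (lin 4 (λ g k j n → con 4 :* g :≤ j :* n ⇒ k :* g :≡ j ⇒ (k :* g) :* n :≡ j :* n ⇒ ⊢ g
      :* con 4 :≤ g :* (k :* n)) (ι g) κ (ι (suc j)) (ι N)
    (subst₂ _≼_ (ι-* 4 g) (ι-* (suc j) N) (ι-mono enough)) κg (cong (_⊗ ι N) κg))
  Y₁ : N * N + N + 1 ≤ Y
  Y₁ = ℕₚ.≤-trans (ℕₚ.m≤m+n _ _) (ℕₚ.m≤n+m _ x₀)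
  Y₂ : 2 ^ (2 * (216 * N)) ≤ Y
  Y₂ = ℕₚ.≤-trans (ℕₚ.m≤m+n _ (8 * N + K)) (ℕₚ.≤-trans (ℕₚ.m≤n+m _ (N * N + N + 1)) (ℕₚ.m≤n+m _ x₀))
  Y₃₄ : 8 * N + K ≤ Y
  Y₃₄ = ℕₚ.≤-trans (ℕₚ.m≤n+m _ (2 ^ (2 * (216 * N)))) (ℕₚ.≤-trans (ℕₚ.m≤n+m _ (N * N + N + 1)) (ℕₚ.m≤n+m _ x₀))
  result : ∀ {X L} (isLog : IsLog X L) → 3 ≤ X → ∀ x → Y ^ 4 + 2 ^ (2 * T) ≤ x → x ≤ X → ι g ⊗ ∥ R-of isLog x ∥
      ≼ ι j ⊗ ι x
  result {X} {L} isLog 3≤X x x₁≤x x≤X = ≼-trans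
    (Improvement.improve isLog 1≤X 3≤X N 1≤N x κ Y 1≤x x≤X Y₁ Y₂ (ℕₚ.≤-trans (ℕₚ.m≤m+n _ K) Y₃₄)
        (ℕₚ.≤-trans (ℕₚ.m≤n+m K (8 * N)) Y₃₄) 0≼κ 4≼κN bounded 4≼L (suc j) κg j≤
        (ℕₚ.≤-trans (ℕₚ.m≤m+n _ _) x₁≤x) T≼L)
    (≼-reflexive (cong (_⊗ ι x) (trans (cong (_⊖ ι 1) (ι-suc j))
        (lin 1 (λ a → ⊢ (a :+ con 1) :- con 1 :≡ a) (ι j)))))
    where
    1≤X : 1 ≤ X
    1≤X = ℕₚ.≤-trans (s≤s z≤n) 3≤X
    2T≤x : 2 ^ (2 * T) ≤ x
    2T≤x = ℕₚ.≤-trans (ℕₚ.m≤n+m _ (Y ^ 4)) x₁≤x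
    1≤x : 1 ≤ x
    1≤x = ℕₚ.≤-trans (^≥1 (2 * T) (s≤s z≤n)) 2T≤x
    T≼L : ι T ≼ L x
    T≼L = Windows.L-large isLog 1≤X 3≤X T x 2T≤x x≤X
    4≤T : 4 ≤ T
    4≤T = ℕₚ.≤-trans (ℕₚ.≤-trans (ℕₚ.*-mono-≤ {4} {126} (s≤s (s≤s (s≤s (s≤s z≤n)))) 1≤g)
        (ℕₚ.m≤m+n (126 * g) (2 * C))) (ℕₚ.m≤m+n (126 * g + 2 * C) _)
    4≼L : ι 4 ≼ L x
    4≼L = ≼-trans (ι-mono 4≤T) T≼L
    bounded : ∀ t → Y ≤ t → t ≤ x → ∥ R-of isLog t ∥ ≼ κ ⊗ ι t
    bounded t Y≤t t≤x = ⊗-cancel-≼ g 1≤g (≼-trans (h isLog 3≤X t (ℕₚ.≤-trans (ℕₚ.m≤m+n x₀ _) Y≤t)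
        (ℕₚ.≤-trans t≤x x≤X))
      (≼-reflexive (trans (cong (_⊗ ι t) (sym κg)) (lin 3 (λ k g t → ⊢ k :* g :* t :≡ g :* (k :* t)) κ (ι g)
          (ι t)))))

descend : ∀ N → 1 ≤ N → ∀ j → j ≤ 6 * gain N → Bounded (gain N) j → ∃ λ i → i * N ≤ 4 * gain N × Bounded
    (gain N) i
descend N 1≤N zero    le b = 0 , z≤n , b
descend N 1≤N (suc j) le b = go (ℕₚ.≤-total (4 * gain N) (suc j * N))
  where
  go : 4 * gain N ≤ suc j * N ⊎ suc j * N ≤ 4 * gain N → ∃ λ i → i * N ≤ 4 * gain N × Bounded (gain N) i
  go (inj₁ p) = descend N 1≤N j (ℕₚ.≤-trans (ℕₚ.n≤1+n j) le) (bounded-step N 1≤N j p le b)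
  go (inj₂ p) = suc j , p , b

-- `N = 4 * E` because the descent ends at the bound `4/N`.
R-small : ∀ E → 1 ≤ E → ∃ λ x₀ → ∀ {X L} (isLog : IsLog X L) → 3 ≤ X → ∀ x → x₀ ≤ x → x ≤ X → ι E ⊗ ∥ R-of isLog
    x ∥ ≼ ι x
R-small E 1≤E = let i , p , x₀ , h = descend (4 * E) 1≤N (6 * gain (4 * E)) ℕₚ.≤-refl (bounded-start (gain (4 * E))) in
  x₀ , λ isLog 3≤X x q le → conclude i p (∥ R-of isLog x ∥) x (h isLog 3≤X x q le)
  where
  1≤N : 1 ≤ 4 * E
  1≤N = ℕₚ.*-mono-≤ (s≤s (z≤n {3})) 1≤E
  conclude : ∀ i → i * (4 * E) ≤ 4 * gain (4 * E) → ∀ r x → ι (gain (4 * E)) ⊗ r ≼ ι i ⊗ ι x → ι E ⊗ r ≼ ι x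
  conclude i p r x h = ⊗-cancel-≼ (gain (4 * E)) (gain≥1 (4 * E) 1≤N)
      (lin 5 (λ g e r x i → con 0 :≤ e :* (i :* x :- g :* r) ⇒ con 0 :≤ (con 4 :* g :- i :* (con 4 :* e)) :* x ⇒
      ⊢ g :* (e :* r) :≤ g :* x)
    (ι (gain (4 * E))) (ι E) r (ι x) (ι i) (⊗-nonneg (0≼ι E) (0≼-gap h))
    (⊗-nonneg (0≼-gap (subst₂ _≼_ (trans (ι-* i (4 * E)) (cong (ι i ⊗_) (ι-* 4 E))) (ι-* 4 (gain (4 * E)))
        (ι-mono p))) (0≼ι x)))

-- Construction of the approximate logarithm

n⊗inv[nm] : ∀ n m → 1 ≤ n → 1 ≤ m → ι n ⊗ inv (n * m) ≡ inv m
n⊗inv[nm] n m p q = trans (cong (ι n ⊗_) (inv-* n m p q)) (trans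
    (lin 3 (λ a i j → ⊢ a :* (i :* j) :≡ (i :* a) :* j) (ι n) (inv n) (inv m))
    (trans (cong (_⊗ inv m) (inv-ι′ n p)) (⊗-identityˡ _)))

harmonic-split : ∀ b s → harmonic (b * suc s) ⊖ harmonic (b * s) ≡ ∑ b (λ i → inv (b * s + i))
harmonic-split b s = trans (cong (λ k → harmonic k ⊖ harmonic (b * s))
    (trans (ℕₚ.*-suc b s) (ℕₚ.+-comm b (b * s)))) (trans (cong (_⊖ harmonic (b * s)) (∑-split (b * s) b inv))
    (lin 2 (λ u v → ⊢ (u :+ v) :- u :≡ v) _ _))

harmonic-block-upper : ∀ b s → 1 ≤ b → 1 ≤ s → harmonic (b * suc s) ⊖ harmonic (b * s) ≼ inv s
harmonic-block-upper b s p q = harmonic-split b s ≡≼ ≼-trans (∑-mono b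
    (λ i _ _ → inv-antitone (b * s) (b * s + i) (ℕₚ.*-mono-≤ p q) (ℕₚ.m≤m+n _ i)))
    (≼-reflexive (trans (∑-const b _) (n⊗inv[nm] b s p q)))

harmonic-block-lower : ∀ b s → 1 ≤ b → inv (suc s) ≼ harmonic (b * suc s) ⊖ harmonic (b * s)
harmonic-block-lower b s p = ≼-trans (≼-reflexive (sym (trans (∑-const b (inv (b * suc s)))
    (n⊗inv[nm] b (suc s) p (s≤s z≤n))))) (≼-trans
  (∑-mono b (λ i a c → inv-antitone (b * s + i) (b * suc s) (ℕₚ.≤-trans a (ℕₚ.m≤n+m i (b * s)))
      (ℕₚ.≤-trans (ℕₚ.+-monoʳ-≤ (b * s) c) (ℕₚ.≤-reflexive (trans (ℕₚ.+-comm (b * s) b)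
      (sym (ℕₚ.*-suc b s)))))))
  (≼-reflexive (sym (harmonic-split b s))))

-- H(bs) - H(s), for the harmonic numbers H, increases to log b as s grows, with error at most 1/s.

ratio : ℕ → ℕ → Q
ratio b s = harmonic (b * s) ⊖ harmonic s

ratio-increasing : ∀ b s k → 1 ≤ b → ratio b s ≼ ratio b (s + k)
ratio-increasing b s zero    p rewrite ℕₚ.+-identityʳ s = ≼-refl
ratio-increasing b s (suc k) p rewrite ℕₚ.+-suc s k = ≼-trans (ratio-increasing b s k p)
  (lin 4 (λ a c d i → i :≤ d :- a ⇒ ⊢ a :- c :≤ d :- (c :+ i)) (harmonic (b * (s + k))) (harmonic (s + k))
      (harmonic (b * suc (s + k))) (inv (suc (s + k))) (harmonic-block-lower b (s + k) p))

ratio-decreasing : ∀ b s k → 1 ≤ b → 1 ≤ s → ratio b (s + k) ⊕ inv (s + k) ≼ ratio b s ⊕ inv s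
ratio-decreasing b s zero    p q rewrite ℕₚ.+-identityʳ s = ≼-refl
ratio-decreasing b s (suc k) p q rewrite ℕₚ.+-suc s k = ≼-trans
  (lin 5 (λ a c d i j → d :- a :≤ i ⇒ ⊢ d :- (c :+ j) :+ j :≤ a :- c :+ i) (harmonic (b * (s + k)))
      (harmonic (s + k)) (harmonic (b * suc (s + k))) (inv (s + k)) (inv (suc (s + k)))
      (harmonic-block-upper b (s + k) p (ℕₚ.≤-trans q (ℕₚ.m≤m+n s k))))
  (ratio-decreasing b s k p q)

module Construct (X : ℕ) (1≤X : 1 ≤ X) where

  -- `m` is even for the halving in `ℓ-step`, and `m = 6 X³` is what `margin` demands.
  m m/2 : ℕ
  m/2 = 3 * (X * X * X)
  m = m/2 * 2

  1≤m/2 : 1 ≤ m/2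
  1≤m/2 = ℕₚ.*-mono-≤ (s≤s (z≤n {2})) (ℕₚ.*-mono-≤ (ℕₚ.*-mono-≤ 1≤X 1≤X) 1≤X)

  1≤m : 1 ≤ m
  1≤m = ℕₚ.*-mono-≤ 1≤m/2 (s≤s z≤n)

  ℓ : ℕ → Q
  ℓ b = ratio b m

  open Additive ℓ

  ℓ-1 : ℓ 1 ≡ ι 0
  ℓ-1 = trans (cong (λ k → harmonic k ⊖ harmonic m) (ℕₚ.*-identityˡ m)) (⊕-inverseʳ _)

  -- `ℓ (a * b)` is `ℓ a` plus the ratio for `b` taken at `a * m` instead of `m`. That the ratio
  -- increases gives this side, and its error bound `1/m` gives `ℓ-*-upper`.
  ℓ-*-lower : ∀ a b → 1 ≤ a → 1 ≤ b → ℓ a ⊕ ℓ b ≼ ℓ (a * b)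
  ℓ-*-lower a b p q with ℕₚ.m≤n⇒∃[o]m+o≡n (ℕₚ.m≤n*m m a {{>-nonZero p}})
  ... | k , e = lin 4 (λ u v t s → u :- s :≤ v :- t ⇒ ⊢ (t :- s) :+ (u :- s) :≤ v :- s) (harmonic (b * m))
      (harmonic (a * b * m)) (harmonic (a * m)) (harmonic m)
    (subst₂ (λ y z → ratio b m ≼ harmonic y ⊖ harmonic z) (trans (cong (b *_) e)
        (trans (sym (ℕₚ.*-assoc b a m)) (cong (_* m) (ℕₚ.*-comm b a)))) e (ratio-increasing b m k q))

  ℓ-*-upper : ∀ a b → 1 ≤ a → 1 ≤ b → ℓ (a * b) ≼ ℓ a ⊕ ℓ b ⊕ inv m
  ℓ-*-upper a b p q with ℕₚ.m≤n⇒∃[o]m+o≡n (ℕₚ.m≤n*m m a {{>-nonZero p}})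
  ... | k , e = lin 6 (λ u v t s i j → v :- t :+ j :≤ u :- s :+ i ⇒ con 0 :≤ j ⇒ ⊢ v :- s :≤ (t :- s) :+
      (u :- s) :+ i) (harmonic (b * m)) (harmonic (a * b * m)) (harmonic (a * m)) (harmonic m) (inv m)
      (inv (a * m))
    (subst (λ y → y ⊖ harmonic (a * m) ⊕ inv (a * m) ≼ ratio b m ⊕ inv m)
        (cong harmonic (trans (sym (ℕₚ.*-assoc b a m)) (cong (_* m) (ℕₚ.*-comm b a))))
      (subst (λ z → harmonic (b * z) ⊖ harmonic z ⊕ inv z ≼ ratio b m ⊕ inv m) e
          (ratio-decreasing b m k q 1≤m))) (inv-nonneg (a * m) (ℕₚ.*-mono-≤ p 1≤m))

  total-lower : ∀ {ps} → All Prime ps → total ps ≼ ℓ (product ps)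
  total-lower []                   = ≼-reflexive (sym ℓ-1)
  total-lower {p ∷ ps} (pp ∷ pps) = ≼-trans (⊕-mono ≼-refl (total-lower pps))
      (ℓ-*-lower p (product ps) (prime≥1 pp) (product≥1 pps))

  total-upper : ∀ {ps} → All Prime ps → ℓ (product ps) ≼ total ps ⊕ ι (length ps) ⊗ inv m
  total-upper []                   = lin 2 (λ a i → a :≡ con 0 ⇒ ⊢ a :≤ con 0 :+ con 0 :* i) (ℓ 1) (inv m) ℓ-1
  total-upper {p ∷ ps} (pp ∷ pps) = lin 7 (λ a b c t n n′ i → a :≤ b :+ c :+ i ⇒ c :≤ t :+ n :* i ⇒ n′ :≡ n :+
      con 1 ⇒ n′ :* i :≡ (n :+ con 1) :* i ⇒ ⊢ a :≤ (b :+ t) :+ n′ :* i)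
    (ℓ (p * product ps)) (ℓ p) (ℓ (product ps)) (total ps) (ι (length ps)) (ι (suc (length ps))) (inv m)
        (ℓ-*-upper p (product ps) (prime≥1 pp) (product≥1 pps)) (total-upper pps) (ι-suc (length ps))
        (cong (_⊗ inv m) (ι-suc (length ps)))

  length< : ∀ {ps} → All Prime ps → length ps < product ps
  length< []                   = s≤s z≤n
  length< {p ∷ ps} (pp ∷ pps) = ℕₚ.≤-trans (ℕₚ.+-mono-≤ (product≥1 pps) (length< pps))
      (ℕₚ.≤-trans (ℕₚ.≤-reflexive (cong (product ps +_) (sym (ℕₚ.+-identityʳ (product ps)))))
      (ℕₚ.*-monoˡ-≤ (product ps) (prime≥2 pp)))

  -- Additivity now holds by construction. The distance from `ℓ` is at most `X/m`, a defect of `1/m`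
  -- for each prime factor.
  L : ℕ → Q
  L = additive

  L≼ℓ : ∀ n → 1 ≤ n → L n ≼ ℓ n
  L≼ℓ (suc n) _ = let f = factorise (suc n) in total-lower (factorsPrime f) ≼≡ cong ℓ (sym (isFactorisation f))

  ℓ≼L : ∀ n → 1 ≤ n → n ≤ X → ℓ n ≼ L n ⊕ ι X ⊗ inv m
  ℓ≼L (suc n) _ le = let f = factorise (suc n) in ≼-trans (≼-reflexive (cong ℓ (isFactorisation f))) (≼-trans (total-upper (factorsPrime f))
    (⊕-mono ≼-refl (⊗-monoʳ (inv-nonneg m 1≤m) (ι-mono (ℕₚ.≤-trans (ℕₚ.<⇒≤ (length< (factorsPrime f)))
        (ℕₚ.≤-trans (ℕₚ.≤-reflexive (sym (isFactorisation f))) le))))))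

  -- Estimating the two halves of the block from `n m` to `(n + 1) m` separately puts the increment
  -- strictly between `1/(n+1)` and `1/n`; the slack pays for the difference between `L` and `ℓ`.
  ℓ-step : ∀ n → 1 ≤ n → inv (2 * n + 1) ⊕ inv (2 * n + 2) ≼ ℓ (suc n) ⊖ ℓ n × ℓ (suc n) ⊖ ℓ n ≼ inv (2 * n) ⊕
      inv (2 * n + 1)
  ℓ-step n p = ≼-trans lower regroup , (sym regroup-≡ ≡≼ upper)
    where
    a b c : Q
    a = harmonic (n * m)
    b = harmonic (m/2 * suc (2 * n))
    c = harmonic (suc n * m)
    e₀ : m/2 * (2 * n) ≡ n * m
    e₀ = trans (sym (ℕₚ.*-assoc m/2 2 n)) (ℕₚ.*-comm (m/2 * 2) n)
    e₂ : m/2 * suc (suc (2 * n)) ≡ suc n * m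
    e₂ = trans (cong (m/2 *_) (sym (ℕₚ.*-distribˡ-+ 2 1 n))) (trans (sym (ℕₚ.*-assoc m/2 2 (suc n)))
        (ℕₚ.*-comm (m/2 * 2) (suc n)))

    regroup-≡ : c ⊖ a ≡ ℓ (suc n) ⊖ ℓ n
    regroup-≡ = lin 3 (λ a c s → ⊢ c :- a :≡ (c :- s) :- (a :- s)) a c (harmonic m)
    regroup : c ⊖ a ≼ ℓ (suc n) ⊖ ℓ n
    regroup = ≼-reflexive regroup-≡
    lower : inv (2 * n + 1) ⊕ inv (2 * n + 2) ≼ c ⊖ a
    lower = lin 5 (λ a b c s t → s :≤ b :- a ⇒ t :≤ c :- b ⇒ ⊢ s :+ t :≤ c :- a) a b c (inv (2 * n + 1))
        (inv (2 * n + 2))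
      (subst₂ (λ i z → inv i ≼ b ⊖ harmonic z) (ℕₚ.+-comm 1 (2 * n)) e₀
          (harmonic-block-lower m/2 (2 * n) 1≤m/2))
      (subst₂ (λ i z → inv i ≼ harmonic z ⊖ b) (ℕₚ.+-comm 2 (2 * n)) e₂
          (harmonic-block-lower m/2 (suc (2 * n)) 1≤m/2))
    upper : c ⊖ a ≼ inv (2 * n) ⊕ inv (2 * n + 1)
    upper = lin 5 (λ a b c s t → b :- a :≤ s ⇒ c :- b :≤ t ⇒ ⊢ c :- a :≤ s :+ t) a b c (inv (2 * n))
        (inv (2 * n + 1))
      (subst (λ z → b ⊖ harmonic z ≼ inv (2 * n)) e₀ (harmonic-block-upper m/2 (2 * n) 1≤m/2
          (ℕₚ.*-mono-≤ (s≤s (z≤n {1})) p)))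
      (subst₂ (λ z i → harmonic z ⊖ b ≼ inv i) e₂ (ℕₚ.+-comm 1 (2 * n))
          (harmonic-block-upper m/2 (suc (2 * n)) 1≤m/2 (s≤s z≤n)))

  -- m is so large that the additivity defect of H(nm) - H(m) is absorbed by the convexity of 1/t.

  margin : ∀ a n → a ≤ X → n < X → ι 2 ⊗ ι a ⊗ (ι X ⊗ inv m) ≼ inv (2 * n + 1)
  margin a n p q = lin 6 (λ a x i j k z → j :* k :≡ con 1 ⇒ z :≡ (con 2 :* (a :* x)) :* k ⇒ con 0 :≤ j :*
      (con 1 :- z :* i) ⇒ (con 2 :* a :* (x :* i)) :* (j :* k) :≡ (con 2 :* a :* (x :* i)) :* con 1 ⇒
      j :* (z :* i) :≡ j :* ((con 2 :* (a :* x)) :* k :* i) ⇒ ⊢ con 2 :* a :* (x :* i) :≤ j) (ι a) (ι X) (inv m)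
          (inv (2 * n + 1)) (ι (2 * n + 1)) (ι z)
    (inv-ι′ (2 * n + 1) (ℕₚ.m≤n+m 1 (2 * n))) z-≡ (⊗-nonneg (inv-nonneg (2 * n + 1) (ℕₚ.m≤n+m 1 (2 * n)))
        (0≼-gap small)) (cong ((ι 2 ⊗ ι a ⊗ (ι X ⊗ inv m)) ⊗_) (inv-ι′ (2 * n + 1) (ℕₚ.m≤n+m 1 (2 * n))))
        (cong (λ y → inv (2 * n + 1) ⊗ (y ⊗ inv m)) z-≡)
    where
    z = 2 * (a * X) * (2 * n + 1)
    z-≡ : ι z ≡ (ι 2 ⊗ (ι a ⊗ ι X)) ⊗ ι (2 * n + 1)
    z-≡ = trans (ι-* (2 * (a * X)) (2 * n + 1)) (cong (_⊗ ι (2 * n + 1))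
        (trans (ι-* 2 (a * X)) (cong (ι 2 ⊗_) (ι-* a X))))
    2n+1≤3X : 2 * n + 1 ≤ 3 * X
    2n+1≤3X = ℕₚ.≤-trans (ℕₚ.+-mono-≤ (ℕₚ.*-monoʳ-≤ 2 (ℕₚ.<⇒≤ q)) 1≤X) (ℕₚ.≤-reflexive (ℕₚ.+-comm (2 * X) X))
    z≤m : z ≤ m
    z≤m = ℕₚ.≤-trans (ℕₚ.*-mono-≤ (ℕₚ.*-monoʳ-≤ 2 (ℕₚ.*-monoˡ-≤ X p)) 2n+1≤3X)
        (ℕₚ.≤-reflexive (trans (ℕₚ.*-comm (2 * (X * X)) (3 * X))
        (trans (ℕₚ.*-assoc 3 X _) (trans (cong (3 *_) eq) (sym (ℕₚ.*-assoc 3 (X * X * X) 2))))))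
      where
      eq : X * (2 * (X * X)) ≡ X * X * X * 2
      eq = trans (cong (X *_) (ℕₚ.*-comm 2 (X * X))) (trans (sym (ℕₚ.*-assoc X (X * X) 2))
          (cong (_* 2) (sym (ℕₚ.*-assoc X X X))))
    small : ι z ⊗ inv m ≼ ι 1
    small = ≼-trans (⊗-monoʳ (inv-nonneg m 1≤m) (ι-mono z≤m)) (≼-reflexive (trans (⊗-comm _ _) (inv-ι′ m 1≤m)))

  isLog : IsLog X L
  isLog = record { L-* = additive-* ; L-upper = upper ; L-lower = lower }
    where
    ι2n+ : ∀ n k → ι (2 * n + k) ≡ ι 2 ⊗ ι n ⊕ ι k
    ι2n+ n k = trans (ι-+ (2 * n) k) (cong (_⊕ ι k) (ι-* 2 n))
    upper : ∀ n → 1 ≤ n → n < X → (L (suc n) ⊖ L n) ⊗ ι n ≼ ι 1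
    upper n p q = lin 8 (λ l l′ e e′ n η i j → l′ :≤ e′ ⇒ e :≤ l :+ η ⇒ con 0 :≤ n :*
        ((e′ :- e :+ η) :- (l′ :- l)) ⇒ con 0 :≤ n :* (i :+ j :- (e′ :- e)) ⇒ i :* (con 2 :* n) :≡ con 1 ⇒ j :*
        (con 2 :* n :+ con 1) :≡ con 1 ⇒ con 2 :* n :* η :≤ j ⇒ ⊢ (l′ :- l) :* n :≤ con 1)
      (L n) (L (suc n)) (ℓ n) (ℓ (suc n)) (ι n) (ι X ⊗ inv m) (inv (2 * n)) (inv (2 * n + 1))
          (L≼ℓ (suc n) (s≤s z≤n)) (ℓ≼L n p (ℕₚ.<⇒≤ q))
      (⊗-nonneg (0≼ι n) (lin 5 (λ l l′ e e′ η → l′ :≤ e′ ⇒ e :≤ l :+ η ⇒ ⊢ con 0 :≤ (e′ :- e :+ η) :- (l′ :- l))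
          _ _ _ _ _ (L≼ℓ (suc n) (s≤s z≤n)) (ℓ≼L n p (ℕₚ.<⇒≤ q))))
      (⊗-nonneg (0≼ι n) (0≼-gap (proj₂ (ℓ-step n p)))) (subst (λ z → inv (2 * n) ⊗ z ≡ ι 1) (ι-* 2 n)
          (inv-ι′ (2 * n) (ℕₚ.*-mono-≤ (s≤s (z≤n {1})) p)))
      (subst (λ z → inv (2 * n + 1) ⊗ z ≡ ι 1) (ι2n+ n 1) (inv-ι′ (2 * n + 1) (ℕₚ.m≤n+m 1 (2 * n))))
          (margin n n (ℕₚ.<⇒≤ q) q)
    lower : ∀ n → 1 ≤ n → n < X → ι 1 ≼ (L (suc n) ⊖ L n) ⊗ ι (suc n)
    lower n p q = lin 9 (λ l l′ e e′ n′ η i j n → con 0 :≤ n′ :* ((l′ :- l) :- (e′ :- e :- η)) ⇒ con 0 :≤ n′ :*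
        ((e′ :- e) :- (j :+ i)) ⇒ n′ :≡ n :+ con 1 ⇒ n′ :* j :≡ (n :+ con 1) :* j ⇒ n′ :* i :≡ (n :+ con 1) :* i
        ⇒ i :* (con 2 :* n :+ con 2) :≡ con 1 ⇒ j :* (con 2 :* n :+ con 1) :≡ con 1 ⇒ con 2 :* n′ :* η :≤ j ⇒ ⊢
        con 1 :≤ (l′ :- l) :* n′)
      (L n) (L (suc n)) (ℓ n) (ℓ (suc n)) (ι (suc n)) (ι X ⊗ inv m) (inv (2 * n + 2)) (inv (2 * n + 1)) (ι n)
      (⊗-nonneg (0≼ι (suc n)) (lin 5 (λ l l′ e e′ η → l :≤ e ⇒ e′ :≤ l′ :+ η ⇒ ⊢ con 0 :≤ (l′ :- l) :-
          (e′ :- e :- η)) _ _ _ _ _ (L≼ℓ n p) (ℓ≼L (suc n) (s≤s z≤n) q)))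
      (⊗-nonneg (0≼ι (suc n)) (0≼-gap (proj₁ (ℓ-step n p)))) (ι-suc n) (cong (_⊗ inv (2 * n + 1)) (ι-suc n))
          (cong (_⊗ inv (2 * n + 2)) (ι-suc n))
      (subst (λ z → inv (2 * n + 2) ⊗ z ≡ ι 1) (ι2n+ n 2) (inv-ι′ (2 * n + 2)
          (ℕₚ.≤-trans (s≤s z≤n) (ℕₚ.m≤n+m 2 (2 * n))))) (subst (λ z → inv (2 * n + 1) ⊗ z ≡ ι 1) (ι2n+ n 1)
          (inv-ι′ (2 * n + 1) (ℕₚ.m≤n+m 1 (2 * n)))) (margin (suc n) n q q)

-- From prime powers to primes

πQ : ℕ → Q
πQ x = ∑ x (λ p → 𝟙 (prime? p))

πχ : ℕ → Q
πχ x = ∑ x (λ p → 𝟙 (prime? p) ⊗ χ p)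

πχ-bound : ∀ x → ∥ πχ x ∥ ≼ πQ x
πχ-bound x = ≼-trans (∥∑∥ x _) (∑-mono x (λ p _ _ → ≼-trans (≼-reflexive (∥∥-⊗ _ _))
    (≼-trans (⊗-monoˡ (0≼∥∥ _) (χ-bound p)) (≼-reflexive (trans (⊗-identityʳ _)
    (∥∥-nonneg (𝟙-nonneg (prime? p))))))))

∑𝟙≤ : ∀ n s → ∑ n (λ p → 𝟙 (p ≤? s)) ≼ ι s
∑𝟙≤ n s with ℕₚ.≤-total n s
... | inj₁ h = ≼-trans (∑-mono n (λ p _ _ → 𝟙-≼1 (p ≤? s))) (≼-trans (≼-reflexive (∑-ones n)) (ι-mono h))
... | inj₂ h = ≼-trans (≼-reflexive (trans (∑-cong′ n (λ p → sym (⊗-identityʳ _)))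
    (trans (∑-cut n (λ _ → ι 1) h) (∑-ones s)))) ≼-refl

module PrimeSums {x : ℕ} {L : ℕ → Q} (isLog : IsLog x L) (1≤x : 1 ≤ x) (3≤x : 3 ≤ x) where
  open Contract isLog 1≤x 3≤x

  0≼Lx : ι 0 ≼ L x
  0≼Lx = L-nonneg x 1≤x ℕₚ.≤-refl

  -- The count is bounded by an actual exponent instead of the quotient `log x / log p`: `p ^ j ≤ x`
  -- yields `j L p ≤ L x` by additivity.
  power-count : ∀ p n → 1 ≤ p → p ≤ x → ∃ λ j → p ^ j ≤ x × ∑ n (λ j → 𝟙 (p ^ j ≤? x)) ≼ ι j
  power-count p zero    1≤p le = 0 , 1≤x , ≼-refl
  power-count p (suc n) 1≤p le with p ^ suc n ≤? x
  ... | yes h = suc n , h , ≼-trans (∑-mono (suc n) (λ j _ _ → 𝟙-≼1 (p ^ j ≤? x)))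
      (≼-reflexive (∑-ones (suc n)))
  ... | no ¬h with power-count p n 1≤p le
  ...   | j , a , b = j , a , (cong (∑ n (λ j → 𝟙 (p ^ j ≤? x)) ⊕_) (𝟙-no (p ^ suc n ≤? x) ¬h) ≡≼ ⊕-identityʳ _
      ≡≼ b)

  power-weight : ∀ p → 1 ≤ p → p ≤ x → weight p ⊗ ∑ x (λ j → 𝟙 (p ^ j ≤? x)) ≼ 𝟙 (prime? p) ⊗ L x
  power-weight p 1≤p le = let j , a , b = power-count p x 1≤p le in
    ≼-trans (≼-reflexive (⊗-assoc _ _ _)) (⊗-monoˡ (𝟙-nonneg (prime? p))
      (≼-trans (⊗-monoˡ (L-nonneg p 1≤p le) b) (≼-trans (≼-reflexive (trans (⊗-comm _ _) (sym (L-^ p j 1≤p))))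
          (L-mono (p ^ j) x (^≥1 j 1≤p) a ℕₚ.≤-refl))))

  ψ≼πL : ψ x ≼ πQ x ⊗ L x
  ψ≼πL = ≼-trans (≼-reflexive (trans (sym (ψ-cut ℕₚ.≤-refl)) (Λ-sum (λ n → 𝟙 (n ≤? x)) (θ-supp ℕₚ.≤-refl))))
    (≼-trans (∑-mono x (λ p a b → power-weight p a b)) (≼-reflexive (∑-⊗ʳ x (L x) _)))

  θχ : ℕ → Q
  θχ y = ∑ y (λ p → weight p ⊗ χ p)

  -- Only primes with `p² ≤ x` have higher powers up to `x`, and all powers of one prime together
  -- contribute at most `log x`.
  R-θχ : ∀ s → (∀ p → p * p ≤ x → p ≤ s) → ∥ R x ⊖ θχ x ∥ ≼ ι s ⊗ L x
  R-θχ s root = ≼-trans (≼-reflexive (cong ∥_∥ difference)) (≼-trans (∥∑∥ x _) (≼-trans (∑-mono x bound)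
      (≼-trans (≼-reflexive (∑-⊗ʳ x (L x) _)) (⊗-monoʳ 0≼Lx (∑𝟙≤ x s)))))
    where
    higher : ℕ → Q
    higher p = ∑ x (λ j → 𝟙 (p ^ j ≤? x) ⊗ χ (p ^ j)) ⊖ χ p
    difference : R x ⊖ θχ x ≡ ∑ x (λ p → weight p ⊗ higher p)
    difference = trans (cong (_⊖ θχ x) (trans (trans (sym (∑-cut x (λ n → χ n ⊗ Λ n) ℕₚ.≤-refl))
        (∑-cong′ x (λ n → lin 3 (λ a b c → ⊢ a :* (b :* c) :≡ c :* (a :* b)) (𝟙 (n ≤? x)) (χ n) (Λ n))))
        (Λ-sum (λ n → 𝟙 (n ≤? x) ⊗ χ n) (λ n lt → trans (cong (_⊗ χ n) (𝟙-no (n ≤? x) (ℕₚ.<⇒≱ lt)))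
            (⊗-zeroˡ _)))))
      (trans (sym (∑-⊖ x _ _)) (∑-cong′ x (λ p → lin 3 (λ a b c → ⊢ a :* b :- a :* c :≡ a :* (b :- c))
          (weight p) _ (χ p))))
    higher-≡ : ∀ p → p ≤ x → ∀ Z → Z ≡ x → 1 ≤ Z → ∃ λ Y → Z ≡ suc Y ×
        (∑ Z (λ j → 𝟙 (p ^ j ≤? x) ⊗ χ (p ^ j)) ⊖ χ p ≡ ∑ Y (λ j → 𝟙 (p ^ suc j ≤? x) ⊗ χ (p ^ suc j)))
    higher-≡ p le (suc Y) _ _ = Y , refl , trans (cong (_⊖ χ p) (∑-split 1 Y _))
        (trans (cong (λ z → (ι 0 ⊕ z) ⊕ rest ⊖ χ p) first) (lin 2 (λ a b → ⊢ (con 0 :+ a) :+ b :- a :≡ b) (χ p)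
        rest))
      where
      rest : Q
      rest = ∑ Y (λ j → 𝟙 (p ^ suc j ≤? x) ⊗ χ (p ^ suc j))
      first : 𝟙 (p ^ 1 ≤? x) ⊗ χ (p ^ 1) ≡ χ p
      first = trans (cong₂ _⊗_ (𝟙-yes (p ^ 1 ≤? x) (subst (_≤ x) (sym (ℕₚ.*-identityʳ p)) le))
          (cong χ (ℕₚ.*-identityʳ p))) (⊗-identityˡ _)
    higher-bound : ∀ p → 1 ≤ p → p ≤ x → ∥ higher p ∥ ≼ 𝟙 (p ≤? s) ⊗ ∑ x (λ j → 𝟙 (p ^ j ≤? x))
    higher-bound p 1≤p le with higher-≡ p le x refl 1≤x
    ... | Y , x≡ , eq = ≼-trans (≼-reflexive (cong ∥_∥ eq)) (≼-trans (∥∑∥ Y _)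
        (≼-trans (∑-mono Y (λ j a _ → each j a)) (≼-trans (≼-reflexive (∑-⊗ˡ Y (𝟙 (p ≤? s)) _))
        (⊗-monoˡ (𝟙-nonneg (p ≤? s)) (∑-monoʳ _ Y≤x (λ j _ _ → 𝟙-nonneg (p ^ j ≤? x)))))))
      where
      Y≤x : Y ≤ x
      Y≤x = subst (Y ≤_) (sym x≡) (ℕₚ.n≤1+n Y)
      each : ∀ j → 1 ≤ j → ∥ 𝟙 (p ^ suc j ≤? x) ⊗ χ (p ^ suc j) ∥ ≼ 𝟙 (p ≤? s) ⊗ 𝟙 (p ^ j ≤? x)
      each j 1≤j with p ^ suc j ≤? x
      ... | yes h = ≼-trans (∥∥-contract _ (≼-trans (≼-reflexive (∥∥-nonneg (𝟙-nonneg (p ^ suc j ≤? x))))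
          (𝟙-≼1 (p ^ suc j ≤? x)))) (≼-trans (χ-bound (p ^ suc j))
            (≼-reflexive (sym (trans (cong₂ _⊗_ (𝟙-yes (p ≤? s) (root p (ℕₚ.≤-trans (ℕₚ.*-monoʳ-≤ p p≤p^j) h)))
                (𝟙-yes (p ^ j ≤? x) (ℕₚ.≤-trans (ℕₚ.m≤n*m (p ^ j) p {{>-nonZero 1≤p}}) h))) (⊗-identityˡ _)))))
        where
        p≤p^j : p ≤ p ^ j
        p≤p^j = subst (_≤ p ^ j) (ℕₚ.*-identityʳ p) (ℕₚ.^-monoʳ-≤ p {{>-nonZero 1≤p}} 1≤j)
      ... | no ¬h = ≼-trans (≼-reflexive (trans (cong ∥_∥ (trans
          (cong (_⊗ χ (p ^ suc j)) (𝟙-no (p ^ suc j ≤? x) ¬h)) (⊗-zeroˡ _))) (∥∥-nonneg ≼-refl)))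
          (⊗-nonneg (𝟙-nonneg (p ≤? s)) (𝟙-nonneg (p ^ j ≤? x)))
    bound : ∀ p → 1 ≤ p → p ≤ x → ∥ weight p ⊗ higher p ∥ ≼ 𝟙 (p ≤? s) ⊗ L x
    bound p a b = ≼-trans (≼-reflexive (trans (∥∥-⊗ _ _) (cong (_⊗ ∥ higher p ∥)
        (∥∥-nonneg (weight-nonneg p a b)))))
      (≼-trans (⊗-monoˡ (weight-nonneg p a b) (higher-bound p a b))
          (≼-trans (≼-reflexive (⊗-left-comm _ _ _)) (⊗-monoˡ (𝟙-nonneg (p ≤? s))
        (≼-trans (power-weight p a b) (≼-trans (⊗-monoʳ 0≼Lx (𝟙-≼1 (prime? p)))
            (≼-reflexive (⊗-identityˡ _)))))))

  -- Primes beyond `2 ^ (2 * T)` have `Λ p ≥ T`, so Chebyshev's bound makes them rare. This is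
  -- `π(y) = o(y)`, as partial summation requires.
  π-sparse : ∀ T y → 1 ≤ T → 2 ^ (2 * T) ≤ x → y ≤ x → ι T ⊗ πQ y ≼ ι T ⊗ ι (2 ^ (2 * T)) ⊕ ι 6 ⊗ ι y
  π-sparse T y 1≤T big le = ≼-trans (≼-reflexive (sym (∑-⊗ˡ y (ι T) _))) (≼-trans (∑-mono y each)
      (≼-trans (≼-reflexive (∑-⊕ y _ _)) (⊕-mono (≼-trans (≼-reflexive (∑-⊗ˡ y (ι T) _))
          (⊗-monoˡ (0≼ι T) (∑𝟙≤ y w))) (ψ-upper y le))))
    where
    w = 2 ^ (2 * T)
    each : ∀ p → 1 ≤ p → p ≤ y → ι T ⊗ 𝟙 (prime? p) ≼ ι T ⊗ 𝟙 (p ≤? w) ⊕ Λ p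
    each p a b with ℕₚ.≤-total p w
    ... | inj₁ h = lin 4 (λ t i j l → con 0 :≤ t :* (con 1 :- i) ⇒ j :≡ con 1 ⇒ t :* j :≡ t :* con 1 ⇒ con 0 :≤
        l ⇒ ⊢ t :* i :≤ t :* j :+ l) (ι T) (𝟙 (prime? p)) (𝟙 (p ≤? w)) (Λ p)
                    (⊗-nonneg (0≼ι T) (0≼-gap (𝟙-≼1 (prime? p)))) (𝟙-yes (p ≤? w) h)
                        (cong (ι T ⊗_) (𝟙-yes (p ≤? w) h)) (Λ-nonneg p)
    ... | inj₂ h = ≼-trans weight-large (≼-trans weight≼Λ (lin 2 (λ a b → con 0 :≤ a ⇒ ⊢ b :≤ a :+ b) _ _
        (⊗-nonneg (0≼ι T) (𝟙-nonneg (p ≤? w)))))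
      where
      p≤x = ℕₚ.≤-trans b le
      weight-large : ι T ⊗ 𝟙 (prime? p) ≼ weight p
      weight-large = ≼-trans (≼-reflexive (⊗-comm _ _)) (⊗-monoˡ (𝟙-nonneg (prime? p)) (L-large T p h p≤x))
      weight≼Λ : weight p ≼ Λ p
      weight≼Λ = ≼-trans (≼-reflexive (sym (∑-δ x p weight a p≤x)))
          (∑-mono x (λ q c d → ≼-trans (≼-reflexive (⊗-comm _ _)) (⊗-monoˡ (weight-nonneg q c d) (term q))))
        where
        term : ∀ q → 𝟙 (q ≟ p) ≼ ∑ x (λ j → 𝟙 (p ≟ q ^ j))
        term q with q ≟ p
        ... | no ne    = ≼-trans (≼-reflexive (𝟙-no (q ≟ p) ne)) (∑-nonneg x (λ j _ _ → 𝟙-nonneg (p ≟ q ^ j)))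
        ... | yes refl = ≼-trans (𝟙-≼1 (q ≟ q)) (≼-trans (≼-reflexive
            (sym (trans (⊕-identityˡ _) (𝟙-yes (q ≟ q ^ 1) (sym (ℕₚ.*-identityʳ q))))))
                           (∑-monoʳ _ 1≤x (λ j _ _ → 𝟙-nonneg (q ≟ q ^ j))))

  -- Partial summation: L(y) πχ(y) - θχ(y) = Σ_{n<y} πχ(n) (L(n+1) - L(n))

  LS-θχ : ∀ T y → 1 ≤ T → 2 ^ (2 * T) ≤ x → 1 ≤ y → y ≤ x → ι T ⊗ ∥ L y ⊗ πχ y ⊖ θχ y ∥ ≼ ι T ⊗ ι (2 ^ (2 * T))
      ⊗ L y ⊕ ι 6 ⊗ ι y
  LS-θχ T (suc zero) 1≤T big _ le = ≼-trans (≼-reflexive (trans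
      (cong (λ z → ι T ⊗ ∥ z ∥) (lin 3 (λ l a c → ⊢ l :* (con 0 :+ a :* c) :- (con 0 :+ a :* l :* c) :≡ con 0)
      (L 1) (𝟙 (prime? 1)) (χ 1))) (trans (cong (ι T ⊗_) (∥∥-nonneg ≼-refl)) (⊗-zeroʳ _))))
    (lin 2 (λ a b → con 0 :≤ a ⇒ con 0 :≤ b ⇒ ⊢ con 0 :≤ a :+ b) _ _
        (⊗-nonneg (⊗-nonneg (0≼ι T) (0≼ι _)) (L-nonneg 1 ℕₚ.≤-refl 1≤x)) (⊗-nonneg (0≼ι 6) (0≼ι 1)))
  LS-θχ T (suc (suc n)) 1≤T big _ le = step (suc n) (s≤s z≤n) le (LS-θχ T (suc n) 1≤T big (s≤s z≤n) (ℕₚ.<⇒≤ le))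
    where
    step : ∀ y → 1 ≤ y → suc y ≤ x → ι T ⊗ ∥ L y ⊗ πχ y ⊖ θχ y ∥ ≼ ι T ⊗ ι (2 ^ (2 * T)) ⊗ L y ⊕ ι 6 ⊗ ι y → ι T
        ⊗ ∥ L (suc y) ⊗ πχ (suc y) ⊖ θχ (suc y) ∥ ≼ ι T ⊗ ι (2 ^ (2 * T)) ⊗ L (suc y) ⊕ ι 6 ⊗ ι (suc y)
    step y 1≤y le ih = ≼-trans (⊗-monoˡ (0≼ι T) (≼-trans (≼-reflexive
        (cong ∥_∥ (lin 6 (λ l l′ s a c t → ⊢ l′ :* (s :+ a :* c) :- (t :+ a :* l′ :* c) :≡ (l :* s :- t) :+
        (l′ :- l) :* s) (L y) (L (suc y)) (πχ y) (𝟙 (prime? (suc y))) (χ (suc y)) (θχ y))))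
        (≼-trans (∥∥-triangle _ _) (⊕-mono ≼-refl (≼-trans (≼-reflexive
            (trans (∥∥-⊗ _ _) (cong (_⊗ ∥ πχ y ∥) (∥∥-nonneg 0≼Δ)))) (⊗-monoˡ 0≼Δ (πχ-bound y)))))))
      (lin 9 (λ t a d p w l l′ y y′ → t :* a :≤ t :* w :* l :+ con 6 :* y ⇒ d :≡ l′ :- l ⇒ con 0 :≤ d :*
          (t :* w :+ con 6 :* y :- t :* p) ⇒ d :* y :≤ con 1 ⇒ y′ :≡ y :+ con 1 ⇒ t :* w :* d :≡ t :* w :*
          (l′ :- l) ⇒ ⊢ t :* (a :+ d :* p) :≤ t :* w :* l′ :+ con 6 :* y′)
        (ι T) (∥ L y ⊗ πχ y ⊖ θχ y ∥) Δ (πQ y) (ι (2 ^ (2 * T))) (L y) (L (suc y)) (ι y) (ι (suc y)) ih refl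
            (⊗-nonneg 0≼Δ (0≼-gap (π-sparse T y 1≤T big (ℕₚ.<⇒≤ le)))) (L-upper y 1≤y le) (ι-suc y) refl)
      where
      Δ : Q
      Δ = L (suc y) ⊖ L y
      0≼Δ : ι 0 ≼ Δ
      0≼Δ = 0≼-gap (L-suc-≼ y 1≤y le)

  -- `x ≤ 16 r⁴` gives `log x ≤ 4 log r + 15`, and the tangent bound `N log r ≤ r + N²` absorbs the
  -- factor `N` once `r` is large.
  L≤root : ∀ N r → 1 ≤ N → 4 * (N * N) + 15 * N ≤ r → 1 ≤ r → r ^ 4 ≤ x → x < suc r ^ 4 → ι N ⊗ L x ≼ ι 5 ⊗ ι r
  L≤root N r 1≤N big 1≤r lo hi = lin 6 (λ n lx lr l₄ r nn → con 0 :≤ n :* (con 15 :- (lx :- l₄)) ⇒ l₄ :≡ con 4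
      :* lr ⇒ n :* l₄ :≡ n :* (con 4 :* lr) ⇒ n :* lr :≤ r :+ nn ⇒ con 4 :* nn :+ con 15 :* n :≤ r ⇒ ⊢ n :* lx
      :≤ con 5 :* r)
      (ι N) (L x) (L r) (L (r ^ 4)) (ι r) (ι N ⊗ ι N) (⊗-nonneg (0≼ι N) (0≼-gap jump)) (L-^ r 4 1≤r)
          (cong (ι N ⊗_) (L-^ r 4 1≤r)) (L-small N r 1≤N N≤r r≤x)
      (subst (_≼ ι r) (trans (ι-+ (4 * (N * N)) (15 * N)) (cong₂ _⊕_
          (trans (ι-* 4 (N * N)) (cong (ι 4 ⊗_) (ι-* N N))) (ι-* 15 N))) (ι-mono big))
    where
    N≤r : N ≤ r
    N≤r = ℕₚ.≤-trans (ℕₚ.≤-trans (ℕₚ.m≤n*m N 15) (ℕₚ.m≤n+m _ (4 * (N * N)))) big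
    r≤x : r ≤ x
    r≤x = ℕₚ.≤-trans (≤^4 1≤r) lo
    v = r ^ 4
    sucr≤2r : suc r ≤ 2 * r
    sucr≤2r = ℕₚ.≤-trans (ℕₚ.+-monoˡ-≤ r 1≤r) (ℕₚ.+-monoʳ-≤ r (ℕₚ.m≤m+n r 0))
    jump : L x ⊖ L v ≼ ι 15
    jump = ⊗-cancel-≼ v (^≥1 4 1≤r) (lin 3 (λ d v x → d :* v :≤ x :- v ⇒ x :≤ con 16 :* v ⇒ ⊢ v :* d :≤ v :* con
        15) (L x ⊖ L v) (ι v) (ι x) (L-diff-≼ v x (^≥1 4 1≤r) lo ℕₚ.≤-refl)
      (subst (ι x ≼_) (ι-* 16 v) (ι-mono (ℕₚ.≤-trans (ℕₚ.<⇒≤ hi)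
          (ℕₚ.≤-trans (^4-mono sucr≤2r) (ℕₚ.≤-reflexive (*-^ 2 r 4)))))))

  -- 4 r ((r+1)² + 1) counts the prime powers with exponent at least two, generously.

  discrepancy : ∀ Z r → 1 ≤ Z → 4 * (2000 * Z * (2000 * Z)) + 15 * (2000 * Z) ≤ r → 2 ^ (2 * (48 * Z)) + 5 ≤ r →
      r ^ 4 ≤ x → x < suc r ^ 4 →
    ι (8 * Z) ⊗ ∥ R x ∥ ≼ ι x → ι 1 ≼ L x → ι Z ⊗ (∥ πχ x ∥ ⊕ ι 5 ⊕ ι 2 ⊗ ι (4 * r * (suc r * suc r + 1))) ≼ πQ
        x
  discrepancy Z r 1≤Z big₁ big₂ lo hi R-bnd 1≼L = cancel-≼ 1≼L (cancel-≼ 1≼1000 final)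
    where
    -- After multiplication by `log x`, the right side is at least about `x/2` by Chebyshev. On the
    -- left, the bound for `R` contributes `x/8` and `π-sparse` contributes `6x/48`; the other
    -- errors amount to fewer than 50 multiples of `Z q`, each at most `5x/2000`.
    N = 2000 * Z
    T₀ = 48 * Z
    w = 2 ^ (2 * T₀)
    1≤N : 1 ≤ N
    1≤N = ℕₚ.*-mono-≤ (s≤s (z≤n {1999})) 1≤Z
    1≤T : 1 ≤ T₀
    1≤T = ℕₚ.*-mono-≤ (s≤s (z≤n {47})) 1≤Z
    w≤x : w ≤ x
    1≤r : 1 ≤ r
    1≤r = ℕₚ.≤-trans (ℕₚ.≤-trans (s≤s z≤n) (ℕₚ.m≤n+m 5 w)) big₂
    w≤x = ℕₚ.≤-trans (ℕₚ.≤-trans (ℕₚ.m≤m+n w 5) big₂) (ℕₚ.≤-trans (≤^4 1≤r) lo)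
    1≼1000 : ι 1 ≼ ι 1000
    1≼1000 = ι-mono (s≤s z≤n)
    s = suc r * suc r
    root : ∀ p → p * p ≤ x → p ≤ s
    root p h with ℕₚ.≤-total p s
    ... | inj₁ q = q
    ... | inj₂ q = contradiction hi (ℕₚ.≤⇒≯ (ℕₚ.≤-trans (ℕₚ.≤-reflexive
        (trans (cong (suc r *_) (cong (suc r *_) (cong (suc r *_) (ℕₚ.*-identityʳ (suc r)))))
        (sym (ℕₚ.*-assoc (suc r) (suc r) (suc r * suc r))))) (ℕₚ.≤-trans (ℕₚ.*-mono-≤ q q) h)))
    -- `r³ log x` majorises the lower-order errors up to constants, and is itself `o(x)` because
    -- `r⁴ ≤ x` and `log x = o(r)`.
    q : Q
    q = ι r ⊗ (ι r ⊗ (ι r ⊗ L x))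
    a b c : Q
    a = ∥ πχ x ∥ ⊗ L x
    b = ∥ θχ x ∥
    c = ∥ R x ∥
    0≼r-1 : ι 0 ≼ ι r ⊖ ι 1
    0≼r-1 = 0≼-gap (1≼ι 1≤r)
    rL : ι r ⊗ L x ≼ q
    rL = lin 2 (λ r l → con 0 :≤ (r :- con 1) :* (r :* l) ⇒ con 0 :≤ (r :- con 1) :* (r :* (r :* l)) ⇒ ⊢ r :* l
        :≤ r :* (r :* (r :* l))) (ι r) (L x)
      (⊗-nonneg 0≼r-1 (⊗-nonneg (0≼ι r) 0≼Lx)) (⊗-nonneg 0≼r-1 (⊗-nonneg (0≼ι r) (⊗-nonneg (0≼ι r) 0≼Lx)))
    w5 : (ι w ⊕ ι 5) ⊗ L x ≼ q
    w5 = ≼-trans (⊗-monoʳ 0≼Lx (subst (_≼ ι r) (ι-+ w 5) (ι-mono big₂))) rL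
    sL : ι s ⊗ L x ≼ ι 4 ⊗ q
    sL = lin 3 (λ r l k → k :≡ (r :+ con 1) :* (r :+ con 1) ⇒ k :* l :≡ (r :+ con 1) :* (r :+ con 1) :* l ⇒ r :*
        l :≤ r :* (r :* (r :* l)) ⇒ con 0 :≤ (r :- con 1) :* (r :* (r :* l)) ⇒ con 0 :≤ (r :- con 1) :* l ⇒ ⊢ k
        :* l :≤ con 4 :* (r :* (r :* (r :* l))))
      (ι r) (L x) (ι s) s-≡ (cong (_⊗ L x) s-≡) rL (⊗-nonneg 0≼r-1 (⊗-nonneg (0≼ι r) (⊗-nonneg (0≼ι r) 0≼Lx)))
          (⊗-nonneg 0≼r-1 0≼Lx)
      where
      s-≡ : ι s ≡ (ι r ⊕ ι 1) ⊗ (ι r ⊕ ι 1)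
      s-≡ = trans (ι-* (suc r) (suc r)) (cong₂ _⊗_ (ι-suc r) (ι-suc r))
    powers : ι (4 * r * (s + 1)) ⊗ L x ≼ ι 20 ⊗ q
    powers = ≼-trans (≼-reflexive (trans (cong (_⊗ L x) eq) (lin 3
        (λ r t l → ⊢ (con 4 :* r) :* t :* l :≡ con 4 :* (r :* (t :* l))) (ι r) (ι (s + 1)) (L x))))
      (≼-trans (⊗-monoˡ (0≼ι 4) (⊗-monoˡ (0≼ι r) five)) (≼-reflexive
          (lin 2 (λ r l → ⊢ con 4 :* (r :* (con 5 :* (r :* (r :* l)))) :≡ con 20 :* (r :* (r :* (r :* l))))
          (ι r) (L x))))
      where
      eq : ι (4 * r * (s + 1)) ≡ (ι 4 ⊗ ι r) ⊗ ι (s + 1)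
      eq = trans (ι-* (4 * r) (s + 1)) (cong (_⊗ ι (s + 1)) (ι-* 4 r))
      t-≡ : ι (s + 1) ≡ (ι r ⊕ ι 1) ⊗ (ι r ⊕ ι 1) ⊕ ι 1
      t-≡ = trans (ι-+ s 1) (cong (_⊕ ι 1) (trans (ι-* (suc r) (suc r)) (cong₂ _⊗_ (ι-suc r) (ι-suc r))))
      five : ι (s + 1) ⊗ L x ≼ ι 5 ⊗ (ι r ⊗ (ι r ⊗ L x))
      five = cong (_⊗ L x) t-≡ ≡≼ lin 2 (λ r l → con 0 :≤ (r :- con 1) :* (r :* l) ⇒ con 0 :≤ (r :- con 1) :* l
          ⇒ ⊢ ((r :+ con 1) :* (r :+ con 1) :+ con 1) :* l :≤ con 5 :* (r :* (r :* l))) (ι r) (L x)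
        (⊗-nonneg 0≼r-1 (⊗-nonneg (0≼ι r) 0≼Lx)) (⊗-nonneg 0≼r-1 0≼Lx)
    q-small : ι 2000 ⊗ ι Z ⊗ q ≼ ι 5 ⊗ ι x
    q-small = ≼-trans (≼-trans (≼-reflexive (lin 3 (λ n r l → ⊢ n :* (r :* (r :* (r :* l))) :≡ r :*
        (r :* (r :* (n :* l)))) (ι 2000 ⊗ ι Z) (ι r) (L x)))
        (⊗-monoˡ (0≼ι r) (⊗-monoˡ (0≼ι r) (⊗-monoˡ (0≼ι r) (subst (λ z → z ⊗ L x ≼ ι 5 ⊗ ι r) (ι-* 2000 Z)
            (L≤root N r 1≤N big₁ 1≤r lo hi))))))
      (≼-trans (≼-reflexive (lin 1 (λ r → ⊢ r :* (r :* (r :* (con 5 :* r))) :≡ con 5 :*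
          (r :* (r :* (r :* (r :* con 1))))) (ι r))) (⊗-monoˡ (0≼ι 5) (subst (_≼ ι x) r⁴ (ι-mono lo))))
      where
      r⁴ : ι (r ^ 4) ≡ ι r ⊗ (ι r ⊗ (ι r ⊗ (ι r ⊗ ι 1)))
      r⁴ = trans (ι-* r _) (cong (ι r ⊗_) (trans (ι-* r _) (cong (ι r ⊗_)
          (trans (ι-* r _) (cong (ι r ⊗_) (ι-* r 1))))))
    θ-bound : b ≼ c ⊕ ι 4 ⊗ q
    θ-bound = ≼-trans (≼-trans (≼-reflexive (cong ∥_∥ (lin 2 (λ t r → ⊢ t :≡ r :- (r :- t)) (θχ x) (R x))))
        (∥∥-⊖ _ _)) (⊕-mono ≼-refl (≼-trans (R-θχ s root) sL))
    πχ-split : ι 48 ⊗ ι Z ⊗ a ≼ ι 48 ⊗ ι Z ⊗ (q ⊕ b) ⊕ ι 6 ⊗ ι x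
    πχ-split = lin 7 (λ t a d b q e x → a :≤ d :+ b ⇒ con 0 :≤ t :* (d :+ b :- a) ⇒ t :* d :≤ e :+ con 6 :* x ⇒
        e :≤ t :* q ⇒ ⊢ t :* a :≤ t :* (q :+ b) :+ con 6 :* x) (ι 48 ⊗ ι Z) a d b q (ι T₀ ⊗ ι w ⊗ L x) (ι x)
        triangle (⊗-nonneg 0≼t (0≼-gap triangle)) (subst (λ z → z ⊗ d ≼ ι T₀ ⊗ ι w ⊗ L x ⊕ ι 6 ⊗ ι x) (ι-* 48 Z)
            (LS-θχ T₀ x 1≤T w≤x 1≤x ℕₚ.≤-refl))
        (≼-trans (≼-reflexive (trans (⊗-assoc _ _ _) (cong (_⊗ (ι w ⊗ L x)) (ι-* 48 Z))))
            (⊗-monoˡ 0≼t (≼-trans (lin 2 (λ w l → con 0 :≤ l ⇒ ⊢ w :* l :≤ (w :+ con 5) :* l) (ι w) (L x) 0≼Lx)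
            w5)))
      where
      0≼t : ι 0 ≼ ι 48 ⊗ ι Z
      0≼t = ⊗-nonneg (0≼ι 48) (0≼ι Z)
      d = ∥ L x ⊗ πχ x ⊖ θχ x ∥
      triangle : a ≼ d ⊕ b
      triangle = ≼-trans (≼-reflexive (trans (sym (trans (∥∥-⊗ _ _)
          (trans (cong (_⊗ ∥ πχ x ∥) (∥∥-nonneg 0≼Lx)) (⊗-comm _ _))))
          (cong ∥_∥ (lin 2 (λ l t → ⊢ l :≡ (l :- t) :+ t) (L x ⊗ πχ x) (θχ x))))) (∥∥-triangle _ _)
    final : ι 1000 ⊗ (L x ⊗ (ι Z ⊗ (∥ πχ x ∥ ⊕ ι 5 ⊕ ι 2 ⊗ ι (4 * r * (s + 1))))) ≼ ι 1000 ⊗ (L x ⊗ πQ x)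
    final = lin 11 (λ z l sx k p a b c q x f → a :≡ sx :* l ⇒ z :* a :≡ z :* (sx :* l) ⇒ con 48 :* z :* a :≤ con
        48 :* z :* (q :+ b) :+ con 6 :* x ⇒ con 0 :≤ z :* (c :+ con 4 :* q :- b) ⇒ con 8 :* z :* c :≤ x ⇒ con
        2000 :* z :* q :≤ con 5 :* x ⇒
        con 0 :≤ z :* (con 20 :* q :- k :* l) ⇒ con 0 :≤ z :* (q :- con 5 :* l) ⇒ x :≤ con 2 :* f :+ con 4 :* l
            :+ con 4 ⇒ f :≤ p :* l ⇒ con 1 :≤ l ⇒ con 5 :* l :≤ q ⇒ con 0 :≤ (z :- con 1) :* q ⇒
        ⊢ con 1000 :* (l :* (z :* (sx :+ con 5 :+ con 2 :* k))) :≤ con 1000 :* (l :* p))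
      (ι Z) (L x) (∥ πχ x ∥) (ι (4 * r * (s + 1))) (πQ x) a b c q (ι x) (ψ x)
      refl refl πχ-split (⊗-nonneg (0≼ι Z) (0≼-gap θ-bound)) (subst (λ z → z ⊗ c ≼ ι x) (ι-* 8 Z) R-bnd) q-small
      (⊗-nonneg (0≼ι Z) (0≼-gap powers)) (⊗-nonneg (0≼ι Z) (0≼-gap 5L)) (ψ-lower x 2≤x ℕₚ.≤-refl) ψ≼πL 1≼L 5L
          (⊗-nonneg (0≼-gap (1≼ι 1≤Z)) 0≼q)
      where
      2≤x = ℕₚ.≤-trans (s≤s (s≤s z≤n)) 3≤x
      5L : ι 5 ⊗ L x ≼ q
      5L = ≼-trans (lin 2 (λ w l → con 0 :≤ w :* l ⇒ ⊢ con 5 :* l :≤ (w :+ con 5) :* l) (ι w) (L x)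
          (⊗-nonneg (0≼ι w) 0≼Lx)) w5
      0≼q : ι 0 ≼ q
      0≼q = ⊗-nonneg (0≼ι r) (⊗-nonneg (0≼ι r) (⊗-nonneg (0≼ι r) 0≼Lx))

-- Each `x` is treated with the logarithm constructed for `X = x`, so the uniformity of `R-small`
-- enters here. The witness `r` is the integral fourth root of `x`.
prime-race : ∀ Z → 1 ≤ Z → ∃ λ x₀ → ∀ x → x₀ ≤ x → ∃ λ r → x < suc r ^ 4 × ι Z ⊗
    (∥ πχ x ∥ ⊕ ι 5 ⊕ ι 2 ⊗ ι (4 * r * (suc r * suc r + 1))) ≼ πQ x
prime-race Z 1≤Z = let x₁ , small = R-small (8 * Z) (ℕₚ.*-mono-≤ (s≤s (z≤n {7})) 1≤Z) in x₁ + (suc r₀ ^ 4 + 4) , conclude x₁ small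
  where
  r₁ r₂ r₀ : ℕ
  r₁ = 4 * (2000 * Z * (2000 * Z)) + 15 * (2000 * Z)
  r₂ = 2 ^ (2 * (48 * Z)) + 5
  r₀ = r₁ + r₂
  conclude : ∀ x₁ → (∀ {X L} (isLog : IsLog X L) → 3 ≤ X → ∀ x → x₁ ≤ x → x ≤ X → ι (8 * Z) ⊗ ∥ R-of isLog x ∥ ≼
      ι x) → ∀ x → x₁ + (suc r₀ ^ 4 + 4) ≤ x →
    ∃ λ r → x < suc r ^ 4 × ι Z ⊗ (∥ πχ x ∥ ⊕ ι 5 ⊕ ι 2 ⊗ ι (4 * r * (suc r * suc r + 1))) ≼ πQ x
  conclude x₁ small x h = finish (last-true (λ i → i ^ 4 ≤? x) z≤n (suc x)
      (λ q → ℕₚ.<⇒≱ (≤^4 (s≤s (z≤n {x}))) q))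
    where
    4≤x : 4 ≤ x
    4≤x = ℕₚ.≤-trans (ℕₚ.m≤n+m 4 (suc r₀ ^ 4)) (ℕₚ.≤-trans (ℕₚ.m≤n+m _ x₁) h)
    3≤x : 3 ≤ x
    3≤x = ℕₚ.≤-trans (ℕₚ.n≤1+n 3) 4≤x
    1≤x : 1 ≤ x
    1≤x = ℕₚ.≤-trans (s≤s z≤n) 4≤x
    r₀⁴≤x : suc r₀ ^ 4 ≤ x
    r₀⁴≤x = ℕₚ.≤-trans (ℕₚ.m≤m+n _ 4) (ℕₚ.≤-trans (ℕₚ.m≤n+m _ x₁) h)
    finish : (∃ λ i → i ^ 4 ≤ x × ¬ suc i ^ 4 ≤ x) → ∃ λ r → x < suc r ^ 4 × ι Z ⊗
        (∥ πχ x ∥ ⊕ ι 5 ⊕ ι 2 ⊗ ι (4 * r * (suc r * suc r + 1))) ≼ πQ x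
    finish (r , lo , ¬hi) = r , ℕₚ.≰⇒> ¬hi ,
      PrimeSums.discrepancy (Construct.isLog x 1≤x) 1≤x 3≤x Z r 1≤Z (ℕₚ.≤-trans (ℕₚ.m≤m+n r₁ r₂) r₀≤r)
          (ℕₚ.≤-trans (ℕₚ.m≤n+m r₂ r₁) r₀≤r) lo (ℕₚ.≰⇒> ¬hi)
        (small (Construct.isLog x 1≤x) 3≤x x (ℕₚ.≤-trans (ℕₚ.m≤m+n x₁ _) h) ℕₚ.≤-refl)
            (Windows.L-large (Construct.isLog x 1≤x) 1≤x 3≤x 1 x 4≤x ℕₚ.≤-refl)
      where
      r₀≤r : r₀ ≤ r
      r₀≤r = ℕₚ.≤-pred (ℕₚ.≰⇒≥ (λ q → ¬hi (ℕₚ.≤-trans (^4-mono q) r₀⁴≤x)))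

-- Euler's totient

count-applyUpTo : {A : ℕ → Set} (A? : ∀ n → Dec (A n)) (f : ℕ → ℕ) (n : ℕ) → ι
    (length (filter A? (applyUpTo f n))) ≡ ∑ n (λ i → 𝟙 (A? (f (pred i))))
count-applyUpTo A? f zero    = refl
count-applyUpTo A? f (suc n) = trans head-count (sym (∑-split 1 n _))
  where
  tail-count : ι (length (filter A? (applyUpTo (λ i → f (suc i)) n))) ≡ ∑ n (λ i → 𝟙 (A? (f (pred (1 + i)))))
  tail-count = trans (count-applyUpTo A? (λ i → f (suc i)) n) (∑-cong n (λ { (suc i) _ _ → refl }))
  head-count : ι (length (filter A? (f 0 ∷ applyUpTo (λ i → f (suc i)) n))) ≡ (ι 0 ⊕ 𝟙 (A? (f 0))) ⊕ ∑ n
      (λ i → 𝟙 (A? (f (pred (1 + i)))))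
  head-count with A? (f 0)
  ... | yes a = trans (ι-suc _) (trans (⊕-comm _ _) (cong₂ _⊕_ (sym (⊕-identityˡ _)) tail-count))
  ... | no ¬a = trans tail-count (trans (sym (⊕-identityˡ _)) (cong (_⊕ ∑ n (λ i → 𝟙 (A? (f (pred (1 + i))))))
      (sym (⊕-identityˡ (ι 0)))))

count-range : {A : ℕ → Set} (A? : ∀ n → Dec (A n)) (n : ℕ) → ι (length (filter A? (map suc (upTo n)))) ≡ ∑ n
    (λ i → 𝟙 (A? i))
count-range A? n = trans (cong (λ xs → ι (length (filter A? xs))) (map-upTo suc n))
    (trans (count-applyUpTo A? suc n) (∑-cong n (λ { (suc i) _ _ → refl })))

ι-φ : ∀ n → ι (φ n) ≡ ∑ n (λ k → 𝟙 (coprime? k n))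
ι-φ n = count-range (λ k → coprime? k n) n

ι-π : ∀ x → ι (π x) ≡ πQ x
ι-π x = trans (count-applyUpTo prime? (λ i → i) (suc x)) (trans (∑-split 1 x _)
    (trans (cong (λ z → (ι 0 ⊕ z) ⊕ ∑ x (λ i → 𝟙 (prime? i))) (𝟙-no (prime? 0) ¬prime[0]))
    (trans (cong (_⊕ πQ x) (⊕-identityˡ (ι 0))) (⊕-identityˡ _))))

ι-injective : ∀ {m n} → ι m ≡ ι n → m ≡ n
ι-injective e = ℕₚ.≤-antisym (ι-cancel (≼-reflexive e)) (ι-cancel (≼-reflexive (sym e)))

coprime-shift : ∀ j n k → 𝟙 (coprime? (j * n + k) n) ≡ 𝟙 (coprime? k n)
coprime-shift j n k = 𝟙-⇔ (coprime? (j * n + k) n) (coprime? k n)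
  (λ c (d₁ , d₂) → c (∣m∣n⇒∣m+n (∣n⇒∣m*n j d₂) d₁ , d₂)) (λ c (d₁ , d₂) → c (∣m+n∣m⇒∣n d₁ (∣n⇒∣m*n j d₂) , d₂))

coprime-periods : ∀ j n → ∑ (j * n) (λ k → 𝟙 (coprime? k n)) ≡ ι j ⊗ ι (φ n)
coprime-periods zero    n = sym (⊗-zeroˡ _)
coprime-periods (suc j) n = trans (cong (λ k → ∑ k (λ k → 𝟙 (coprime? k n))) (ℕₚ.+-comm n (j * n)))
    (trans (∑-split (j * n) n _)
  (trans (cong₂ _⊕_ (coprime-periods j n) (trans (∑-cong′ n (coprime-shift j n)) (sym (ι-φ n))))
      (trans (lin 2 (λ j f → ⊢ j :* f :+ f :≡ (j :+ con 1) :* f) (ι j) (ι (φ n)))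
      (cong (_⊗ ι (φ n)) (sym (ι-suc j))))))

coprime-*ʳ : ∀ {k m n} → Coprime k m → Coprime k n → Coprime k (m * n)
coprime-*ʳ c d (d₁ , d₂) = d (d₁ , Coprimality.coprime-divisor (λ (e₁ , e₂) → c (∣-trans e₁ d₁ , e₂)) d₂)

coprime-prime : ∀ {k p} → Prime p → p ∤ k → Coprime k p
coprime-prime pp nd (d₁ , d₂) with prime⇒irreducible pp d₂
... | inj₁ refl = refl
... | inj₂ refl = contradiction d₁ nd

-- Coprimality to `p * n` amounts to coprimality to `n`, and `[1, p n]` consists of `p` periods of
-- the latter.
φ-∣ : ∀ p n → Prime p → p ∣ n → φ (p * n) ≡ p * φ n
φ-∣ p n pp p∣n = ι-injective (trans (ι-φ (p * n)) (trans (∑-cong′ (p * n)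
    (λ k → 𝟙-⇔ (coprime? k (p * n)) (coprime? k n)
    (λ c (d₁ , d₂) → c (d₁ , ∣n⇒∣m*n p d₂)) (λ c → coprime-*ʳ (coprime-prime pp
        (λ p∣k → ¬prime[1] (subst Prime (c (p∣k , p∣n)) pp))) c)))
  (trans (coprime-periods p n) (sym (ι-* p (φ n))))))

-- From `p` periods of coprimality to `n` the multiples `j p` are removed. These are coprime to `n`
-- exactly when `j` is, so there are `φ n` of them.
φ-∤ : ∀ p n → Prime p → 1 ≤ n → p ∤ n → φ (p * n) ≡ pred p * φ n
φ-∤ zero      n pp 1≤n nd = contradiction pp ¬prime[0]
φ-∤ p@(suc q) n pp 1≤n nd = ι-injective (lin 4 (λ f g q pp → f :≡ (q :+ con 1) :* g :- g ⇒ pp :≡ q :* g ⇒ ⊢ f :≡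
    pp) (ι (φ (p * n))) (ι (φ n)) (ι q) (ι (q * φ n)) main (ι-* q (φ n)))
  where
  c : ℕ → Q
  c k = 𝟙 (coprime? k n)
  split : ∀ k → 𝟙 (coprime? k (p * n)) ≡ c k ⊖ 𝟙 (p ∣? k) ⊗ c k
  split k = go (p ∣? k)
    where
    go : Dec (p ∣ k) → 𝟙 (coprime? k (p * n)) ≡ c k ⊖ 𝟙 (p ∣? k) ⊗ c k
    go (yes d) = trans (𝟙-no (coprime? k (p * n)) (λ e → ¬prime[1] (subst Prime (e (d , m∣m*n n)) pp)))
      (sym (trans (cong (λ z → c k ⊖ z ⊗ c k) (𝟙-yes (p ∣? k) d))
          (lin 1 (λ a → ⊢ a :- con 1 :* a :≡ con 0) (c k))))
    go (no d)  = trans (𝟙-⇔ (coprime? k (p * n)) (coprime? k n) (λ e (d₁ , d₂) → e (d₁ , ∣n⇒∣m*n p d₂))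
        (coprime-*ʳ (coprime-prime pp d)))
      (sym (trans (cong (λ z → c k ⊖ z ⊗ c k) (𝟙-no (p ∣? k) d)) (lin 1 (λ a → ⊢ a :- con 0 :* a :≡ a) (c k))))
  X = p * n
  multiples : ∑ X (λ k → 𝟙 (p ∣? k) ⊗ c k) ≡ ι (φ n)
  multiples = begin
    ∑ X (λ k → 𝟙 (p ∣? k) ⊗ c k)                       ≡⟨ ∑-cong X
        (λ k _ le → cong (𝟙 (p ∣? k) ⊗_) (sym (trans (cong (_⊗ c k) (𝟙-yes (k ≤? X) le)) (⊗-identityˡ _)))) ⟩
    ∑ X (λ k → 𝟙 (p ∣? k) ⊗ (𝟙 (k ≤? X) ⊗ c k))        ≡⟨ sym (sum-multiples X {λ k → 𝟙 (k ≤? X) ⊗ c k} p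
        (s≤s z≤n) (λ k lt → trans (cong (_⊗ c k) (𝟙-no (k ≤? X) (ℕₚ.<⇒≱ lt))) (⊗-zeroˡ _))) ⟩
    ∑ X (λ j → 𝟙 (j * p ≤? X) ⊗ c (j * p))             ≡⟨ ∑-floor X p (λ j → c (j * p)) (s≤s z≤n) ℕₚ.≤-refl ⟩
    ∑ (X ÷ p) (λ j → c (j * p))                        ≡⟨ cong (λ k → ∑ k (λ j → c (j * p))) X÷p ⟩
    ∑ n (λ j → c (j * p))                              ≡⟨ ∑-cong′ n
        (λ j → 𝟙-⇔ (coprime? (j * p) n) (coprime? j n) (λ e (d₁ , d₂) → e (∣m⇒∣m*n p d₁ , d₂))
                                                            (λ e → Coprimality.sym
                                                                (coprime-*ʳ (Coprimality.sym e)
                                                                (coprime-prime pp nd)))) ⟩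
    ∑ n c                                              ≡⟨ sym (ι-φ n) ⟩
    ι (φ n)                                            ∎
    where
    open ≡-Reasoning
    X÷p : X ÷ p ≡ n
    X÷p = ℕₚ.≤-antisym (ℕₚ.*-cancelʳ-≤ (X ÷ p) n p (ℕₚ.≤-trans (÷-from p ℕₚ.≤-refl)
        (ℕₚ.≤-reflexive (ℕₚ.*-comm p n)))) (÷-to p (ℕₚ.≤-reflexive (ℕₚ.*-comm n p)) (s≤s z≤n))
  main : ι (φ (p * n)) ≡ (ι q ⊕ ι 1) ⊗ ι (φ n) ⊖ ι (φ n)
  main = trans (ι-φ (p * n)) (trans (∑-cong′ X split) (trans (∑-⊖ X _ _)
      (cong₂ _⊖_ (trans (coprime-periods p n) (cong (_⊗ ι (φ n)) (ι-suc q))) multiples)))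

φ-prime-power : ∀ p j m → Prime p → 1 ≤ m → p ∤ m → φ (p ^ suc j * m) ≡ p ^ j * pred p * φ m
φ-prime-power p zero    m pp 1≤m nd = trans (cong (λ k → φ (k * m)) (ℕₚ.*-identityʳ p))
    (trans (φ-∤ p m pp 1≤m nd) (cong (_* φ m) (sym (ℕₚ.*-identityˡ (pred p)))))
φ-prime-power p (suc j) m pp 1≤m nd = trans (cong φ (ℕₚ.*-assoc p (p ^ suc j) m))
    (trans (φ-∣ p (p ^ suc j * m) pp (∣m⇒∣m*n m (m∣m*n (p ^ j))))
  (trans (cong (p *_) (φ-prime-power p j m pp 1≤m nd)) (trans (sym (ℕₚ.*-assoc p (p ^ j * pred p) (φ m)))
      (cong (_* φ m) (sym (ℕₚ.*-assoc p (p ^ j) (pred p)))))))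

-- Solutions of φ(n) = 2r with r odd

extract-prime : ∀ p → Prime p → ∀ n → 1 ≤ n → ∃ λ a → ∃ λ m → n ≡ p ^ a * m × p ∤ m × 1 ≤ m
extract-prime p pp = <-rec _ go
  where
  go : ∀ n → (∀ {k} → k < n → 1 ≤ k → ∃ λ a → ∃ λ m → k ≡ p ^ a * m × p ∤ m × 1 ≤ m) → 1 ≤ n → ∃ λ a → ∃ λ m → n
      ≡ p ^ a * m × p ∤ m × 1 ≤ m
  go n ih 1≤n with p ∣? n
  ... | no nd = 0 , n , sym (ℕₚ.+-identityʳ n) , nd , 1≤n
  ... | yes (divides k refl) with k
  ...   | zero = contradiction 1≤n λ ()
  ...   | suc k′ with ih {suc k′} (ℕₚ.m<m*n (suc k′) p (prime≥2 pp)) (s≤s z≤n)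
  ...     | a , m , e , nd , 1≤m = suc a , m , trans (cong (_* p) e)
      (trans (ℕₚ.*-comm (p ^ a * m) p) (sym (ℕₚ.*-assoc p (p ^ a) m))) , nd , 1≤m

Odd : ℕ → Set
Odd n = ∃ λ j → n ≡ 2 * j + 1

even-or-odd : ∀ n → 2 ∣ n ⊎ Odd n
even-or-odd zero = inj₁ (divides 0 refl)
even-or-odd (suc n) with even-or-odd n
... | inj₁ (divides k e) = inj₂ (k , trans (ℕₚ.+-comm 1 n) (cong (_+ 1) (trans e (ℕₚ.*-comm k 2))))
... | inj₂ (j , e) = inj₁ (divides (suc j) (trans (cong suc e)
    (trans (ℕₚ.+-comm 1 (2 * j + 1)) (trans (ℕₚ.+-assoc (2 * j) 1 1)
    (trans (ℕₚ.+-comm (2 * j) 2) (cong (2 +_) (ℕₚ.*-comm 2 j)))))))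

odd∤2 : ∀ {n} → Odd n → 2 ∤ n
odd∤2 (j , refl) d with ∣1⇒≡1 (∣m+n∣m⇒∣n d (m∣m*n j))
... | ()

odd-prime-pred : ∀ {p} → Prime p → p ≢ 2 → 2 ∣ pred p
odd-prime-pred {zero}  pp ne = contradiction pp ¬prime[0]
odd-prime-pred {suc q} pp ne with even-or-odd q
... | inj₁ d       = d
... | inj₂ (j , e) = contradiction (sym (prime∣prime prime[2] pp
    (divides (suc j) (trans (cong suc e) (trans (ℕₚ.+-comm 1 (2 * j + 1))
    (trans (ℕₚ.+-assoc (2 * j) 1 1) (trans (ℕₚ.+-comm (2 * j) 2) (cong (2 +_) (ℕₚ.*-comm 2 j))))))))) ne

data Shape (n : ℕ) : Set where
  power-of-two : ∀ a → n ≡ 2 ^ a → Shape n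
  odd-factor   : ∀ q b m → Prime q → q ≢ 2 → n ≡ q ^ suc b * m → q ∤ m → 1 ≤ m → Shape n

shape : ∀ n → 1 ≤ n → Shape n
shape n 1≤n with extract-prime 2 prime[2] n 1≤n
... | a , zero , _ , _ , ()
... | a , suc zero , e , _ , _ = power-of-two a (trans e (ℕₚ.*-identityʳ (2 ^ a)))
... | a , m@(suc (suc _)) , e , 2∤m , _ with primeDivisor m (s≤s (s≤s z≤n))
...   | q , pq , q∣m with extract-prime q pq n 1≤n
...     | zero , k , e′ , q∤k , 1≤k = contradiction (subst (q ∣_) (trans (sym e) (trans e′ (ℕₚ.*-identityˡ k)))
    (∣n⇒∣m*n (2 ^ a) q∣m)) q∤k
...     | suc b , k , e′ , q∤k , 1≤k = odd-factor q b k pq (λ { refl → 2∤m q∣m }) e′ q∤k 1≤k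

φ-2^ : ∀ a → φ (2 ^ suc a) ≡ 2 ^ a
φ-2^ a = trans (cong φ (sym (ℕₚ.*-identityʳ (2 ^ suc a)))) (trans
    (φ-prime-power 2 a 1 prime[2] ℕₚ.≤-refl (prime∤1 prime[2]))
    (trans (ℕₚ.*-identityʳ (2 ^ a * 1)) (ℕₚ.*-identityʳ (2 ^ a))))

-- An odd prime `q` contributes the even factor `q - 1`, and a divisor 4 contributes a factor 2.
φ-odd : ∀ n → 1 ≤ n → Odd (φ n) → n ≡ 1 ⊎ n ≡ 2
φ-odd n 1≤n odd with shape n 1≤n
... | power-of-two zero e          = inj₁ e
... | power-of-two (suc zero) e    = inj₂ e
... | power-of-two (suc (suc a)) e = contradiction (subst (2 ∣_) (sym (trans (cong φ e) (φ-2^ (suc a))))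
    (m∣m*n (2 ^ a))) (odd∤2 odd)
... | odd-factor q b m pq q≢2 e q∤m 1≤m = contradiction (subst (2 ∣_)
    (sym (trans (cong φ e) (φ-prime-power q b m pq 1≤m q∤m))) (∣m⇒∣m*n (φ m)
    (∣n⇒∣m*n (q ^ b) (odd-prime-pred pq q≢2)))) (odd∤2 odd)

data Solution (m n : ℕ) : Set where
  four  : n ≡ 4 → m ≡ 2 → Solution m n
  power : ∀ q b → Prime q → q ≢ 2 → m ≡ q ^ b * pred q → n ≡ q ^ suc b ⊎ n ≡ q ^ suc b * 2 → Solution m n

odd-factorʳ : ∀ a b j → a * b ≡ 2 * j + 1 → Odd b
odd-factorʳ a b j e with even-or-odd b
... | inj₂ o = o
... | inj₁ d = contradiction (subst (2 ∣_) e (∣n⇒∣m*n a d)) (odd∤2 (j , refl))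

-- The factor `q - 1` of an odd prime already uses up the single 2, so the cofactor `m` has odd
-- totient and is 1 or 2. Among the powers of two only 4 qualifies.
solve-φ : ∀ j n → 1 ≤ n → φ n ≡ 2 * (2 * j + 1) → Solution (2 * (2 * j + 1)) n
solve-φ j n 1≤n eq with shape n 1≤n
... | power-of-two zero refl       = contradiction (subst (2 ∣_) (sym eq) (m∣m*n (2 * j + 1)))
    (λ d → odd∤2 (0 , refl) d)
... | power-of-two (suc zero) refl = contradiction (subst (2 ∣_) (sym eq) (m∣m*n (2 * j + 1)))
    (λ d → odd∤2 (0 , refl) d)
... | power-of-two (suc (suc zero)) refl = four refl (sym eq)
... | power-of-two (suc (suc (suc a))) refl = contradiction (subst (2 ∣_)
    (ℕₚ.*-cancelˡ-≡ (2 ^ suc a) (2 * j + 1) 2 (trans (sym (φ-2^ (suc (suc a)))) eq)) (m∣m*n (2 ^ a)))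
    (odd∤2 (j , refl))
... | odd-factor q b m pq q≢2 refl q∤m 1≤m = go (φ-odd m 1≤m (odd-factorʳ (q ^ b * h) (φ m) j halved))
  where
  2∣ = odd-prime-pred pq q≢2
  h = quotient 2∣
  h-≡ : pred q ≡ h * 2
  h-≡ = m∣n⇒n≡quotient*m 2∣
  value : φ (q ^ suc b * m) ≡ q ^ b * pred q * φ m
  value = φ-prime-power q b m pq 1≤m q∤m
  halved : q ^ b * h * φ m ≡ 2 * j + 1
  halved = ℕₚ.*-cancelˡ-≡ _ _ 2 (trans (trans (sym (ℕₚ.*-assoc 2 (q ^ b * h) (φ m)))
      (cong (_* φ m) (trans (ℕₚ.*-comm 2 (q ^ b * h)) (trans (ℕₚ.*-assoc (q ^ b) h 2)
      (cong (q ^ b *_) (sym h-≡)))))) (trans (sym value) eq))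
  go : m ≡ 1 ⊎ m ≡ 2 → Solution (2 * (2 * j + 1)) (q ^ suc b * m)
  go (inj₁ refl) = power q b pq q≢2 (trans (sym eq) (trans value (ℕₚ.*-identityʳ _))) (inj₁ (ℕₚ.*-identityʳ _))
  go (inj₂ refl) = power q b pq q≢2 (trans (sym eq) (trans value (ℕₚ.*-identityʳ _))) (inj₂ refl)

-- Totients of prime powers with exponent at least two: the rare values for which `m + 1` need not
-- be prime.
Exceptional : ℕ → Set
Exceptional m = ∃ λ q → ∃ λ b → Prime q × m ≡ q ^ suc b * pred q

-- Preimages of twice an odd number

-- Duplicate-free lists with the same members are permutations of each other.
HasSize-unique : ∀ {P : ℕ → Set} {c d} → HasSize P c → HasSize P d → c ≡ d
HasSize-unique (xs , ux , mx , refl) (ys , uy , my , refl) = ↭-length (∼bag⇒↭ (unique∧set⇒bag ux uy (λ {n} → mk⇔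
  (λ h → Equivalence.from (my n) (Equivalence.to (mx n) h)) (λ h → Equivalence.from (mx n)
      (Equivalence.to (my n) h)))))

HasSize-range : ∀ {P : ℕ → Set} (P? : ∀ n → Dec (P n)) b → (∀ n → P n → 1 ≤ n × n ≤ b) → HasSize P
    (length (filter P? (map suc (upTo b))))
HasSize-range {P} P? b bounded = _ , filter⁺ P? (map⁺ ℕₚ.suc-injective (upTo⁺ b)) ,
    (λ n → mk⇔ (λ h → proj₂ (∈-filter⁻ P? {xs = map suc (upTo b)} h)) (to n)) , refl
  where
  to : ∀ n → P n → n ∈ filter P? (map suc (upTo b))
  to n p with bounded n p
  to (suc n) p | _ , le = ∈-filter⁺ P? (∈-map⁺ suc (∈-upTo⁺ le)) p

TwiceOdd : ℕ → Set
TwiceOdd m = ∃ λ j → m ≡ 2 * (2 * j + 1)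

twiceOdd : ∀ j → 2 * (2 * j + 1) ≡ 2 + 4 * j
twiceOdd j = trans (ℕₚ.*-distribˡ-+ 2 (2 * j) 1) (trans (ℕₚ.+-comm (2 * (2 * j)) 2)
    (cong (2 +_) (sym (ℕₚ.*-assoc 2 2 j))))

residue : ∀ m → (∃ λ j → m ≡ 4 * j) ⊎ (∃ λ j → m ≡ 1 + 4 * j) ⊎ TwiceOdd m ⊎ (∃ λ j → m ≡ 3 + 4 * j)
residue 0 = inj₁ (0 , refl)
residue 1 = inj₂ (inj₁ (0 , refl))
residue 2 = inj₂ (inj₂ (inj₁ (0 , refl)))
residue 3 = inj₂ (inj₂ (inj₂ (0 , refl)))
residue (suc (suc (suc (suc m)))) with residue m
... | inj₁ (j , refl)               = inj₁ (suc j , sym (ℕₚ.*-suc 4 j))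
... | inj₂ (inj₁ (j , refl))        = inj₂ (inj₁ (suc j , cong suc (sym (ℕₚ.*-suc 4 j))))
... | inj₂ (inj₂ (inj₁ (j , e)))    = inj₂ (inj₂ (inj₁ (suc j , trans (cong (4 +_) (trans e (twiceOdd j)))
    (trans (cong (2 +_) (sym (ℕₚ.*-suc 4 j))) (sym (twiceOdd (suc j)))))))
... | inj₂ (inj₂ (inj₂ (j , refl))) = inj₂ (inj₂ (inj₂ (suc j , cong (3 +_) (sym (ℕₚ.*-suc 4 j)))))

4∣∧1 : ∀ i j k → 1 ≤ k → k ≤ 3 → k + 4 * i ≢ 4 * j
4∣∧1 i j k p q e = ℕₚ.<⇒≱ (s≤s q) (∣⇒≤′ p (Data.Nat.Divisibility.∣m+n∣m⇒∣n
    (subst (4 ∣_) (trans (sym e) (ℕₚ.+-comm k (4 * i))) (m∣m*n j)) (m∣m*n i)))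

twiceOdd? : ∀ m → Dec (TwiceOdd m)
twiceOdd? m with residue m
... | inj₂ (inj₂ (inj₁ t)) = yes t
... | inj₁ (i , e) = no (λ (j , e′) → 4∣∧1 j i 2 (s≤s z≤n) (s≤s (s≤s z≤n))
    (trans (sym (twiceOdd j)) (trans (sym e′) e)))
... | inj₂ (inj₁ (i , e)) = no (λ (j , e′) → 4∣∧1 j i 1 (s≤s z≤n) (s≤s z≤n)
    (ℕₚ.suc-injective (trans (sym (twiceOdd j)) (trans (sym e′) e))))
... | inj₂ (inj₂ (inj₂ (i , e))) = no (λ (j , e′) → 4∣∧1 i j 1 (s≤s z≤n) (s≤s z≤n)
    (ℕₚ.suc-injective (ℕₚ.suc-injective (trans (sym e) (trans e′ (twiceOdd j))))))

-- A finite range for the preimages makes `V12` decidable. The 4 combines `q ≤ 2 (q - 1)` with the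
-- possible factor 2 in `n`.
preimage-bound : ∀ m n → TwiceOdd m → Preimage m n → n ≤ 4 * m
preimage-bound m n (j , refl) (1≤n , e) with solve-φ j n 1≤n e
... | four refl m≡2 = ℕₚ.≤-trans (s≤s (s≤s (s≤s (s≤s (z≤n {4}))))) (ℕₚ.≤-reflexive (cong (4 *_) (sym m≡2)))
... | power q b pq _ m≡ n≡ = ℕₚ.≤-trans (n≤ n≡) (ℕₚ.≤-trans (ℕₚ.*-monoˡ-≤ 2 (ℕₚ.*-monoˡ-≤ (q ^ b) q≤))
    (ℕₚ.≤-reflexive (trans regroup (cong (4 *_) (sym m≡)))))
  where
  n≤ : n ≡ q ^ suc b ⊎ n ≡ q ^ suc b * 2 → n ≤ q ^ suc b * 2
  n≤ (inj₁ refl) = ℕₚ.m≤m*n (q ^ suc b) 2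
  n≤ (inj₂ refl) = ℕₚ.≤-refl
  q≤ : q ≤ 2 * pred q
  q≤ = twice q (prime≥2 pq)
    where
    twice : ∀ q → 2 ≤ q → q ≤ 2 * pred q
    twice (suc q) (s≤s p) = ℕₚ.≤-trans (ℕₚ.+-monoˡ-≤ q p) (ℕₚ.≤-reflexive
        (cong (q +_) (sym (ℕₚ.+-identityʳ q))))
  regroup : 2 * pred q * q ^ b * 2 ≡ 4 * (q ^ b * pred q)
  regroup = trans (ℕₚ.*-comm (2 * pred q * q ^ b) 2) (trans (cong (2 *_)
      (trans (ℕₚ.*-assoc 2 (pred q) (q ^ b)) (cong (2 *_) (ℕₚ.*-comm (pred q) (q ^ b)))))
      (sym (ℕₚ.*-assoc 2 2 (q ^ b * pred q))))

preimage? : ∀ m n → Dec (Preimage m n)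
preimage? m n with 1 ≤? n | φ n ≟ m
... | yes a | yes b = yes (a , b)
... | no a  | _     = no (λ p → a (proj₁ p))
... | _     | no b  = no (λ p → b (proj₂ p))

preimage-size : ∀ m → TwiceOdd m → HasSize (Preimage m) (length (filter (preimage? m) (map suc (upTo (4 * m)))))
preimage-size m t = HasSize-range (preimage? m) (4 * m) (λ n p → proj₁ p , preimage-bound m n t p)

V12? : ∀ m → Dec (V12 m)
V12? m with twiceOdd? m
... | no ¬t = no (λ v → ¬t (proj₁ v))
... | yes t with length (filter (preimage? m) (map suc (upTo (4 * m)))) ≟ 2
...   | yes e = yes (t , subst (HasSize (Preimage m)) e (preimage-size m t))
...   | no ¬e = no (λ v → ¬e (HasSize-unique (preimage-size m t) (proj₂ v)))

-- A single preimage reveals the form of `m`. If it is 4, then `m = 2`, which is again a prime minus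
-- one.
V12⇒prime : ∀ m → V12 m → Prime (suc m) ⊎ Exceptional m
V12⇒prime m ((j , refl) , [] , _ , _ , ())
V12⇒prime m ((j , refl) , n ∷ _ , _ , members , _) with Equivalence.to (members n) (here refl)
... | 1≤n , e with solve-φ j n 1≤n e
...   | four _ m≡2 = inj₁ (subst (λ k → Prime (suc k)) (sym m≡2) prime[3])
  where
  prime[3] : Prime 3
  prime[3] = Relation.Nullary.Decidable.toWitness {a? = prime? 3} _
    where import Relation.Nullary.Decidable
...   | power q (suc b) pq _ m≡ _ = inj₂ (q , b , pq , m≡)
...   | power q zero pq _ m≡ _ = inj₁ (subst Prime (sym (trans (cong suc (trans m≡ (ℕₚ.*-identityˡ (pred q))))
    (ℕₚ.suc-pred q {{>-nonZero (prime≥1 pq)}}))) pq)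

-- 2 is excluded because 3, 4 and 6 all have totient 2; an exceptional `m` could have further
-- preimages `q ^ a` and `2 q ^ a`.
prime⇒V12 : ∀ m → TwiceOdd m → m ≢ 2 → Prime (suc m) → ¬ Exceptional m → V12 m
prime⇒V12 m t@(j , refl) m≢2 pp ¬exc = t , p ∷ p * 2 ∷ [] , ((p≢2p ∷ []) ∷ [] ∷ []) ,
    (λ n → mk⇔ (to n) (from n)) , refl
  where
  p = suc m
  2≤m : 2 ≤ m
  2≤m = subst (2 ≤_) (sym (twiceOdd j)) (s≤s (s≤s z≤n))
  p≢2p : p ≢ p * 2
  p≢2p e = ℕₚ.<⇒≢ (ℕₚ.m<m*n p 2 (s≤s (s≤s z≤n))) e
  φ-p : φ p ≡ m
  φ-p = trans (cong φ (sym (trans (ℕₚ.*-identityʳ (p * 1)) (ℕₚ.*-identityʳ p))))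
      (trans (φ-prime-power p 0 1 pp (s≤s z≤n) (prime∤1 pp)) (trans (ℕₚ.*-identityʳ (1 * m))
      (ℕₚ.*-identityˡ m)))
  φ-2p : φ (p * 2) ≡ m
  φ-2p = trans (cong (λ k → φ (k * 2)) (sym (ℕₚ.*-identityʳ p)))
      (trans (φ-prime-power p 0 2 pp (s≤s z≤n) (λ d → ℕₚ.<⇒≱ (s≤s 2≤m) (∣⇒≤′ (s≤s z≤n) d)))
      (trans (ℕₚ.*-identityʳ (1 * m)) (ℕₚ.*-identityˡ m)))
  to : ∀ n → n ∈ p ∷ p * 2 ∷ [] → Preimage m n
  to n (here refl)         = s≤s z≤n , φ-p
  to n (there (here refl)) = s≤s z≤n , φ-2p
  from : ∀ n → Preimage m n → n ∈ p ∷ p * 2 ∷ []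
  from n (1≤n , e) with solve-φ j n 1≤n e
  ... | four _ m≡2 = contradiction m≡2 m≢2
  ... | power q (suc b) pq _ m≡ _ = contradiction (q , b , pq , m≡) ¬exc
  ... | power q zero pq _ m≡ n≡ = member n≡
    where
    q≡p : q ≡ p
    q≡p = trans (sym (ℕₚ.suc-pred q {{>-nonZero (prime≥1 pq)}}))
        (cong suc (sym (trans m≡ (ℕₚ.*-identityˡ (pred q)))))
    member : n ≡ q ^ 1 ⊎ n ≡ q ^ 1 * 2 → n ∈ p ∷ p * 2 ∷ []
    member (inj₁ n≡) = here (trans n≡ (trans (ℕₚ.*-identityʳ q) q≡p))
    member (inj₂ n≡) = there (here (trans n≡ (cong (_* 2) (trans (ℕₚ.*-identityʳ q) q≡p))))

-- Counting the exceptional values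

∑-indicator-≼1 : ∀ x v → ∑ x (λ m → 𝟙 (m ≟ v)) ≼ ι 1
∑-indicator-≼1 x v with 1 ≤? v | v ≤? x
... | yes p | yes q = ≼-reflexive (trans (∑-cong′ x (λ m → sym (⊗-identityʳ _))) (∑-δ x v (λ _ → ι 1) p q))
... | no p  | _     = ≼-trans (≼-reflexive (∑-zero x (λ m a _ → 𝟙-no (m ≟ v) (λ { refl → p a })))) 0≼1
... | yes _ | no q  = ≼-trans (≼-reflexive (∑-zero x (λ m _ b → 𝟙-no (m ≟ v) (λ { refl → q b })))) 0≼1

term-≼-∑ : ∀ n k (f : ℕ → Q) → 1 ≤ k → k ≤ n → (∀ i → ι 0 ≼ f i) → f k ≼ ∑ n f
term-≼-∑ n k f p q h = ≼-trans (≼-reflexive (sym (∑-δ n k f p q)))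
    (∑-mono n (λ i _ _ → ≼-trans (⊗-monoʳ (h i) (𝟙-≼1 (i ≟ k))) (≼-reflexive (⊗-identityˡ _))))

-- A majorant of the indicator of `Exceptional` below `(r + 1)⁴`. As `q` and `j` run through a fixed
-- box, the total over `m` is at most the number of pairs.
exceptional : ℕ → ℕ → Q
exceptional r m = ∑ (suc r * suc r + 1) (λ q → ∑ (4 * r) (λ j → 𝟙 (m ≟ q ^ j * pred q)))

exceptional-nonneg : ∀ r m → ι 0 ≼ exceptional r m
exceptional-nonneg r m = ∑-nonneg (suc r * suc r + 1) (λ q _ _ → ∑-nonneg (4 * r)
    (λ j _ _ → 𝟙-nonneg (m ≟ q ^ j * pred q)))

-- `2 ^ j ≤ m < (r + 1)⁴ ≤ 2 ^ (4 r)` limits the exponent, and `(q - 1)² ≤ m` limits `q` to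
-- `(r + 1)² + 1`.
exceptional-≥1 : ∀ r m → m < suc r ^ 4 → Exceptional m → ι 1 ≼ exceptional r m
exceptional-≥1 r m lt (q , b , pq , refl) = ≼-trans (≼-reflexive (sym (𝟙-yes (m ≟ m) refl)))
  (≼-trans (term-≼-∑ (4 * r) (suc b) (λ j → 𝟙 (m ≟ q ^ j * pred q)) (s≤s z≤n) j≤
      (λ j → 𝟙-nonneg (m ≟ q ^ j * pred q)))
    (term-≼-∑ (suc r * suc r + 1) q (λ q → ∑ (4 * r) (λ j → 𝟙 (m ≟ q ^ j * pred q))) (prime≥1 pq) q≤
        (λ q → ∑-nonneg (4 * r) (λ j _ _ → 𝟙-nonneg (m ≟ q ^ j * pred q)))))
  where
  1≤pred : 1 ≤ pred q
  1≤pred = ℕₚ.pred-mono-≤ (prime≥2 pq)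
  s = suc r * suc r
  s²≡ : s * s ≡ suc r ^ 4
  s²≡ = trans (ℕₚ.*-assoc (suc r) (suc r) s) (cong (λ k → suc r * (suc r * (suc r * k)))
      (sym (ℕₚ.*-identityʳ (suc r))))
  j≤ : suc b ≤ 4 * r
  j≤ with ℕₚ.≤-total (suc b) (4 * r)
  ... | inj₁ h = h
  ... | inj₂ h = contradiction lt (ℕₚ.≤⇒≯ (ℕₚ.≤-trans (ℕₚ.≤-trans (ℕₚ.^-monoˡ-≤ 4 (n<p^n (s≤s (s≤s z≤n)) r))
      (ℕₚ.≤-reflexive (trans (ℕₚ.^-*-assoc 2 r 4) (cong (2 ^_) (ℕₚ.*-comm r 4)))))
    (ℕₚ.≤-trans (ℕₚ.^-monoʳ-≤ 2 h) (ℕₚ.≤-trans (ℕₚ.^-monoˡ-≤ (suc b) (prime≥2 pq))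
        (ℕₚ.m≤m*n (q ^ suc b) (pred q) {{>-nonZero 1≤pred}})))))
  q≤ : q ≤ s + 1
  q≤ with ℕₚ.≤-total q (s + 1)
  ... | inj₁ h = h
  ... | inj₂ h = contradiction lt (ℕₚ.≤⇒≯ (ℕₚ.≤-trans (ℕₚ.≤-reflexive (sym s²≡))
      (ℕₚ.*-mono-≤ (ℕₚ.≤-trans (ℕₚ.≤-trans (ℕₚ.m≤m+n s 1) h) (ℕₚ.m≤m*n q (q ^ b)
      {{>-nonZero (^≥1 b (prime≥1 pq))}}))
    (ℕₚ.≤-trans (ℕₚ.≤-reflexive (cong pred (ℕₚ.+-comm 1 s))) (ℕₚ.pred-mono-≤ h)))))

exceptional-total : ∀ r x → ∑ x (exceptional r) ≼ ι (4 * r * (suc r * suc r + 1))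
exceptional-total r x = ≼-trans (≼-reflexive (∑-swap x Q₀ _)) (≼-trans
    (∑-mono Q₀ (λ q _ _ → ≼-trans (≼-reflexive (∑-swap x (4 * r) _))
    (∑-mono (4 * r) (λ j _ _ → ∑-indicator-≼1 x (q ^ j * pred q)))))
  (≼-reflexive (trans (∑-cong′ Q₀ (λ q → ∑-ones (4 * r))) (trans (∑-const Q₀ _)
      (trans (sym (ι-* Q₀ (4 * r))) (cong ι (ℕₚ.*-comm Q₀ (4 * r))))))))
  where
  Q₀ = suc r * suc r + 1

-- Twice the indicator of "m + 1 is a prime ≡ 3 mod 4", except at m = 1

t : ℕ → Q
t m = 𝟙 (prime? (suc m)) ⊗ (ι 1 ⊖ χ (suc m))

χ-4k : ∀ k i → χ (k + 4 * i) ≡ χ k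
χ-4k k i = trans (cong χ (ℕₚ.+-comm k (4 * i))) (χ-period i k)

0≼1-χ : ∀ n → ι 0 ≼ ι 1 ⊖ χ n
0≼1-χ n = 0≼-gap (≼-trans (≼-∥∥ (χ n)) (χ-bound n))

t-nonneg : ∀ m → ι 0 ≼ t m
t-nonneg m = ⊗-nonneg (𝟙-nonneg (prime? (suc m))) (0≼1-χ (suc m))

χ-twiceOdd : ∀ m → TwiceOdd m → χ (suc m) ≡ ⊝ ι 1
χ-twiceOdd m (j , refl) = trans (cong (λ k → χ (suc k)) (twiceOdd j)) (χ-4k 3 j)

V12-upper : ∀ r m → m < suc r ^ 4 → ι 2 ⊗ 𝟙 (V12? m) ≼ t m ⊕ ι 2 ⊗ exceptional r m
V12-upper r m lt = go (V12? m)
  where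
  go : Dec (V12 m) → ι 2 ⊗ 𝟙 (V12? m) ≼ t m ⊕ ι 2 ⊗ exceptional r m
  go (no ¬v) = lin 3 (λ v a e → v :≡ con 0 ⇒ con 0 :≤ a ⇒ con 0 :≤ e ⇒ ⊢ con 2 :* v :≤ a :+ con 2 :* e)
      (𝟙 (V12? m)) (t m) (exceptional r m) (𝟙-no (V12? m) ¬v) (t-nonneg m) (exceptional-nonneg r m)
  go (yes v) with V12⇒prime m v
  ... | inj₁ pp  = lin 3 (λ v a e → v :≤ con 1 ⇒ a :≡ con 2 ⇒ con 0 :≤ e ⇒ ⊢ con 2 :* v :≤ a :+ con 2 :* e)
      (𝟙 (V12? m)) (t m) (exceptional r m) (𝟙-≼1 (V12? m))
      (trans (cong₂ (λ y z → y ⊗ (ι 1 ⊖ z)) (𝟙-yes (prime? (suc m)) pp) (χ-twiceOdd m (proj₁ v)))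
          (lin 0 (⊢ con 1 :* (con 1 :- :- con 1) :≡ con 2))) (exceptional-nonneg r m)
  ... | inj₂ exc = lin 3 (λ v a e → v :≤ con 1 ⇒ con 0 :≤ a ⇒ con 1 :≤ e ⇒ ⊢ con 2 :* v :≤ a :+ con 2 :* e)
      (𝟙 (V12? m)) (t m) (exceptional r m) (𝟙-≼1 (V12? m)) (t-nonneg m) (exceptional-≥1 r m lt exc)

∃exceptional? : ∀ r m → m < suc r ^ 4 → (ι 1 ≼ exceptional r m) ⊎ ¬ Exceptional m
∃exceptional? r m lt with ι 1 ≼? exceptional r m
... | yes h = inj₁ h
... | no h  = inj₂ (λ e → h (exceptional-≥1 r m lt e))

-- `t m` is nonzero only at `m = 1`, from the prime 2, and where `m` is twice an odd number and
-- `m + 1` is prime. In the second case `V12 m` can fail only at 2 and at exceptional values.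
V12-lower : ∀ r m → m < suc r ^ 4 → t m ≼ ι 2 ⊗ 𝟙 (V12? m) ⊕ ι 2 ⊗ exceptional r m ⊕ ι 2 ⊗ 𝟙 (m ≟ 2) ⊕ 𝟙 (m ≟ 1)
V12-lower r m lt = go (residue m)
  where
  Goal : Set
  Goal = t m ≼ ι 2 ⊗ 𝟙 (V12? m) ⊕ ι 2 ⊗ exceptional r m ⊕ ι 2 ⊗ 𝟙 (m ≟ 2) ⊕ 𝟙 (m ≟ 1)
  0≼v = 𝟙-nonneg (V12? m)
  0≼e = exceptional-nonneg r m
  0≼2 = 𝟙-nonneg (m ≟ 2)
  0≼₁ = 𝟙-nonneg (m ≟ 1)
  from-zero : t m ≡ ι 0 → Goal
  from-zero e = lin 5 (λ a v e b c → a :≡ con 0 ⇒ con 0 :≤ v ⇒ con 0 :≤ e ⇒ con 0 :≤ b ⇒ con 0 :≤ c ⇒ ⊢ a :≤ con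
      2 :* v :+ con 2 :* e :+ con 2 :* b :+ c) (t m) (𝟙 (V12? m)) (exceptional r m) (𝟙 (m ≟ 2)) (𝟙 (m ≟ 1)) e
      0≼v 0≼e 0≼2 0≼₁
  not-prime : ¬ Prime (suc m) → t m ≡ ι 0
  not-prime ¬p = trans (cong (_⊗ (ι 1 ⊖ χ (suc m))) (𝟙-no (prime? (suc m)) ¬p)) (⊗-zeroˡ _)
  even-prime : ∀ i → suc m ≡ 2 * i → Prime (suc m) → m ≡ 1
  even-prime i e pp = ℕₚ.suc-injective (sym (prime∣prime prime[2] pp (divides i (trans e (ℕₚ.*-comm 2 i)))))
  t≼2 : t m ≼ ι 2
  t≼2 = lin 2 (λ p c → con 0 :≤ (con 1 :- p) :* (con 1 :- c) ⇒ :- c :≤ con 1 ⇒ ⊢ p :* (con 1 :- c) :≤ con 2)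
      (𝟙 (prime? (suc m))) (χ (suc m)) (⊗-nonneg (0≼-gap (𝟙-≼1 (prime? (suc m)))) (0≼1-χ (suc m)))
      (≼-trans (⊝-∥∥ _) (χ-bound (suc m)))
  go : (∃ λ j → m ≡ 4 * j) ⊎ (∃ λ j → m ≡ 1 + 4 * j) ⊎ TwiceOdd m ⊎ (∃ λ j → m ≡ 3 + 4 * j) → Goal
  go (inj₁ (j , e)) = from-zero (trans (cong (λ z → 𝟙 (prime? (suc m)) ⊗ (ι 1 ⊖ z))
      (trans (cong (λ k → χ (suc k)) e) (χ-4k 1 j))) (lin 1 (λ a → ⊢ a :* (con 1 :- con 1) :≡ con 0) _))
  go (inj₂ (inj₁ (j , e))) = lin 5 (λ a v e b c → a :≤ con 1 :* c ⇒ con 0 :≤ v ⇒ con 0 :≤ e ⇒ con 0 :≤ b ⇒ ⊢ a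
      :≤ con 2 :* v :+ con 2 :* e :+ con 2 :* b :+ c) (t m) (𝟙 (V12? m)) (exceptional r m) (𝟙 (m ≟ 2))
      (𝟙 (m ≟ 1)) small 0≼v 0≼e 0≼2
    where
    small : t m ≼ ι 1 ⊗ 𝟙 (m ≟ 1)
    small = ≼-trans (≼-reflexive (trans (cong (λ z → 𝟙 (prime? (suc m)) ⊗ (ι 1 ⊖ z))
        (trans (cong (λ k → χ (suc k)) e) (χ-4k 2 j))) (lin 1 (λ a → ⊢ a :* (con 1 :- con 0) :≡ a) _)))
      (≼-trans (by-cases (prime? (suc m))) (≼-reflexive (sym (⊗-identityˡ _))))
      where
      by-cases : Dec (Prime (suc m)) → 𝟙 (prime? (suc m)) ≼ 𝟙 (m ≟ 1)
      by-cases (no ¬p) = ≼-trans (≼-reflexive (𝟙-no (prime? (suc m)) ¬p)) 0≼₁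
      by-cases (yes p) = ≼-trans (𝟙-≼1 (prime? (suc m))) (≼-reflexive
          (sym (𝟙-yes (m ≟ 1) (even-prime (suc (2 * j)) (trans (cong suc e)
          (trans (cong (2 +_) (ℕₚ.*-assoc 2 2 j)) (sym (ℕₚ.*-suc 2 (2 * j))))) p))))
  go (inj₂ (inj₂ (inj₂ (j , e)))) = from-zero (not-prime (λ p → contradiction
      (trans (sym (even-prime (2 * suc j) (trans (cong suc e) (trans (sym (ℕₚ.*-suc 4 j))
      (ℕₚ.*-assoc 2 2 (suc j)))) p)) e) λ ()))
  go (inj₂ (inj₂ (inj₁ t₂))) = decide (m ≟ 2) (prime? (suc m)) (∃exceptional? r m lt)
    where
    decide : Dec (m ≡ 2) → Dec (Prime (suc m)) → (ι 1 ≼ exceptional r m) ⊎ ¬ Exceptional m → Goal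
    decide (yes m≡2) _ _ = lin 5 (λ a v e b c → a :≤ con 2 ⇒ con 0 :≤ v ⇒ con 0 :≤ e ⇒ b :≡ con 1 ⇒ con 0 :≤ c ⇒
        ⊢ a :≤ con 2 :* v :+ con 2 :* e :+ con 2 :* b :+ c) (t m) (𝟙 (V12? m)) (exceptional r m) (𝟙 (m ≟ 2))
        (𝟙 (m ≟ 1)) t≼2 0≼v 0≼e (𝟙-yes (m ≟ 2) m≡2) 0≼₁
    decide (no _) (no ¬p) _ = from-zero (not-prime ¬p)
    decide (no _) (yes p) (inj₁ h) = lin 5 (λ a v e b c → a :≤ con 2 ⇒ con 0 :≤ v ⇒ con 1 :≤ e ⇒ con 0 :≤ b ⇒
        con 0 :≤ c ⇒ ⊢ a :≤ con 2 :* v :+ con 2 :* e :+ con 2 :* b :+ c) (t m) (𝟙 (V12? m)) (exceptional r m)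
        (𝟙 (m ≟ 2)) (𝟙 (m ≟ 1)) t≼2 0≼v h 0≼2 0≼₁
    decide (no m≢2) (yes p) (inj₂ ¬exc) = lin 5 (λ a v e b c → a :≤ con 2 ⇒ v :≡ con 1 ⇒ con 0 :≤ e ⇒ con 0 :≤ b
        ⇒ con 0 :≤ c ⇒ ⊢ a :≤ con 2 :* v :+ con 2 :* e :+ con 2 :* b :+ c) (t m) (𝟙 (V12? m)) (exceptional r m)
        (𝟙 (m ≟ 2)) (𝟙 (m ≟ 1)) t≼2 (𝟙-yes (V12? m) (prime⇒V12 m t₂ m≢2 p ¬exc)) 0≼e 0≼2 0≼₁

-- Asymptotics of the counting function

∑t : ∀ x → ∑ x t ≡ πQ (suc x) ⊖ πχ (suc x)
∑t x = trans (∑-cong′ x (λ m → lin 2 (λ p c → ⊢ p :* (con 1 :- c) :≡ p :- p :* c) (𝟙 (prime? (suc m)))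
    (χ (suc m)))) (trans (∑-⊖ x _ _)
  (trans (lin 4 (λ a b p c → p :≡ con 0 ⇒ p :* c :≡ con 0 :* c ⇒ ⊢ a :- b :≡ (con 0 :+ p :+ a) :-
      (con 0 :+ p :* c :+ b)) _ _ (𝟙 (prime? 1)) (χ 1) no-1 (cong (_⊗ χ 1) no-1))
    (cong₂ _⊖_ (sym (∑-split 1 x _)) (sym (∑-split 1 x _)))))
  where
  no-1 : 𝟙 (prime? 1) ≡ ι 0
  no-1 = 𝟙-no (prime? 1) ¬prime[1]

count-V12 : ℕ → ℕ
count-V12 x = length (filter V12? (map suc (upTo x)))

V12≤-size : ∀ x → HasSize (V12≤ x) (count-V12 x)
V12≤-size x = _ , filter⁺ V12? (map⁺ ℕₚ.suc-injective (upTo⁺ x)) , (λ n → mk⇔ (to n) (from n)) , refl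
  where
  to : ∀ n → n ∈ filter V12? (map suc (upTo x)) → V12≤ x n
  to n h with ∈-filter⁻ V12? {xs = map suc (upTo x)} h
  ... | a , v with ∈-map⁻ suc a
  ...   | k , b , refl = ∈-upTo⁻ b , v
  from : ∀ n → V12≤ x n → n ∈ filter V12? (map suc (upTo x))
  from zero    (_ , (j , e) , _)  = contradiction (trans e (twiceOdd j)) λ ()
  from (suc n) (le , v)           = ∈-filter⁺ V12? (∈-map⁺ suc (∈-upTo⁺ le)) v

distance : ∀ a b {d} → ι a ⊖ ι b ≼ d → ι b ⊖ ι a ≼ d → ι ∣ a - b ∣ ≼ d
distance a b h h′ with ℕₚ.≤-total a b
... | inj₁ le = ≼-trans (≼-reflexive (trans (cong ι (ℕₚ.m≤n⇒∣m-n∣≡n∸m le)) (minus le))) h′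
  where
  minus : ∀ {a b} → a ≤ b → ι (b ∸ a) ≡ ι b ⊖ ι a
  minus {a} {b} le = lin 3 (λ a b c → b :≡ a :+ c ⇒ ⊢ c :≡ b :- a) (ι a) (ι b) (ι (b ∸ a))
      (trans (cong ι (sym (ℕₚ.m+[n∸m]≡n le))) (ι-+ a (b ∸ a)))
... | inj₂ le = ≼-trans (≼-reflexive (trans (cong ι (trans (ℕₚ.∣-∣-comm a b) (ℕₚ.m≤n⇒∣m-n∣≡n∸m le)))
    (lin 3 (λ a b c → a :≡ b :+ c ⇒ ⊢ c :≡ a :- b) (ι a) (ι b) (ι (a ∸ b))
    (trans (cong ι (sym (ℕₚ.m+[n∸m]≡n le))) (ι-+ b (a ∸ b)))))) h

theorem2p4 : ∀ (k : ℕ) → ∃ λ N → ∀ x → N ≤ x →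
    ∃ λ c → HasSize (V12≤ x) c × (suc k * ∣ 2 * c - π x ∣ ≤ π x)
theorem2p4 k = let x₀ , race = prime-race (suc k) (s≤s z≤n) in x₀ , λ x h → count-V12 x , V12≤-size x , bound x (race x h)
  where
  bound : ∀ x → (∃ λ r → x < suc r ^ 4 × ι (suc k) ⊗ (∥ πχ x ∥ ⊕ ι 5 ⊕ ι 2 ⊗ ι (4 * r * (suc r * suc r + 1))) ≼
      πQ x) → suc k * ∣ 2 * count-V12 x - π x ∣ ≤ π x
  bound x (r , lt , h) = ι-cancel (≼-trans (≼-reflexive (ι-* (suc k) _))
      (≼-trans (⊗-monoˡ (0≼ι (suc k)) (distance (2 * c) (π x) upper lower))
      (≼-trans h (≼-reflexive (sym (ι-π x))))))
    where
    c = count-V12 x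
    e : Q
    e = ι (4 * r * (suc r * suc r + 1))
    c₂ : ι (2 * c) ≡ ι 2 ⊗ ∑ x (λ m → 𝟙 (V12? m))
    c₂ = trans (ι-* 2 c) (cong (ι 2 ⊗_) (count-range V12? x))
    -- For `m ≤ x` the primes `m + 1` run up to `x + 1`; `p′` accounts for the one number beyond the
    -- range of `π x`.
    p′ : Q
    p′ = 𝟙 (prime? (suc x))
    t-sum : ∑ x t ≡ πQ x ⊖ πχ x ⊕ (p′ ⊖ p′ ⊗ χ (suc x))
    t-sum = trans (∑t x) (lin 4 (λ p s q n → ⊢ (p :+ q) :- (s :+ n) :≡ p :- s :+ (q :- n)) (πQ x) (πχ x) p′
        (p′ ⊗ χ (suc x)))
    upper-sum : ι 2 ⊗ ∑ x (λ m → 𝟙 (V12? m)) ≼ ∑ x t ⊕ ι 2 ⊗ ∑ x (exceptional r)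
    upper-sum = ≼-trans (≼-reflexive (sym (∑-⊗ˡ x (ι 2) _))) (≼-trans
        (∑-mono x (λ m _ le → V12-upper r m (ℕₚ.≤-<-trans le lt)))
        (≼-reflexive (trans (∑-⊕ x _ _) (cong (∑ x t ⊕_) (∑-⊗ˡ x (ι 2) _)))))
    lower-sum : ∑ x t ≼ ι 2 ⊗ ∑ x (λ m → 𝟙 (V12? m)) ⊕ ι 2 ⊗ ∑ x (exceptional r) ⊕ ι 2 ⊗ ∑ x (λ m → 𝟙 (m ≟ 2)) ⊕
        ∑ x (λ m → 𝟙 (m ≟ 1))
    lower-sum = ≼-trans (∑-mono x (λ m _ le → V12-lower r m (ℕₚ.≤-<-trans le lt)))
        (≼-reflexive (trans (∑-⊕ x _ _) (cong (_⊕ ∑ x (λ m → 𝟙 (m ≟ 1))) (trans (∑-⊕ x _ _)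
      (cong₂ _⊕_ (trans (∑-⊕ x _ _) (cong₂ _⊕_ (∑-⊗ˡ x (ι 2) _) (∑-⊗ˡ x (ι 2) _))) (∑-⊗ˡ x (ι 2) _))))))
    next-upper : p′ ⊖ p′ ⊗ χ (suc x) ≼ ι 2
    next-upper = lin 2 (λ p c → con 0 :≤ (con 1 :- p) :* (con 1 :- c) ⇒ :- c :≤ con 1 ⇒ ⊢ p :- p :* c :≤ con 2)
        p′ (χ (suc x)) (⊗-nonneg (0≼-gap (𝟙-≼1 (prime? (suc x)))) (0≼1-χ (suc x)))
        (≼-trans (⊝-∥∥ _) (χ-bound (suc x)))
    next-lower : ι 0 ≼ p′ ⊖ p′ ⊗ χ (suc x)
    next-lower = ≼-trans (t-nonneg x) (≼-reflexive (lin 2 (λ p c → ⊢ p :* (con 1 :- c) :≡ p :- p :* c) p′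
        (χ (suc x))))
    -- The 5 covers the 2 that the number `x + 1` may contribute here, and in `lower` the 3 coming
    -- from `m = 1` and `m = 2`.
    upper : ι (2 * c) ⊖ ι (π x) ≼ ∥ πχ x ∥ ⊕ ι 5 ⊕ ι 2 ⊗ e
    upper = lin 10 (λ c v t ex e p s a pi d → c :≡ v ⇒ v :≤ t :+ con 2 :* ex ⇒ ex :≤ e ⇒ t :≡ p :- s :+ d ⇒ d :≤
        con 2 ⇒ pi :≡ p ⇒ :- s :≤ a ⇒ ⊢ c :- pi :≤ a :+ con 5 :+ con 2 :* e)
      (ι (2 * c)) (ι 2 ⊗ ∑ x (λ m → 𝟙 (V12? m))) (∑ x t) (∑ x (exceptional r)) e (πQ x) (πχ x) (∥ πχ x ∥)
          (ι (π x)) (p′ ⊖ p′ ⊗ χ (suc x))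
      c₂ upper-sum (exceptional-total r x) t-sum next-upper (ι-π x) (⊝-∥∥ _)
    lower : ι (π x) ⊖ ι (2 * c) ≼ ∥ πχ x ∥ ⊕ ι 5 ⊕ ι 2 ⊗ e
    lower = lin 12 (λ c v t ex e p s a pi d u w → c :≡ v ⇒ t :≤ v :+ con 2 :* ex :+ con 2 :* u :+ w ⇒ ex :≤ e ⇒
        t :≡ p :- s :+ d ⇒ con 0 :≤ d ⇒ pi :≡ p ⇒ s :≤ a ⇒ u :≤ con 1 ⇒ w :≤ con 1 ⇒ ⊢ pi :- c :≤ a :+ con 5 :+
        con 2 :* e)
      (ι (2 * c)) (ι 2 ⊗ ∑ x (λ m → 𝟙 (V12? m))) (∑ x t) (∑ x (exceptional r)) e (πQ x) (πχ x) (∥ πχ x ∥)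
          (ι (π x)) (p′ ⊖ p′ ⊗ χ (suc x)) (∑ x (λ m → 𝟙 (m ≟ 2))) (∑ x (λ m → 𝟙 (m ≟ 1)))
      c₂ lower-sum (exceptional-total r x) t-sum next-lower (ι-π x) (≼-∥∥ _) (∑-indicator-≼1 x 2)
          (∑-indicator-≼1 x 1)
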